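{- For every integer $n\ge 1$: $$\overline{N}(0,3,n)>\overline{N}(1,3,n)\quad\text{if } n\equiv 0,1\pmod 3,$$ $$\overline{N}(0,3,n)<\overline{N}(1,3,n)\quad\text{if } n\equiv 2\pmod 3.$$
   Context: An overpartition of a positive integer $n$ is a partition of $n$ (a non-increasing sequence of positive integers with sum $n$) in which the first occurrence of each distinct part may or may not be overlined; thus a partition with $d$ distinct part sizes gives rise to $2^d$ overpartitions. The rank of an overpartition is its largest part minus its number of parts (overlines are ignored). $\overline{N}(a,c,n)$ denotes the number of overpartitions of $n$ whose rank is congruent to $a$ modulo $c$. -}

module Defs where

open import Data.Bool using (Bool; true; false)
import Data.Bool.Properties as Bool
open import Data.Integer as ℤ using (ℤ; +_)
import Data.Integer.Divisibility as ℤ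
open import Data.List using (List; []; _∷_; map; filter; foldr; length; upTo; cartesianProductWith; concatMap)
open import Data.List.Membership.Propositional using (_∈_; find; lose)
open import Data.List.Membership.Propositional.Properties
  using (∈-map⁺; ∈-map⁻; ∈-filter⁺; ∈-filter⁻; ∈-upTo⁺; ∈-cartesianProductWith⁺; ∈-concatMap⁺; ∈-concatMap⁻)
open import Data.List.Relation.Binary.Disjoint.Propositional using (Disjoint)
open import Data.List.Relation.Unary.All as All using (All; []; _∷_)
import Data.List.Relation.Unary.All.Properties as All
import Data.List.Relation.Unary.AllPairs as AllPairs
import Data.List.Relation.Unary.AllPairs.Properties as AllPairs
open import Data.List.Relation.Unary.Any using (here; there)
open import Data.List.Relation.Unary.Linked as Linked using (Linked; []; [-]; _∷_)
open import Data.List.Relation.Unary.Unique.Propositional using (Unique; []; _∷_)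
import Data.List.Relation.Unary.Unique.Propositional.Properties as Unique
open import Data.List.Properties using (∷-injectiveˡ; ∷-injectiveʳ)
open import Data.Nat using (ℕ; zero; suc; _+_; _∸_; _⊔_; _≤_; _≥_; s≤s⁻¹; _≟_; _≤?_; _≥?_)
open import Data.Nat.Divisibility using (_∣?_)
open import Data.Nat.ListAction using (sum)
open import Data.Nat.Properties
  using (≤-refl; ≤-reflexive; ≤-trans; m≤m+n; m+n∸m≡n; m+[n∸m]≡n; ∸-monoʳ-≤; n≤1+n; 1+n≰n)
open import Data.Product using (_×_; _,_)
open import Function using (_∘_; _⇔_; mk⇔)
open import Relation.Binary using (Rel; Decidable)
open import Relation.Binary.PropositionalEquality using (_≡_; _≢_; refl; sym; trans; cong; subst)
open import Relation.Nullary using (Dec; contradiction)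
open import Relation.Nullary.Decidable using (_×-dec_; _→-dec_)
import Relation.Unary as Unary
open import Level using (0ℓ)

record Part : Set where
  constructor part
  field
    size      : ℕ
    overlined : Bool

open Part public

-- In a non-increasing sequence equal sizes are adjacent, so an entry is the
-- first occurrence of its size unless its immediate predecessor has that size.
_MayPrecede_ : Rel Part 0ℓ
p MayPrecede q = size p ≥ size q × (size p ≡ size q → overlined q ≡ false)

record IsOverpartition (n : ℕ) (π : List Part) : Set where
  field
    positive : All (λ p → 1 ≤ size p) π
    ordered  : Linked _MayPrecede_ π
    total    : sum (map size π) ≡ n

largestPart : List Part → ℕ
largestPart π = foldr _⊔_ 0 (map size π)

rank : List Part → ℤ
rank π = + largestPart π ℤ.- + length π

_≡_[mod_] : ℤ → ℤ → ℕ → Set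
i ≡ j [mod c ] = + c ℤ.∣ (i ℤ.- j)

_≡?_[mod_] : ∀ i j c → Dec (i ≡ j [mod c ])
i ≡? j [mod c ] = c ∣? ℤ.∣ i ℤ.- j ∣

mayPrecede? : Decidable _MayPrecede_
mayPrecede? p q = (size p ≥? size q) ×-dec ((size p ≟ size q) →-dec (overlined q Bool.≟ false))

parts : ℕ → List Part
parts n = cartesianProductWith (part ∘ suc) (upTo n) (false ∷ true ∷ [])

Next : Part → ℕ → Part → Set
Next p n q = (1 ≤ size q × size q ≤ n) × p MayPrecede q

next? : ∀ p n → Unary.Decidable (Next p n)
next? p n q = ((1 ≤? size q) ×-dec (size q ≤? n)) ×-dec mayPrecede? p q

-- All ways to continue an overpartition after the entry p by entries summing
-- to n.  The first argument is fuel; n units suffice because parts are positive.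
continuations : ℕ → Part → ℕ → List (List Part)
continuations _       p zero      = [] ∷ []
continuations zero    p (suc n)   = []
continuations (suc f) p n@(suc _) =
  concatMap (λ q → map (q ∷_) (continuations f q (n ∸ size q)))
            (filter (next? p n) (parts n))

-- The virtual predecessor of size n + 1 imposes no condition on the first part.
overpartitions : ℕ → List (List Part)
overpartitions n = continuations n (part (suc n) false) n

N̄ : ℤ → ℕ → ℕ → ℕ
N̄ a c n = length (filter (λ π → rank π ≡? a [mod c ]) (overpartitions n))

private
  Continues : Part → ℕ → List Part → Set
  Continues p n π = All (λ q → 1 ≤ size q) π × Linked _MayPrecede_ (p ∷ π) × sum (map size π) ≡ n

  ∈-parts : ∀ {n} q → 1 ≤ size q → size q ≤ n → q ∈ parts n
  ∈-parts (part (suc s) b) _ s<n = ∈-cartesianProductWith⁺ (part ∘ suc) (∈-upTo⁺ s<n) (∈-bool b)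
    where
    ∈-bool : ∀ b → b ∈ false ∷ true ∷ []
    ∈-bool false = here refl
    ∈-bool true  = there (here refl)

  parts-unique : ∀ n → Unique (parts n)
  parts-unique n = Unique.cartesianProductWith⁺ (part ∘ suc) (λ { refl → refl , refl })
                     (Unique.upTo⁺ n) (((λ ()) ∷ []) ∷ [] ∷ [])

  fuel-step : ∀ {f n s} → suc n ≤ suc f → 1 ≤ s → suc n ∸ s ≤ f
  fuel-step {n = n} n<f 1≤s = ≤-trans (∸-monoʳ-≤ (suc n) 1≤s) (s≤s⁻¹ n<f)

  continuations-sound : ∀ f p n {π} → π ∈ continuations f p n → Continues p n π
  continuations-sound _ p zero (here refl) = [] , [-] , refl
  continuations-sound (suc f) p n@(suc _) π∈
    with q , q∈ , π∈q ← find (∈-concatMap⁻ (λ q → map (q ∷_) (continuations f q (n ∸ size q))) {xs = filter (next? p n) (parts n)} π∈)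
    with ρ , ρ∈ , refl ← ∈-map⁻ (q ∷_) π∈q
    with _ , (1≤q , q≤n) , p▷q ← ∈-filter⁻ (next? p n) {xs = parts n} q∈
    with pos , linked , tot ← continuations-sound f q (n ∸ size q) ρ∈
    = 1≤q ∷ pos , p▷q ∷ linked , trans (cong (λ m → size q + m) tot) (m+[n∸m]≡n q≤n)

  continuations-complete : ∀ f p n {π} → n ≤ f → Continues p n π → π ∈ continuations f p n
  continuations-complete _ p zero {[]} _ _ = here refl
  continuations-complete _ p zero {part zero _ ∷ _} _ (() ∷ _ , _)
  continuations-complete _ p zero {part (suc _) _ ∷ _} _ (_ , _ , ())
  continuations-complete (suc f) p (suc n) {[]} _ (_ , _ , ())
  continuations-complete (suc f) p n@(suc _) {q ∷ ρ} n≤f (1≤q ∷ pos , p▷q ∷ linked , tot) =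
    ∈-concatMap⁺ _ (lose
      (∈-filter⁺ (next? p n) (∈-parts q 1≤q q≤n) ((1≤q , q≤n) , p▷q))
      (∈-map⁺ (q ∷_) (continuations-complete f q (n ∸ size q) (fuel-step n≤f 1≤q)
        (pos , linked , trans (sym (m+n∸m≡n (size q) _)) (cong (_∸ size q) tot)))))
    where
    q≤n : size q ≤ n
    q≤n = subst (size q ≤_) tot (m≤m+n (size q) _)

  continuations-unique : ∀ f p n → Unique (continuations f p n)
  continuations-unique _       p zero      = [] ∷ []
  continuations-unique zero    p (suc n)   = []
  continuations-unique (suc f) p n@(suc _) = Unique.concat⁺
    (All.map⁺ (All.universal (λ q → Unique.map⁺ ∷-injectiveʳ (continuations-unique f q (n ∸ size q))) _))
    (AllPairs.map⁺ (AllPairs.map disjoint (Unique.filter⁺ (next? p n) (parts-unique n))))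
    where
    disjoint : ∀ {q r} → q ≢ r → Disjoint (map (q ∷_) (continuations f q (n ∸ size q)))
                                          (map (r ∷_) (continuations f r (n ∸ size r)))
    disjoint {q} {r} q≢r (π∈q , π∈r)
      with _ , _ , refl ← ∈-map⁻ (q ∷_) π∈q
      with _ , _ , eq ← ∈-map⁻ (r ∷_) π∈r
      = q≢r (∷-injectiveˡ eq)

-- overpartitions n lists every overpartition of n exactly once.
∈-overpartitions : ∀ {n π} → π ∈ overpartitions n ⇔ IsOverpartition n π
∈-overpartitions {n} = mk⇔ to from
  where
  start : Part
  start = part (suc n) false

  to : ∀ {π} → π ∈ overpartitions n → IsOverpartition n π
  to π∈ with pos , linked , tot ← continuations-sound n start n π∈ =
    record { positive = pos ; ordered = Linked.tail linked ; total = tot }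

  link : ∀ {π} → sum (map size π) ≡ n → Linked _MayPrecede_ π → Linked _MayPrecede_ (start ∷ π)
  link {[]}    _   _  = [-]
  link {q ∷ ρ} tot ls = (≤-trans q≤n (n≤1+n n) , λ eq → contradiction (≤-trans (≤-reflexive eq) q≤n) 1+n≰n) ∷ ls
    where
    q≤n : size q ≤ n
    q≤n = subst (size q ≤_) tot (m≤m+n (size q) _)

  from : ∀ {π} → IsOverpartition n π → π ∈ overpartitions n
  from o = continuations-complete n start n ≤-refl (positive , link total ordered , total)
    where open IsOverpartition o

overpartitions-unique : ∀ n → Unique (overpartitions n)
overpartitions-unique n = continuations-unique n (part (suc n) false) n

-- Overpartitions with largest part i + 1 and k further parts form an array D(i,k) of series, symmetric in i and k.
-- Its diagonal sums E(m) satisfy E(m) + q^(m+2) E(m+2) = C, where C = 1/∑ (-1)^i q^(i²), and the series of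
-- N̄(0,3,n) - N̄(1,3,n) is F = C + 6 ∑ (E(3k) - E(3k+1)). Let E₉ be the same diagonal sums in base q⁹. Adding suitable
-- multiples of E₉ to E gives a sequence v with v(m) + q^(m+2) v(m+2) constant on residue classes of m modulo 3, which
-- extends to negative m by v(-m) = q^m v(m). Convolving v with the coefficients of j(x) = ∑ (-1)^i q^(3i(i-1)/2) x^i turns
-- this recurrence into one solved by theta terms; as j(1) = 0, comparing derivatives at x = 1 evaluates ∑ (v(3k) - v(3k+1)).
-- Classical theta identities then give
--     F = U σ² + q U σ Ψ(q⁹) + q² (4 Θ - 6 g₉),   U = ∏ 1/(1 - q^(6n)),
-- in which U, σ, Ψ(q⁹), Θ, g₉ are series in q³ with nonnegative coefficients and Θ ≤ g₉, so that each residue class of n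
-- modulo 3 sees one term of a definite sign.

module Submission where

open import Defs
open import Algebra.Bundles using (CommutativeRing)
import Algebra.Solver.Ring
import Algebra.Solver.Ring.AlmostCommutativeRing as ACR
open import Algebra.Structures using (IsCommutativeRing)
open import Data.Bool using (true; false)
open import Data.Empty using (⊥-elim)
open import Data.Fin as Fin using (Fin; zero; suc; toℕ; fromℕ<)
open import Data.Fin.Properties using (toℕ<n; toℕ-fromℕ<; toℕ-injective)
open import Data.Integer as ℤ using (ℤ; +_; -[1+_]; 0ℤ; 1ℤ)
import Data.Integer.Divisibility.Signed as Signed
import Data.Integer.DivMod as ℤ
import Data.Integer.Properties as ℤ
import Data.Integer.Solver
open import Data.Integer.Tactic.RingSolver using (solve-∀)
open import Data.List
  using (List; []; _∷_; map; _++_; upTo; applyUpTo; allFin; filter; length; cartesianProduct; cartesianProductWith; concatMap; deduplicate)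
open import Data.List.Membership.Propositional using (_∈_; find)
open import Data.List.Membership.Propositional.Properties
  using (∈-map⁺; ∈-map⁻; ∈-++⁺ˡ; ∈-++⁺ʳ; ∈-++⁻; ∈-upTo⁺; ∈-allFin; ∈-cartesianProduct⁺; ∈-concatMap⁻; ∈-filter⁻; ∈-deduplicate⁺)
open import Data.List.Relation.Unary.All as All using (All; []; _∷_)
open import Data.List.Relation.Unary.Any using (here; there)
open import Data.List.Relation.Unary.Unique.Propositional using (Unique; []; _∷_)
import Data.List.Relation.Unary.Unique.DecPropositional.Properties as DecUnique
import Data.List.Relation.Unary.Unique.Propositional.Properties as Unique
open import Data.Maybe using (Maybe; just; nothing)
open import Data.Nat as ℕ using (ℕ; zero; suc; z≤n; s≤s; _≤_; _<_; _>_; _%_; NonZero)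
open import Data.Nat.Divisibility as ℕ using (_∣_; _∣?_)
import Data.Nat.DivMod as ℕ
import Data.Nat.Properties as ℕ
import Data.Nat.Tactic.RingSolver as ℕ-Ring
open import Data.Product using (_×_; _,_; proj₁; proj₂; ∃-syntax)
open import Data.Product.Properties using (≡-dec)
open import Data.Sum using (_⊎_; inj₁; inj₂; [_,_]′)
open import Function using (_∘_; id; case_of_)
open import Level using (0ℓ)
open import Relation.Binary using (DecidableEquality; Setoid; tri<; tri≈; tri>)
open import Relation.Binary.PropositionalEquality
  using (_≡_; _≢_; refl; sym; trans; cong; cong₂; subst; subst₂; module ≡-Reasoning)
import Relation.Binary.Reasoning.Setoid
open import Relation.Nullary using (¬_; Dec; yes; no)

-- Formal power series in q over ℤ

-- Why base q⁹ enters: extend E by E(-m) = q^m E(m), as the symmetry of D suggests. The recurrence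
-- then fails at m = -1 only, where it reads 2 q E(1) = C - 1, because the corner entry D(0,0) = 1
-- has no partner. The series in base q⁹ have the same defect at their own index -1. Placing E₉(k)
-- at index 3k + 2 puts that index at m = -1 as well, so subtracting it there cancels the two 1s.
-- The recurrence then forces the multiples of E₉ in the other two residue classes. The price is a
-- right-hand side that depends on m modulo 3, which is why the convolution proceeds in steps of 3,
-- and a correction q² g₉ in the final formula. Why a derivative: since j(1) = 0, the convolved
-- equations say nothing at x = 1 itself, and the first derivative is what carries information. The
-- recurrence leaves one unknown factor, the convolution at index 0. It is never evaluated but
-- eliminated between three such derivatives, which evaluate C, C - C₉ and the sum of v(3k) -
-- v(3k+1).

Series : Set
Series = ℕ → ℤ

infix 4 _≐_ _≈[_]_
infixl 6 _⊕_ _⊖_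
infixl 7 _⊗_
infix 8 ⊝_

-- A record rather than a bare quantified equation, so that both series can be inferred from the
-- type of a proof; likewise for `_≈[_]_`, which compares the coefficients below q^N.
record _≐_ (f g : Series) : Set where
  constructor eq
  field at : ∀ n → f n ≡ g n
open _≐_ public

record _≈[_]_ (f : Series) (N : ℕ) (g : Series) : Set where
  constructor eq<
  field below : ∀ n → n < N → f n ≡ g n
open _≈[_]_ public

≐-refl : ∀ {f} → f ≐ f
≐-refl = eq λ _ → refl

≐-sym : ∀ {f g} → f ≐ g → g ≐ f
≐-sym (eq p) = eq λ n → sym (p n)

≐-trans : ∀ {f g h} → f ≐ g → g ≐ h → f ≐ h
≐-trans (eq p) (eq r) = eq λ n → trans (p n) (r n)

≐-setoid : Setoid 0ℓ 0ℓ
≐-setoid = record { Carrier = Series ; _≈_ = _≐_ ; isEquivalence = record { refl = ≐-refl ; sym = ≐-sym ; trans = ≐-trans } }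

≈-refl : ∀ {N f} → f ≈[ N ] f
≈-refl = eq< λ _ _ → refl

≈-sym : ∀ {N f g} → f ≈[ N ] g → g ≈[ N ] f
≈-sym (eq< p) = eq< λ n l → sym (p n l)

≈-trans : ∀ {N f g h} → f ≈[ N ] g → g ≈[ N ] h → f ≈[ N ] h
≈-trans (eq< p) (eq< r) = eq< λ n l → trans (p n l) (r n l)

≈-setoid : ℕ → Setoid 0ℓ 0ℓ
≈-setoid N = record { Carrier = Series ; _≈_ = _≈[ N ]_ ; isEquivalence = record { refl = ≈-refl ; sym = ≈-sym ; trans = ≈-trans } }

≐⇒≈ : ∀ {N f g} → f ≐ g → f ≈[ N ] g
≐⇒≈ (eq p) = eq< λ n _ → p n

≈⇒≐ : ∀ {f g} → (∀ N → f ≈[ N ] g) → f ≐ g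
≈⇒≐ p = eq λ n → below (p (suc n)) n ℕ.≤-refl

≈-weaken : ∀ {M N f g} → M ≤ N → f ≈[ N ] g → f ≈[ M ] g
≈-weaken M≤N (eq< p) = eq< λ n l → p n (ℕ.<-≤-trans l M≤N)

tail : Series → Series
tail f n = f (suc n)

shift : Series → Series
shift f zero    = 0ℤ
shift f (suc n) = f n

opaque
  _⊕_ : Series → Series → Series
  (f ⊕ g) n = f n ℤ.+ g n

  ⊝_ : Series → Series
  (⊝ f) n = ℤ.- f n

  -- The Cauchy product by recursion on the coefficient index. Finite sums are avoided, and the ring
  -- laws become inductions on `n` with the series generalised. Opacity keeps these coefficients
  -- from unfolding in the later algebra.
  _⊗_ : Series → Series → Series
  (f ⊗ g) zero    = f 0 ℤ.* g 0
  (f ⊗ g) (suc n) = f 0 ℤ.* g (suc n) ℤ.+ (tail f ⊗ g) n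

  # : ℤ → Series
  # c zero    = c
  # c (suc _) = 0ℤ

  q^ : ℕ → Series
  q^ zero    = # 1ℤ
  q^ (suc n) = shift (q^ n)

𝟘 𝟙 : Series
𝟘 = # 0ℤ
𝟙 = # 1ℤ

_⊖_ : Series → Series → Series
f ⊖ g = f ⊕ ⊝ g

opaque
  unfolding _⊕_

  ⊕-coeff : ∀ f g n → (f ⊕ g) n ≡ f n ℤ.+ g n
  ⊕-coeff _ _ _ = refl

  ⊝-coeff : ∀ f n → (⊝ f) n ≡ ℤ.- f n
  ⊝-coeff _ _ = refl

  𝟘-coeff : ∀ n → 𝟘 n ≡ 0ℤ
  𝟘-coeff zero    = refl
  𝟘-coeff (suc _) = refl

  #-coeff₀ : ∀ c → # c 0 ≡ c
  #-coeff₀ c = refl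

  #-coeff₊ : ∀ c n → # c (suc n) ≡ 0ℤ
  #-coeff₊ c n = refl

  ⊗-coeff₀ : ∀ f g → (f ⊗ g) 0 ≡ f 0 ℤ.* g 0
  ⊗-coeff₀ _ _ = refl

  ⊕-cong≈ : ∀ {N f f′ g g′} → f ≈[ N ] f′ → g ≈[ N ] g′ → f ⊕ g ≈[ N ] f′ ⊕ g′
  ⊕-cong≈ (eq< p) (eq< r) = eq< λ n l → cong₂ ℤ._+_ (p n l) (r n l)

  ⊝-cong≈ : ∀ {N f f′} → f ≈[ N ] f′ → ⊝ f ≈[ N ] ⊝ f′
  ⊝-cong≈ (eq< p) = eq< λ n l → cong ℤ.-_ (p n l)

  ⊗-cong≈ : ∀ {N f f′ g g′} → f ≈[ N ] f′ → g ≈[ N ] g′ → f ⊗ g ≈[ N ] f′ ⊗ g′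
  ⊗-cong≈ (eq< p) (eq< r) = eq< (go p r)
    where
    go : ∀ {N f f′ g g′} → (∀ n → n < N → f n ≡ f′ n) → (∀ n → n < N → g n ≡ g′ n) →
         ∀ n → n < N → (f ⊗ g) n ≡ (f′ ⊗ g′) n
    go p r zero    l = cong₂ ℤ._*_ (p 0 l) (r 0 l)
    go {suc N} p r (suc n) (s≤s l) =
      cong₂ ℤ._+_ (cong₂ ℤ._*_ (p 0 (s≤s z≤n)) (r (suc n) (s≤s l)))
                  (go (λ k k<N → p (suc k) (s≤s k<N)) (λ k k<N → r k (ℕ.m≤n⇒m≤1+n k<N)) n l)

  ⊕-cong : ∀ {f f′ g g′} → f ≐ f′ → g ≐ g′ → f ⊕ g ≐ f′ ⊕ g′
  ⊕-cong p r = ≈⇒≐ λ N → ⊕-cong≈ (≐⇒≈ p) (≐⇒≈ r)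

  ⊝-cong : ∀ {f f′} → f ≐ f′ → ⊝ f ≐ ⊝ f′
  ⊝-cong p = ≈⇒≐ λ N → ⊝-cong≈ (≐⇒≈ p)

  ⊗-cong : ∀ {f f′ g g′} → f ≐ f′ → g ≐ g′ → f ⊗ g ≐ f′ ⊗ g′
  ⊗-cong p r = ≈⇒≐ λ N → ⊗-cong≈ (≐⇒≈ p) (≐⇒≈ r)

  private
    distribʳ : ∀ h f g n → ((f ⊕ g) ⊗ h) n ≡ (f ⊗ h) n ℤ.+ (g ⊗ h) n
    distribʳ h f g zero    = ℤ.*-distribʳ-+ (h 0) (f 0) (g 0)
    distribʳ h f g (suc n) = trans (cong (ℤ._+_ ((f 0 ℤ.+ g 0) ℤ.* h (suc n))) (distribʳ h (tail f) (tail g) n))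
      (lemma (f 0) (g 0) (h (suc n)) _ _)
      where
      lemma : ∀ a b c d e → (a ℤ.+ b) ℤ.* c ℤ.+ (d ℤ.+ e) ≡ a ℤ.* c ℤ.+ d ℤ.+ (b ℤ.* c ℤ.+ e)
      lemma = solve-∀

    scaleˡ : ∀ c f g n → ((λ k → c ℤ.* f k) ⊗ g) n ≡ c ℤ.* (f ⊗ g) n
    scaleˡ c f g zero    = ℤ.*-assoc c (f 0) (g 0)
    scaleˡ c f g (suc n) = trans (cong (ℤ._+_ (c ℤ.* f 0 ℤ.* g (suc n))) (scaleˡ c (tail f) g n))
      (lemma c (f 0) (g (suc n)) _)
      where
      lemma : ∀ a b c d → a ℤ.* b ℤ.* c ℤ.+ a ℤ.* d ≡ a ℤ.* (b ℤ.* c ℤ.+ d)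
      lemma = solve-∀

    -- The mirror image of the defining recursion, peeling off the right factor; commutativity is
    -- the comparison of the two.
    ⊗-sucʳ : ∀ f g n → (f ⊗ g) (suc n) ≡ f (suc n) ℤ.* g 0 ℤ.+ (f ⊗ tail g) n
    ⊗-sucʳ f g zero    = ℤ.+-comm (f 0 ℤ.* g 1) (f 1 ℤ.* g 0)
    ⊗-sucʳ f g (suc n) = trans (cong (ℤ._+_ (f 0 ℤ.* g (suc (suc n)))) (⊗-sucʳ (tail f) g n))
      (lemma (f 0 ℤ.* g (suc (suc n))) (f (suc (suc n)) ℤ.* g 0) ((tail f ⊗ tail g) n))
      where
      lemma : ∀ a b c → a ℤ.+ (b ℤ.+ c) ≡ b ℤ.+ (a ℤ.+ c)
      lemma = solve-∀

    comm : ∀ f g n → (f ⊗ g) n ≡ (g ⊗ f) n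
    comm f g zero    = ℤ.*-comm (f 0) (g 0)
    comm f g (suc n) = trans (cong₂ ℤ._+_ (ℤ.*-comm (f 0) (g (suc n))) (comm (tail f) g n)) (sym (⊗-sucʳ g f n))

    assoc : ∀ f g h n → ((f ⊗ g) ⊗ h) n ≡ (f ⊗ (g ⊗ h)) n
    assoc f g h zero    = ℤ.*-assoc (f 0) (g 0) (h 0)
    assoc f g h (suc n) = begin
      f 0 ℤ.* g 0 ℤ.* h (suc n) ℤ.+ (tail (f ⊗ g) ⊗ h) n
        -- By definition the tail of `f ⊗ g` is `f 0` times the tail of `g`, plus `tail f ⊗ g`;
        -- distributivity and scaling apply to these two summands.
        ≡⟨ cong (ℤ._+_ (f 0 ℤ.* g 0 ℤ.* h (suc n)))
             (trans (distribʳ h (λ k → f 0 ℤ.* tail g k) (tail f ⊗ g) n)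
                    (cong₂ ℤ._+_ (scaleˡ (f 0) (tail g) h n) (assoc (tail f) g h n))) ⟩
      f 0 ℤ.* g 0 ℤ.* h (suc n) ℤ.+ (f 0 ℤ.* (tail g ⊗ h) n ℤ.+ (tail f ⊗ (g ⊗ h)) n)
        ≡⟨ lemma (f 0) (g 0) (h (suc n)) _ _ ⟩
      f 0 ℤ.* (g 0 ℤ.* h (suc n) ℤ.+ (tail g ⊗ h) n) ℤ.+ (tail f ⊗ (g ⊗ h)) n ∎
      where
      open ≡-Reasoning
      lemma : ∀ a b c d e → a ℤ.* b ℤ.* c ℤ.+ (a ℤ.* d ℤ.+ e) ≡ a ℤ.* (b ℤ.* c ℤ.+ d) ℤ.+ e
      lemma = solve-∀

    zero-⊗ : ∀ f g → (∀ n → f n ≡ 0ℤ) → ∀ n → (f ⊗ g) n ≡ 0ℤ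
    zero-⊗ f g p zero    = cong (ℤ._* g 0) (p 0)
    zero-⊗ f g p (suc n) = cong₂ ℤ._+_ (cong (ℤ._* g (suc n)) (p 0)) (zero-⊗ (tail f) g (λ k → p (suc k)) n)

    #-⊗ : ∀ c f n → (# c ⊗ f) n ≡ c ℤ.* f n
    #-⊗ c f zero    = refl
    #-⊗ c f (suc n) = trans (cong (ℤ._+_ (c ℤ.* f (suc n))) (zero-⊗ (tail (# c)) f (λ _ → refl) n)) (ℤ.+-identityʳ _)

  ⊗-comm : ∀ f g → f ⊗ g ≐ g ⊗ f
  ⊗-comm f g = eq (comm f g)

  #-scale : ∀ c f n → (# c ⊗ f) n ≡ c ℤ.* f n
  #-scale = #-⊗

  series-isCommutativeRing : IsCommutativeRing _≐_ _⊕_ _⊗_ ⊝_ 𝟘 𝟙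
  series-isCommutativeRing = record
      { isRing = record
        { +-isAbelianGroup = record
          { isGroup = record
            { isMonoid = record
              { isSemigroup = record
                { isMagma = record { isEquivalence = Setoid.isEquivalence ≐-setoid ; ∙-cong = ⊕-cong }
                ; assoc = λ f g h → eq λ n → ℤ.+-assoc (f n) (g n) (h n) }
              ; identity = (λ f → eq λ n → trans (cong (ℤ._+ f n) (𝟘-coeff n)) (ℤ.+-identityˡ (f n)))
                         , (λ f → eq λ n → trans (cong (ℤ._+_ (f n)) (𝟘-coeff n)) (ℤ.+-identityʳ (f n))) }
            ; inverse = (λ f → eq λ n → trans (ℤ.+-inverseˡ (f n)) (sym (𝟘-coeff n)))
                      , (λ f → eq λ n → trans (ℤ.+-inverseʳ (f n)) (sym (𝟘-coeff n)))
            ; ⁻¹-cong = ⊝-cong }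
          ; comm = λ f g → eq λ n → ℤ.+-comm (f n) (g n) }
        ; *-cong = ⊗-cong
        ; *-assoc = λ f g h → eq (assoc f g h)
        ; *-identity = (λ f → eq λ n → trans (#-⊗ 1ℤ f n) (ℤ.*-identityˡ (f n)))
                     , (λ f → eq λ n → trans (comm f 𝟙 n) (trans (#-⊗ 1ℤ f n) (ℤ.*-identityˡ (f n))))
        ; distrib = (λ h f g → eq λ n → trans (comm h (f ⊕ g) n) (trans (distribʳ h f g n) (cong₂ ℤ._+_ (comm f h n) (comm g h n))))
                  , (λ h f g → eq (distribʳ h f g)) }
      ; *-comm = ⊗-comm }

  #-+ : ∀ a b → # (a ℤ.+ b) ≐ # a ⊕ # b
  #-+ a b = eq λ { zero → refl ; (suc _) → refl }

  #-* : ∀ a b → # (a ℤ.* b) ≐ # a ⊗ # b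
  #-* a b = eq λ { zero → refl ; (suc n) → sym (trans (#-⊗ a (# b) (suc n)) (ℤ.*-zeroʳ a)) }

  #-neg : ∀ a → # (ℤ.- a) ≐ ⊝ # a
  #-neg a = eq λ { zero → refl ; (suc _) → refl }

  shift-⊗ : ∀ f g → shift f ⊗ g ≐ shift (f ⊗ g)
  shift-⊗ f g = eq λ { zero → refl ; (suc n) → ℤ.+-identityˡ _ }

  q^0 : q^ 0 ≐ 𝟙
  q^0 = ≐-refl

  q^-+ : ∀ m n → q^ (m ℕ.+ n) ≐ q^ m ⊗ q^ n
  q^-+ m n = eq (go m)
    where
    go : ∀ m k → q^ (m ℕ.+ n) k ≡ (q^ m ⊗ q^ n) k
    go zero    k = sym (trans (#-⊗ 1ℤ (q^ n) k) (ℤ.*-identityˡ _))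
    go (suc m) zero    = refl
    go (suc m) (suc k) = trans (go m k) (sym (at (shift-⊗ (q^ m) (q^ n)) (suc k)))

  q^-shift : ∀ m f n → (q^ m ⊗ f) (m ℕ.+ n) ≡ f n
  q^-shift zero    f n = trans (#-⊗ 1ℤ f n) (ℤ.*-identityˡ _)
  q^-shift (suc m) f n = trans (at (shift-⊗ (q^ m) f) (suc (m ℕ.+ n))) (q^-shift m f n)

  q^-below : ∀ m f n → n < m → (q^ m ⊗ f) n ≡ 0ℤ
  q^-below (suc m) f zero    _       = at (shift-⊗ (q^ m) f) 0
  q^-below (suc m) f (suc n) (s≤s l) = trans (at (shift-⊗ (q^ m) f) (suc n)) (q^-below m f n l)

  q^-diagonal : ∀ m → q^ m m ≡ 1ℤ
  q^-diagonal zero    = refl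
  q^-diagonal (suc m) = q^-diagonal m

  q^-off-diagonal : ∀ m n → m ≢ n → q^ m n ≡ 0ℤ
  q^-off-diagonal zero    zero    m≢n = ⊥-elim (m≢n refl)
  q^-off-diagonal zero    (suc n) m≢n = refl
  q^-off-diagonal (suc m) zero    m≢n = refl
  q^-off-diagonal (suc m) (suc n) m≢n = q^-off-diagonal m n (m≢n ∘ cong suc)

  ⊗-vanish-at : ∀ f g n → (∀ i j → i ℕ.+ j ≡ n → f i ≡ 0ℤ ⊎ g j ≡ 0ℤ) → (f ⊗ g) n ≡ 0ℤ
  ⊗-vanish-at f g zero    p = product-zero (p 0 0 refl)
    where
    product-zero : ∀ {a b} → a ≡ 0ℤ ⊎ b ≡ 0ℤ → a ℤ.* b ≡ 0ℤ
    product-zero {b = b} (inj₁ refl) = ℤ.*-zeroˡ b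
    product-zero {a = a} (inj₂ refl) = ℤ.*-zeroʳ a
  ⊗-vanish-at f g (suc n) p = cong₂ ℤ._+_ (product-zero (p 0 (suc n) refl)) (⊗-vanish-at (tail f) g n λ i j e → p (suc i) j (cong suc e))
    where
    product-zero : ∀ {a b} → a ≡ 0ℤ ⊎ b ≡ 0ℤ → a ℤ.* b ≡ 0ℤ
    product-zero {b = b} (inj₁ refl) = ℤ.*-zeroˡ b
    product-zero {a = a} (inj₂ refl) = ℤ.*-zeroʳ a

  q^-nonneg : ∀ m n → 0ℤ ℤ.≤ q^ m n
  q^-nonneg zero    zero    = ℤ.+≤+ z≤n
  q^-nonneg zero    (suc n) = ℤ.+≤+ z≤n
  q^-nonneg (suc m) zero    = ℤ.+≤+ z≤n
  q^-nonneg (suc m) (suc n) = q^-nonneg m n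

  𝟙-nonneg : ∀ n → 0ℤ ℤ.≤ 𝟙 n
  𝟙-nonneg zero    = ℤ.+≤+ z≤n
  𝟙-nonneg (suc n) = ℤ.+≤+ z≤n

  ⊕-nonneg : ∀ {f g} → (∀ n → 0ℤ ℤ.≤ f n) → (∀ n → 0ℤ ℤ.≤ g n) → ∀ n → 0ℤ ℤ.≤ (f ⊕ g) n
  ⊕-nonneg p r n = ℤ.+-mono-≤ (p n) (r n)

  *-nonneg : ∀ {a b} → 0ℤ ℤ.≤ a → 0ℤ ℤ.≤ b → 0ℤ ℤ.≤ a ℤ.* b
  *-nonneg {+ a} {+ b} _ _ = subst (0ℤ ℤ.≤_) (ℤ.pos-* a b) (ℤ.+≤+ z≤n)

  ⊗-nonneg : ∀ {f g} → (∀ n → 0ℤ ℤ.≤ f n) → (∀ n → 0ℤ ℤ.≤ g n) → ∀ n → 0ℤ ℤ.≤ (f ⊗ g) n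
  ⊗-nonneg p r zero    = *-nonneg (p 0) (r 0)
  ⊗-nonneg {f} {g} p r (suc n) = ℤ.+-mono-≤ (*-nonneg (p 0) (r (suc n))) (⊗-nonneg {tail f} {g} (λ k → p (suc k)) r n)

  ⊗-lower : ∀ {f g} → (∀ n → 0ℤ ℤ.≤ f n) → (∀ n → 0ℤ ℤ.≤ g n) → ∀ i j → f i ℤ.* g j ℤ.≤ (f ⊗ g) (i ℕ.+ j)
  ⊗-lower p r zero    zero    = ℤ.≤-refl
  ⊗-lower {f} {g} p r zero    (suc j) = subst (ℤ._≤ (f ⊗ g) (suc j)) (ℤ.+-identityʳ _) (ℤ.+-monoʳ-≤ (f 0 ℤ.* g (suc j)) (⊗-nonneg {tail f} {g} (λ k → p (suc k)) r j))
  ⊗-lower {f} {g} p r (suc i) j = subst (ℤ._≤ (f ⊗ g) (suc (i ℕ.+ j))) (ℤ.+-identityˡ _) (ℤ.+-mono-≤ (*-nonneg (p 0) (r (suc (i ℕ.+ j)))) (⊗-lower {tail f} {g} (λ k → p (suc k)) r i j))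

series-ring : CommutativeRing 0ℓ 0ℓ
series-ring = record { isCommutativeRing = series-isCommutativeRing }

module Ring = CommutativeRing series-ring using (+-assoc; +-comm; +-identityˡ; +-identityʳ; *-assoc; *-identityˡ; *-identityʳ; distribˡ; distribʳ; zeroˡ; zeroʳ)

#-≟ : ∀ a b → Maybe (# a ≐ # b)
#-≟ a b with a ℤ.≟ b
... | yes refl = just ≐-refl
... | no  _    = nothing

#-homomorphism : CommutativeRing.rawRing ℤ.+-*-commutativeRing ACR.-Raw-AlmostCommutative⟶ ACR.fromCommutativeRing series-ring
#-homomorphism = record { ⟦_⟧ = # ; +-homo = #-+ ; *-homo = #-* ; -‿homo = #-neg ; 0-homo = ≐-refl ; 1-homo = ≐-refl }

open Algebra.Solver.Ring (CommutativeRing.rawRing ℤ.+-*-commutativeRing) (ACR.fromCommutativeRing series-ring) #-homomorphism #-≟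
  public using (solve; _:=_; _:+_; _:*_; _:-_; :-_; con)

-- Unordered summation of families of power series over an arbitrary index type

private variable
  I J : Set

module ≐-Reasoning = Relation.Binary.Reasoning.Setoid ≐-setoid
module ≈-Reasoning (N : ℕ) = Relation.Binary.Reasoning.Setoid (≈-setoid N)

ΣL : (I → Series) → List I → Series
ΣL f []      = 𝟘
ΣL f (i ∷ L) = f i ⊕ ΣL f L

-- A finite list that contains every index whose term is visible below q^N. Absence of repetitions
-- lets a plain list sum stand for a sum over a set.
record Covers (N : ℕ) (f : I → Series) (L : List I) : Set where
  constructor covers
  field
    unique  : Unique L
    outside : ∀ i → i ∈ L ⊎ f i ≈[ N ] 𝟘
open Covers

-- Summability and value in one notion, with one finite support for each precision. No enumeration
-- of the index type is involved, so a bijection transports sums at no cost.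
record HasSum (f : I → Series) (s : Series) : Set where
  constructor hasSum
  field
    support : ∀ N → ∃[ L ] Covers N f L × ΣL f L ≈[ N ] s
open HasSum

ΣL-cong≈ : ∀ {N} {f g : I → Series} → (∀ i → f i ≈[ N ] g i) → ∀ L → ΣL f L ≈[ N ] ΣL g L
ΣL-cong≈ p []      = ≈-refl
ΣL-cong≈ p (i ∷ L) = ⊕-cong≈ (p i) (ΣL-cong≈ p L)

ΣL-cong : {f g : I → Series} → (∀ i → f i ≐ g i) → ∀ L → ΣL f L ≐ ΣL g L
ΣL-cong p L = ≈⇒≐ λ N → ΣL-cong≈ (λ i → ≐⇒≈ (p i)) L

ΣL-⊕ : ∀ (f g : I → Series) L → ΣL (λ i → f i ⊕ g i) L ≐ ΣL f L ⊕ ΣL g L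
ΣL-⊕ f g []      = ≐-sym (Ring.+-identityˡ 𝟘)
ΣL-⊕ f g (i ∷ L) = ≐-trans (⊕-cong ≐-refl (ΣL-⊕ f g L))
  (solve 4 (λ a b c d → (a :+ b) :+ (c :+ d) := (a :+ c) :+ (b :+ d)) ≐-refl (f i) (g i) (ΣL f L) (ΣL g L))

ΣL-⊗ : ∀ c (f : I → Series) L → ΣL (λ i → c ⊗ f i) L ≐ c ⊗ ΣL f L
ΣL-⊗ c f []      = ≐-sym (Ring.zeroʳ c)
ΣL-⊗ c f (i ∷ L) = ≐-trans (⊕-cong ≐-refl (ΣL-⊗ c f L)) (≐-sym (Ring.distribˡ c (f i) (ΣL f L)))

ΣL-map : ∀ (f : J → Series) (h : I → J) L → ΣL f (map h L) ≐ ΣL (f ∘ h) L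
ΣL-map f h []      = ≐-refl
ΣL-map f h (i ∷ L) = ⊕-cong ≐-refl (ΣL-map f h L)

ΣL-++ : ∀ (f : I → Series) L M → ΣL f (L ++ M) ≐ ΣL f L ⊕ ΣL f M
ΣL-++ f []      M = ≐-sym (Ring.+-identityˡ _)
ΣL-++ f (i ∷ L) M = ≐-trans (⊕-cong ≐-refl (ΣL-++ f L M)) (≐-sym (Ring.+-assoc (f i) (ΣL f L) (ΣL f M)))

ΣL-vanish : ∀ {N} {f : I → Series} {L} → (∀ {i} → i ∈ L → f i ≈[ N ] 𝟘) → ΣL f L ≈[ N ] 𝟘
ΣL-vanish {L = []}    p = ≈-refl
ΣL-vanish {L = i ∷ L} p = ≈-trans (⊕-cong≈ (p (here refl)) (ΣL-vanish (p ∘ there))) (≐⇒≈ (Ring.+-identityˡ 𝟘))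

without : ∀ {x : I} L → x ∈ L → List I
without (_ ∷ L) (here _)  = L
without (y ∷ L) (there p) = y ∷ without L p

without-⊆ : ∀ {x y : I} {L} (p : x ∈ L) → y ∈ without L p → y ∈ L
without-⊆ (here _)  r         = there r
without-⊆ (there p) (here e)  = here e
without-⊆ (there p) (there r) = there (without-⊆ p r)

without-all : ∀ {P : I → Set} {x : I} {L} (p : x ∈ L) → All P L → All P (without L p)
without-all (here _)  (_ ∷ a) = a
without-all (there p) (b ∷ a) = b ∷ without-all p a

without-unique : ∀ {x : I} {L} (p : x ∈ L) → Unique L → Unique (without L p)
without-unique (here _)  (_ ∷ u) = u
without-unique (there p) (a ∷ u) = without-all p a ∷ without-unique p u

without-≢ : ∀ {x y : I} {L} (p : x ∈ L) → Unique L → y ∈ without L p → x ≢ y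
without-≢ (here refl) (a ∷ u) r           = All.lookup a r
without-≢ (there p)   (a ∷ u) (here refl) = λ { refl → All.lookup a p refl }
without-≢ (there p)   (a ∷ u) (there r)   = without-≢ p u r

without-split : ∀ {x y : I} {L} (p : x ∈ L) → y ∈ L → y ≡ x ⊎ y ∈ without L p
without-split (here refl) (here e)  = inj₁ e
without-split (here refl) (there r) = inj₂ r
without-split (there p)   (here e)  = inj₂ (here e)
without-split (there p)   (there r) with without-split p r
... | inj₁ e = inj₁ e
... | inj₂ m = inj₂ (there m)

ΣL-without : ∀ (f : I → Series) {x L} (p : x ∈ L) → ΣL f L ≐ f x ⊕ ΣL f (without L p)
ΣL-without f (here refl) = ≐-refl
ΣL-without f {x} {y ∷ L} (there p) = ≐-trans (⊕-cong ≐-refl (ΣL-without f p))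
  (solve 3 (λ a b c → a :+ (b :+ c) := b :+ (a :+ c)) ≐-refl (f y) (f x) (ΣL f (without L p)))

-- Induction on `L`, striking each common index out of `M`; an index present on one side only
-- contributes nothing below q^N.
ΣL-agree : ∀ {N} (f : I → Series) {L M} → Unique L → Unique M →
           (∀ {x} → x ∈ L → x ∈ M ⊎ f x ≈[ N ] 𝟘) → (∀ {x} → x ∈ M → x ∈ L ⊎ f x ≈[ N ] 𝟘) →
           ΣL f L ≈[ N ] ΣL f M
ΣL-agree f {[]} {M} _ _ _ M⊆L = ≈-sym (ΣL-vanish λ m → case M⊆L m of λ { (inj₂ z) → z })
ΣL-agree {N = N} f {x ∷ L} {M} (x∉L ∷ uL) uM L⊆M M⊆L with L⊆M (here refl)
... | inj₁ p = ≈-trans (⊕-cong≈ ≈-refl (ΣL-agree f uL (without-unique p uM) there⊆ ⊆there)) (≐⇒≈ (≐-sym (ΣL-without f p)))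
  where
  there⊆ : ∀ {y} → y ∈ L → y ∈ without M p ⊎ f y ≈[ N ] 𝟘
  there⊆ y∈L with L⊆M (there y∈L)
  ... | inj₂ z = inj₂ z
  ... | inj₁ y∈M with without-split p y∈M
  ...   | inj₁ refl = ⊥-elim (All.lookup x∉L y∈L refl)
  ...   | inj₂ m    = inj₁ m
  ⊆there : ∀ {y} → y ∈ without M p → y ∈ L ⊎ f y ≈[ N ] 𝟘
  ⊆there y∈ with M⊆L (without-⊆ p y∈)
  ... | inj₂ z           = inj₂ z
  ... | inj₁ (there y∈L) = inj₁ y∈L
  ... | inj₁ (here e)    = ⊥-elim (without-≢ p uM y∈ (sym e))
... | inj₂ z = ≈-trans (⊕-cong≈ z (ΣL-agree f uL uM (L⊆M ∘ there) ⊆tail)) (≐⇒≈ (Ring.+-identityˡ (ΣL f M)))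
  where
  ⊆tail : ∀ {y} → y ∈ M → y ∈ L ⊎ f y ≈[ N ] 𝟘
  ⊆tail y∈M with M⊆L y∈M
  ... | inj₂ z′          = inj₂ z′
  ... | inj₁ (there y∈L) = inj₁ y∈L
  ... | inj₁ (here refl) = inj₂ z

ΣL-covers : ∀ {N} (f : I → Series) {L M} → Covers N f L → Covers N f M → ΣL f L ≈[ N ] ΣL f M
ΣL-covers f c d = ΣL-agree f (unique c) (unique d) (λ {x} _ → outside d x) (λ {x} _ → outside c x)

-- The main source of identities below: one family is summed in two ways.
HasSum-unique : {f : I → Series} {s t : Series} → HasSum f s → HasSum f t → s ≐ t
HasSum-unique {f = f} hs ht = ≈⇒≐ λ N → case (support hs N , support ht N) of λ
  { ((L , c , p) , (M , d , r)) → ≈-trans (≈-sym p) (≈-trans (ΣL-covers f c d) r) }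

HasSum-cong : {f g : I → Series} {s t : Series} → (∀ i → f i ≐ g i) → s ≐ t → HasSum f s → HasSum g t
HasSum-cong {f = f} {g} f≐g s≐t h = hasSum λ N → case support h N of λ
  { (L , covers u o , p) → L
  , covers u (λ i → case o i of λ { (inj₁ m) → inj₁ m ; (inj₂ z) → inj₂ (≈-trans (≐⇒≈ (≐-sym (f≐g i))) z) })
  , ≈-trans (≐⇒≈ (ΣL-cong (λ i → ≐-sym (f≐g i)) L)) (≈-trans p (≐⇒≈ s≐t)) }

private
  enlarge : ∀ {N} {f : I → Series} {L K} → Covers N f L → Unique K → (∀ {i} → i ∈ L → i ∈ K) → Covers N f K
  enlarge c u L⊆K = covers u λ i → case outside c i of λ { (inj₁ m) → inj₁ (L⊆K m) ; (inj₂ z) → inj₂ z }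

HasSum-⊕ : DecidableEquality I → {f g : I → Series} {s t : Series} →
           HasSum f s → HasSum g t → HasSum (λ i → f i ⊕ g i) (s ⊕ t)
HasSum-⊕ {I = I} _≟_ {f} {g} {s} {t} hf hg = hasSum λ N → case support hf N , support hg N of λ
  { ((L , c , p) , (M , d , r)) → go N L M c d p r }
  where
  go : ∀ N L M → Covers N f L → Covers N g M → ΣL f L ≈[ N ] s → ΣL g M ≈[ N ] t →
       ∃[ K ] Covers N (λ i → f i ⊕ g i) K × ΣL (λ i → f i ⊕ g i) K ≈[ N ] s ⊕ t
  go N L M c d p r = K , covers uK out , ≈-trans (≐⇒≈ (ΣL-⊕ f g K))
    (⊕-cong≈ (≈-trans (ΣL-covers f c′ c) p) (≈-trans (ΣL-covers g d′ d) r))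
    where
    K : List I
    -- The two supports may overlap, hence the decidable equality.
    K = deduplicate _≟_ (L ++ M)
    uK : Unique K
    uK = DecUnique.deduplicate-! _≟_ (L ++ M)
    c′ : Covers N f K
    c′ = enlarge c uK (λ m → ∈-deduplicate⁺ _≟_ (∈-++⁺ˡ m))
    d′ : Covers N g K
    d′ = enlarge d uK (λ m → ∈-deduplicate⁺ _≟_ (∈-++⁺ʳ L m))
    out : ∀ i → i ∈ K ⊎ f i ⊕ g i ≈[ N ] 𝟘
    out i with outside c′ i | outside d′ i
    ... | inj₁ m | _      = inj₁ m
    ... | inj₂ _ | inj₁ m = inj₁ m
    ... | inj₂ z | inj₂ w = inj₂ (≈-trans (⊕-cong≈ z w) (≐⇒≈ (Ring.+-identityˡ 𝟘)))

HasSum-⊗ : ∀ c {f : I → Series} {s} → HasSum f s → HasSum (λ i → c ⊗ f i) (c ⊗ s)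
HasSum-⊗ c {f} h = hasSum λ N → case support h N of λ
  { (L , covers u o , p) → L
  , covers u (λ i → case o i of λ { (inj₁ m) → inj₁ m
                                  ; (inj₂ z) → inj₂ (≈-trans (⊗-cong≈ ≈-refl z) (≐⇒≈ (Ring.zeroʳ c))) })
  , ≈-trans (≐⇒≈ (ΣL-⊗ c f L)) (⊗-cong≈ ≈-refl p) }

record _≅_ (I J : Set) : Set where
  constructor bij
  field
    to      : I → J
    from    : J → I
    from-to : ∀ i → from (to i) ≡ i
    to-from : ∀ j → to (from j) ≡ j

HasSum-reindex : (b : I ≅ J) {f : J → Series} {s : Series} → HasSum f s → HasSum (f ∘ _≅_.to b) s
HasSum-reindex (bij to from ft tf) {f} h = hasSum λ N → case support h N of λ
  { (M , covers u o , p) → map from M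
  , covers (Unique.map⁺ (λ {j} {k} e → trans (sym (tf j)) (trans (cong to e) (tf k))) u)
           (λ i → case o (to i) of λ { (inj₁ m) → inj₁ (subst (_∈ map from M) (ft i) (∈-map⁺ from m)) ; (inj₂ z) → inj₂ z })
  , ≈-trans (≐⇒≈ (≐-trans (ΣL-map (f ∘ to) from M) (ΣL-cong (λ j → eq λ n → cong (λ k → f k n) (tf j)) M))) p }

HasSum-⊎ : {f : I → Series} {g : J → Series} {s t : Series} → HasSum f s → HasSum g t → HasSum [ f , g ]′ (s ⊕ t)
HasSum-⊎ {f = f} {g} hf hg = hasSum λ N → case support hf N , support hg N of λ
  { ((L , c , p) , (M , d , r)) → map inj₁ L ++ map inj₂ M
  , covers (Unique.++⁺ (Unique.map⁺ (λ { refl → refl }) (unique c)) (Unique.map⁺ (λ { refl → refl }) (unique d))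
             λ { (x , y) → case ∈-map⁻ inj₁ x , ∈-map⁻ inj₂ y of λ { ((_ , _ , refl) , (_ , _ , ())) } })
           (λ { (inj₁ i) → case outside c i of λ { (inj₁ m) → inj₁ (∈-++⁺ˡ (∈-map⁺ inj₁ m)) ; (inj₂ z) → inj₂ z }
              ; (inj₂ j) → case outside d j of λ { (inj₁ m) → inj₁ (∈-++⁺ʳ (map inj₁ L) (∈-map⁺ inj₂ m)) ; (inj₂ z) → inj₂ z } })
  , ≈-trans (≐⇒≈ (≐-trans (ΣL-++ [ f , g ]′ (map inj₁ L) (map inj₂ M)) (⊕-cong (ΣL-map [ f , g ]′ inj₁ L) (ΣL-map [ f , g ]′ inj₂ M))))
            (⊕-cong≈ p r) }

ΣL-product : ∀ (f : I → Series) (g : J → Series) L M →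
             ΣL (λ (i , j) → f i ⊗ g j) (cartesianProduct L M) ≐ ΣL f L ⊗ ΣL g M
ΣL-product f g []      M = ≐-sym (Ring.zeroˡ _)
ΣL-product f g (i ∷ L) M = begin
  ΣL h (map (i ,_) M ++ cartesianProduct L M)          ≈⟨ ΣL-++ h (map (i ,_) M) (cartesianProduct L M) ⟩
  ΣL h (map (i ,_) M) ⊕ ΣL h (cartesianProduct L M)    ≈⟨ ⊕-cong (≐-trans (ΣL-map h (i ,_) M) (ΣL-⊗ (f i) g M)) (ΣL-product f g L M) ⟩
  f i ⊗ ΣL g M ⊕ ΣL f L ⊗ ΣL g M                       ≈⟨ Ring.distribʳ (ΣL g M) (f i) (ΣL f L) ⟨
  ΣL f (i ∷ L) ⊗ ΣL g M                                ∎
  where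
  open ≐-Reasoning
  h : _ → Series
  h (i , j) = f i ⊗ g j

HasSum-× : {f : I → Series} {g : J → Series} {s t : Series} →
           HasSum f s → HasSum g t → HasSum (λ (i , j) → f i ⊗ g j) (s ⊗ t)
HasSum-× {f = f} {g} hf hg = hasSum λ N → case support hf N , support hg N of λ
  { ((L , c , p) , (M , d , r)) → cartesianProduct L M
  , covers (Unique.cartesianProduct⁺ (unique c) (unique d)) (out c d)
  , ≈-trans (≐⇒≈ (ΣL-product f g L M)) (⊗-cong≈ p r) }
  where
  out : ∀ {N L M} → Covers N f L → Covers N g M → ∀ ij → ij ∈ cartesianProduct L M ⊎ (f (proj₁ ij) ⊗ g (proj₂ ij)) ≈[ N ] 𝟘
  out c d (i , j) with outside c i | outside d j
  ... | inj₁ m | inj₁ n = inj₁ (∈-cartesianProduct⁺ m n)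
  ... | inj₂ z | _      = inj₂ (≈-trans (⊗-cong≈ z ≈-refl) (≐⇒≈ (Ring.zeroˡ _)))
  ... | inj₁ _ | inj₂ z = inj₂ (≈-trans (⊗-cong≈ ≈-refl z) (≐⇒≈ (Ring.zeroʳ _)))

-- Fubini for a jointly summable family. Rows are cut at the same precision N, and only the finitely
-- many first coordinates occurring in the joint support are kept.
HasSum-Σ : DecidableEquality I → {f : I × J → Series} {g : I → Series} {s : Series} →
           HasSum f s → (∀ i → HasSum (λ j → f (i , j)) (g i)) → HasSum g s
HasSum-Σ {I = I} {J = J} _≟_ {f} {g} {s} hf hg = hasSum go
  where
  module _ (N : ℕ) where
    rows : I → List J
    rows i = proj₁ (support (hg i) N)
    row-covers : ∀ i → Covers N (λ j → f (i , j)) (rows i)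
    row-covers i = proj₁ (proj₂ (support (hg i) N))
    flat : List I → List (I × J)
    flat []      = []
    flat (i ∷ K) = map (i ,_) (rows i) ++ flat K
    ∈-flat⁻ : ∀ K {ij} → ij ∈ flat K → proj₁ ij ∈ K
    ∈-flat⁻ (i ∷ K) m with ∈-++⁻ (map (i ,_) (rows i)) m
    ... | inj₂ r = there (∈-flat⁻ K r)
    ... | inj₁ r with ∈-map⁻ (i ,_) r
    ...   | _ , _ , refl = here refl
    ∈-flat⁺ : ∀ {K i j} → i ∈ K → j ∈ rows i → (i , j) ∈ flat K
    ∈-flat⁺ (here refl) m = ∈-++⁺ˡ (∈-map⁺ _ m)
    ∈-flat⁺ {K = k ∷ _} (there p) m = ∈-++⁺ʳ (map (k ,_) (rows k)) (∈-flat⁺ p m)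
    flat-unique : ∀ {K} → Unique K → Unique (flat K)
    flat-unique []                  = []
    flat-unique {K = i ∷ K} (a ∷ u) = Unique.++⁺ (Unique.map⁺ (λ { refl → refl }) (unique (row-covers i))) (flat-unique u)
      λ { (x , y) → case ∈-map⁻ (i ,_) x of λ { (_ , _ , refl) → All.lookup a (∈-flat⁻ K y) refl } }
    ΣL-flat : ∀ K → ΣL f (flat K) ≈[ N ] ΣL g K
    ΣL-flat []      = ≈-refl
    ΣL-flat (i ∷ K) = ≈-trans (≐⇒≈ (ΣL-++ f (map (i ,_) (rows i)) (flat K)))
      (⊕-cong≈ (≈-trans (≐⇒≈ (ΣL-map f (i ,_) (rows i))) (proj₂ (proj₂ (support (hg i) N)))) (ΣL-flat K))
  go : ∀ N → ∃[ K ] Covers N g K × ΣL g K ≈[ N ] s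
  go N with support hf N
  ... | L , c , p = K , covers uK out , ≈-trans (≈-sym (ΣL-flat N K))
    (≈-trans (ΣL-agree f (flat-unique N uK) (unique c) (λ {x} _ → outside c x) in-flat) p)
    where
    K : List I
    K = deduplicate _≟_ (map proj₁ L)
    uK : Unique K
    uK = DecUnique.deduplicate-! _≟_ (map proj₁ L)
    in-flat : ∀ {x} → x ∈ L → x ∈ flat N K ⊎ f x ≈[ N ] 𝟘
    in-flat {i , j} m with outside (row-covers N i) j
    ... | inj₁ r = inj₁ (∈-flat⁺ N (∈-deduplicate⁺ _≟_ (∈-map⁺ proj₁ m)) r)
    ... | inj₂ z = inj₂ z
    out : ∀ i → i ∈ K ⊎ g i ≈[ N ] 𝟘
    out i = try (rows N i) ΣL-row
      where
      ΣL-row : ΣL (λ j → f (i , j)) (rows N i) ≈[ N ] g i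
      ΣL-row = proj₂ (proj₂ (support (hg i) N))
      -- Scanning the finite support of row i: either some entry lies in the joint support, which
      -- puts i into `K`, or every entry vanishes below q^N and so does the row sum.
      try : ∀ R → ΣL (λ j → f (i , j)) R ≈[ N ] g i → i ∈ K ⊎ g i ≈[ N ] 𝟘
      try R e = scan R ≈-refl
        where
        scan : ∀ R′ → ΣL (λ j → f (i , j)) R ≈[ N ] ΣL (λ j → f (i , j)) R′ → i ∈ K ⊎ g i ≈[ N ] 𝟘
        scan []       e′ = inj₂ (≈-trans (≈-sym e) e′)
        scan (j ∷ R′) e′ with outside c (i , j)
        ... | inj₁ m = inj₁ (∈-deduplicate⁺ _≟_ (∈-map⁺ proj₁ m))
        ... | inj₂ z = scan R′ (≈-trans e′ (≈-trans (⊕-cong≈ z ≈-refl) (≐⇒≈ (Ring.+-identityˡ _))))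

module _ (box : ℕ → List I) where
  -- Coefficient n is read off from the box for precision n + 1. The definition asks for no
  -- summability, so a sum can be named first and justified later by `HasSum-box`.
  sumOver : (I → Series) → Series
  sumOver f n = ΣL f (box (suc n)) n

  HasSum-box : ∀ {f : I → Series} → (∀ N → Covers N f (box N)) → HasSum f (sumOver f)
  HasSum-box {f} c = hasSum λ N → box N , c N , eq< λ n n<N →
    below (ΣL-covers f (covers (unique (c N)) (λ i → case outside (c N) i of λ { (inj₁ m) → inj₁ m ; (inj₂ z) → inj₂ (≈-weaken n<N z) })) (c (suc n))) n ℕ.≤-refl

-- The offset 2 leaves room for exponents such as i(i-1)/2, which exceed i only from i = 2 on.
sumℕ : (ℕ → Series) → Series
sumℕ = sumOver (λ N → upTo (2 ℕ.+ N))

HasSum-ℕ : ∀ {f} → (∀ N i → N ≤ i → f (2 ℕ.+ i) ≈[ N ] 𝟘) → HasSum f (sumℕ f)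
HasSum-ℕ {f} p = HasSum-box _ λ N → covers (Unique.upTo⁺ (2 ℕ.+ N)) (out N)
  where
  out : ∀ N i → i ∈ upTo (2 ℕ.+ N) ⊎ f i ≈[ N ] 𝟘
  out N i with i ℕ.<? 2 ℕ.+ N
  ... | yes l = inj₁ (∈-upTo⁺ l)
  ... | no  l with i | ℕ.≮⇒≥ l
  ...   | suc (suc j) | s≤s (s≤s N≤j) = inj₂ (p N j N≤j)

ℤ≅ℕ⊎ℕ : ℤ ≅ (ℕ ⊎ ℕ)
ℤ≅ℕ⊎ℕ = bij (λ { (+ n) → inj₁ n ; -[1+ n ] → inj₂ n }) [ +_ , -[1+_] ]′ (λ { (+ _) → refl ; -[1+ _ ] → refl }) (λ { (inj₁ _) → refl ; (inj₂ _) → refl })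

HasSum-halves : ∀ {f : ℤ → Series} {s t} → HasSum (f ∘ +_) s → HasSum (f ∘ -[1+_]) t → HasSum f (s ⊕ t)
HasSum-halves hs ht = HasSum-cong (λ { (+ _) → ≐-refl ; -[1+ _ ] → ≐-refl }) ≐-refl (HasSum-reindex ℤ≅ℕ⊎ℕ (HasSum-⊎ hs ht))

sumℤ : (ℤ → Series) → Series
sumℤ f = sumℕ (f ∘ +_) ⊕ sumℕ (f ∘ -[1+_])

HasSum-ℤ : ∀ {f} → (∀ N n → N ≤ n → f (+ (2 ℕ.+ n)) ≈[ N ] 𝟘) → (∀ N n → N ≤ n → f -[1+ (2 ℕ.+ n) ] ≈[ N ] 𝟘) → HasSum f (sumℤ f)
HasSum-ℤ p r = HasSum-halves (HasSum-ℕ p) (HasSum-ℕ r)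

HasSum-telescope : ∀ {f : ℕ → Series} {a} → (∀ N k → N ≤ k → f k ≈[ N ] a) → HasSum (λ k → f (suc k) ⊖ f k) (a ⊖ f 0)
HasSum-telescope {f} {a} p = hasSum λ N → upTo N , covers (Unique.upTo⁺ N) (out N) , ≈-trans (≐⇒≈ (tele f N)) (⊕-cong≈ (p N N ℕ.≤-refl) ≈-refl)
  where
  out : ∀ N i → i ∈ upTo N ⊎ f (suc i) ⊖ f i ≈[ N ] 𝟘
  out N i with i ℕ.<? N
  ... | yes l = inj₁ (∈-upTo⁺ l)
  ... | no  l = inj₂ (≈-trans (⊕-cong≈ (p N (suc i) (ℕ.m≤n⇒m≤1+n (ℕ.≮⇒≥ l))) (⊝-cong≈ (p N i (ℕ.≮⇒≥ l))))
                              (≐⇒≈ (solve 1 (λ a → a :- a := con 0ℤ) ≐-refl a)))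
  shiftL : ∀ (g : ℕ → Series) (h : ℕ → ℕ) n → ΣL g (Data.List.applyUpTo h n) ≐ ΣL (g ∘ h) (upTo n)
  shiftL g h zero    = ≐-refl
  shiftL g h (suc n) = ⊕-cong ≐-refl (≐-trans (shiftL g (h ∘ suc) n) (≐-sym (shiftL (g ∘ h) suc n)))
  tele : ∀ (f : ℕ → Series) n → ΣL (λ k → f (suc k) ⊖ f k) (upTo n) ≐ f n ⊖ f 0
  tele f zero    = solve 1 (λ a → con 0ℤ := a :- a) ≐-refl (f 0)
  tele f (suc n) = ≐-trans (⊕-cong ≐-refl (≐-trans (shiftL (λ k → f (suc k) ⊖ f k) suc n) (tele (f ∘ suc) n)))
    (solve 3 (λ a b c → (b :- a) :+ (c :- b) := c :- a) ≐-refl (f 0) (f 1) (f (suc n)))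

-- Monomials and theta series

-- Zero for negative exponents.
qz : ℤ → Series
qz (+ n)    = q^ n
qz -[1+ n ] = 𝟘

qz-+ : ∀ {a b} → 0ℤ ℤ.≤ a → 0ℤ ℤ.≤ b → qz (a ℤ.+ b) ≐ qz a ⊗ qz b
qz-+ {+ a} {+ b} _ _ = q^-+ a b

qz-cong : ∀ {a b} → a ≡ b → qz a ≐ qz b
qz-cong refl = ≐-refl

mono : ℤ → ℤ → Series
mono c e = # c ⊗ qz e

mono-cong : ∀ {c d a b} → c ≡ d → a ≡ b → mono c a ≐ mono d b
mono-cong refl refl = ≐-refl

mono-coef : ∀ {c d} a → c ≡ d → mono c a ≐ mono d a
mono-coef a refl = ≐-refl

mono-⊗ : ∀ {c d a b} → 0ℤ ℤ.≤ a → 0ℤ ℤ.≤ b → mono c a ⊗ mono d b ≐ mono (c ℤ.* d) (a ℤ.+ b)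
mono-⊗ {c} {d} {a} {b} p r = ≐-sym (≐-trans (⊗-cong (#-* c d) (qz-+ p r))
  (solve 4 (λ c d a b → c :* d :* (a :* b) := c :* a :* (d :* b)) ≐-refl (# c) (# d) (qz a) (qz b)))

mono-⊕ : ∀ c d a → mono c a ⊕ mono d a ≐ mono (c ℤ.+ d) a
mono-⊕ c d a = ≐-sym (≐-trans (⊗-cong (#-+ c d) ≐-refl) (Ring.distribʳ (qz a) (# c) (# d)))

mono-⊝ : ∀ c a → ⊝ mono c a ≐ mono (ℤ.- c) a
mono-⊝ c a = ≐-sym (≐-trans (⊗-cong (#-neg c) ≐-refl) (solve 2 (λ c a → (:- c) :* a := :- (c :* a)) ≐-refl (# c) (qz a)))

q^⊗-vanish : ∀ {N m} f → N ≤ m → q^ m ⊗ f ≈[ N ] 𝟘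
q^⊗-vanish {m = m} f N≤m = eq< λ n n<N → trans (q^-below m f n (ℕ.<-≤-trans n<N N≤m)) (sym (𝟘-coeff n))

mono-vanish : ∀ {N} c e → + N ℤ.≤ e → mono c e ≈[ N ] 𝟘
mono-vanish c (+ m) (ℤ.+≤+ l) = ≈-trans (≐⇒≈ (⊗-comm (# c) (q^ m))) (q^⊗-vanish (# c) l)

alternating : ℕ → ℤ
alternating zero    = 1ℤ
alternating (suc n) = ℤ.- alternating n

sgn : ℤ → ℤ
sgn (+ n)    = alternating n
sgn -[1+ n ] = alternating (suc n)

sgn-suc : ∀ i → sgn (ℤ.suc i) ≡ ℤ.- sgn i
sgn-suc (+ n)          = refl
sgn-suc -[1+ zero ]    = refl
sgn-suc -[1+ suc n ]   = sym (ℤ.neg-involutive _)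

ℤ-induction : (P : ℤ → Set) → P 0ℤ → (∀ i → P i → P (ℤ.suc i)) → (∀ i → P (ℤ.suc i) → P i) → ∀ i → P i
ℤ-induction P p₀ up down (+ zero)       = p₀
ℤ-induction P p₀ up down (+ suc n)      = up (+ n) (ℤ-induction P p₀ up down (+ n))
ℤ-induction P p₀ up down -[1+ zero ]    = down -[1+ 0 ] p₀
ℤ-induction P p₀ up down -[1+ suc n ]   = down -[1+ suc n ] (ℤ-induction P p₀ up down -[1+ n ])

+-suc : ∀ i j → i ℤ.+ ℤ.suc j ≡ ℤ.suc (i ℤ.+ j)
+-suc i j = lemma i j
  where
  lemma : ∀ i j → i ℤ.+ (1ℤ ℤ.+ j) ≡ 1ℤ ℤ.+ (i ℤ.+ j)
  lemma = solve-∀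

sgn-+ : ∀ i j → sgn (i ℤ.+ j) ≡ sgn i ℤ.* sgn j
sgn-+ i = ℤ-induction _ (trans (cong sgn (ℤ.+-identityʳ i)) (sym (ℤ.*-identityʳ (sgn i)))) up down
  where
  step : ∀ j → sgn (i ℤ.+ ℤ.suc j) ≡ ℤ.- sgn (i ℤ.+ j)
  step j = trans (cong sgn (+-suc i j)) (sgn-suc (i ℤ.+ j))
  up : ∀ j → sgn (i ℤ.+ j) ≡ sgn i ℤ.* sgn j → sgn (i ℤ.+ ℤ.suc j) ≡ sgn i ℤ.* sgn (ℤ.suc j)
  up j p = trans (step j) (trans (cong ℤ.-_ p) (trans (ℤ.neg-distribʳ-* (sgn i) (sgn j)) (cong (sgn i ℤ.*_) (sym (sgn-suc j)))))
  down : ∀ j → sgn (i ℤ.+ ℤ.suc j) ≡ sgn i ℤ.* sgn (ℤ.suc j) → sgn (i ℤ.+ j) ≡ sgn i ℤ.* sgn j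
  down j p = ℤ.neg-injective (trans (sym (step j)) (trans p (trans (cong (sgn i ℤ.*_) (sgn-suc j)) (sym (ℤ.neg-distribʳ-* (sgn i) (sgn j))))))

sgn-sq : ∀ i → sgn i ℤ.* sgn i ≡ 1ℤ
sgn-sq = ℤ-induction _ refl (λ i p → trans (neg i) p) (λ i p → trans (sym (neg i)) p)
  where
  lemma : ∀ a → ℤ.- a ℤ.* ℤ.- a ≡ a ℤ.* a
  lemma = solve-∀
  neg : ∀ i → sgn (ℤ.suc i) ℤ.* sgn (ℤ.suc i) ≡ sgn i ℤ.* sgn i
  neg i = trans (cong₂ ℤ._*_ (sgn-suc i) (sgn-suc i)) (lemma (sgn i))

sgn-double : ∀ i → sgn (i ℤ.+ i) ≡ 1ℤ
sgn-double i = trans (sgn-+ i i) (sgn-sq i)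

sgn-neg : ∀ i → sgn (ℤ.- i) ≡ sgn i
sgn-neg (+ zero)  = refl
sgn-neg (+ suc n) = refl
sgn-neg -[1+ n ]  = refl

ℤ-cancelʳ : ∀ c {a b} → a ℤ.+ c ≡ b ℤ.+ c → a ≡ b
ℤ-cancelʳ c {a} {b} e = trans (lemma a c) (trans (cong (ℤ._- c) e) (sym (lemma b c)))
  where
  lemma : ∀ a c → a ≡ a ℤ.+ c ℤ.- c
  lemma = solve-∀

ℤ-cancelˡ : ∀ c {a b} → c ℤ.+ a ≡ c ℤ.+ b → a ≡ b
ℤ-cancelˡ c {a} {b} e = ℤ-cancelʳ c (trans (ℤ.+-comm a c) (trans e (ℤ.+-comm c b)))

triℕ : ℕ → ℕ
triℕ zero    = 0
triℕ (suc n) = triℕ n ℕ.+ n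

-- i(i-1)/2
tri : ℤ → ℤ
tri (+ n)    = + triℕ n
tri -[1+ n ] = + triℕ (suc (suc n))

tri-suc : ∀ i → tri (ℤ.suc i) ≡ tri i ℤ.+ i
tri-suc (+ n)        = refl
tri-suc -[1+ zero ]  = refl
tri-suc -[1+ suc n ] = sym (trans (cong (ℤ._+ -[1+ suc n ]) (ℤ.pos-+ (triℕ (suc (suc n))) (suc (suc n)))) (lemma (+ triℕ (suc (suc n))) (+ suc (suc n))))
  where
  lemma : ∀ a b → a ℤ.+ b ℤ.+ ℤ.- b ≡ a
  lemma = solve-∀

-- The polarisation of i(i-1)/2. Together with `tri-neg` it reduces identities between theta
-- exponents to polynomial identities in `tri i`, `tri j`, `i` and `j`.
tri-+ : ∀ i j → tri (i ℤ.+ j) ≡ tri i ℤ.+ tri j ℤ.+ i ℤ.* j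
tri-+ i = ℤ-induction _ base up down
  where
  base : tri (i ℤ.+ 0ℤ) ≡ tri i ℤ.+ 0ℤ ℤ.+ i ℤ.* 0ℤ
  base = trans (cong tri (ℤ.+-identityʳ i)) (lemma (tri i) i)
    where
    lemma : ∀ a b → a ≡ a ℤ.+ 0ℤ ℤ.+ b ℤ.* 0ℤ
    lemma = solve-∀
  step : ∀ j → tri (i ℤ.+ ℤ.suc j) ≡ tri (i ℤ.+ j) ℤ.+ (i ℤ.+ j)
  step j = trans (cong tri (+-suc i j)) (tri-suc (i ℤ.+ j))
  rhs : ∀ j → tri i ℤ.+ tri (ℤ.suc j) ℤ.+ i ℤ.* ℤ.suc j ≡ tri i ℤ.+ tri j ℤ.+ i ℤ.* j ℤ.+ (i ℤ.+ j)
  rhs j = trans (cong (λ z → tri i ℤ.+ z ℤ.+ i ℤ.* ℤ.suc j) (tri-suc j)) (lemma (tri i) (tri j) i j)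
    where
    lemma : ∀ a b i j → a ℤ.+ (b ℤ.+ j) ℤ.+ i ℤ.* (1ℤ ℤ.+ j) ≡ a ℤ.+ b ℤ.+ i ℤ.* j ℤ.+ (i ℤ.+ j)
    lemma = solve-∀
  up : ∀ j → tri (i ℤ.+ j) ≡ tri i ℤ.+ tri j ℤ.+ i ℤ.* j → tri (i ℤ.+ ℤ.suc j) ≡ tri i ℤ.+ tri (ℤ.suc j) ℤ.+ i ℤ.* ℤ.suc j
  up j p = trans (step j) (trans (cong (ℤ._+ (i ℤ.+ j)) p) (sym (rhs j)))
  down : ∀ j → tri (i ℤ.+ ℤ.suc j) ≡ tri i ℤ.+ tri (ℤ.suc j) ℤ.+ i ℤ.* ℤ.suc j → tri (i ℤ.+ j) ≡ tri i ℤ.+ tri j ℤ.+ i ℤ.* j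
  down j p = ℤ-cancelʳ (i ℤ.+ j) (trans (sym (step j)) (trans p (rhs j)))

tri-neg : ∀ i → tri (ℤ.- i) ≡ tri i ℤ.+ i
tri-neg (+ zero)  = refl
tri-neg (+ suc n) = refl
tri-neg -[1+ n ]  = sym (trans (cong (ℤ._+ -[1+ n ]) (ℤ.pos-+ (triℕ (suc n)) (suc n))) (lemma (+ triℕ (suc n)) (+ suc n)))
  where
  lemma : ∀ a b → a ℤ.+ b ℤ.+ ℤ.- b ≡ a
  lemma = solve-∀

square : ∀ i → i ℤ.* i ≡ tri i ℤ.+ tri i ℤ.+ i
square i = trans (lemma (tri i) (tri (ℤ.- i)) i) (trans (cong₂ (λ a b → tri i ℤ.+ a ℤ.- b) (tri-neg i) zero-tri) (lemma₂ (tri i) i))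
  where
  zero-tri : tri i ℤ.+ tri (ℤ.- i) ℤ.+ i ℤ.* ℤ.- i ≡ 0ℤ
  zero-tri = trans (sym (tri-+ i (ℤ.- i))) (cong tri (ℤ.+-inverseʳ i))
  lemma : ∀ a b i → i ℤ.* i ≡ a ℤ.+ b ℤ.- (a ℤ.+ b ℤ.+ i ℤ.* ℤ.- i)
  lemma = solve-∀
  lemma₂ : ∀ a i → a ℤ.+ (a ℤ.+ i) ℤ.- 0ℤ ≡ a ℤ.+ a ℤ.+ i
  lemma₂ = solve-∀

tri-double : ∀ i → tri (i ℤ.+ i) ≡ tri i ℤ.+ tri i ℤ.+ (tri i ℤ.+ tri i ℤ.+ i)
tri-double i = trans (tri-+ i i) (cong (ℤ._+_ (tri i ℤ.+ tri i)) (square i))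

tri-triple : ∀ i → tri (+ 3 ℤ.* i) ≡ + 3 ℤ.* (+ 3 ℤ.* tri i ℤ.+ i)
tri-triple i = trans (cong tri (three i)) (trans (tri-+ (i ℤ.+ i) i) (trans (cong (λ z → z ℤ.+ tri i ℤ.+ (i ℤ.+ i) ℤ.* i) (tri-double i))
  (trans (lemma (tri i) i) (trans (cong (λ z → + 5 ℤ.* tri i ℤ.+ i ℤ.+ (z ℤ.+ z)) (square i)) (lemma₂ (tri i) i)))))
  where
  three : ∀ i → + 3 ℤ.* i ≡ i ℤ.+ i ℤ.+ i
  three = solve-∀
  lemma : ∀ a i → a ℤ.+ a ℤ.+ (a ℤ.+ a ℤ.+ i) ℤ.+ a ℤ.+ (i ℤ.+ i) ℤ.* i ≡ + 5 ℤ.* a ℤ.+ i ℤ.+ (i ℤ.* i ℤ.+ i ℤ.* i)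
  lemma = solve-∀
  lemma₂ : ∀ a i → + 5 ℤ.* a ℤ.+ i ℤ.+ (a ℤ.+ a ℤ.+ i ℤ.+ (a ℤ.+ a ℤ.+ i)) ≡ + 3 ℤ.* (+ 3 ℤ.* a ℤ.+ i)
  lemma₂ = solve-∀

n≤tri : ∀ n → n ≤ triℕ (suc (suc n))
n≤tri n = ℕ.≤-trans (ℕ.n≤1+n n) (ℕ.m≤n+m (suc n) (triℕ (suc n)))

0≤tri : ∀ i → 0ℤ ℤ.≤ tri i
0≤tri (+ n)    = ℤ.+≤+ z≤n
0≤tri -[1+ n ] = ℤ.+≤+ z≤n

0≤+ : ∀ {a b} → 0ℤ ℤ.≤ a → 0ℤ ℤ.≤ b → 0ℤ ℤ.≤ a ℤ.+ b
0≤+ p r = ℤ.+-mono-≤ p r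

0≤+n : ∀ {n} → 0ℤ ℤ.≤ + n
0≤+n = ℤ.+≤+ z≤n

-- Bijections of ℤ and ℤ × ℤ for reindexing theta series

ℤ-neg : ℤ ≅ ℤ
ℤ-neg = bij ℤ.-_ ℤ.-_ ℤ.neg-involutive ℤ.neg-involutive

ℤ-shift : ℤ → ℤ ≅ ℤ
ℤ-shift k = bij (ℤ._+ k) (ℤ._- k) (lemma₁ k) (lemma₂ k)
  where
  lemma₁ : ∀ k i → i ℤ.+ k ℤ.- k ≡ i
  lemma₁ = solve-∀
  lemma₂ : ∀ k i → i ℤ.- k ℤ.+ k ≡ i
  lemma₂ = solve-∀

ℤ-reflect : ℤ → ℤ ≅ ℤ
ℤ-reflect k = bij (ℤ._-_ k) (ℤ._-_ k) (lemma k) (lemma k)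
  where
  lemma : ∀ k i → k ℤ.- (k ℤ.- i) ≡ i
  lemma = solve-∀

private
  divmod-<-impossible : ∀ n i j r r′ → r < n → i ℤ.< j → ¬ (+ n ℤ.* i ℤ.+ + r ≡ + n ℤ.* j ℤ.+ + r′)
  divmod-<-impossible n i j r r′ r<n i<j e = ℤ.<-irrefl e (begin-strict
    + n ℤ.* i ℤ.+ + r       <⟨ ℤ.+-monoʳ-< (+ n ℤ.* i) (ℤ.+<+ r<n) ⟩
    + n ℤ.* i ℤ.+ + n       ≡⟨ lemma (+ n) i ⟩
    + n ℤ.* ℤ.suc i         ≤⟨ ℤ.*-monoˡ-≤-nonNeg (+ n) (ℤ.i<j⇒suc[i]≤j i<j) ⟩
    + n ℤ.* j               ≤⟨ ℤ.i≤i+j (+ n ℤ.* j) (+ r′) ⟩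
    + n ℤ.* j ℤ.+ + r′      ∎)
    where
    open ℤ.≤-Reasoning
    lemma : ∀ n i → n ℤ.* i ℤ.+ n ≡ n ℤ.* (1ℤ ℤ.+ i)
    lemma = solve-∀

divmod-unique : ∀ n i j r r′ → r < n → r′ < n → + n ℤ.* i ℤ.+ + r ≡ + n ℤ.* j ℤ.+ + r′ → i ≡ j × r ≡ r′
divmod-unique n i j r r′ r<n r′<n e with ℤ.<-cmp i j
... | tri< i<j _ _  = ⊥-elim (divmod-<-impossible n i j r r′ r<n i<j e)
... | tri> _ _ j<i  = ⊥-elim (divmod-<-impossible n j i r′ r r′<n j<i (sym e))
... | tri≈ _ refl _ = refl , ℤ.+-injective (ℤ-cancelˡ (+ n ℤ.* i) e)

module _ (n : ℕ) .{{_ : NonZero n}} where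
  residue : ℤ → Fin n
  residue j = fromℕ< (ℤ.n%ℕd<d j n)

  divmod : ∀ j → + n ℤ.* (j ℤ./ℕ n) ℤ.+ + toℕ (residue j) ≡ j
  divmod j = trans (cong₂ (λ a r → a ℤ.+ + r) (ℤ.*-comm (+ n) (j ℤ./ℕ n)) (toℕ-fromℕ< (ℤ.n%ℕd<d j n)))
    (trans (ℤ.+-comm ((j ℤ./ℕ n) ℤ.* + n) (+ (j ℤ.%ℕ n))) (sym (ℤ.a≡a%ℕn+[a/ℕn]*n j n)))

  ℤ-residues : (Fin n × ℤ) ≅ ℤ
  ℤ-residues = bij (λ (r , i) → + n ℤ.* i ℤ.+ + toℕ r) (λ j → residue j , j ℤ./ℕ n)
    (λ (r , i) → let j = + n ℤ.* i ℤ.+ + toℕ r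
                     (p , p′) = divmod-unique n (j ℤ./ℕ n) i _ _ (toℕ<n (residue j)) (toℕ<n r) (divmod j)
                 in cong₂ _,_ (toℕ-injective p′) p)
    divmod

  HasSum-Fin : (g : Fin n → Series) → HasSum g (ΣL g (allFin n))
  HasSum-Fin g = hasSum λ N → allFin n , covers (Unique.allFin⁺ n) (λ i → inj₁ (∈-allFin i)) , ≈-refl

-- Pairs (m , n) sorted by the parity r of m - n = 2j + r.
parity : (Fin 2 × ℤ × ℤ) ≅ (ℤ × ℤ)
parity = bij (λ (r , i , j) → i ℤ.+ j ℤ.+ + toℕ r , i ℤ.- j)
             (λ (m , n) → residue 2 (m ℤ.- n) , n ℤ.+ (m ℤ.- n) ℤ./ℕ 2 , (m ℤ.- n) ℤ./ℕ 2)
             (λ (r , i , j) → from-to r i j)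
             (λ (m , n) → cong₂ _,_ (trans (lemma₁ n ((m ℤ.- n) ℤ./ℕ 2) (+ toℕ (residue 2 (m ℤ.- n))))
                                            (trans (cong (ℤ._+_ n) (divmod 2 (m ℤ.- n))) (lemma₂ m n)))
                                     (lemma₃ n _))
  where
  lemma₁ : ∀ n j r → n ℤ.+ j ℤ.+ j ℤ.+ r ≡ n ℤ.+ (+ 2 ℤ.* j ℤ.+ r)
  lemma₁ = solve-∀
  lemma₂ : ∀ m n → n ℤ.+ (m ℤ.- n) ≡ m
  lemma₂ = solve-∀
  lemma₃ : ∀ n j → n ℤ.+ j ℤ.- j ≡ n
  lemma₃ = solve-∀
  lemma₄ : ∀ i j r → i ℤ.+ j ℤ.+ r ℤ.- (i ℤ.- j) ≡ + 2 ℤ.* j ℤ.+ r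
  lemma₄ = solve-∀
  lemma₅ : ∀ i j → i ℤ.- j ℤ.+ j ≡ i
  lemma₅ = solve-∀
  from-to : ∀ r i j → let d = i ℤ.+ j ℤ.+ + toℕ r ℤ.- (i ℤ.- j) in
            (residue 2 d , i ℤ.- j ℤ.+ d ℤ./ℕ 2 , d ℤ./ℕ 2) ≡ (r , i , j)
  from-to r i j = cong₂ (λ r k → r , i ℤ.- j ℤ.+ k , k) (cong proj₁ e) (cong proj₂ e) ∙ cong (λ k → r , k , j) (lemma₅ i j)
    where
    _∙_ = trans
    d : ℤ
    d = i ℤ.+ j ℤ.+ + toℕ r ℤ.- (i ℤ.- j)
    e : (residue 2 d , d ℤ./ℕ 2) ≡ (r , j)
    e = trans (cong (_≅_.from (ℤ-residues 2)) (lemma₄ i j (+ toℕ r))) (_≅_.from-to (ℤ-residues 2) (r , j))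

sum-parity : ∀ {f : ℤ × ℤ → Series} {s a b} → HasSum f s →
             HasSum (λ (i , j) → f (i ℤ.+ j , i ℤ.- j)) a → HasSum (λ (i , j) → f (i ℤ.+ j ℤ.+ 1ℤ , i ℤ.- j)) b → s ≐ a ⊕ b
sum-parity {f} {a = a} {b} hs ha hb = ≐-trans
  (HasSum-unique (HasSum-Σ Fin._≟_ (HasSum-reindex parity hs) rows) (HasSum-Fin 2 sums))
  (⊕-cong ≐-refl (Ring.+-identityʳ b))
  where
  sums : Fin 2 → Series
  sums zero       = a
  sums (suc zero) = b
  rows : ∀ r → HasSum (λ (i , j) → f (i ℤ.+ j ℤ.+ + toℕ r , i ℤ.- j)) (sums r)
  rows zero       = HasSum-cong (λ (i , j) → eq λ n → cong (λ k → f (k , i ℤ.- j) n) (sym (ℤ.+-identityʳ (i ℤ.+ j)))) ≐-refl ha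
  rows (suc zero) = hb

-- The sum equals its own negative, and ℤ has no 2-torsion.
sum-antisymmetric : ∀ {f : ℤ → Series} {s} (b : ℤ ≅ ℤ) → HasSum f s → (∀ i → f (_≅_.to b i) ≐ ⊝ f i) → s ≐ 𝟘
sum-antisymmetric {f} {s} b h p = eq λ n → self-neg (at s≐-s n)
  where
  s≐-s : s ≐ ⊝ s
  s≐-s = ≐-trans (HasSum-unique (HasSum-reindex b h)
           (HasSum-cong (λ i → ≐-trans (solve 1 (λ x → con (ℤ.- 1ℤ) :* x := :- x) ≐-refl (f i)) (≐-sym (p i)))
                        (solve 1 (λ x → con (ℤ.- 1ℤ) :* x := :- x) ≐-refl s) (HasSum-⊗ (# (ℤ.- 1ℤ)) h)))
           ≐-refl
  self-neg : ∀ {n} → s n ≡ (⊝ s) n → s n ≡ 𝟘 n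
  self-neg {n} e = trans (lemma (s n) (trans e (⊝-coeff s n))) (sym (𝟘-coeff n))
    where
    lemma : ∀ a → a ≡ ℤ.- a → a ≡ 0ℤ
    lemma (+ zero) _ = refl

-- The series ∑ c(i) q^(a i(i-1)/2 + b i(i+1)/2), as in Ramanujan's general theta function.
record Theta : Set where
  constructor theta
  field
    coef : ℤ → ℤ
    a b  : ℕ

module _ (A : Theta) where
  open Theta A
  expo : ℤ → ℤ
  expo i = + a ℤ.* tri i ℤ.+ + b ℤ.* tri (ℤ.- i)

  opaque
    ⟦_⟧ : Series
    ⟦_⟧ = sumℤ (λ i → mono (coef i) (expo i))

  0≤expo : ∀ i → 0ℤ ℤ.≤ expo i
  0≤expo i = 0≤+ (*-nonneg (0≤+n {a}) (0≤tri i)) (*-nonneg (0≤+n {b}) (0≤tri (ℤ.- i)))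

private
  expo-grows : ∀ A x y n → 0 < Theta.a A ℕ.+ Theta.b A → n ≤ x → n ≤ y → + n ℤ.≤ + Theta.a A ℤ.* + x ℤ.+ + Theta.b A ℤ.* + y
  expo-grows (theta _ a b) x y n 0<a+b n≤x n≤y = subst (+ n ℤ.≤_) (cong₂ ℤ._+_ (ℤ.pos-* a x) (ℤ.pos-* b y)) (ℤ.+≤+ (go a b 0<a+b))
    where
    go : ∀ a b → 0 < a ℕ.+ b → n ≤ a ℕ.* x ℕ.+ b ℕ.* y
    go (suc a) b _       = ℕ.≤-trans n≤x (ℕ.≤-trans (ℕ.m≤m+n x (a ℕ.* x)) (ℕ.m≤m+n (suc a ℕ.* x) (b ℕ.* y)))
    go zero (suc b) _    = ℕ.≤-trans n≤y (ℕ.m≤m+n y (b ℕ.* y))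

θ-small⁺ : ∀ A → 0 < Theta.a A ℕ.+ Theta.b A → ∀ N n → N ≤ n → mono (Theta.coef A (+ (2 ℕ.+ n))) (expo A (+ (2 ℕ.+ n))) ≈[ N ] 𝟘
θ-small⁺ A nz N n N≤n = mono-vanish _ _ (ℤ.≤-trans (ℤ.+≤+ N≤n) (expo-grows A _ _ n nz (n≤tri n) (ℕ.≤-trans (n≤tri n) (ℕ.m≤m+n _ _))))

θ-small⁻ : ∀ A → 0 < Theta.a A ℕ.+ Theta.b A → ∀ N n → N ≤ n → mono (Theta.coef A -[1+ 2 ℕ.+ n ]) (expo A -[1+ 2 ℕ.+ n ]) ≈[ N ] 𝟘
θ-small⁻ A nz N n N≤n = mono-vanish _ _ (ℤ.≤-trans (ℤ.+≤+ N≤n) (expo-grows A _ _ n nz (ℕ.≤-trans (n≤tri n) (ℕ.≤-trans (ℕ.m≤m+n _ _) (ℕ.m≤m+n _ _))) (ℕ.≤-trans (n≤tri n) (ℕ.m≤m+n _ _))))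

opaque
  unfolding ⟦_⟧

  HasSum-θ : ∀ A → 0 < Theta.a A ℕ.+ Theta.b A → HasSum (λ i → mono (Theta.coef A i) (expo A i)) ⟦ A ⟧
  HasSum-θ A nz = HasSum-ℤ (θ-small⁺ A nz) (θ-small⁻ A nz)

HasSum-θ-⊗ : ∀ A B → 0 < Theta.a A ℕ.+ Theta.b A → 0 < Theta.a B ℕ.+ Theta.b B →
             HasSum (λ (i , j) → mono (Theta.coef A i ℤ.* Theta.coef B j) (expo A i ℤ.+ expo B j)) (⟦ A ⟧ ⊗ ⟦ B ⟧)
HasSum-θ-⊗ A B nzA nzB = HasSum-cong (λ (i , j) → mono-⊗ (0≤expo A i) (0≤expo B j)) ≐-refl (HasSum-× (HasSum-θ A nzA) (HasSum-θ B nzB))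

-- A double theta series rearranged along (i , j) ↦ (i + j , i - j) and (i + j + 1 , i - j).
parity-product : ∀ A B A₁ B₁ A₂ B₂ γ r →
  0 < Theta.a A ℕ.+ Theta.b A → 0 < Theta.a B ℕ.+ Theta.b B →
  0 < Theta.a A₁ ℕ.+ Theta.b A₁ → 0 < Theta.a B₁ ℕ.+ Theta.b B₁ →
  0 < Theta.a A₂ ℕ.+ Theta.b A₂ → 0 < Theta.a B₂ ℕ.+ Theta.b B₂ →
  (∀ i j → Theta.coef A (i ℤ.+ j) ℤ.* Theta.coef B (i ℤ.- j) ≡ Theta.coef A₁ i ℤ.* Theta.coef B₁ j) →
  (∀ i j → expo A (i ℤ.+ j) ℤ.+ expo B (i ℤ.- j) ≡ expo A₁ i ℤ.+ expo B₁ j) →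
  (∀ i j → Theta.coef A (i ℤ.+ j ℤ.+ 1ℤ) ℤ.* Theta.coef B (i ℤ.- j) ≡ γ ℤ.* (Theta.coef A₂ i ℤ.* Theta.coef B₂ j)) →
  (∀ i j → expo A (i ℤ.+ j ℤ.+ 1ℤ) ℤ.+ expo B (i ℤ.- j) ≡ + r ℤ.+ (expo A₂ i ℤ.+ expo B₂ j)) →
  ⟦ A ⟧ ⊗ ⟦ B ⟧ ≐ ⟦ A₁ ⟧ ⊗ ⟦ B₁ ⟧ ⊕ mono γ (+ r) ⊗ (⟦ A₂ ⟧ ⊗ ⟦ B₂ ⟧)
parity-product A B A₁ B₁ A₂ B₂ γ r nA nB nA₁ nB₁ nA₂ nB₂ c₁ e₁ c₂ e₂ = sum-parity (HasSum-θ-⊗ A B nA nB)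
  (HasSum-cong (λ (i , j) → mono-cong (sym (c₁ i j)) (sym (e₁ i j))) ≐-refl (HasSum-θ-⊗ A₁ B₁ nA₁ nB₁))
  (HasSum-cong (λ (i , j) → ≐-trans (mono-⊗ 0≤+n (0≤+ (0≤expo A₂ i) (0≤expo B₂ j))) (mono-cong (sym (c₂ i j)) (sym (e₂ i j)))) ≐-refl
    (HasSum-⊗ (mono γ (+ r)) (HasSum-θ-⊗ A₂ B₂ nA₂ nB₂)))

-- The exponent with the value of `tri i` abstracted to `t`, the form in which an integer ring
-- solver can treat it.
linear : Theta → ℤ → ℤ → ℤ
linear A i t = + Theta.a A ℤ.* t ℤ.+ + Theta.b A ℤ.* (t ℤ.+ i)

expo≡ : ∀ A i {t} → tri i ≡ t → expo A i ≡ linear A i t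
expo≡ A i e = trans (cong (λ z → + Theta.a A ℤ.* tri i ℤ.+ + Theta.b A ℤ.* z) (tri-neg i)) (cong (linear A i) e)

tri-i-j : ∀ i j → tri (i ℤ.- j) ≡ tri i ℤ.+ (tri j ℤ.+ j) ℤ.- i ℤ.* j
tri-i-j i j = trans (tri-+ i (ℤ.- j)) (trans (cong (λ z → tri i ℤ.+ z ℤ.+ i ℤ.* ℤ.- j) (tri-neg j)) (lemma (tri i) (tri j) i j))
  where
  lemma : ∀ a b i j → a ℤ.+ (b ℤ.+ j) ℤ.+ i ℤ.* ℤ.- j ≡ a ℤ.+ (b ℤ.+ j) ℤ.- i ℤ.* j
  lemma = solve-∀

tri-i+j+1 : ∀ i j → tri (i ℤ.+ j ℤ.+ 1ℤ) ≡ tri i ℤ.+ tri j ℤ.+ i ℤ.* j ℤ.+ (i ℤ.+ j)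
tri-i+j+1 i j = trans (cong tri (ℤ.+-comm (i ℤ.+ j) 1ℤ)) (trans (tri-suc (i ℤ.+ j)) (cong (ℤ._+ (i ℤ.+ j)) (tri-+ i j)))

sgn-i-j : ∀ i j → sgn (i ℤ.- j) ≡ sgn i ℤ.* sgn j
sgn-i-j i j = trans (sgn-+ i (ℤ.- j)) (cong (sgn i ℤ.*_) (sgn-neg j))

sgn-i+j+1 : ∀ i j → sgn (i ℤ.+ j ℤ.+ 1ℤ) ≡ ℤ.- (sgn i ℤ.* sgn j)
sgn-i+j+1 i j = trans (cong sgn (ℤ.+-comm (i ℤ.+ j) 1ℤ)) (trans (sgn-suc (i ℤ.+ j)) (cong ℤ.-_ (sgn-+ i j)))

κ-coef : ℤ → ℤ
κ-coef i = ℤ.- i ℤ.* sgn i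

one : ℤ → ℤ
one _ = 1ℤ

-- In base Q = q^s these are φ = ∑ (-1)^i Q^(i²), Ψ = ∑ Q^(i(i-1)/2), ε = ∏ (1 - Q^n) and κ = ε³, by Euler and Jacobi.
φ Ψ κ ε S̃ : ℕ → Theta
φ s = theta sgn s s
Ψ s = theta one s 0
κ s = theta κ-coef s 0
ε s = theta sgn (s ℕ.+ s) s
S̃ s = theta (λ i → + 6 ℤ.* i ℤ.+ 1ℤ) s (s ℕ.+ s)

-- The exponents are 3i(3i-1)/2 for `σ`, then 9i², 9i²+6i, 9i²+9i and 9i²-3i. The last four arise
-- when a square such as σ² is split by parity.
σ P₀ P₁ R₀ R₁ : Theta
σ  = theta one 6 3
P₀ = theta one 9 9
P₁ = theta one 3 15
R₀ = theta one 0 18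
R₁ = theta one 12 6

-- Products of theta series split by parity

module Sol = Data.Integer.Solver.+-*-Solver

sgn-product₁ : ∀ i j → sgn (i ℤ.+ j) ℤ.* sgn (i ℤ.- j) ≡ 1ℤ ℤ.* 1ℤ
sgn-product₁ i j = trans (cong₂ ℤ._*_ (sgn-+ i j) (sgn-i-j i j)) (trans (lemma (sgn i) (sgn j)) (cong₂ ℤ._*_ (sgn-sq i) (sgn-sq j)))
  where
  lemma : ∀ a b → a ℤ.* b ℤ.* (a ℤ.* b) ≡ a ℤ.* a ℤ.* (b ℤ.* b)
  lemma = solve-∀

sgn-product₂ : ∀ i j → sgn (i ℤ.+ j ℤ.+ 1ℤ) ℤ.* sgn (i ℤ.- j) ≡ ℤ.- 1ℤ ℤ.* (1ℤ ℤ.* 1ℤ)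
sgn-product₂ i j = trans (cong₂ ℤ._*_ (sgn-i+j+1 i j) (sgn-i-j i j)) (trans (lemma (sgn i) (sgn j)) (cong (ℤ.- 1ℤ ℤ.*_) (cong₂ ℤ._*_ (sgn-sq i) (sgn-sq j))))
  where
  lemma : ∀ a b → ℤ.- (a ℤ.* b) ℤ.* (a ℤ.* b) ≡ ℤ.- 1ℤ ℤ.* (a ℤ.* a ℤ.* (b ℤ.* b))
  lemma = solve-∀

split₁ : ∀ A B i j → expo A (i ℤ.+ j) ℤ.+ expo B (i ℤ.- j) ≡
         linear A (i ℤ.+ j) (tri i ℤ.+ tri j ℤ.+ i ℤ.* j) ℤ.+ linear B (i ℤ.- j) (tri i ℤ.+ (tri j ℤ.+ j) ℤ.- i ℤ.* j)
split₁ A B i j = cong₂ ℤ._+_ (expo≡ A (i ℤ.+ j) (tri-+ i j)) (expo≡ B (i ℤ.- j) (tri-i-j i j))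

split₂ : ∀ A B i j → expo A (i ℤ.+ j ℤ.+ 1ℤ) ℤ.+ expo B (i ℤ.- j) ≡
         linear A (i ℤ.+ j ℤ.+ 1ℤ) (tri i ℤ.+ tri j ℤ.+ i ℤ.* j ℤ.+ (i ℤ.+ j)) ℤ.+ linear B (i ℤ.- j) (tri i ℤ.+ (tri j ℤ.+ j) ℤ.- i ℤ.* j)
split₂ A B i j = cong₂ ℤ._+_ (expo≡ A (i ℤ.+ j ℤ.+ 1ℤ) (tri-i+j+1 i j)) (expo≡ B (i ℤ.- j) (tri-i-j i j))

split₃ : ∀ A B i j → linear A i (tri i) ℤ.+ linear B j (tri j) ≡ expo A i ℤ.+ expo B j
split₃ A B i j = sym (cong₂ ℤ._+_ (expo≡ A i refl) (expo≡ B j refl))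

open Sol using () renaming (_:+_ to infixl 6 _⊞_; _:*_ to infixl 7 _⊠_; _:-_ to infixl 6 _⊟_; con to lit; _:=_ to infix 4 _≗_)

lin : ∀ {n} → Theta → (i t : Sol.Polynomial n) → Sol.Polynomial n
lin A i t = lit (+ Theta.a A) ⊠ t ⊞ lit (+ Theta.b A) ⊠ (t ⊞ i)

at₁ at₂ at₃ : ∀ {n} (ti tj i j : Sol.Polynomial n) → Sol.Polynomial n
at₁ ti tj i j = ti ⊞ tj ⊞ i ⊠ j
at₂ ti tj i j = ti ⊞ (tj ⊞ j) ⊟ i ⊠ j
at₃ ti tj i j = ti ⊞ tj ⊞ i ⊠ j ⊞ (i ⊞ j)

first : (A B A₁ B₁ : Theta) → (∀ (a b i j : Sol.Polynomial 4) → Sol.Polynomial 4 × Sol.Polynomial 4)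
first A B A₁ B₁ a b i j = lin A (i ⊞ j) (at₁ a b i j) ⊞ lin B (i ⊟ j) (at₂ a b i j) ≗ lin A₁ i a ⊞ lin B₁ j b

second : (A B A₂ B₂ : Theta) (r : ℕ) → (∀ (a b i j : Sol.Polynomial 4) → Sol.Polynomial 4 × Sol.Polynomial 4)
second A B A₂ B₂ r a b i j = lin A (i ⊞ j ⊞ lit 1ℤ) (at₃ a b i j) ⊞ lin B (i ⊟ j) (at₂ a b i j) ≗ lit (+ r) ⊞ (lin A₂ i a ⊞ lin B₂ j b)

0<1+n : ∀ {n} → 0 < suc n
0<1+n = s≤s z≤n

θ-reflect : ∀ c a b → 0 < a ℕ.+ b → ⟦ theta c a b ⟧ ≐ ⟦ theta (c ∘ ℤ.-_) b a ⟧
θ-reflect c a b nz = HasSum-unique (HasSum-reindex ℤ-neg (HasSum-θ (theta c a b) nz))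
  (HasSum-cong (λ i → mono-cong refl (trans (ℤ.+-comm (+ b ℤ.* tri i) (+ a ℤ.* tri (ℤ.- i))) (cong (λ j → + a ℤ.* tri (ℤ.- i) ℤ.+ + b ℤ.* tri j) (sym (ℤ.neg-involutive i)))))
    ≐-refl (HasSum-θ (theta (c ∘ ℤ.-_) b a) (subst (0 <_) (ℕ.+-comm a b) nz)))

θ-coef : ∀ {c d} a b → 0 < a ℕ.+ b → (∀ i → c i ≡ d i) → ⟦ theta c a b ⟧ ≐ ⟦ theta d a b ⟧
θ-coef {c} {d} a b nz p = HasSum-unique (HasSum-θ (theta c a b) nz)
  (HasSum-cong (λ i → mono-coef (expo (theta c a b) i) (sym (p i))) ≐-refl (HasSum-θ (theta d a b) nz))

σσ : ⟦ σ ⟧ ⊗ ⟦ σ ⟧ ≐ ⟦ R₁ ⟧ ⊗ ⟦ P₀ ⟧ ⊕ mono 1ℤ (+ 3) ⊗ (⟦ P₁ ⟧ ⊗ ⟦ R₀ ⟧)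
σσ = parity-product σ σ R₁ P₀ P₁ R₀ 1ℤ 3 0<1+n 0<1+n 0<1+n 0<1+n 0<1+n 0<1+n
  (λ _ _ → refl)
  (λ i j → trans (split₁ σ σ i j) (trans (Sol.solve 4 (first σ σ R₁ P₀) refl (tri i) (tri j) i j) (split₃ R₁ P₀ i j)))
  (λ _ _ → refl)
  (λ i j → trans (split₂ σ σ i j) (trans (Sol.solve 4 (second σ σ P₁ R₀ 3) refl (tri i) (tri j) i j) (cong (ℤ._+_ (+ 3)) (split₃ P₁ R₀ i j))))

-- The exponents are those of `σσ`, but the sign is constant on each parity class and negative on
-- the odd one. So σ² = a + b and ε² = a - b, whence σ⁴ - ε⁴ = 4ab; the factors of 4ab regroup into
-- Ψσ and Ψ², each of which is twice a product of two of the four series.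
εε : ⟦ ε 3 ⟧ ⊗ ⟦ ε 3 ⟧ ≐ ⟦ R₁ ⟧ ⊗ ⟦ P₀ ⟧ ⊕ mono (ℤ.- 1ℤ) (+ 3) ⊗ (⟦ P₁ ⟧ ⊗ ⟦ R₀ ⟧)
εε = parity-product (ε 3) (ε 3) R₁ P₀ P₁ R₀ (ℤ.- 1ℤ) 3 0<1+n 0<1+n 0<1+n 0<1+n 0<1+n 0<1+n
  sgn-product₁
  (λ i j → trans (split₁ (ε 3) (ε 3) i j) (trans (Sol.solve 4 (first (ε 3) (ε 3) R₁ P₀) refl (tri i) (tri j) i j) (split₃ R₁ P₀ i j)))
  sgn-product₂
  (λ i j → trans (split₂ (ε 3) (ε 3) i j) (trans (Sol.solve 4 (second (ε 3) (ε 3) P₁ R₀ 3) refl (tri i) (tri j) i j) (cong (ℤ._+_ (+ 3)) (split₃ P₁ R₀ i j))))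

ΨΨ : ⟦ Ψ 9 ⟧ ⊗ ⟦ Ψ 9 ⟧ ≐ ⟦ theta one 18 0 ⟧ ⊗ ⟦ P₀ ⟧ ⊕ mono 1ℤ (+ 0) ⊗ (⟦ P₀ ⟧ ⊗ ⟦ R₀ ⟧)
ΨΨ = parity-product (Ψ 9) (Ψ 9) (theta one 18 0) P₀ P₀ R₀ 1ℤ 0 0<1+n 0<1+n 0<1+n 0<1+n 0<1+n 0<1+n
  (λ _ _ → refl)
  (λ i j → trans (split₁ (Ψ 9) (Ψ 9) i j) (trans (Sol.solve 4 (first (Ψ 9) (Ψ 9) (theta one 18 0) P₀) refl (tri i) (tri j) i j) (split₃ (theta one 18 0) P₀ i j)))
  (λ _ _ → refl)
  (λ i j → trans (split₂ (Ψ 9) (Ψ 9) i j) (trans (Sol.solve 4 (second (Ψ 9) (Ψ 9) P₀ R₀ 0) refl (tri i) (tri j) i j) (cong (ℤ._+_ (+ 0)) (split₃ P₀ R₀ i j))))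

Ψσ : ⟦ Ψ 9 ⟧ ⊗ ⟦ σ ⟧ ≐ ⟦ theta one 15 3 ⟧ ⊗ ⟦ R₁ ⟧ ⊕ mono 1ℤ (+ 0) ⊗ (⟦ theta one 6 12 ⟧ ⊗ ⟦ P₁ ⟧)
Ψσ = parity-product (Ψ 9) σ (theta one 15 3) R₁ (theta one 6 12) P₁ 1ℤ 0 0<1+n 0<1+n 0<1+n 0<1+n 0<1+n 0<1+n
  (λ _ _ → refl)
  (λ i j → trans (split₁ (Ψ 9) σ i j) (trans (Sol.solve 4 (first (Ψ 9) σ (theta one 15 3) R₁) refl (tri i) (tri j) i j) (split₃ (theta one 15 3) R₁ i j)))
  (λ _ _ → refl)
  (λ i j → trans (split₂ (Ψ 9) σ i j) (trans (Sol.solve 4 (second (Ψ 9) σ (theta one 6 12) P₁ 0) refl (tri i) (tri j) i j) (cong (ℤ._+_ (+ 0)) (split₃ (theta one 6 12) P₁ i j))))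

-- The quartic relation j(q)⁴ = j(-q)⁴ - q j(-1)³ j(-q) between theta functions j of base q³.
quartic : ⟦ σ ⟧ ⊗ ⟦ σ ⟧ ⊗ (⟦ σ ⟧ ⊗ ⟦ σ ⟧) ≐ ⟦ ε 3 ⟧ ⊗ ⟦ ε 3 ⟧ ⊗ (⟦ ε 3 ⟧ ⊗ ⟦ ε 3 ⟧) ⊕ q^ 3 ⊗ (⟦ Ψ 9 ⟧ ⊗ ⟦ σ ⟧ ⊗ (⟦ Ψ 9 ⟧ ⊗ ⟦ Ψ 9 ⟧))
quartic = begin
  s ⊗ s ⊗ (s ⊗ s)
    ≈⟨ ⊗-cong σσ σσ ⟩
  (r₁ ⊗ p₀ ⊕ # 1ℤ ⊗ x ⊗ (p₁ ⊗ r₀)) ⊗ (r₁ ⊗ p₀ ⊕ # 1ℤ ⊗ x ⊗ (p₁ ⊗ r₀))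
    ≈⟨ solve 5 (λ r₁ p₀ x p₁ r₀ →
         (r₁ :* p₀ :+ con 1ℤ :* x :* (p₁ :* r₀)) :* (r₁ :* p₀ :+ con 1ℤ :* x :* (p₁ :* r₀))
         := (r₁ :* p₀ :+ con (ℤ.- 1ℤ) :* x :* (p₁ :* r₀)) :* (r₁ :* p₀ :+ con (ℤ.- 1ℤ) :* x :* (p₁ :* r₀))
            :+ x :* ((p₁ :* r₁ :+ con 1ℤ :* con 1ℤ :* (r₁ :* p₁)) :* (r₀ :* p₀ :+ con 1ℤ :* con 1ℤ :* (p₀ :* r₀)))) ≐-refl r₁ p₀ x p₁ r₀ ⟩
  (r₁ ⊗ p₀ ⊕ # (ℤ.- 1ℤ) ⊗ x ⊗ (p₁ ⊗ r₀)) ⊗ (r₁ ⊗ p₀ ⊕ # (ℤ.- 1ℤ) ⊗ x ⊗ (p₁ ⊗ r₀))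
    ⊕ x ⊗ ((p₁ ⊗ r₁ ⊕ # 1ℤ ⊗ # 1ℤ ⊗ (r₁ ⊗ p₁)) ⊗ (r₀ ⊗ p₀ ⊕ # 1ℤ ⊗ # 1ℤ ⊗ (p₀ ⊗ r₀)))
    ≈⟨ ⊕-cong (⊗-cong εε εε) (⊗-cong (≐-refl {x}) (⊗-cong Ψσ′ ΨΨ′)) ⟨
  e ⊗ e ⊗ (e ⊗ e) ⊕ x ⊗ (p ⊗ s ⊗ (p ⊗ p)) ∎
  where
  open ≐-Reasoning
  s r₁ p₀ p₁ r₀ e p x : Series
  s  = ⟦ σ ⟧
  r₁ = ⟦ R₁ ⟧
  p₀ = ⟦ P₀ ⟧
  p₁ = ⟦ P₁ ⟧
  r₀ = ⟦ R₀ ⟧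
  e  = ⟦ ε 3 ⟧
  p  = ⟦ Ψ 9 ⟧
  x  = q^ 3
  q^0≐ : qz (+ 0) ≐ # 1ℤ
  q^0≐ = q^0
  Ψσ′ : p ⊗ s ≐ p₁ ⊗ r₁ ⊕ # 1ℤ ⊗ # 1ℤ ⊗ (r₁ ⊗ p₁)
  Ψσ′ = ≐-trans Ψσ (⊕-cong (⊗-cong (θ-reflect one 15 3 0<1+n) ≐-refl)
          (⊗-cong (⊗-cong ≐-refl q^0≐) (⊗-cong (θ-reflect one 6 12 0<1+n) ≐-refl)))
  ΨΨ′ : p ⊗ p ≐ r₀ ⊗ p₀ ⊕ # 1ℤ ⊗ # 1ℤ ⊗ (p₀ ⊗ r₀)
  ΨΨ′ = ≐-trans ΨΨ (⊕-cong (⊗-cong (θ-reflect one 18 0 0<1+n) ≐-refl) (⊗-cong (⊗-cong ≐-refl q^0≐) ≐-refl))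

sgn-1-i : ∀ i → sgn (1ℤ ℤ.- i) ≡ ℤ.- sgn i
sgn-1-i i = trans (sgn-suc (ℤ.- i)) (cong ℤ.-_ (sgn-neg i))

-- The reflection i ↦ 1 - i fixes i(i-1)/2 and flips the sign.
θ-odd : ∀ a → 0 < a → ⟦ theta sgn a 0 ⟧ ≐ 𝟘
θ-odd a nz = sum-antisymmetric (ℤ-reflect 1ℤ) (HasSum-θ (theta sgn a 0) (subst (0 <_) (sym (ℕ.+-identityʳ a)) nz))
  λ i → ≐-trans (mono-cong (sgn-1-i i) (cong (λ z → + a ℤ.* z ℤ.+ 0ℤ) (tri-1-i i))) (≐-sym (mono-⊝ (sgn i) (expo (theta sgn a 0) i)))
  where
  tri-1-i : ∀ i → tri (1ℤ ℤ.- i) ≡ tri i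
  tri-1-i i = trans (tri-suc (ℤ.- i)) (trans (cong (ℤ._+ ℤ.- i) (tri-neg i)) (lemma (tri i) i))
    where
    lemma : ∀ a i → a ℤ.+ i ℤ.+ ℤ.- i ≡ a
    lemma = solve-∀

θ-odd′ : ∀ b → 0 < b → ⟦ theta sgn 0 b ⟧ ≐ 𝟘
θ-odd′ b nz = ≐-trans (θ-reflect sgn 0 b nz) (≐-trans (θ-coef b 0 (subst (0 <_) (sym (ℕ.+-identityʳ b)) nz) sgn-neg) (θ-odd b nz))

0<s+s : ∀ {s t} → 0 < s → 0 < s ℕ.+ t
0<s+s {s} {t} nz = ℕ.≤-trans nz (ℕ.m≤m+n s t)

sgn-product₃ : ∀ i j → sgn (i ℤ.+ j) ℤ.* 1ℤ ≡ sgn i ℤ.* sgn j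
sgn-product₃ i j = trans (ℤ.*-identityʳ _) (sgn-+ i j)

sgn-product₄ : ∀ i j → sgn (i ℤ.+ j ℤ.+ 1ℤ) ℤ.* 1ℤ ≡ ℤ.- 1ℤ ℤ.* (sgn i ℤ.* sgn j)
sgn-product₄ i j = trans (ℤ.*-identityʳ _) (trans (sgn-i+j+1 i j) (sym (ℤ.-1*i≡-i _)))

-- Only the even class survives: the odd one contains the antisymmetric series with exponents
-- 9i(i+1).
εσ : ⟦ ε 3 ⟧ ⊗ ⟦ σ ⟧ ≐ ⟦ ε 6 ⟧ ⊗ ⟦ φ 9 ⟧
εσ = ≐-trans
  (parity-product (ε 3) σ (ε 6) (φ 9) (theta sgn 3 15) (theta sgn 0 18) (ℤ.- 1ℤ) 3 0<1+n 0<1+n 0<1+n 0<1+n 0<1+n 0<1+n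
    sgn-product₃
    (λ i j → trans (split₁ (ε 3) σ i j) (trans (Sol.solve 4 (first (ε 3) σ (ε 6) (φ 9)) refl (tri i) (tri j) i j) (split₃ (ε 6) (φ 9) i j)))
    sgn-product₄
    (λ i j → trans (split₂ (ε 3) σ i j) (trans (Sol.solve 4 (second (ε 3) σ (theta sgn 3 15) (theta sgn 0 18) 3) refl (tri i) (tri j) i j) (cong (ℤ._+_ (+ 3)) (split₃ (theta sgn 3 15) (theta sgn 0 18) i j)))))
  (≐-trans (⊕-cong ≐-refl (⊗-cong ≐-refl (⊗-cong ≐-refl (θ-odd′ 18 0<1+n))))
    (solve 4 (λ a b c d → a :+ b :* (c :* con 0ℤ) := a) ≐-refl (⟦ ε 6 ⟧ ⊗ ⟦ φ 9 ⟧) (mono (ℤ.- 1ℤ) (+ 3)) ⟦ theta sgn 3 15 ⟧ 𝟘))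

_≟ℤ²_ : DecidableEquality (ℤ × ℤ)
_≟ℤ²_ = ≡-dec ℤ._≟_ ℤ._≟_

-- κ(q) Ψ(q) = 2 κ(q²) φ(q), from j(x) j(-x) = φ j(x²; q²) differentiated at x = 1.
module _ (s : ℕ) (nz : 0 < s) where
  private
    nz₀ : 0 < s ℕ.+ 0
    nz₀ = 0<s+s nz

  κΨ : ⟦ κ s ⟧ ⊗ ⟦ Ψ s ⟧ ≐ # (+ 2) ⊗ (⟦ κ (s ℕ.+ s) ⟧ ⊗ ⟦ φ s ⟧)
  κΨ = begin
    k ⊗ p                       ≈⟨ solve 3 (λ k p n → k :* p := k :* p :+ con 0ℤ :* n) ≐-refl k p ν ⟩
    -- A vanishing product is added to make the coefficient -(m + n), up to sign. On the even class
    -- this is -2i, so the sum factors; the odd class factors too, and one of its factors is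
    -- antisymmetric.
    k ⊗ p ⊕ 𝟘 ⊗ ν               ≈⟨ ⊕-cong ≐-refl (⊗-cong (≐-sym (θ-odd s nz)) ≐-refl) ⟩
    k ⊗ p ⊕ o ⊗ ν               ≈⟨ sum-parity total even-part odd-part ⟩
    # (+ 2) ⊗ (k₂ ⊗ f) ⊕ (⟦ B ⟧ ⊗ ⟦ O′ ⟧) ≈⟨ ⊕-cong ≐-refl (⊗-cong ≐-refl (θ-odd′ (s ℕ.+ s) (0<s+s nz))) ⟩
    # (+ 2) ⊗ (k₂ ⊗ f) ⊕ ⟦ B ⟧ ⊗ 𝟘 ≈⟨ solve 2 (λ a b → a :+ b :* con 0ℤ := a) ≐-refl (# (+ 2) ⊗ (k₂ ⊗ f)) ⟦ B ⟧ ⟩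
    # (+ 2) ⊗ (k₂ ⊗ f) ∎
    where
    open ≐-Reasoning
    N O B O′ : Theta
    N = theta ℤ.-_ s 0
    O = theta sgn s 0
    B = theta (λ i → sgn i ℤ.* (i ℤ.+ i ℤ.+ 1ℤ)) s s
    O′ = theta sgn 0 (s ℕ.+ s)
    k p ν o k₂ f : Series
    k = ⟦ κ s ⟧
    p = ⟦ Ψ s ⟧
    ν = ⟦ N ⟧
    o = ⟦ O ⟧
    k₂ = ⟦ κ (s ℕ.+ s) ⟧
    f = ⟦ φ s ⟧
    F : ℤ × ℤ → Series
    F (m , n) = mono (sgn m ℤ.* (ℤ.- m ℤ.- n)) (expo (Ψ s) m ℤ.+ expo (Ψ s) n)
    coef-lemma : ∀ m n σ → ℤ.- m ℤ.* σ ℤ.* 1ℤ ℤ.+ σ ℤ.* ℤ.- n ≡ σ ℤ.* (ℤ.- m ℤ.- n)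
    coef-lemma = solve-∀
    total : HasSum F (k ⊗ p ⊕ o ⊗ ν)
    total = HasSum-cong (λ (m , n) → ≐-trans (mono-⊕ _ _ (expo (Ψ s) m ℤ.+ expo (Ψ s) n)) (mono-coef (expo (Ψ s) m ℤ.+ expo (Ψ s) n) (coef-lemma m n (sgn m)))) ≐-refl
      (HasSum-⊕ _≟ℤ²_ (HasSum-θ-⊗ (κ s) (Ψ s) nz₀ nz₀) (HasSum-θ-⊗ O N nz₀ nz₀))
    even-coef : ∀ i j → + 2 ℤ.* (κ-coef i ℤ.* sgn j) ≡ sgn (i ℤ.+ j) ℤ.* (ℤ.- (i ℤ.+ j) ℤ.- (i ℤ.- j))
    even-coef i j = trans (lemma i j (sgn i) (sgn j)) (cong (ℤ._* (ℤ.- (i ℤ.+ j) ℤ.- (i ℤ.- j))) (sym (sgn-+ i j)))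
      where
      lemma : ∀ i j a b → + 2 ℤ.* (ℤ.- i ℤ.* a ℤ.* b) ≡ a ℤ.* b ℤ.* (ℤ.- (i ℤ.+ j) ℤ.- (i ℤ.- j))
      lemma = solve-∀
    odd-coef : ∀ i j → sgn i ℤ.* (i ℤ.+ i ℤ.+ 1ℤ) ℤ.* sgn j ≡ sgn (i ℤ.+ j ℤ.+ 1ℤ) ℤ.* (ℤ.- (i ℤ.+ j ℤ.+ 1ℤ) ℤ.- (i ℤ.- j))
    odd-coef i j = trans (lemma i j (sgn i) (sgn j)) (cong (ℤ._* (ℤ.- (i ℤ.+ j ℤ.+ 1ℤ) ℤ.- (i ℤ.- j))) (sym (sgn-i+j+1 i j)))
      where
      lemma : ∀ i j a b → a ℤ.* (i ℤ.+ i ℤ.+ 1ℤ) ℤ.* b ≡ ℤ.- (a ℤ.* b) ℤ.* (ℤ.- (i ℤ.+ j ℤ.+ 1ℤ) ℤ.- (i ℤ.- j))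
      lemma = solve-∀
    even-expo : ∀ i j → expo (κ (s ℕ.+ s)) i ℤ.+ expo (φ s) j ≡ expo (Ψ s) (i ℤ.+ j) ℤ.+ expo (Ψ s) (i ℤ.- j)
    even-expo i j = trans (sym (split₃ (κ (s ℕ.+ s)) (φ s) i j)) (trans
      (Sol.solve 5 (λ s a b i j → (s ⊞ s) ⊠ a ⊞ lit 0ℤ ⊠ (a ⊞ i) ⊞ (s ⊠ b ⊞ s ⊠ (b ⊞ j))
         ≗ s ⊠ at₁ a b i j ⊞ lit 0ℤ ⊠ (at₁ a b i j ⊞ (i ⊞ j)) ⊞ (s ⊠ at₂ a b i j ⊞ lit 0ℤ ⊠ (at₂ a b i j ⊞ (i ⊟ j)))) refl (+ s) (tri i) (tri j) i j)
      (sym (split₁ (Ψ s) (Ψ s) i j)))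
    odd-expo : ∀ i j → expo B i ℤ.+ expo O′ j ≡ expo (Ψ s) (i ℤ.+ j ℤ.+ 1ℤ) ℤ.+ expo (Ψ s) (i ℤ.- j)
    odd-expo i j = trans (sym (split₃ B O′ i j)) (trans
      (Sol.solve 5 (λ s a b i j → s ⊠ a ⊞ s ⊠ (a ⊞ i) ⊞ (lit 0ℤ ⊠ b ⊞ (s ⊞ s) ⊠ (b ⊞ j))
         ≗ s ⊠ at₃ a b i j ⊞ lit 0ℤ ⊠ (at₃ a b i j ⊞ (i ⊞ j ⊞ lit 1ℤ)) ⊞ (s ⊠ at₂ a b i j ⊞ lit 0ℤ ⊠ (at₂ a b i j ⊞ (i ⊟ j)))) refl (+ s) (tri i) (tri j) i j)
      (sym (split₂ (Ψ s) (Ψ s) i j)))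
    even-part : HasSum (λ (i , j) → F (i ℤ.+ j , i ℤ.- j)) (# (+ 2) ⊗ (k₂ ⊗ f))
    even-part = HasSum-cong (λ (i , j) → ≐-trans (≐-sym (Ring.*-assoc (# (+ 2)) _ _))
        (≐-trans (⊗-cong (≐-sym (#-* (+ 2) (κ-coef i ℤ.* sgn j))) ≐-refl) (mono-cong (even-coef i j) (even-expo i j)))) ≐-refl
      (HasSum-⊗ (# (+ 2)) (HasSum-θ-⊗ (κ (s ℕ.+ s)) (φ s) (0<s+s (0<s+s nz)) (0<s+s nz)))
    odd-part : HasSum (λ (i , j) → F (i ℤ.+ j ℤ.+ 1ℤ , i ℤ.- j)) (⟦ B ⟧ ⊗ ⟦ O′ ⟧)
    odd-part = HasSum-cong (λ (i , j) → mono-cong (odd-coef i j) (odd-expo i j)) ≐-refl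
      (HasSum-θ-⊗ B O′ (0<s+s nz) (0<s+s nz))

-- (m , k) is written with m + 2k = 3ν + r and k = c + ν.
thirds : (Fin 3 × ℤ × ℤ) ≅ (ℤ × ℤ)
thirds = bij (λ (r , ν , c) → ν ℤ.+ + toℕ r ℤ.- (c ℤ.+ c) , c ℤ.+ ν)
             (λ (m , k) → let N = m ℤ.+ (k ℤ.+ k) in residue 3 N , N ℤ./ℕ 3 , k ℤ.- N ℤ./ℕ 3)
             (λ (r , ν , c) → from-to r ν c)
             (λ (m , k) → let N = m ℤ.+ (k ℤ.+ k) in cong₂ _,_
               (trans (lemma₁ (N ℤ./ℕ 3) (+ toℕ (residue 3 N)) k) (trans (cong (ℤ._- (k ℤ.+ k)) (divmod 3 N)) (lemma₂ m k)))
               (lemma₃ k (N ℤ./ℕ 3)))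
  where
  lemma₁ : ∀ ν r k → ν ℤ.+ r ℤ.- (k ℤ.- ν ℤ.+ (k ℤ.- ν)) ≡ + 3 ℤ.* ν ℤ.+ r ℤ.- (k ℤ.+ k)
  lemma₁ = solve-∀
  lemma₂ : ∀ m k → m ℤ.+ (k ℤ.+ k) ℤ.- (k ℤ.+ k) ≡ m
  lemma₂ = solve-∀
  lemma₃ : ∀ k ν → k ℤ.- ν ℤ.+ ν ≡ k
  lemma₃ = solve-∀
  lemma₄ : ∀ ν r c → ν ℤ.+ r ℤ.- (c ℤ.+ c) ℤ.+ (c ℤ.+ ν ℤ.+ (c ℤ.+ ν)) ≡ + 3 ℤ.* ν ℤ.+ r
  lemma₄ = solve-∀
  lemma₅ : ∀ c ν → c ℤ.+ ν ℤ.- ν ≡ c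
  lemma₅ = solve-∀
  from-to : ∀ r ν c → let N = ν ℤ.+ + toℕ r ℤ.- (c ℤ.+ c) ℤ.+ (c ℤ.+ ν ℤ.+ (c ℤ.+ ν)) in
            (residue 3 N , N ℤ./ℕ 3 , c ℤ.+ ν ℤ.- N ℤ./ℕ 3) ≡ (r , ν , c)
  from-to r ν c = trans (cong₂ (λ r n → r , n , c ℤ.+ ν ℤ.- n) (cong proj₁ e) (cong proj₂ e)) (cong (λ k → r , ν , k) (lemma₅ c ν))
    where
    N : ℤ
    N = ν ℤ.+ + toℕ r ℤ.- (c ℤ.+ c) ℤ.+ (c ℤ.+ ν ℤ.+ (c ℤ.+ ν))
    e : (residue 3 N , N ℤ./ℕ 3) ≡ (r , ν)
    e = trans (cong (_≅_.from (ℤ-residues 3)) (lemma₄ ν (+ toℕ r) c)) (_≅_.from-to (ℤ-residues 3) (r , ν))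

-- The quintuple product identity ∑ (-1)^(m+k) q^(m(m-1)/2 + k²) w(m + 2k) = e(q²) ∑ q^(ν(3ν-1)/2) (w(3ν) - q^ν w(3ν+1)) for an arbitrary weight w.
module Quintuple (s : ℕ) (nz : 0 < s) (w : ℤ → ℤ) where
  family : ℤ × ℤ → Series
  family (m , k) = mono (sgn m ℤ.* sgn k ℤ.* w (m ℤ.+ (k ℤ.+ k))) (expo (Ψ s) m ℤ.+ expo (φ s) k)

  A₀ A₁ A₂ B₁ B₂ : Theta
  A₀ = theta (λ ν → w (+ 3 ℤ.* ν ℤ.+ + 0)) (s ℕ.+ s) s
  A₁ = theta (λ ν → w (+ 3 ℤ.* ν ℤ.+ + 1)) s (s ℕ.+ s)
  A₂ = theta (λ ν → w (+ 3 ℤ.* ν ℤ.+ + 2)) 0 (s ℕ.+ s ℕ.+ s)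
  B₁ = theta sgn (s ℕ.+ s) (s ℕ.+ s ℕ.+ (s ℕ.+ s))
  B₂ = theta sgn (s ℕ.+ s ℕ.+ (s ℕ.+ s) ℕ.+ (s ℕ.+ s)) 0

  private
    s>0 : ∀ {t} → 0 < s ℕ.+ t
    s>0 = 0<s+s nz

    tri-lemma : ∀ ν r c → tri (ν ℤ.+ r ℤ.- (c ℤ.+ c)) ≡ tri ν ℤ.+ tri r ℤ.+ ν ℤ.* r ℤ.+ (tri c ℤ.+ tri c ℤ.+ (tri c ℤ.+ tri c ℤ.+ c) ℤ.+ (c ℤ.+ c)) ℤ.- (ν ℤ.+ r) ℤ.* (c ℤ.+ c)
    tri-lemma ν r c = trans (tri-i-j (ν ℤ.+ r) (c ℤ.+ c)) (cong₂ (λ x y → x ℤ.+ (y ℤ.+ (c ℤ.+ c)) ℤ.- (ν ℤ.+ r) ℤ.* (c ℤ.+ c)) (tri-+ ν r) (tri-double c))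

    expo-lemma : ∀ ν r c → expo (Ψ s) (ν ℤ.+ r ℤ.- (c ℤ.+ c)) ℤ.+ expo (φ s) (c ℤ.+ ν) ≡
      + s ℤ.* (tri ν ℤ.+ tri r ℤ.+ ν ℤ.* r ℤ.+ (tri c ℤ.+ tri c ℤ.+ (tri c ℤ.+ tri c ℤ.+ c) ℤ.+ (c ℤ.+ c)) ℤ.- (ν ℤ.+ r) ℤ.* (c ℤ.+ c))
      ℤ.+ (+ s ℤ.* (tri c ℤ.+ tri ν ℤ.+ c ℤ.* ν) ℤ.+ + s ℤ.* (tri c ℤ.+ tri ν ℤ.+ c ℤ.* ν ℤ.+ (c ℤ.+ ν)))
    expo-lemma ν r c = cong₂ ℤ._+_
      (trans (ℤ.+-identityʳ _) (cong (+ s ℤ.*_) (tri-lemma ν r c)))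
      (expo≡ (φ s) (c ℤ.+ ν) (tri-+ c ν))

    weight : ∀ ν r c → ν ℤ.+ r ℤ.- (c ℤ.+ c) ℤ.+ (c ℤ.+ ν ℤ.+ (c ℤ.+ ν)) ≡ + 3 ℤ.* ν ℤ.+ r
    weight = solve-∀

    sign : ∀ ν r c → sgn (ν ℤ.+ r ℤ.- (c ℤ.+ c)) ℤ.* sgn (c ℤ.+ ν) ≡ sgn r ℤ.* sgn c
    sign ν r c = trans (cong₂ ℤ._*_ (trans (sgn-i-j (ν ℤ.+ r) (c ℤ.+ c)) (cong₂ ℤ._*_ (sgn-+ ν r) (sgn-double c))) (sgn-+ c ν))
      (trans (lemma (sgn ν) (sgn r) (sgn c)) (trans (cong (ℤ._* (sgn r ℤ.* sgn c)) (sgn-sq ν)) (ℤ.*-identityˡ _)))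
      where
      lemma : ∀ a b c → a ℤ.* b ℤ.* 1ℤ ℤ.* (c ℤ.* a) ≡ a ℤ.* a ℤ.* (b ℤ.* c)
      lemma = solve-∀

    row-coef : ∀ ν r c → sgn r ℤ.* (w (+ 3 ℤ.* ν ℤ.+ r) ℤ.* sgn c) ≡
      sgn (ν ℤ.+ r ℤ.- (c ℤ.+ c)) ℤ.* sgn (c ℤ.+ ν) ℤ.* w (ν ℤ.+ r ℤ.- (c ℤ.+ c) ℤ.+ (c ℤ.+ ν ℤ.+ (c ℤ.+ ν)))
    row-coef ν r c = sym (trans (cong₂ ℤ._*_ (sign ν r c) (cong w (weight ν r c))) (lemma (sgn r) (sgn c) _))
      where
      lemma : ∀ a b c → a ℤ.* b ℤ.* c ≡ a ℤ.* (c ℤ.* b)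
      lemma = solve-∀

    sums : Fin 3 → Series
    sums zero             = mono 1ℤ (+ 0) ⊗ (⟦ A₀ ⟧ ⊗ ⟦ B₁ ⟧)
    sums (suc zero)       = mono (ℤ.- 1ℤ) (+ 0) ⊗ (⟦ A₁ ⟧ ⊗ ⟦ ε (s ℕ.+ s) ⟧)
    sums (suc (suc zero)) = mono 1ℤ (+ s) ⊗ (⟦ A₂ ⟧ ⊗ ⟦ B₂ ⟧)

    row : ∀ A B e r → 0 < Theta.a A ℕ.+ Theta.b A → 0 < Theta.a B ℕ.+ Theta.b B →
          (∀ ν c → sgn r ℤ.* (Theta.coef A ν ℤ.* Theta.coef B c) ≡ sgn r ℤ.* (w (+ 3 ℤ.* ν ℤ.+ r) ℤ.* sgn c)) →
          (∀ ν c → + e ℤ.+ (linear A ν (tri ν) ℤ.+ linear B c (tri c)) ≡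
             + s ℤ.* (tri ν ℤ.+ tri r ℤ.+ ν ℤ.* r ℤ.+ (tri c ℤ.+ tri c ℤ.+ (tri c ℤ.+ tri c ℤ.+ c) ℤ.+ (c ℤ.+ c)) ℤ.- (ν ℤ.+ r) ℤ.* (c ℤ.+ c))
             ℤ.+ (+ s ℤ.* (tri c ℤ.+ tri ν ℤ.+ c ℤ.* ν) ℤ.+ + s ℤ.* (tri c ℤ.+ tri ν ℤ.+ c ℤ.* ν ℤ.+ (c ℤ.+ ν)))) →
          HasSum (λ (ν , c) → family (ν ℤ.+ r ℤ.- (c ℤ.+ c) , c ℤ.+ ν)) (mono (sgn r) (+ e) ⊗ (⟦ A ⟧ ⊗ ⟦ B ⟧))
    row A B e r nA nB coefs expos = HasSum-cong
      (λ (ν , c) → ≐-trans (mono-⊗ 0≤+n (0≤+ (0≤expo A ν) (0≤expo B c)))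
        (mono-cong (trans (coefs ν c) (row-coef ν r c))
                   (trans (cong (ℤ._+_ (+ e)) (sym (split₃ A B ν c))) (trans (expos ν c) (sym (expo-lemma ν r c))))))
      ≐-refl (HasSum-⊗ (mono (sgn r) (+ e)) (HasSum-θ-⊗ A B nA nB))

    rhs : (s a b i j t r : Sol.Polynomial 5) → Sol.Polynomial 5
    rhs s a b i j t r = s ⊠ (a ⊞ t ⊞ i ⊠ r ⊞ (b ⊞ b ⊞ (b ⊞ b ⊞ j) ⊞ (j ⊞ j)) ⊟ (i ⊞ r) ⊠ (j ⊞ j))
                        ⊞ (s ⊠ (b ⊞ a ⊞ j ⊠ i) ⊞ s ⊠ (b ⊞ a ⊞ j ⊠ i ⊞ (j ⊞ i)))

    rows : ∀ r → HasSum (λ ((ν , c) : ℤ × ℤ) → family (ν ℤ.+ + toℕ r ℤ.- (c ℤ.+ c) , c ℤ.+ ν)) (sums r)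
    rows zero = row A₀ B₁ 0 (+ 0) (0<s+s s>0) (0<s+s s>0) (λ _ _ → refl) λ ν c →
      Sol.solve 5 (λ s a b i j → lit (+ 0) ⊞ ((s ⊞ s) ⊠ a ⊞ s ⊠ (a ⊞ i) ⊞ ((s ⊞ s) ⊠ b ⊞ (s ⊞ s ⊞ (s ⊞ s)) ⊠ (b ⊞ j)))
        ≗ rhs s a b i j (lit 0ℤ) (lit (+ 0))) refl (+ s) (tri ν) (tri c) ν c
    rows (suc zero) = row A₁ (ε (s ℕ.+ s)) 0 (+ 1) s>0 (0<s+s (0<s+s s>0)) (λ _ _ → refl) λ ν c →
      Sol.solve 5 (λ s a b i j → lit (+ 0) ⊞ (s ⊠ a ⊞ (s ⊞ s) ⊠ (a ⊞ i) ⊞ ((s ⊞ s ⊞ (s ⊞ s)) ⊠ b ⊞ (s ⊞ s) ⊠ (b ⊞ j)))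
        ≗ rhs s a b i j (lit 0ℤ) (lit (+ 1))) refl (+ s) (tri ν) (tri c) ν c
    rows (suc (suc zero)) = row A₂ B₂ s (+ 2) (0<s+s s>0) (0<s+s (0<s+s (0<s+s s>0))) (λ _ _ → refl) λ ν c →
      Sol.solve 5 (λ s a b i j → s ⊞ (lit 0ℤ ⊠ a ⊞ (s ⊞ s ⊞ s) ⊠ (a ⊞ i) ⊞ ((s ⊞ s ⊞ (s ⊞ s) ⊞ (s ⊞ s)) ⊠ b ⊞ lit 0ℤ ⊠ (b ⊞ j)))
        ≗ rhs s a b i j (lit 1ℤ) (lit (+ 2))) refl (+ s) (tri ν) (tri c) ν c

  -- For each residue r of m + 2k modulo 3 the double sum factors into a weighted series in ν and a
  -- signed series in c. The latter is `ε (s ℕ.+ s)` for r = 0 and r = 1, up to reflection, and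
  -- antisymmetric for r = 2, where it vanishes.
  quintuple : ∀ {t} → HasSum family t → t ≐ ⟦ ε (s ℕ.+ s) ⟧ ⊗ (⟦ A₀ ⟧ ⊖ ⟦ A₁ ⟧)
  quintuple {t} h = begin
    t ≈⟨ HasSum-unique (HasSum-Σ Fin._≟_ (HasSum-reindex thirds h) rows) (HasSum-Fin 3 sums) ⟩
    # 1ℤ ⊗ q^ 0 ⊗ (a₀ ⊗ ⟦ B₁ ⟧) ⊕ (# (ℤ.- 1ℤ) ⊗ q^ 0 ⊗ (a₁ ⊗ e) ⊕ (mono 1ℤ (+ s) ⊗ (⟦ A₂ ⟧ ⊗ ⟦ B₂ ⟧) ⊕ 𝟘))
      ≈⟨ ⊕-cong (⊗-cong (⊗-cong ≐-refl q^0) (⊗-cong ≐-refl (≐-trans (θ-reflect sgn (s ℕ.+ s) (s ℕ.+ s ℕ.+ (s ℕ.+ s)) (0<s+s s>0)) (θ-coef (s ℕ.+ s ℕ.+ (s ℕ.+ s)) (s ℕ.+ s) (0<s+s (0<s+s s>0)) sgn-neg))))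
           (⊕-cong (⊗-cong (⊗-cong ≐-refl q^0) ≐-refl) (⊕-cong (⊗-cong ≐-refl (⊗-cong ≐-refl (θ-odd (s ℕ.+ s ℕ.+ (s ℕ.+ s) ℕ.+ (s ℕ.+ s)) (0<s+s (0<s+s s>0))))) ≐-refl)) ⟩
    # 1ℤ ⊗ 𝟙 ⊗ (a₀ ⊗ e) ⊕ (# (ℤ.- 1ℤ) ⊗ 𝟙 ⊗ (a₁ ⊗ e) ⊕ (mono 1ℤ (+ s) ⊗ (⟦ A₂ ⟧ ⊗ 𝟘) ⊕ 𝟘))
      ≈⟨ solve 5 (λ a b e m n → con 1ℤ :* con 1ℤ :* (a :* e) :+ (con (ℤ.- 1ℤ) :* con 1ℤ :* (b :* e) :+ (m :* (n :* con 0ℤ) :+ con 0ℤ))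
           := e :* (a :- b)) ≐-refl a₀ a₁ e (mono 1ℤ (+ s)) ⟦ A₂ ⟧ ⟩
    e ⊗ (a₀ ⊖ a₁) ∎
    where
    open ≐-Reasoning
    e a₀ a₁ : Series
    e  = ⟦ ε (s ℕ.+ s) ⟧
    a₀ = ⟦ A₀ ⟧
    a₁ = ⟦ A₁ ⟧

θ-⊕ : ∀ c d a b → 0 < a ℕ.+ b → ⟦ theta c a b ⟧ ⊕ ⟦ theta d a b ⟧ ≐ ⟦ theta (λ i → c i ℤ.+ d i) a b ⟧
θ-⊕ c d a b nz = HasSum-unique
  (HasSum-cong (λ i → mono-⊕ (c i) (d i) (expo (theta c a b) i)) ≐-refl (HasSum-⊕ ℤ._≟_ (HasSum-θ (theta c a b) nz) (HasSum-θ (theta d a b) nz)))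
  (HasSum-θ (theta (λ i → c i ℤ.+ d i) a b) nz)

θ-⊝ : ∀ c a b → 0 < a ℕ.+ b → ⟦ theta (ℤ.-_ ∘ c) a b ⟧ ≐ ⊝ ⟦ theta c a b ⟧
θ-⊝ c a b nz = HasSum-unique (HasSum-θ (theta (ℤ.-_ ∘ c) a b) nz)
  (HasSum-cong (λ i → ≐-trans (neg _) (mono-⊝ (c i) (expo (theta c a b) i))) (neg _) (HasSum-⊗ (# (ℤ.- 1ℤ)) (HasSum-θ (theta c a b) nz)))
  where
  neg : ∀ f → # (ℤ.- 1ℤ) ⊗ f ≐ ⊝ f
  neg = solve 1 (λ f → con (ℤ.- 1ℤ) :* f := :- f) ≐-refl

module _ (s : ℕ) (nz : 0 < s) where
  private
    nz₀ : 0 < s ℕ.+ 0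
    nz₀ = 0<s+s nz
    nz₂ : ∀ {t u} → 0 < s ℕ.+ t ℕ.+ u
    nz₂ = 0<s+s (0<s+s nz)

  -- The derivative of the quintuple product at x = 1, that is, the weight w(N) = -N. A vanishing
  -- product supplies the part -2k of the weight. Reflecting the first series turns -3ν into 3ν, and
  -- 3ν + (3ν + 1) gives the coefficients of `S̃`.
  κφ : ⟦ κ s ⟧ ⊗ ⟦ φ s ⟧ ≐ ⟦ ε (s ℕ.+ s) ⟧ ⊗ ⟦ S̃ s ⟧
  κφ = begin
    ⟦ κ s ⟧ ⊗ ⟦ φ s ⟧
      ≈⟨ solve 3 (λ k f n → k :* f := k :* f :+ con 0ℤ :* n) ≐-refl ⟦ κ s ⟧ ⟦ φ s ⟧ ⟦ N ⟧ ⟩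
    ⟦ κ s ⟧ ⊗ ⟦ φ s ⟧ ⊕ 𝟘 ⊗ ⟦ N ⟧
      ≈⟨ ⊕-cong ≐-refl (⊗-cong (≐-sym (θ-odd s nz)) ≐-refl) ⟩
    ⟦ κ s ⟧ ⊗ ⟦ φ s ⟧ ⊕ ⟦ O ⟧ ⊗ ⟦ N ⟧
      ≈⟨ quintuple total ⟩
    e ⊗ (⟦ A₀ ⟧ ⊖ ⟦ A₁ ⟧)
      ≈⟨ ⊗-cong ≐-refl (⊕-cong (≐-trans (θ-reflect _ (s ℕ.+ s) s nz₂) (θ-coef s (s ℕ.+ s) (0<s+s nz) coef₀))
                               (≐-trans (⊝-cong (θ-coef s (s ℕ.+ s) (0<s+s nz) coef₁)) (≐-trans (⊝-cong (θ-⊝ (λ ν → + 3 ℤ.* ν ℤ.+ 1ℤ) s (s ℕ.+ s) (0<s+s nz)))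
                                 (solve 1 (λ a → :- (:- a) := a) ≐-refl _)))) ⟩
    e ⊗ (⟦ theta (ℤ._*_ (+ 3)) s (s ℕ.+ s) ⟧ ⊕ ⟦ theta (λ ν → + 3 ℤ.* ν ℤ.+ 1ℤ) s (s ℕ.+ s) ⟧)
      ≈⟨ ⊗-cong ≐-refl (≐-trans (θ-⊕ _ _ s (s ℕ.+ s) (0<s+s nz)) (θ-coef s (s ℕ.+ s) (0<s+s nz) coef₂)) ⟩
    e ⊗ ⟦ S̃ s ⟧ ∎
    where
    open ≐-Reasoning
    open Quintuple s nz ℤ.-_
    e : Series
    e = ⟦ ε (s ℕ.+ s) ⟧
    N O : Theta
    N = theta (λ k → sgn k ℤ.* ℤ.- (k ℤ.+ k)) s s
    O = theta sgn s 0
    coef₀ : ∀ ν → ℤ.- (+ 3 ℤ.* ℤ.- ν ℤ.+ + 0) ≡ + 3 ℤ.* ν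
    coef₀ = solve-∀
    coef₁ : ∀ ν → ℤ.- (+ 3 ℤ.* ν ℤ.+ + 1) ≡ ℤ.- (+ 3 ℤ.* ν ℤ.+ 1ℤ)
    coef₁ ν = refl
    coef₂ : ∀ ν → + 3 ℤ.* ν ℤ.+ (+ 3 ℤ.* ν ℤ.+ 1ℤ) ≡ + 6 ℤ.* ν ℤ.+ 1ℤ
    coef₂ = solve-∀
    total-coef : ∀ m k a b → ℤ.- m ℤ.* a ℤ.* b ℤ.+ a ℤ.* (b ℤ.* ℤ.- (k ℤ.+ k)) ≡ a ℤ.* b ℤ.* ℤ.- (m ℤ.+ (k ℤ.+ k))
    total-coef = solve-∀
    total : HasSum family (⟦ κ s ⟧ ⊗ ⟦ φ s ⟧ ⊕ ⟦ O ⟧ ⊗ ⟦ N ⟧)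
    total = HasSum-cong (λ (m , k) → ≐-trans (mono-⊕ _ _ (expo (Ψ s) m ℤ.+ expo (φ s) k)) (mono-coef (expo (Ψ s) m ℤ.+ expo (φ s) k) (total-coef m k (sgn m) (sgn k)))) ≐-refl
      (HasSum-⊕ _≟ℤ²_ (HasSum-θ-⊗ (κ s) (φ s) nz₀ (0<s+s nz)) (HasSum-θ-⊗ O N nz₀ (0<s+s nz)))

  -- The quintuple product at x = -1: the weight (-1)^(m+2k) cancels the sign (-1)^m, and the two
  -- series on the right add up instead of subtracting.
  Ψφ : ⟦ Ψ s ⟧ ⊗ ⟦ φ s ⟧ ≐ # (+ 2) ⊗ (⟦ ε s ⟧ ⊗ ⟦ ε (s ℕ.+ s) ⟧)
  Ψφ = begin
    ⟦ Ψ s ⟧ ⊗ ⟦ φ s ⟧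
      ≈⟨ quintuple total ⟩
    e₂ ⊗ (⟦ A₀ ⟧ ⊖ ⟦ A₁ ⟧)
      ≈⟨ ⊗-cong ≐-refl (⊕-cong (θ-coef (s ℕ.+ s) s nz₂ coef₀)
           (⊝-cong (≐-trans (≐-trans (θ-coef s (s ℕ.+ s) (0<s+s nz) coef₁) (θ-⊝ sgn s (s ℕ.+ s) (0<s+s nz)))
             (⊝-cong (≐-trans (θ-reflect sgn s (s ℕ.+ s) (0<s+s nz)) (θ-coef (s ℕ.+ s) s nz₂ sgn-neg)))))) ⟩
    e₂ ⊗ (⟦ ε s ⟧ ⊖ ⊝ ⟦ ε s ⟧)
      ≈⟨ solve 2 (λ a b → b :* (a :- (:- a)) := con (+ 2) :* (a :* b)) ≐-refl ⟦ ε s ⟧ e₂ ⟩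
    # (+ 2) ⊗ (⟦ ε s ⟧ ⊗ e₂) ∎
    where
    open ≐-Reasoning
    open Quintuple s nz sgn
    e₂ : Series
    e₂ = ⟦ ε (s ℕ.+ s) ⟧
    sgn-3 : ∀ ν → sgn (+ 3 ℤ.* ν) ≡ sgn ν
    sgn-3 ν = trans (cong sgn (three ν)) (trans (sgn-+ (ν ℤ.+ ν) ν) (trans (cong (ℤ._* sgn ν) (sgn-double ν)) (ℤ.*-identityˡ (sgn ν))))
      where
      three : ∀ ν → + 3 ℤ.* ν ≡ ν ℤ.+ ν ℤ.+ ν
      three = solve-∀
    coef₀ : ∀ ν → sgn (+ 3 ℤ.* ν ℤ.+ + 0) ≡ sgn ν
    coef₀ ν = trans (cong sgn (ℤ.+-identityʳ (+ 3 ℤ.* ν))) (sgn-3 ν)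
    coef₁ : ∀ ν → sgn (+ 3 ℤ.* ν ℤ.+ + 1) ≡ ℤ.- sgn ν
    coef₁ ν = trans (cong sgn (ℤ.+-comm (+ 3 ℤ.* ν) (+ 1))) (trans (sgn-suc (+ 3 ℤ.* ν)) (cong ℤ.-_ (sgn-3 ν)))
    total-coef : ∀ m k → 1ℤ ℤ.* sgn k ≡ sgn m ℤ.* sgn k ℤ.* sgn (m ℤ.+ (k ℤ.+ k))
    total-coef m k = sym (trans (cong (ℤ._*_ (sgn m ℤ.* sgn k)) (trans (sgn-+ m (k ℤ.+ k)) (trans (cong (sgn m ℤ.*_) (sgn-double k)) (ℤ.*-identityʳ (sgn m)))))
      (trans (lemma (sgn m) (sgn k)) (cong (ℤ._* sgn k) (sgn-sq m))))
      where
      lemma : ∀ a b → a ℤ.* b ℤ.* a ≡ a ℤ.* a ℤ.* b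
      lemma = solve-∀
    total : HasSum family (⟦ Ψ s ⟧ ⊗ ⟦ φ s ⟧)
    total = HasSum-cong (λ (m , k) → mono-coef (expo (Ψ s) m ℤ.+ expo (φ s) k) (total-coef m k)) ≐-refl (HasSum-θ-⊗ (Ψ s) (φ s) nz₀ (0<s+s nz))

-- Equations from linear combinations of equations

difference⇒≐ : ∀ {f g} → f ⊖ g ≐ 𝟘 → f ≐ g
difference⇒≐ {f} {g} e = ≐-trans (solve 2 (λ f g → f := f :- g :+ g) ≐-refl f g) (≐-trans (⊕-cong e ≐-refl) (Ring.+-identityˡ g))

≐⇒difference : ∀ {f g} → f ≐ g → f ⊖ g ≐ 𝟘
≐⇒difference {f} {g} e = ≐-trans (⊕-cong e ≐-refl) (solve 1 (λ g → g :- g := con 0ℤ) ≐-refl g)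

record Multiple : Set where
  constructor _·_
  field
    factor      : Series
    {lhs} {rhs} : Series
    equation    : lhs ≐ rhs

total : List Multiple → Series
total []             = 𝟘
total (_·_ c {l} {r} _ ∷ es) = c ⊗ (l ⊖ r) ⊕ total es

infix 3 _·_

-- Derivation by ideal membership: the listed factors are cofactors that express `f ⊖ g` through the
-- differences of the given equations, and the ring solver checks the polynomial identity.
combine : ∀ {f g} es → f ⊖ g ≐ total es → f ≐ g
combine es p = difference⇒≐ (≐-trans p (vanish es))
  where
  vanish : ∀ es → total es ≐ 𝟘
  vanish []           = ≐-refl
  vanish ((c · e) ∷ es) = ≐-trans (⊕-cong (≐-trans (⊗-cong ≐-refl (≐⇒difference e)) (Ring.zeroʳ c)) (vanish es)) (Ring.+-identityˡ 𝟘)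

HasSum-suc : ∀ {f : ℕ → Series} {s} → HasSum (f ∘ suc) s → HasSum f (f 0 ⊕ s)
HasSum-suc {f} h = hasSum λ N → case HasSum.support h N of λ
  { (L , c , p) → 0 ∷ map suc L
  , covers (0∉ L ∷ Unique.map⁺ ℕ.suc-injective (Covers.unique c))
           (λ { zero → inj₁ (here refl) ; (suc i) → case Covers.outside c i of λ { (inj₁ m) → inj₁ (there (∈-map⁺ suc m)) ; (inj₂ z) → inj₂ z } })
  , ⊕-cong≈ ≈-refl (≈-trans (≐⇒≈ (ΣL-map f suc L)) p) }
  where
  0∉ : ∀ L → All (0 ≢_) (map suc L)
  0∉ []      = []
  0∉ (_ ∷ L) = (λ ()) ∷ 0∉ L

-- The array of coefficients of ∑ xⁱ yʲ D(i,j) = ∑ y^N (-x;Q)_N / (x;Q)_(N+1), where Q = q^s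

module Array (s : ℕ) where
  Q : ℕ → Series
  Q k = q^ (s ℕ.* k)

  Q-0 : Q 0 ≐ 𝟙
  Q-0 = ≐-trans (eq λ n → cong (λ k → q^ k n) (ℕ.*-zeroʳ s)) q^0

  Q-+ : ∀ a b → Q (a ℕ.+ b) ≐ Q a ⊗ Q b
  Q-+ a b = ≐-trans (eq λ n → cong (λ k → q^ k n) (ℕ.*-distribˡ-+ s a b)) (q^-+ (s ℕ.* a) (s ℕ.* b))

  Q-cong : ∀ {a b} → a ≡ b → Q a ≐ Q b
  Q-cong refl = ≐-refl

  x : Series
  x = Q 1

  Q-suc : ∀ a → Q (suc a) ≐ x ⊗ Q a
  Q-suc a = Q-+ 1 a

  -- `D i k` enumerates the sequences of k entries that may follow an entry of size i + 1, each
  -- entry lowered by 1. Raising i by one admits two new choices for the next entry: size i + 2,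
  -- which cannot be overlined, and an overlined entry of size i + 1.
  D : ℕ → ℕ → Series
  D zero    j       = 𝟙
  D (suc i) zero    = 𝟙
  D (suc i) (suc j) = D i (suc j) ⊕ (Q (suc i) ⊗ D (suc i) j ⊕ Q i ⊗ D i j)

  D-0 : ∀ i → D i 0 ≐ 𝟙
  D-0 zero    = ≐-refl
  D-0 (suc i) = ≐-refl

  private
    -- Precisely what makes the recurrence and its transpose have equal right-hand sides. Being
    -- symmetric in i and j, it can be proved by induction from the recurrence in i alone.
    Balanced : ℕ → ℕ → Set
    Balanced i j = (𝟙 ⊖ x ⊗ Q j) ⊗ D i (suc j) ⊖ Q j ⊗ D i j ≐ (𝟙 ⊖ x ⊗ Q i) ⊗ D (suc i) j ⊖ Q i ⊗ D i j

    D-suc : ∀ i j → D (suc i) (suc j) ≐ D i (suc j) ⊕ (x ⊗ Q i ⊗ D (suc i) j ⊕ Q i ⊗ D i j)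
    D-suc i j = ⊕-cong ≐-refl (⊕-cong (⊗-cong (Q-suc i) ≐-refl) ≐-refl)

    balanced₀ : ∀ j → (𝟙 ⊖ x) ⊗ D 1 j ≐ # (+ 2) ⊖ Q j ⊖ x ⊗ Q j
    balanced₀ zero = combine ((⊝ (𝟙 ⊕ x) · ≐-sym Q-0) ∷ [])
      (solve 2 (λ x y → (con 1ℤ :- x) :* con 1ℤ :- (con (+ 2) :- y :- x :* y) := (:- (con 1ℤ :+ x)) :* (con 1ℤ :- y) :+ con 0ℤ) ≐-refl x (Q 0))
    balanced₀ (suc j) = combine ((𝟙 ⊖ x · D-suc 0 j) ∷ (𝟙 ⊕ x · Q-suc j) ∷ ((𝟙 ⊖ x) ⊗ (𝟙 ⊕ x ⊗ D 1 j) · Q-0) ∷ (x · balanced₀ j) ∷ [])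
      (solve 6 (λ x d d₁ y y₁ q → (con 1ℤ :- x) :* d₁ :- (con (+ 2) :- y₁ :- x :* y₁)
          := (con 1ℤ :- x) :* (d₁ :- (con 1ℤ :+ (x :* q :* d :+ q :* con 1ℤ))) :+ ((con 1ℤ :+ x) :* (y₁ :- x :* y)
             :+ ((con 1ℤ :- x) :* (con 1ℤ :+ x :* d) :* (q :- con 1ℤ) :+ (x :* ((con 1ℤ :- x) :* d :- (con (+ 2) :- y :- x :* y)) :+ con 0ℤ))))
        ≐-refl x (D 1 j) (D 1 (suc j)) (Q j) (Q (suc j)) (Q 0))

    balanced : ∀ i j → Balanced i j
    balanced zero j = combine ((⊝ 𝟙 · balanced₀ j) ∷ (x ⊗ D 1 j ⊕ 𝟙 · Q-0) ∷ [])
      (solve 4 (λ x d y q → (con 1ℤ :- x :* y) :* con 1ℤ :- y :* con 1ℤ :- ((con 1ℤ :- x :* q) :* d :- q :* con 1ℤ)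
          := (:- con 1ℤ) :* ((con 1ℤ :- x) :* d :- (con (+ 2) :- y :- x :* y)) :+ ((x :* d :+ con 1ℤ) :* (q :- con 1ℤ) :+ con 0ℤ)) ≐-refl x (D 1 j) (Q j) (Q 0))
    balanced (suc i) zero = combine
      ((𝟙 ⊖ x ⊗ Q 0 · D-suc i 0) ∷ (𝟙 ⊕ x · Q-suc i) ∷ (𝟙 · balanced i 0) ∷ (Q 0 ⊖ x ⊗ Q 0 ⊗ Q i · D-0 i) ∷ (⊝ ((𝟙 ⊕ x) ⊗ x ⊗ Q i) · Q-0) ∷ [])
      (solve 7 (λ x q p p₁ a d d₁ →
          (con 1ℤ :- x :* q) :* d₁ :- q :* con 1ℤ :- ((con 1ℤ :- x :* p₁) :* con 1ℤ :- p₁ :* con 1ℤ)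
          := (con 1ℤ :- x :* q) :* (d₁ :- (d :+ (x :* p :* con 1ℤ :+ p :* a))) :+ ((con 1ℤ :+ x) :* (p₁ :- x :* p)
             :+ (con 1ℤ :* ((con 1ℤ :- x :* q) :* d :- q :* a :- ((con 1ℤ :- x :* p) :* con 1ℤ :- p :* a))
             :+ ((q :- x :* q :* p) :* (a :- con 1ℤ) :+ ((:- ((con 1ℤ :+ x) :* x :* p)) :* (q :- con 1ℤ) :+ con 0ℤ)))))
        ≐-refl x (Q 0) (Q i) (Q (suc i)) (D i 0) (D i 1) (D (suc i) 1))
    balanced (suc i) (suc j) = combine
      ((𝟙 ⊖ x ⊗ Q (suc j) · D-suc i (suc j)) ∷ (⊝ (𝟙 ⊖ x ⊗ Q (suc i)) · D-suc (suc i) j)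
        ∷ (𝟙 · balanced i (suc j)) ∷ (x ⊗ Q (suc i) · balanced (suc i) j)
        ∷ (x ⊗ Q i · balanced i j) ∷ (x ⊗ Q i ⊖ x ⊗ Q j · D-suc i j)
        ∷ (x ⊗ d ⊖ c ⊖ x ⊗ (𝟙 ⊖ x ⊗ Q j) ⊗ d ⊕ x ⊗ Q j ⊗ c ⊕ d · Q-suc i)
        ∷ (b ⊖ d ⊖ x ⊗ (x ⊗ Q i ⊗ d ⊕ Q i ⊗ b) · Q-suc j) ∷ [])
      (solve 13 (λ x p p₁ r r₁ a b c d e f g h →
          (con 1ℤ :- x :* r₁) :* f :- r₁ :* d :- ((con 1ℤ :- x :* p₁) :* h :- p₁ :* d)
          := (con 1ℤ :- x :* r₁) :* (f :- (e :+ (x :* p :* d :+ p :* b)))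
          :+ ((:- (con 1ℤ :- x :* p₁)) :* (h :- (d :+ (x :* p₁ :* g :+ p₁ :* c)))
          :+ (con 1ℤ :* ((con 1ℤ :- x :* r₁) :* e :- r₁ :* b :- ((con 1ℤ :- x :* p) :* d :- p :* b))
          :+ (x :* p₁ :* ((con 1ℤ :- x :* r) :* d :- r :* c :- ((con 1ℤ :- x :* p₁) :* g :- p₁ :* c))
          :+ (x :* p :* ((con 1ℤ :- x :* r) :* b :- r :* a :- ((con 1ℤ :- x :* p) :* c :- p :* a))
          :+ ((x :* p :- x :* r) :* (d :- (b :+ (x :* p :* c :+ p :* a)))
          :+ ((x :* d :- c :- x :* (con 1ℤ :- x :* r) :* d :+ x :* r :* c :+ d) :* (p₁ :- x :* p)
          :+ ((b :- d :- x :* (x :* p :* d :+ p :* b)) :* (r₁ :- x :* r) :+ con 0ℤ))))))))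
        ≐-refl x (Q i) (Q (suc i)) (Q j) (Q (suc j)) (D i j) b c d (D i (suc (suc j))) (D (suc i) (suc (suc j))) (D (suc (suc i)) j) (D (suc (suc i)) (suc j)))
      where
      b c d : Series
      b = D i (suc j)
      c = D (suc i) j
      d = D (suc i) (suc j)

  D-sucʳ : ∀ i j → D (suc i) (suc j) ≐ D (suc i) j ⊕ (Q (suc j) ⊗ D i (suc j) ⊕ Q j ⊗ D i j)
  D-sucʳ i j = combine ((𝟙 · D-suc i j) ∷ (𝟙 · balanced i j) ∷ (⊝ D i (suc j) · Q-suc j) ∷ [])
    (solve 8 (λ x p r r₁ a b c d →
        d :- (c :+ (r₁ :* b :+ r :* a)) := con 1ℤ :* (d :- (b :+ (x :* p :* c :+ p :* a)))
        :+ (con 1ℤ :* ((con 1ℤ :- x :* r) :* b :- r :* a :- ((con 1ℤ :- x :* p) :* c :- p :* a))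
        :+ ((:- b) :* (r₁ :- x :* r) :+ con 0ℤ)))
      ≐-refl x (Q i) (Q j) (Q (suc j)) (D i j) (D i (suc j)) (D (suc i) j) (D (suc i) (suc j)))

  -- Conjugation of overpartitions, obtained from the two recurrences without a bijection.
  D-sym : ∀ i j → D i j ≐ D j i
  D-sym zero    zero    = ≐-refl
  D-sym zero    (suc j) = ≐-refl
  D-sym (suc i) zero    = ≐-refl
  D-sym (suc i) (suc j) = ≐-trans (D-sucʳ i j)
    (⊕-cong (D-sym (suc i) j) (⊕-cong (⊗-cong ≐-refl (D-sym i (suc j))) (⊗-cong ≐-refl (D-sym i j))))

  D-nonneg : ∀ i j n → 0ℤ ℤ.≤ D i j n
  D-nonneg zero    j       = 𝟙-nonneg
  D-nonneg (suc i) zero    = 𝟙-nonneg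
  D-nonneg (suc i) (suc j) = ⊕-nonneg (D-nonneg i (suc j))
    (⊕-nonneg (⊗-nonneg (q^-nonneg (s ℕ.* suc i)) (D-nonneg (suc i) j)) (⊗-nonneg (q^-nonneg (s ℕ.* i)) (D-nonneg i j)))

  Q-vanish : ∀ {N k} f → 0 < s → N ≤ k → Q k ⊗ f ≈[ N ] 𝟘
  Q-vanish {N} {k} f 0<s N≤k = q^⊗-vanish f (ℕ.≤-trans N≤k (ℕ.m≤n*m k s {{ℕ.>-nonZero 0<s}}))

module Diagonals (s : ℕ) (0<s : 0 < s) where
  open Array s public

  -- Overpartitions of rank m have entries D(m+j, j) with weight q^(m+1+2j), so `Ẽ` is the series of
  -- combinatorial interest. The weights of `E` are chosen because it satisfies a recurrence of its
  -- own.
  E Ẽ : ℕ → Series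
  E m = sumℕ (λ j → Q j ⊗ D (m ℕ.+ j) j)
  Ẽ m = sumℕ (λ j → Q (j ℕ.+ j) ⊗ D (m ℕ.+ j) j)

  HasSum-E : ∀ m → HasSum (λ j → Q j ⊗ D (m ℕ.+ j) j) (E m)
  HasSum-E m = HasSum-ℕ λ N i N≤i → Q-vanish _ 0<s (ℕ.≤-trans N≤i (ℕ.m≤n+m i 2))

  HasSum-Ẽ : ∀ m → HasSum (λ j → Q (j ℕ.+ j) ⊗ D (m ℕ.+ j) j) (Ẽ m)
  HasSum-Ẽ m = HasSum-ℕ λ N i N≤i → Q-vanish _ 0<s (ℕ.≤-trans N≤i (ℕ.≤-trans (ℕ.m≤n+m i 2) (ℕ.m≤m+n _ _)))

  D-cong : ∀ {i i′} j → i ≡ i′ → D i j ≐ D i′ j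
  D-cong j refl = ≐-refl

  first-term : ∀ i → Q 0 ⊗ D i 0 ≐ 𝟙
  first-term i = ≐-trans (⊗-cong Q-0 (D-0 i)) (Ring.*-identityˡ 𝟙)

  tail-sum : ∀ {f : ℕ → Series} {t} → HasSum f t → f 0 ≐ 𝟙 → (∀ N i → N ≤ i → f (suc (2 ℕ.+ i)) ≈[ N ] 𝟘) → HasSum (f ∘ suc) (t ⊖ 𝟙)
  tail-sum {f} {t} h f0 small = HasSum-cong (λ _ → ≐-refl)
    (combine ((𝟙 · HasSum-unique (HasSum-suc sumtail) h) ∷ (⊝ 𝟙 · f0) ∷ [])
      (solve 3 (λ a b t → a :- (t :- con 1ℤ) := con 1ℤ :* (b :+ a :- t) :+ ((:- con 1ℤ) :* (b :- con 1ℤ) :+ con 0ℤ)) ≐-refl (sumℕ (f ∘ suc)) (f 0) t))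
    sumtail
    where
    sumtail : HasSum (f ∘ suc) (sumℕ (f ∘ suc))
    sumtail = HasSum-ℕ small

  tail-E : ∀ m → HasSum (λ j → Q (suc j) ⊗ D (m ℕ.+ suc j) (suc j)) (E m ⊖ 𝟙)
  tail-E m = tail-sum (HasSum-E m) (first-term (m ℕ.+ 0)) λ N i N≤i → Q-vanish _ 0<s (ℕ.≤-trans N≤i (ℕ.m≤n+m i 3))

  tail-Ẽ : ∀ m → HasSum (λ j → Q (suc j ℕ.+ suc j) ⊗ D (m ℕ.+ suc j) (suc j)) (Ẽ m ⊖ 𝟙)
  tail-Ẽ m = tail-sum (HasSum-Ẽ m) (first-term (m ℕ.+ 0)) λ N i N≤i → Q-vanish _ 0<s (ℕ.≤-trans N≤i (ℕ.≤-trans (ℕ.m≤n+m i 3) (ℕ.m≤m+n _ _)))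

  _⊕ₛ_ : ∀ {f g : ℕ → Series} {s t} → HasSum f s → HasSum g t → HasSum (λ i → f i ⊕ g i) (s ⊕ t)
  _⊕ₛ_ = HasSum-⊕ ℕ._≟_

  Q-merge : ∀ {a b c d} f → a ℕ.+ b ≡ c ℕ.+ d → Q a ⊗ (Q b ⊗ f) ≐ Q c ⊗ (Q d ⊗ f)
  Q-merge {a} {b} {c} {d} f e = ≐-trans (≐-sym (Ring.*-assoc (Q a) (Q b) f))
    (≐-trans (⊗-cong (≐-trans (≐-sym (Q-+ a b)) (≐-trans (Q-cong e) (Q-+ c d))) ≐-refl) (Ring.*-assoc (Q c) (Q d) f))

  -- The recurrence of D in its first index, summed along a diagonal; `E-stepʳ` comes from the
  -- recurrence in the second index.
  E-step : ∀ m → E (suc m) ≐ E m ⊕ (Q (3 ℕ.+ m) ⊗ Ẽ (2 ℕ.+ m) ⊕ Q (2 ℕ.+ m) ⊗ Ẽ (suc m))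
  E-step m = combine ((𝟙 · HasSum-unique (tail-E (suc m)) (HasSum-cong term ≐-refl
      (tail-E m ⊕ₛ (HasSum-⊗ (Q (3 ℕ.+ m)) (HasSum-Ẽ (2 ℕ.+ m)) ⊕ₛ HasSum-⊗ (Q (2 ℕ.+ m)) (HasSum-Ẽ (suc m)))))) ∷ [])
    (solve 3 (λ a b c → a :- (b :+ c) := con 1ℤ :* (a :- con 1ℤ :- (b :- con 1ℤ :+ c)) :+ con 0ℤ) ≐-refl (E (suc m)) (E m) (Q (3 ℕ.+ m) ⊗ Ẽ (2 ℕ.+ m) ⊕ Q (2 ℕ.+ m) ⊗ Ẽ (suc m)))
    where
    expand : ∀ a b c d → a ⊗ (b ⊕ (c ⊕ d)) ≐ a ⊗ b ⊕ (a ⊗ c ⊕ a ⊗ d)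
    expand = solve 4 (λ a b c d → a :* (b :+ (c :+ d)) := a :* b :+ (a :* c :+ a :* d)) ≐-refl
    exponent₁ : ∀ m j → suc j ℕ.+ suc (m ℕ.+ suc j) ≡ 3 ℕ.+ m ℕ.+ (j ℕ.+ j)
    exponent₁ = ℕ-Ring.solve-∀
    exponent₂ : ∀ m j → suc j ℕ.+ (m ℕ.+ suc j) ≡ 2 ℕ.+ m ℕ.+ (j ℕ.+ j)
    exponent₂ = ℕ-Ring.solve-∀
    term : ∀ j → Q (suc j) ⊗ D (m ℕ.+ suc j) (suc j) ⊕ (Q (3 ℕ.+ m) ⊗ (Q (j ℕ.+ j) ⊗ D (2 ℕ.+ m ℕ.+ j) j) ⊕ Q (2 ℕ.+ m) ⊗ (Q (j ℕ.+ j) ⊗ D (suc m ℕ.+ j) j))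
             ≐ Q (suc j) ⊗ D (suc m ℕ.+ suc j) (suc j)
    term j = ≐-sym (≐-trans (expand (Q (suc j)) _ _ _) (⊕-cong ≐-refl (⊕-cong
      (≐-trans (Q-merge _ (exponent₁ m j)) (⊗-cong ≐-refl (⊗-cong ≐-refl (D-cong j (cong suc (ℕ.+-suc m j))))))
      (≐-trans (Q-merge _ (exponent₂ m j)) (⊗-cong ≐-refl (⊗-cong ≐-refl (D-cong j (ℕ.+-suc m j))))))))

  E-stepʳ : ∀ m → E (suc m) ≐ x ⊗ E (2 ℕ.+ m) ⊕ (Ẽ m ⊕ x ⊗ Ẽ (suc m))
  E-stepʳ m = combine ((𝟙 · HasSum-unique (tail-E (suc m)) (HasSum-cong term ≐-refl
      (HasSum-⊗ x (HasSum-E (2 ℕ.+ m)) ⊕ₛ (tail-Ẽ m ⊕ₛ HasSum-⊗ x (HasSum-Ẽ (suc m)))))) ∷ [])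
    (solve 4 (λ a b c d → a :- (b :+ (c :+ d)) := con 1ℤ :* (a :- con 1ℤ :- (b :+ (c :- con 1ℤ :+ d))) :+ con 0ℤ) ≐-refl
      (E (suc m)) (x ⊗ E (2 ℕ.+ m)) (Ẽ m) (x ⊗ Ẽ (suc m)))
    where
    expand : ∀ a b c d → a ⊗ (b ⊕ (c ⊕ d)) ≐ a ⊗ b ⊕ (a ⊗ c ⊕ a ⊗ d)
    expand = solve 4 (λ a b c d → a :* (b :+ (c :+ d)) := a :* b :+ (a :* c :+ a :* d)) ≐-refl
    term : ∀ j → x ⊗ (Q j ⊗ D (2 ℕ.+ m ℕ.+ j) j) ⊕ (Q (suc j ℕ.+ suc j) ⊗ D (m ℕ.+ suc j) (suc j) ⊕ x ⊗ (Q (j ℕ.+ j) ⊗ D (suc m ℕ.+ j) j))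
             ≐ Q (suc j) ⊗ D (suc m ℕ.+ suc j) (suc j)
    term j = ≐-sym (≐-trans (⊗-cong ≐-refl (D-sucʳ (m ℕ.+ suc j) j)) (≐-trans (expand (Q (suc j)) _ _ _) (⊕-cong
      (≐-trans (⊗-cong (Q-suc j) (D-cong j (cong suc (ℕ.+-suc m j)))) (Ring.*-assoc x (Q j) _))
      (⊕-cong (≐-trans (≐-sym (Ring.*-assoc _ _ _)) (⊗-cong (≐-sym (Q-+ (suc j) (suc j))) ≐-refl))
              (≐-trans (⊗-cong ≐-refl (⊗-cong ≐-refl (D-cong j (ℕ.+-suc m j)))) (Q-merge {suc j} {j} {1} {j ℕ.+ j} _ refl))))))

  -- The main diagonal is adjacent to diagonals 1 and -1, which agree by symmetry up to a factor x.
  -- The 1 is the corner entry of the array.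
  E-zero : E 0 ≐ 𝟙 ⊕ x ⊗ E 1 ⊕ x ⊗ (Ẽ 0 ⊕ x ⊗ Ẽ 1)
  E-zero = combine ((𝟙 · HasSum-unique (tail-E 0) (HasSum-cong term ≐-refl
      (HasSum-⊗ x (HasSum-E 1) ⊕ₛ (HasSum-⊗ (Q 2) (HasSum-Ẽ 1) ⊕ₛ HasSum-⊗ x (HasSum-Ẽ 0))))) ∷ (Ẽ 1 · Q-suc 1) ∷ [])
    (solve 6 (λ a x b q c d → a :- (con 1ℤ :+ x :* b :+ x :* (c :+ x :* d))
       := con 1ℤ :* (a :- con 1ℤ :- (x :* b :+ (q :* d :+ x :* c))) :+ (d :* (q :- x :* x) :+ con 0ℤ)) ≐-refl (E 0) x (E 1) (Q 2) (Ẽ 0) (Ẽ 1))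
    where
    expand : ∀ a b c d → a ⊗ (b ⊕ (c ⊕ d)) ≐ a ⊗ b ⊕ (a ⊗ c ⊕ a ⊗ d)
    expand = solve 4 (λ a b c d → a :* (b :+ (c :+ d)) := a :* b :+ (a :* c :+ a :* d)) ≐-refl
    exponent₁ : ∀ j → suc j ℕ.+ suc j ≡ 2 ℕ.+ (j ℕ.+ j)
    exponent₁ = ℕ-Ring.solve-∀
    term : ∀ j → x ⊗ (Q j ⊗ D (suc j) j) ⊕ (Q 2 ⊗ (Q (j ℕ.+ j) ⊗ D (suc j) j) ⊕ x ⊗ (Q (j ℕ.+ j) ⊗ D j j)) ≐ Q (suc j) ⊗ D (suc j) (suc j)
    term j = ≐-sym (≐-trans (expand (Q (suc j)) _ _ _) (⊕-cong
      (≐-trans (⊗-cong (Q-suc j) (D-sym j (suc j))) (Ring.*-assoc x (Q j) _))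
      (⊕-cong (Q-merge {suc j} {suc j} {2} {j ℕ.+ j} _ (exponent₁ j)) (Q-merge {suc j} {j} {1} {j ℕ.+ j} _ refl))))

  C : Series
  C = E 0 ⊕ Q 2 ⊗ E 2

  -- `E-step` at m and `E-stepʳ` at m + 1 involve the same two values of `Ẽ`. Multiplying the latter
  -- by Q^(m+2) eliminates them, and what remains says that the left-hand side does not depend on m.
  E+E : ∀ m → E m ⊕ Q (2 ℕ.+ m) ⊗ E (2 ℕ.+ m) ≐ C
  E+E zero    = ≐-refl
  E+E (suc m) = ≐-trans (combine ((𝟙 · E-step m) ∷ (⊝ Q (2 ℕ.+ m) · E-stepʳ (suc m)) ∷ (E (3 ℕ.+ m) ⊕ Ẽ (2 ℕ.+ m) · Q-suc (2 ℕ.+ m)) ∷ [])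
    (solve 9 (λ e₀ e₁ e₂ e₃ d₁ d₂ p x p₁ → e₁ :+ p₁ :* e₃ :- (e₀ :+ p :* e₂)
       := con 1ℤ :* (e₁ :- (e₀ :+ (p₁ :* d₂ :+ p :* d₁))) :+ ((:- p) :* (e₂ :- (x :* e₃ :+ (d₁ :+ x :* d₂))) :+ ((e₃ :+ d₂) :* (p₁ :- x :* p) :+ con 0ℤ)))
      ≐-refl (E m) (E (suc m)) (E (2 ℕ.+ m)) (E (3 ℕ.+ m)) (Ẽ (suc m)) (Ẽ (2 ℕ.+ m)) (Q (2 ℕ.+ m)) x (Q (3 ℕ.+ m)))) (E+E m)

  -- The recurrence at m = -1, with E(-1) read as x E(1); the corner entry contributes the extra 1.
  C≐ : C ≐ 𝟙 ⊕ # (+ 2) ⊗ x ⊗ E 1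
  C≐ = combine ((𝟙 · E-zero) ∷ (⊝ x · E-stepʳ 0) ∷ (E 2 · Q-suc 1) ∷ [])
    (solve 7 (λ e₀ e₁ e₂ d₀ d₁ x q → e₀ :+ q :* e₂ :- (con 1ℤ :+ con (+ 2) :* x :* e₁)
       := con 1ℤ :* (e₀ :- (con 1ℤ :+ x :* e₁ :+ x :* (d₀ :+ x :* d₁))) :+ ((:- x) :* (e₁ :- (x :* e₂ :+ (d₀ :+ x :* d₁))) :+ (e₂ :* (q :- x :* x) :+ con 0ℤ)))
      ≐-refl (E 0) (E 1) (E 2) (Ẽ 0) (Ẽ 1) x (Q 2))

-- Infinite products

q^⊗-cong≈ : ∀ {N f g} m → f ≈[ N ] g → q^ m ⊗ f ≈[ m ℕ.+ N ] q^ m ⊗ g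
q^⊗-cong≈ {N} {f} {g} m (eq< p) = eq< λ n n<m+N → case n ℕ.<? m of λ
  { (yes n<m) → trans (q^-below m f n n<m) (sym (q^-below m g n n<m))
  ; (no  n≮m) → let n≡ = ℕ.m+[n∸m]≡n (ℕ.≮⇒≥ n≮m) in
      subst (λ k → (q^ m ⊗ f) k ≡ (q^ m ⊗ g) k) n≡
        (trans (q^-shift m f _) (trans (p (n ℕ.∸ m) (ℕ.+-cancelˡ-< m _ _ (subst (_< m ℕ.+ N) (sym n≡) n<m+N))) (sym (q^-shift m g _)))) }

HasSum-cong≈ : ∀ {I : Set} {N} {f g : I → Series} {s t} → HasSum f s → HasSum g t → (∀ i → f i ≈[ N ] g i) → s ≈[ N ] t
HasSum-cong≈ {N = N} {f} {g} hf hg f≈g = case HasSum.support hf N , HasSum.support hg N of λ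
  { ((L , c , p) , (M , d , r)) → ≈-trans (≈-sym p) (≈-trans (ΣL-cong≈ f≈g L)
      (≈-trans (ΣL-covers g (covers (Covers.unique c) (λ i → case Covers.outside c i of λ
        { (inj₁ m) → inj₁ m ; (inj₂ z) → inj₂ (≈-trans (≈-sym (f≈g i)) z) })) d) r)) }

triℕ-square : ∀ n → n ℕ.* n ≡ triℕ n ℕ.+ triℕ n ℕ.+ n
triℕ-square zero    = refl
triℕ-square (suc n) = trans (lemma₁ n) (trans (cong (λ k → k ℕ.+ (n ℕ.+ suc n)) (triℕ-square n)) (lemma₂ (triℕ n) n))
  where
  lemma₁ : ∀ n → suc n ℕ.* suc n ≡ n ℕ.* n ℕ.+ (n ℕ.+ suc n)
  lemma₁ = ℕ-Ring.solve-∀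
  lemma₂ : ∀ t n → t ℕ.+ t ℕ.+ n ℕ.+ (n ℕ.+ suc n) ≡ t ℕ.+ n ℕ.+ (t ℕ.+ n) ℕ.+ suc n
  lemma₂ = ℕ-Ring.solve-∀

expo-ℕ : ∀ a u b v → + a ℤ.* + u ℤ.+ + b ℤ.* + v ≡ + (a ℕ.* u ℕ.+ b ℕ.* v)
expo-ℕ a u b v = cong₂ ℤ._+_ (sym (ℤ.pos-* a u)) (sym (ℤ.pos-* b v))

module Products (s : ℕ) (0<s : 0 < s) where
  open Diagonals s 0<s public

  E≈C : ∀ m → E m ≈[ m ] C
  E≈C m = ≈-trans (≈-trans (≐⇒≈ (≐-sym (Ring.+-identityʳ (E m)))) (⊕-cong≈ ≈-refl (≈-sym (Q-vanish (E (2 ℕ.+ m)) 0<s (ℕ.m≤n+m m 2))))) (≐⇒≈ (E+E m))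

  -- A partial theta series that solves the recurrence of `E` with 1 in place of C.
  T : ℕ → Series
  T m = sumℕ (λ n → # (alternating n) ⊗ Q (n ℕ.* n ℕ.+ suc m ℕ.* n))

  private
    T-small : ∀ m k N i → N ≤ i → # (alternating (k ℕ.+ i)) ⊗ Q ((k ℕ.+ i) ℕ.* (k ℕ.+ i) ℕ.+ suc m ℕ.* (k ℕ.+ i)) ≈[ N ] 𝟘
    T-small m k N i N≤i = ≈-trans (≐⇒≈ (⊗-comm _ _)) (Q-vanish _ 0<s (ℕ.≤-trans N≤i (ℕ.≤-trans (ℕ.m≤n+m i k)
      (ℕ.≤-trans (ℕ.m≤m+n (k ℕ.+ i) (m ℕ.* (k ℕ.+ i))) (ℕ.m≤n+m _ ((k ℕ.+ i) ℕ.* (k ℕ.+ i)))))))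

  HasSum-T : ∀ m → HasSum (λ n → # (alternating n) ⊗ Q (n ℕ.* n ℕ.+ suc m ℕ.* n)) (T m)
  HasSum-T m = HasSum-ℕ (T-small m 2)

  T-step : ∀ m → T m ≐ 𝟙 ⊖ Q (2 ℕ.+ m) ⊗ T (2 ℕ.+ m)
  T-step m = ≐-trans (HasSum-unique (HasSum-T m) (HasSum-suc (HasSum-cong term (solve 2 (λ a b → (:- a) :* b := :- (a :* b)) ≐-refl (Q (2 ℕ.+ m)) (T (2 ℕ.+ m)))
      (HasSum-⊗ (⊝ Q (2 ℕ.+ m)) (HasSum-T (2 ℕ.+ m))))))
    (⊕-cong (≐-trans (⊗-cong ≐-refl (≐-trans (Q-cong (ℕ.*-zeroʳ m)) Q-0)) (Ring.*-identityʳ 𝟙)) ≐-refl)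
    where
    exponent : ∀ m n → suc n ℕ.* suc n ℕ.+ suc m ℕ.* suc n ≡ 2 ℕ.+ m ℕ.+ (n ℕ.* n ℕ.+ (3 ℕ.+ m) ℕ.* n)
    exponent = ℕ-Ring.solve-∀
    term : ∀ n → ⊝ Q (2 ℕ.+ m) ⊗ (# (alternating n) ⊗ Q (n ℕ.* n ℕ.+ (3 ℕ.+ m) ℕ.* n)) ≐ # (alternating (suc n)) ⊗ Q (suc n ℕ.* suc n ℕ.+ suc m ℕ.* suc n)
    term n = ≐-sym (≐-trans (⊗-cong (#-neg (alternating n)) (≐-trans (Q-cong (exponent m n)) (Q-+ (2 ℕ.+ m) _)))
      (solve 3 (λ c a b → (:- c) :* (a :* b) := (:- a) :* (c :* b)) ≐-refl (# (alternating n)) (Q (2 ℕ.+ m)) _))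

  -- The recurrence has only one solution: the difference X of two satisfies X(m) = -Q^(m+2) X(m+2),
  -- so it is divisible by every power of q.
  E≐CT : ∀ m → E m ≐ C ⊗ T m
  E≐CT m = difference⇒≐ (≈⇒≐ λ N → vanish N m)
    where
    X : ℕ → Series
    X m = E m ⊖ C ⊗ T m
    X-step : ∀ m → X m ≐ ⊝ (Q (2 ℕ.+ m) ⊗ X (2 ℕ.+ m))
    X-step m = combine ((𝟙 · E+E m) ∷ (⊝ C · T-step m) ∷ [])
      (solve 6 (λ e e₂ c t t₂ p → e :- c :* t :- (:- (p :* (e₂ :- c :* t₂))) := con 1ℤ :* (e :+ p :* e₂ :- c) :+ ((:- c) :* (t :- (con 1ℤ :- p :* t₂)) :+ con 0ℤ))
        ≐-refl (E m) (E (2 ℕ.+ m)) C (T m) (T (2 ℕ.+ m)) (Q (2 ℕ.+ m)))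
    vanish : ∀ N m → X m ≈[ N ] 𝟘
    vanish zero    m = eq< λ _ ()
    vanish (suc N) m = ≈-trans (≐⇒≈ (X-step m)) (≈-trans
      (⊝-cong≈ (≈-weaken (ℕ.+-monoˡ-≤ N (ℕ.≤-trans 0<s (ℕ.m≤m*n s (2 ℕ.+ m)))) (q^⊗-cong≈ (s ℕ.* (2 ℕ.+ m)) (vanish N (2 ℕ.+ m)))))
      (≐⇒≈ (solve 1 (λ a → :- (a :* con 0ℤ) := con 0ℤ) ≐-refl (Q (2 ℕ.+ m)))))

  φ≐ : ⟦ φ s ⟧ ≐ 𝟙 ⊖ # (+ 2) ⊗ x ⊗ T 1
  φ≐ = HasSum-unique (HasSum-θ (φ s) (0<s+s 0<s)) (HasSum-cong (λ _ → ≐-refl)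
      (≐-trans (⊕-cong (⊕-cong (≐-trans (⊗-cong ≐-refl (qz-cong (φ-expo (+ 0)))) zero-term) ≐-refl) ≐-refl)
        (solve 2 (λ x t → con 1ℤ :+ (:- x) :* t :+ (:- x) :* t := con 1ℤ :- con (+ 2) :* x :* t) ≐-refl x (T 1)))
      (HasSum-halves (HasSum-suc (HasSum-cong positive ≐-refl (HasSum-⊗ (⊝ x) (HasSum-T 1)))) (HasSum-cong negative ≐-refl (HasSum-⊗ (⊝ x) (HasSum-T 1)))))
    where
    φ-expo : ∀ i → expo (φ s) i ≡ + s ℤ.* (i ℤ.* i)
    φ-expo i = trans (expo≡ (φ s) i refl) (trans (lemma (+ s) (tri i) i) (cong (+ s ℤ.*_) (sym (square i))))
      where
      lemma : ∀ s t i → s ℤ.* t ℤ.+ s ℤ.* (t ℤ.+ i) ≡ s ℤ.* (t ℤ.+ t ℤ.+ i)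
      lemma = solve-∀
    zero-term : # 1ℤ ⊗ qz (+ s ℤ.* + 0) ≐ 𝟙
    zero-term = ≐-trans (⊗-cong ≐-refl (≐-trans (qz-cong (ℤ.*-zeroʳ (+ s))) q^0)) (Ring.*-identityʳ 𝟙)
    exponent : ∀ n → suc n ℕ.* suc n ≡ 1 ℕ.+ (n ℕ.* n ℕ.+ 2 ℕ.* n)
    exponent = ℕ-Ring.solve-∀
    term : ∀ n → ⊝ x ⊗ (# (alternating n) ⊗ Q (n ℕ.* n ℕ.+ 2 ℕ.* n)) ≐ # (ℤ.- alternating n) ⊗ qz (+ s ℤ.* + (suc n ℕ.* suc n))
    term n = ≐-sym (≐-trans (⊗-cong (#-neg (alternating n)) (≐-trans (qz-cong (sym (ℤ.pos-* s (suc n ℕ.* suc n)))) (≐-trans (Q-cong (exponent n)) (Q-+ 1 _))))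
      (solve 3 (λ c a b → (:- c) :* (a :* b) := (:- a) :* (c :* b)) ≐-refl (# (alternating n)) x _))
    positive : ∀ n → ⊝ x ⊗ (# (alternating n) ⊗ Q (n ℕ.* n ℕ.+ 2 ℕ.* n)) ≐ mono (sgn (+ suc n)) (expo (φ s) (+ suc n))
    positive n = ≐-trans (term n) (⊗-cong ≐-refl (qz-cong (sym (φ-expo (+ suc n)))))
    negative : ∀ n → ⊝ x ⊗ (# (alternating n) ⊗ Q (n ℕ.* n ℕ.+ 2 ℕ.* n)) ≐ mono (sgn -[1+ n ]) (expo (φ s) -[1+ n ])
    negative n = ≐-trans (term n) (⊗-cong ≐-refl (qz-cong (sym (φ-expo -[1+ n ]))))

  -- C = 1 + 2x C T(1), while 1 - 2x T(1) is φ.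
  φC≐𝟙 : ⟦ φ s ⟧ ⊗ C ≐ 𝟙
  φC≐𝟙 = combine ((C · φ≐) ∷ (𝟙 · C≐) ∷ (# (+ 2) ⊗ x · E≐CT 1) ∷ [])
    (solve 5 (λ f c x t e → f :* c :- con 1ℤ := c :* (f :- (con 1ℤ :- con (+ 2) :* x :* t)) :+ (con 1ℤ :* (c :- (con 1ℤ :+ con (+ 2) :* x :* e)) :+ (con (+ 2) :* x :* (e :- c :* t) :+ con 0ℤ)))
      ≐-refl ⟦ φ s ⟧ C x (T 1) (E 1))

  -- Row sums of the array and partial products

  P P⁺ : ℕ → Series
  P zero     = 𝟙
  P (suc n)  = P n ⊗ (𝟙 ⊖ Q (suc n))
  P⁺ zero    = 𝟙
  P⁺ (suc n) = P⁺ n ⊗ (𝟙 ⊕ Q (suc n))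

  row : ℕ → Series
  row N = sumℕ (λ j → Q j ⊗ D N j)

  HasSum-row : ∀ N → HasSum (λ j → Q j ⊗ D N j) (row N)
  HasSum-row N = HasSum-ℕ λ M i M≤i → Q-vanish _ 0<s (ℕ.≤-trans M≤i (ℕ.m≤n+m i 2))

  private
    tail-row : ∀ N → HasSum (λ j → Q (suc j) ⊗ D N (suc j)) (row N ⊖ 𝟙)
    tail-row N = tail-sum (HasSum-row N) (first-term N) λ M i M≤i → Q-vanish _ 0<s (ℕ.≤-trans M≤i (ℕ.m≤n+m i 3))

    row-zero : row 0 ⊖ 𝟙 ≐ x ⊗ row 0
    row-zero = HasSum-unique (tail-row 0) (HasSum-cong (λ j → ≐-trans (≐-sym (Ring.*-assoc x (Q j) 𝟙)) (⊗-cong (≐-sym (Q-suc j)) ≐-refl)) ≐-refl (HasSum-⊗ x (HasSum-row 0)))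

    row-suc : ∀ N → row (suc N) ⊖ 𝟙 ≐ (row N ⊖ 𝟙) ⊕ (Q (2 ℕ.+ N) ⊗ row (suc N) ⊕ Q (suc N) ⊗ row N)
    row-suc N = HasSum-unique (tail-row (suc N)) (HasSum-cong term ≐-refl
        (tail-row N ⊕ₛ (HasSum-⊗ (Q (2 ℕ.+ N)) (HasSum-row (suc N)) ⊕ₛ HasSum-⊗ (Q (suc N)) (HasSum-row N))))
      where
      exponent₁ : ∀ N j → suc j ℕ.+ suc N ≡ 2 ℕ.+ N ℕ.+ j
      exponent₁ = ℕ-Ring.solve-∀
      exponent₂ : ∀ N j → suc j ℕ.+ N ≡ suc N ℕ.+ j
      exponent₂ = ℕ-Ring.solve-∀
      term : ∀ j → Q (suc j) ⊗ D N (suc j) ⊕ (Q (2 ℕ.+ N) ⊗ (Q j ⊗ D (suc N) j) ⊕ Q (suc N) ⊗ (Q j ⊗ D N j)) ≐ Q (suc j) ⊗ D (suc N) (suc j)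
      term j = ≐-sym (≐-trans (solve 4 (λ a b c d → a :* (b :+ (c :+ d)) := a :* b :+ (a :* c :+ a :* d)) ≐-refl (Q (suc j)) _ _ _)
        (⊕-cong ≐-refl (⊕-cong (Q-merge _ (exponent₁ N j)) (Q-merge _ (exponent₂ N j)))))

  -- Row N sums to (-Q;Q)_N / (Q;Q)_(N+1), since the recurrence of D gives consecutive rows the
  -- ratio (1 + Q^(N+1)) / (1 - Q^(N+2)).
  P-row : ∀ N → P (suc N) ⊗ row N ≐ P⁺ N
  P-row zero    = combine ((𝟙 · row-zero) ∷ [])
    (solve 2 (λ x r → con 1ℤ :* (con 1ℤ :- x) :* r :- con 1ℤ := con 1ℤ :* (r :- con 1ℤ :- x :* r) :+ con 0ℤ) ≐-refl x (row 0))
  P-row (suc N) = combine ((P (suc N) · row-suc N) ∷ (𝟙 ⊕ Q (suc N) · P-row N) ∷ [])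
    (solve 6 (λ p p⁺ r r₁ y y₂ → p :* (con 1ℤ :- y₂) :* r₁ :- p⁺ :* (con 1ℤ :+ y)
        := p :* (r₁ :- con 1ℤ :- (r :- con 1ℤ :+ (y₂ :* r₁ :+ y :* r))) :+ ((con 1ℤ :+ y) :* (p :* r :- p⁺) :+ con 0ℤ))
      ≐-refl (P (suc N)) (P⁺ N) (row N) (row (suc N)) (Q (suc N)) (Q (2 ℕ.+ N)))

  -- Passing from D(i, j) to D(i+1, j) adds only multiples of Q^i, so diagonal N and row N agree
  -- below q^N, and diagonals tend to C.
  C≈row : ∀ N → C ≈[ N ] row N
  C≈row N = ≈-trans (≈-sym (E≈C N)) (HasSum-cong≈ (HasSum-E N) (HasSum-row N) λ j → ⊗-cong≈ ≈-refl
      (≈-trans (≐⇒≈ (D-cong j (ℕ.+-comm N j))) (stable N j j)))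
    where
    D-step : ∀ i j → D (suc i) j ≈[ i ] D i j
    D-step i zero    = ≐⇒≈ (≐-sym (D-0 i))
    D-step i (suc j) = ≈-trans (⊕-cong≈ ≈-refl (⊕-cong≈ (Q-vanish (D (suc i) j) 0<s (ℕ.n≤1+n i)) (Q-vanish (D i j) 0<s ℕ.≤-refl)))
      (≐⇒≈ (solve 1 (λ a → a :+ (con 0ℤ :+ con 0ℤ) := a) ≐-refl (D i (suc j))))
    stable : ∀ i j k → D (k ℕ.+ i) j ≈[ i ] D i j
    stable i j zero    = ≈-refl
    stable i j (suc k) = ≈-trans (≈-weaken (ℕ.m≤n+m i k) (D-step (k ℕ.+ i) j)) (stable i j k)

  -- Shanks' finite form of Euler's pentagonal number theorem

  Pᵣ : ℕ → ℕ → Series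
  Pᵣ r zero    = 𝟙
  Pᵣ r (suc d) = Pᵣ r d ⊗ (𝟙 ⊖ Q (suc (r ℕ.+ d)))

  -- The term of index r in the sum for n = r + d. Taking d as the parameter avoids truncated
  -- subtraction of n - r; accordingly `shanks r d` is the partial sum up to r for n = r + d.
  summand : ℕ → ℕ → Series
  summand r d = # (alternating r) ⊗ (Pᵣ r d ⊗ Q ((r ℕ.+ d) ℕ.* r ℕ.+ triℕ (suc r)))

  shanks : ℕ → ℕ → Series
  shanks zero    d = summand 0 d
  shanks (suc r) d = shanks r (suc d) ⊕ summand (suc r) d

  private
    Pᵣ-suc : ∀ r d → Pᵣ r (suc d) ≐ (𝟙 ⊖ Q (suc r)) ⊗ Pᵣ (suc r) d
    Pᵣ-suc r zero    = ≐-trans (⊗-comm _ _) (⊗-cong (⊕-cong ≐-refl (⊝-cong (Q-cong (cong suc (ℕ.+-identityʳ r))))) ≐-refl)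
    Pᵣ-suc r (suc d) = ≐-trans (⊗-cong (Pᵣ-suc r d) (⊕-cong ≐-refl (⊝-cong (Q-cong (cong suc (ℕ.+-suc r d)))))) (Ring.*-assoc _ _ _)

    Pᵣ₀ : ∀ n → Pᵣ 0 n ≐ P n
    Pᵣ₀ zero    = ≐-refl
    Pᵣ₀ (suc n) = ⊗-cong (Pᵣ₀ n) ≐-refl

    summand-sucᵈ : ∀ r d → summand r (suc d) ≐ (𝟙 ⊖ Q (suc (r ℕ.+ d))) ⊗ Q r ⊗ summand r d
    summand-sucᵈ r d = ≐-trans (⊗-cong ≐-refl (⊗-cong ≐-refl (≐-trans (Q-cong (exponent r d (triℕ (suc r)))) (Q-+ r _))))
      (solve 5 (λ c p y q z → c :* (p :* (con 1ℤ :- y) :* (q :* z)) := (con 1ℤ :- y) :* q :* (c :* (p :* z))) ≐-refl (# (alternating r)) (Pᵣ r d) (Q (suc (r ℕ.+ d))) (Q r) _)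
      where
      exponent : ∀ r d t → (r ℕ.+ suc d) ℕ.* r ℕ.+ t ≡ r ℕ.+ ((r ℕ.+ d) ℕ.* r ℕ.+ t)
      exponent = ℕ-Ring.solve-∀

    summand-sucʳ : ∀ r d → (𝟙 ⊖ Q (suc r)) ⊗ summand (suc r) d ≐ ⊝ (Q (suc (r ℕ.+ suc d) ℕ.+ r) ⊗ summand r (suc d))
    summand-sucʳ r d = combine
      ((y ⊗ # (alternating r) ⊗ z · Pᵣ-suc r d) ∷ ((𝟙 ⊖ Q (suc r)) ⊗ # (ℤ.- alternating r) ⊗ p₁ · z₁≐) ∷ ((𝟙 ⊖ Q (suc r)) ⊗ p₁ ⊗ (y ⊗ z) · #-neg (alternating r)) ∷ [])
      (solve 8 (λ c c⁻ u p p₁ y z z₁ → (con 1ℤ :- u) :* (c⁻ :* (p₁ :* z₁)) :- (:- (y :* (c :* (p :* z))))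
          := y :* c :* z :* (p :- (con 1ℤ :- u) :* p₁) :+ ((con 1ℤ :- u) :* c⁻ :* p₁ :* (z₁ :- y :* z) :+ ((con 1ℤ :- u) :* p₁ :* (y :* z) :* (c⁻ :- (:- c)) :+ con 0ℤ)))
        ≐-refl (# (alternating r)) (# (ℤ.- alternating r)) (Q (suc r)) (Pᵣ r (suc d)) p₁ y z z₁)
      where
      y z z₁ p₁ : Series
      y  = Q (suc (r ℕ.+ suc d) ℕ.+ r)
      z  = Q ((r ℕ.+ suc d) ℕ.* r ℕ.+ triℕ (suc r))
      z₁ = Q ((suc r ℕ.+ d) ℕ.* suc r ℕ.+ triℕ (suc (suc r)))
      p₁ = Pᵣ (suc r) d
      exponent : ∀ r d t → (suc r ℕ.+ d) ℕ.* suc r ℕ.+ (t ℕ.+ suc r) ≡ suc (r ℕ.+ suc d) ℕ.+ r ℕ.+ ((r ℕ.+ suc d) ℕ.* r ℕ.+ t)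
      exponent = ℕ-Ring.solve-∀
      z₁≐ : z₁ ≐ y ⊗ z
      z₁≐ = ≐-trans (Q-cong (exponent r d (triℕ (suc r)))) (Q-+ _ _)

    -- Raising n by one changes a partial sum by a single term, because the changes of its summands
    -- telescope.
    shanks-step : ∀ r d → shanks r (suc d) ⊖ shanks r d ≐ ⊝ (Q (suc (r ℕ.+ d) ℕ.+ r) ⊗ summand r d)
    shanks-step zero d = combine ((𝟙 · summand-sucᵈ 0 d) ∷ ((𝟙 ⊖ Q (suc d)) ⊗ summand 0 d · Q-0) ∷ (summand 0 d · Q-cong (ℕ.+-identityʳ (suc d))) ∷ [])
      (solve 5 (λ f f₁ y y₀ q → f₁ :- f :- (:- (y₀ :* f)) := con 1ℤ :* (f₁ :- (con 1ℤ :- y) :* q :* f) :+ ((con 1ℤ :- y) :* f :* (q :- con 1ℤ) :+ (f :* (y₀ :- y) :+ con 0ℤ)))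
        ≐-refl (summand 0 d) (summand 0 (suc d)) (Q (suc d)) (Q (suc d ℕ.+ 0)) (Q 0))
    shanks-step (suc r) d = combine
      ((𝟙 · shanks-step r (suc d)) ∷ (⊝ 𝟙 · summand-sucʳ r d) ∷ (𝟙 · summand-sucᵈ (suc r) d) ∷ (summand (suc r) d · Q-+ (suc (suc r ℕ.+ d)) (suc r)) ∷ [])
      (solve 9 (λ a b f f₁ g y u v w → a :+ f₁ :- (b :+ f) :- (:- (w :* f))
          := con 1ℤ :* (a :- b :- (:- (y :* g))) :+ ((:- con 1ℤ) :* ((con 1ℤ :- u) :* f :- (:- (y :* g)))
             :+ (con 1ℤ :* (f₁ :- (con 1ℤ :- v) :* u :* f) :+ (f :* (w :- v :* u) :+ con 0ℤ))))
        ≐-refl (shanks r (suc (suc d))) (shanks r (suc d)) (summand (suc r) d) (summand (suc r) (suc d)) (summand r (suc d))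
          (Q (suc (r ℕ.+ suc d) ℕ.+ r)) (Q (suc r)) (Q (suc (suc r ℕ.+ d))) (Q (suc (suc r ℕ.+ d) ℕ.+ suc r)))

    -- Every summand but the one of index 0 is divisible by Q^n, n = r + d, and that one is `P n`.
    shanks≈P : ∀ r d → shanks r d ≈[ r ℕ.+ d ] P (r ℕ.+ d)
    shanks≈P zero d = ≐⇒≈ (≐-trans (⊗-cong ≐-refl (⊗-cong (Pᵣ₀ d) (≐-trans (Q-cong (trans (ℕ.+-identityʳ (d ℕ.* 0)) (ℕ.*-zeroʳ d))) Q-0)))
      (solve 1 (λ p → con 1ℤ :* (p :* con 1ℤ) := p) ≐-refl (P d)))
    shanks≈P (suc r) d = ≈-trans (⊕-cong≈ (subst (λ k → shanks r (suc d) ≈[ k ] P k) (ℕ.+-suc r d) (shanks≈P r (suc d)))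
        (≈-trans (≐⇒≈ (solve 3 (λ c p y → c :* (p :* y) := y :* (c :* p)) ≐-refl (# (ℤ.- alternating r)) (Pᵣ (suc r) d) _))
          (Q-vanish _ 0<s (ℕ.≤-trans (ℕ.m≤m*n (suc r ℕ.+ d) (suc r)) (ℕ.m≤m+n _ _)))))
      (≐⇒≈ (Ring.+-identityʳ _))

    P-stable : ∀ n k → P n ≈[ n ] P (k ℕ.+ n)
    P-stable n zero    = ≈-refl
    P-stable n (suc k) = ≈-trans (P-stable n k) (≈-trans (≐⇒≈ (solve 1 (λ p → p := p :* (con 1ℤ :- con 0ℤ)) ≐-refl (P (k ℕ.+ n))))
      (⊗-cong≈ ≈-refl (⊕-cong≈ ≈-refl (⊝-cong≈ (≈-sym (≈-trans (≐⇒≈ (≐-sym (Ring.*-identityʳ _))) (Q-vanish 𝟙 0<s (ℕ.m≤n⇒m≤1+n (ℕ.m≤n+m n k)))))))))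

    S : ℕ → Series
    S n = shanks n 0

    P∞ : Series
    P∞ n = P (suc n) n

    P≈P∞ : ∀ N k → N ≤ k → P k ≈[ N ] P∞
    P≈P∞ N k N≤k = eq< λ n n<N → sym (subst (λ m → P (suc n) n ≡ P m n) (ℕ.m∸n+n≡m (ℕ.≤-trans n<N N≤k)) (below (P-stable (suc n) (k ℕ.∸ suc n)) n ℕ.≤-refl))

    S≈P∞ : ∀ N k → N ≤ k → S k ≈[ N ] P∞
    S≈P∞ N k N≤k = ≈-trans (≈-weaken (ℕ.≤-trans N≤k (ℕ.≤-reflexive (sym (ℕ.+-identityʳ k)))) (shanks≈P k 0))
      (P≈P∞ N (k ℕ.+ 0) (ℕ.≤-trans N≤k (ℕ.≤-reflexive (sym (ℕ.+-identityʳ k)))))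

    pentagonal-term : ℤ → Series
    pentagonal-term i = mono (sgn i) (expo (ε s) i)

    -- The last summand for n + 1 gives the pentagonal exponent at -(n+1), and `shanks-step` for the
    -- earlier ones gives the exponent at n + 1.
    S-step : ∀ n → S (suc n) ⊖ S n ≐ pentagonal-term (+ suc n) ⊕ pentagonal-term -[1+ n ]
    S-step n = begin
      shanks n 1 ⊕ summand (suc n) 0 ⊖ shanks n 0
        ≈⟨ combine ((𝟙 · shanks-step n 0) ∷ []) (solve 4 (λ a b c d → a :+ b :- c :- (b :- d) := con 1ℤ :* (a :- c :- (:- d)) :+ con 0ℤ) ≐-refl
             (shanks n 1) (summand (suc n) 0) (shanks n 0) (Q (suc (n ℕ.+ 0) ℕ.+ n) ⊗ summand n 0)) ⟩
      # (ℤ.- alternating n) ⊗ (𝟙 ⊗ Q u) ⊖ Q v ⊗ (# (alternating n) ⊗ (𝟙 ⊗ Q w))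
        ≈⟨ solve 5 (λ c⁻ c a b d → c⁻ :* (con 1ℤ :* a) :- b :* (c :* (con 1ℤ :* d)) := c⁻ :* a :+ (:- c) :* (b :* d)) ≐-refl _ _ (Q u) (Q v) (Q w) ⟩
      # (ℤ.- alternating n) ⊗ Q u ⊕ ⊝ # (alternating n) ⊗ (Q v ⊗ Q w)
        ≈⟨ ⊕-cong (⊗-cong ≐-refl (≐-trans (eq λ k → cong (λ e → q^ e k) (exponent₁ s n)) (qz-cong (sym (expo-ℕ (s ℕ.+ s) (triℕ (2 ℕ.+ n)) s (triℕ (suc n)))))))
             (⊗-cong (≐-sym (#-neg (alternating n))) (≐-trans (≐-sym (Q-+ v w)) (≐-trans (eq λ k → cong (λ e → q^ e k) (exponent₂ s n)) (qz-cong (sym (expo-ℕ (s ℕ.+ s) (triℕ (suc n)) s (triℕ (2 ℕ.+ n)))))))) ⟩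
      pentagonal-term -[1+ n ] ⊕ pentagonal-term (+ suc n)
        ≈⟨ Ring.+-comm _ _ ⟩
      pentagonal-term (+ suc n) ⊕ pentagonal-term -[1+ n ] ∎
      where
      open ≐-Reasoning
      u v w : ℕ
      u = (suc n ℕ.+ 0) ℕ.* suc n ℕ.+ triℕ (2 ℕ.+ n)
      v = suc (n ℕ.+ 0) ℕ.+ n
      w = (n ℕ.+ 0) ℕ.* n ℕ.+ triℕ (suc n)
      square₁ : ∀ n t → t ℕ.+ t ℕ.+ suc n ≡ suc n ℕ.* suc n → (suc n ℕ.+ 0) ℕ.* suc n ℕ.+ (t ℕ.+ suc n) ≡ t ℕ.+ t ℕ.+ suc n ℕ.+ (t ℕ.+ suc n)
      square₁ n t e = trans (lemma n t) (cong (ℕ._+ (t ℕ.+ suc n)) (sym e))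
        where
        lemma : ∀ n t → (suc n ℕ.+ 0) ℕ.* suc n ℕ.+ (t ℕ.+ suc n) ≡ suc n ℕ.* suc n ℕ.+ (t ℕ.+ suc n)
        lemma = ℕ-Ring.solve-∀
      square₂ : ∀ n t → t ℕ.+ t ℕ.+ suc n ≡ suc n ℕ.* suc n → suc (n ℕ.+ 0) ℕ.+ n ℕ.+ ((n ℕ.+ 0) ℕ.* n ℕ.+ t) ≡ t ℕ.+ t ℕ.+ suc n ℕ.+ t
      square₂ n t e = trans (lemma n t) (cong (ℕ._+ t) (sym e))
        where
        lemma : ∀ n t → suc (n ℕ.+ 0) ℕ.+ n ℕ.+ ((n ℕ.+ 0) ℕ.* n ℕ.+ t) ≡ suc n ℕ.* suc n ℕ.+ t
        lemma = ℕ-Ring.solve-∀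
      exponent₁ : ∀ s n → s ℕ.* ((suc n ℕ.+ 0) ℕ.* suc n ℕ.+ triℕ (2 ℕ.+ n)) ≡ (s ℕ.+ s) ℕ.* triℕ (2 ℕ.+ n) ℕ.+ s ℕ.* triℕ (suc n)
      exponent₁ s n = trans (cong (s ℕ.*_) (square₁ n (triℕ (suc n)) (sym (triℕ-square (suc n))))) (lemma s (triℕ (suc n)) (suc n))
        where
        lemma : ∀ s t m → s ℕ.* (t ℕ.+ t ℕ.+ m ℕ.+ (t ℕ.+ m)) ≡ (s ℕ.+ s) ℕ.* (t ℕ.+ m) ℕ.+ s ℕ.* t
        lemma = ℕ-Ring.solve-∀
      exponent₂ : ∀ s n → s ℕ.* (suc (n ℕ.+ 0) ℕ.+ n ℕ.+ ((n ℕ.+ 0) ℕ.* n ℕ.+ triℕ (suc n))) ≡ (s ℕ.+ s) ℕ.* triℕ (suc n) ℕ.+ s ℕ.* triℕ (2 ℕ.+ n)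
      exponent₂ s n = trans (cong (s ℕ.*_) (square₂ n (triℕ (suc n)) (sym (triℕ-square (suc n))))) (lemma s (triℕ (suc n)) (suc n))
        where
        lemma : ∀ s t m → s ℕ.* (t ℕ.+ t ℕ.+ m ℕ.+ t) ≡ (s ℕ.+ s) ℕ.* t ℕ.+ s ℕ.* (t ℕ.+ m)
        lemma = ℕ-Ring.solve-∀

  ε≐P∞ : ⟦ ε s ⟧ ≐ P∞
  ε≐P∞ = combine ((𝟙 · HasSum-unique (HasSum-θ (ε s) (0<s+s (0<s+s 0<s))) (HasSum-halves (HasSum-suc sum⁺) sum⁻))
      ∷ (𝟙 · HasSum-unique (sum⁺ ⊕ₛ sum⁻) (HasSum-cong S-step ≐-refl (HasSum-telescope S≈P∞))) ∷ (𝟙 · zero-term) ∷ (⊝ 𝟙 · S₀) ∷ [])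
    (solve 6 (λ e t a b j s₀ → e :- j := con 1ℤ :* (e :- (t :+ a :+ b)) :+ (con 1ℤ :* (a :+ b :- (j :- s₀)) :+ (con 1ℤ :* (t :- con 1ℤ) :+ ((:- con 1ℤ) :* (s₀ :- con 1ℤ) :+ con 0ℤ))))
      ≐-refl ⟦ ε s ⟧ (pentagonal-term (+ 0)) A B P∞ (S 0))
    where
    A B : Series
    A = sumℕ (λ n → pentagonal-term (+ suc n))
    B = sumℕ (λ n → pentagonal-term -[1+ n ])
    sum⁺ : HasSum (λ n → pentagonal-term (+ suc n)) A
    sum⁺ = HasSum-ℕ λ N n N≤n → θ-small⁺ (ε s) (0<s+s (0<s+s 0<s)) N (suc n) (ℕ.m≤n⇒m≤1+n N≤n)
    sum⁻ : HasSum (λ n → pentagonal-term -[1+ n ]) B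
    sum⁻ = HasSum-ℕ (θ-small⁻ (ε s) (0<s+s (0<s+s 0<s)))
    zero-term : pentagonal-term (+ 0) ≐ 𝟙
    zero-term = ≐-trans (⊗-cong ≐-refl (≐-trans (qz-cong (expo-ℕ (s ℕ.+ s) 0 s 0)) (≐-trans (eq λ k → cong (λ e → q^ e k) (cong₂ ℕ._+_ (ℕ.*-zeroʳ (s ℕ.+ s)) (ℕ.*-zeroʳ s))) q^0))) (Ring.*-identityʳ 𝟙)
    S₀ : S 0 ≐ 𝟙
    S₀ = ≐-trans (⊗-cong ≐-refl (⊗-cong ≐-refl Q-0)) (solve 0 (con 1ℤ :* (con 1ℤ :* con 1ℤ) := con 1ℤ) ≐-refl)

  ε≈P : ∀ N → ⟦ ε s ⟧ ≈[ N ] P N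
  ε≈P N = ≈-trans (≐⇒≈ ε≐P∞) (≈-sym (P≈P∞ N N ℕ.≤-refl))

-- Cancellation of series with constant term 1

head-tail : ∀ f → f ≐ # (f 0) ⊕ q^ 1 ⊗ tail f
head-tail f = eq λ
  { zero    → sym (trans (⊕-coeff (# (f 0)) (q^ 1 ⊗ tail f) 0) (trans (cong₂ ℤ._+_ (#-coeff₀ (f 0)) (q^-below 1 (tail f) 0 (s≤s z≤n))) (ℤ.+-identityʳ (f 0))))
  ; (suc n) → sym (trans (⊕-coeff (# (f 0)) (q^ 1 ⊗ tail f) (suc n)) (trans (cong₂ ℤ._+_ (#-coeff₊ (f 0) n) (q^-shift 1 (tail f) n)) (ℤ.+-identityˡ (f (suc n))))) }

-- With f = 1 + q f′ the difference d satisfies d = -q f′ d, so each comparison of coefficients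
-- gains one order.
cancel : ∀ f {g h} → f 0 ≡ 1ℤ → f ⊗ g ≐ f ⊗ h → g ≐ h
cancel f {g} {h} f₀ e = difference⇒≐ (≈⇒≐ vanish)
  where
  d : Series
  d = g ⊖ h
  d≐ : d ≐ ⊝ (q^ 1 ⊗ (tail f ⊗ d))
  d≐ = combine ((𝟙 · e) ∷ (⊝ d · f≐) ∷ [])
    (solve 5 (λ f g h x y → g :- h :- (:- (x :* (y :* (g :- h)))) := con 1ℤ :* (f :* g :- f :* h) :+ ((:- (g :- h)) :* (f :- (con 1ℤ :+ x :* y)) :+ con 0ℤ)) ≐-refl f g h (q^ 1) (tail f))
    where
    f≐ : f ≐ 𝟙 ⊕ q^ 1 ⊗ tail f
    f≐ = subst (λ c → f ≐ # c ⊕ q^ 1 ⊗ tail f) f₀ (head-tail f)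
  vanish : ∀ N → d ≈[ N ] 𝟘
  vanish zero    = eq< λ _ ()
  vanish (suc N) = ≈-trans (≐⇒≈ d≐) (≈-trans (⊝-cong≈ (q^⊗-cong≈ 1 (⊗-cong≈ ≈-refl (vanish N))))
    (≐⇒≈ (solve 2 (λ x y → :- (x :* (y :* con 0ℤ)) := con 0ℤ) ≐-refl (q^ 1) (tail f))))

cancel-# : ∀ c {f g} → .{{ℤ.NonZero c}} → # c ⊗ f ≐ # c ⊗ g → f ≐ g
cancel-# c {f} {g} e = eq λ n → ℤ.*-cancelˡ-≡ c (f n) (g n) (trans (sym (#-scale c f n)) (trans (at e n) (#-scale c g n)))

⊗-constant : ∀ f g → f 0 ≡ 1ℤ → g 0 ≡ 1ℤ → (f ⊗ g) 0 ≡ 1ℤ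
⊗-constant f g f₀ g₀ = trans (⊗-coeff₀ f g) (cong₂ ℤ._*_ f₀ g₀)

q-perturbation : ∀ k f → 0 < k → (𝟙 ⊖ q^ k ⊗ f) 0 ≡ 1ℤ
q-perturbation k f 0<k = trans (⊕-coeff 𝟙 (⊝ (q^ k ⊗ f)) 0) (cong₂ ℤ._+_ (#-coeff₀ 1ℤ) (trans (⊝-coeff (q^ k ⊗ f) 0) (cong ℤ.-_ (q^-below k f 0 0<k))))

module _ (s : ℕ) (0<s : 0 < s) where
  open Products s 0<s
  private
    module Squared = Products (s ℕ.+ s) (0<s+s 0<s)

    0<s* : ∀ k → 0 < s ℕ.* suc k
    0<s* k = ℕ.≤-trans 0<s (ℕ.m≤m*n s (suc k))

    P-constant : ∀ n → P n 0 ≡ 1ℤ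
    P-constant zero    = #-coeff₀ 1ℤ
    P-constant (suc n) = ⊗-constant (P n) _ (P-constant n)
      (trans (at (⊕-cong ≐-refl (⊝-cong (≐-sym (Ring.*-identityʳ (Q (suc n)))))) 0) (q-perturbation (s ℕ.* suc n) 𝟙 (0<s* n)))

    P-squared : ∀ n → Squared.P n ≐ P n ⊗ P⁺ n
    P-squared zero    = ≐-sym (Ring.*-identityˡ 𝟙)
    P-squared (suc n) = ≐-trans (⊗-cong (P-squared n) (⊕-cong ≐-refl (⊝-cong
        (≐-trans (eq λ k → cong (λ e → q^ e k) (ℕ.*-distribʳ-+ (suc n) s s)) (q^-+ (s ℕ.* suc n) (s ℕ.* suc n))))))
      (solve 3 (λ p r y → p :* r :* (con 1ℤ :- y :* y) := p :* (con 1ℤ :- y) :* (r :* (con 1ℤ :+ y))) ≐-refl (P n) (P⁺ n) (Q (suc n)))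

  ε-constant : ⟦ ε s ⟧ 0 ≡ 1ℤ
  ε-constant = trans (below (ε≈P 1) 0 (s≤s z≤n)) (P-constant 1)

  φ-constant : ⟦ φ s ⟧ 0 ≡ 1ℤ
  φ-constant = trans (at (≐-trans φ≐ (solve 2 (λ x t → con 1ℤ :- con (+ 2) :* x :* t := con 1ℤ :- x :* (con (+ 2) :* t)) ≐-refl x (T 1))) 0) (q-perturbation (s ℕ.* 1) _ (0<s* 0))

  -- Gauss's product for φ. It is the inverse of C, and below q^N the series C is `P⁺ N` divided by
  -- `P (suc N)`, while `P N ⊗ P⁺ N` is the partial product in base Q².
  φε : ⟦ φ s ⟧ ⊗ ⟦ ε (s ℕ.+ s) ⟧ ≐ ⟦ ε s ⟧ ⊗ ⟦ ε s ⟧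
  φε = ≈⇒≐ λ N → let open ≈-Reasoning N in begin
    ⟦ φ s ⟧ ⊗ ⟦ ε (s ℕ.+ s) ⟧        ≈⟨ ⊗-cong≈ ≈-refl (≈-trans (Squared.ε≈P N) (≐⇒≈ (P-squared N))) ⟩
    ⟦ φ s ⟧ ⊗ (P N ⊗ P⁺ N)           ≈⟨ ⊗-cong≈ ≈-refl (⊗-cong≈ ≈-refl (≐⇒≈ (P-row N))) ⟨
    ⟦ φ s ⟧ ⊗ (P N ⊗ (P (suc N) ⊗ row N)) ≈⟨ ⊗-cong≈ ≈-refl (⊗-cong≈ ≈-refl (⊗-cong≈ ≈-refl (C≈row N))) ⟨
    ⟦ φ s ⟧ ⊗ (P N ⊗ (P (suc N) ⊗ C)) ≈⟨ ≐⇒≈ (combine ((P N ⊗ P (suc N) · φC≐𝟙) ∷ []) (solve 4 (λ f p p₁ c → f :* (p :* (p₁ :* c)) :- p :* p₁ := p :* p₁ :* (f :* c :- con 1ℤ) :+ con 0ℤ) ≐-refl ⟦ φ s ⟧ (P N) (P (suc N)) C)) ⟩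
    P N ⊗ P (suc N)                  ≈⟨ ⊗-cong≈ (ε≈P N) (≈-weaken (ℕ.n≤1+n N) (ε≈P (suc N))) ⟨
    ⟦ ε s ⟧ ⊗ ⟦ ε s ⟧                ∎

  ε≈𝟙 : ⟦ ε s ⟧ ≈[ s ] 𝟙
  ε≈𝟙 = ≈-trans (ε≈P s) (P≈𝟙 s)
    where
    P≈𝟙 : ∀ n → P n ≈[ s ] 𝟙
    P≈𝟙 zero    = ≈-refl
    P≈𝟙 (suc n) = ≈-trans (⊗-cong≈ (P≈𝟙 n) (⊕-cong≈ ≈-refl (⊝-cong≈
        (≈-trans (≐⇒≈ (≐-sym (Ring.*-identityʳ (Q (suc n))))) (q^⊗-vanish 𝟙 (ℕ.m≤m*n s (suc n)))))))
      (≐⇒≈ (solve 0 (con 1ℤ :* (con 1ℤ :- con 0ℤ) := con 1ℤ) ≐-refl))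

  κ≈𝟙 : ⟦ κ s ⟧ ≈[ s ] 𝟙
  κ≈𝟙 = ≈-trans (≐⇒≈ (HasSum-unique (HasSum-θ (κ s) (0<s+s 0<s)) (HasSum-halves (HasSum-suc (HasSum-suc sum⁺)) sum⁻)))
    (≈-trans (⊕-cong≈ (⊕-cong≈ (≐⇒≈ term₀) (⊕-cong≈ (≐⇒≈ term₁) (HasSum-cong≈ sum⁺ HasSum-𝟘 small⁺))) (HasSum-cong≈ sum⁻ HasSum-𝟘 small⁻))
      (≐⇒≈ (solve 0 (con 0ℤ :+ (con 1ℤ :+ con 0ℤ) :+ con 0ℤ := con 1ℤ) ≐-refl)))
    where
    term : ℤ → Series
    term i = mono (κ-coef i) (expo (κ s) i)
    sum⁺ : HasSum (λ n → term (+ (2 ℕ.+ n))) (sumℕ (λ n → term (+ (2 ℕ.+ n))))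
    sum⁺ = HasSum-ℕ λ N n N≤n → θ-small⁺ (κ s) (0<s+s 0<s) N (2 ℕ.+ n) (ℕ.m≤n⇒m≤1+n (ℕ.m≤n⇒m≤1+n N≤n))
    sum⁻ : HasSum (λ n → term -[1+ n ]) (sumℕ (λ n → term -[1+ n ]))
    sum⁻ = HasSum-ℕ (θ-small⁻ (κ s) (0<s+s 0<s))
    HasSum-𝟘 : HasSum {ℕ} (λ _ → 𝟘) 𝟘
    HasSum-𝟘 = HasSum-cong (λ _ → Ring.zeroˡ _) (Ring.zeroˡ _) (HasSum-⊗ 𝟘 sum⁻)
    expo₀ : ∀ t → + s ℤ.* + t ℤ.+ 0ℤ ≡ + (s ℕ.* t)
    expo₀ t = trans (ℤ.+-identityʳ _) (sym (ℤ.pos-* s t))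
    term₀ : term (+ 0) ≐ 𝟘
    term₀ = Ring.zeroˡ _
    term₁ : term (+ 1) ≐ 𝟙
    term₁ = ≐-trans (⊗-cong ≐-refl (≐-trans (qz-cong (trans (expo₀ 0) (cong +_ (ℕ.*-zeroʳ s)))) q^0)) (Ring.*-identityʳ 𝟙)
    s≤ : ∀ t → 0 < t → + s ℤ.≤ + s ℤ.* + t ℤ.+ 0ℤ
    s≤ t 0<t = subst (+ s ℤ.≤_) (sym (expo₀ t)) (ℤ.+≤+ (ℕ.m≤m*n s t {{ℕ.>-nonZero 0<t}}))
    small⁺ : ∀ n → term (+ (2 ℕ.+ n)) ≈[ s ] 𝟘
    small⁺ n = mono-vanish _ _ (s≤ (triℕ (2 ℕ.+ n)) (ℕ.≤-trans (s≤s z≤n) (ℕ.m≤n+m (suc n) (triℕ (suc n)))))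
    small⁻ : ∀ n → term -[1+ n ] ≈[ s ] 𝟘
    small⁻ n = mono-vanish _ _ (s≤ (triℕ (2 ℕ.+ n)) (ℕ.≤-trans (s≤s z≤n) (ℕ.m≤n+m (suc n) (triℕ (suc n)))))

cube : Series → Series
cube f = f ⊗ f ⊗ f

cube-constant : ∀ f → f 0 ≡ 1ℤ → cube f 0 ≡ 1ℤ
cube-constant f f₀ = ⊗-constant (f ⊗ f) f (⊗-constant f f f₀ f₀) f₀

-- Jacobi's identity κ = ε³: the quotient κ/ε³ is invariant under q ↦ q².
module _ where
  private
    -- From κΨ = 2κ₂φ and Ψφ = 2εε₂ follows κεε₂ = κ₂φ², and φ = ε²/ε₂ removes φ; the index 2
    -- denotes base q².
    double-step : ∀ s → 0 < s → ⟦ κ s ⟧ ⊗ cube ⟦ ε (s ℕ.+ s) ⟧ ≐ ⟦ κ (s ℕ.+ s) ⟧ ⊗ cube ⟦ ε s ⟧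
    double-step s 0<s = cancel-# (+ 2) (cancel e (ε-constant s 0<s) (combine
      ((e₂ ⊗ e₂ ⊗ k · ≐-sym (Ψφ s 0<s)) ∷ (e₂ ⊗ e₂ ⊗ f · κΨ s 0<s) ∷ (# (+ 2) ⊗ k₂ ⊗ (f ⊗ e₂ ⊕ e ⊗ e) · φε s 0<s) ∷ [])
      (solve 6 (λ e e₂ k k₂ f p → e :* (con (+ 2) :* (k :* (e₂ :* e₂ :* e₂))) :- e :* (con (+ 2) :* (k₂ :* (e :* e :* e)))
        := e₂ :* e₂ :* k :* (con (+ 2) :* (e :* e₂) :- p :* f) :+ (e₂ :* e₂ :* f :* (k :* p :- con (+ 2) :* (k₂ :* f))
           :+ (con (+ 2) :* k₂ :* (f :* e₂ :+ e :* e) :* (f :* e₂ :- e :* e) :+ con 0ℤ))) ≐-refl e e₂ k k₂ f p)))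
      where
      e e₂ k k₂ f p : Series
      e  = ⟦ ε s ⟧
      e₂ = ⟦ ε (s ℕ.+ s) ⟧
      k  = ⟦ κ s ⟧
      k₂ = ⟦ κ (s ℕ.+ s) ⟧
      f  = ⟦ φ s ⟧
      p  = ⟦ Ψ s ⟧

    doubled : ℕ → ℕ → ℕ
    doubled zero    s = s
    doubled (suc k) s = doubled k (s ℕ.+ s)

    doubled-large : ∀ k s → 0 < s → k ℕ.+ s ≤ doubled k s
    doubled-large zero    s 0<s = ℕ.≤-refl
    doubled-large (suc k) s 0<s = ℕ.≤-trans (ℕ.≤-trans (ℕ.≤-reflexive (sym (ℕ.+-suc k s))) (ℕ.+-monoʳ-≤ k (ℕ.+-monoˡ-≤ s 0<s))) (doubled-large k (s ℕ.+ s) (0<s+s 0<s))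

    iterate : ∀ k s → 0 < s → ⟦ κ s ⟧ ⊗ cube ⟦ ε (doubled k s) ⟧ ≐ ⟦ κ (doubled k s) ⟧ ⊗ cube ⟦ ε s ⟧
    iterate zero    s 0<s = ≐-refl
    iterate (suc k) s 0<s = cancel c₂ (cube-constant _ (ε-constant (s ℕ.+ s) (0<s+s 0<s)))
      (combine ((c∞ · double-step s 0<s) ∷ (cube ⟦ ε s ⟧ · iterate k (s ℕ.+ s) (0<s+s 0<s)) ∷ [])
        (solve 6 (λ k k₂ k∞ c c₂ c∞ → c₂ :* (k :* c∞) :- c₂ :* (k∞ :* c) := c∞ :* (k :* c₂ :- k₂ :* c) :+ (c :* (k₂ :* c∞ :- k∞ :* c₂) :+ con 0ℤ))
          ≐-refl ⟦ κ s ⟧ ⟦ κ (s ℕ.+ s) ⟧ ⟦ κ (doubled k (s ℕ.+ s)) ⟧ (cube ⟦ ε s ⟧) c₂ c∞))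
      where
      c₂ c∞ : Series
      c₂ = cube ⟦ ε (s ℕ.+ s) ⟧
      c∞ = cube ⟦ ε (doubled k (s ℕ.+ s)) ⟧

  -- N doublings carry the base beyond q^N, where both series are 1 to the required precision, so
  -- the invariant quotient is 1.
  jacobi : ∀ s → 0 < s → ⟦ κ s ⟧ ≐ cube ⟦ ε s ⟧
  jacobi s 0<s = ≈⇒≐ λ N → let
      t   = doubled N s
      N≤t = ℕ.≤-trans (ℕ.m≤m+n N s) (doubled-large N s 0<s)
      0<t = ℕ.≤-trans 0<s (ℕ.≤-trans (ℕ.m≤n+m s N) (doubled-large N s 0<s))
      ε≈  = ≈-weaken N≤t (ε≈𝟙 t 0<t)
      open ≈-Reasoning N
    in begin
    ⟦ κ s ⟧                       ≈⟨ ≐⇒≈ (solve 1 (λ k → k := k :* (con 1ℤ :* con 1ℤ :* con 1ℤ)) ≐-refl ⟦ κ s ⟧) ⟩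
    ⟦ κ s ⟧ ⊗ cube 𝟙              ≈⟨ ⊗-cong≈ ≈-refl (⊗-cong≈ (⊗-cong≈ ε≈ ε≈) ε≈) ⟨
    ⟦ κ s ⟧ ⊗ cube ⟦ ε t ⟧        ≈⟨ ≐⇒≈ (iterate N s 0<s) ⟩
    ⟦ κ t ⟧ ⊗ cube ⟦ ε s ⟧        ≈⟨ ⊗-cong≈ (≈-weaken N≤t (κ≈𝟙 t 0<t)) ≈-refl ⟩
    𝟙 ⊗ cube ⟦ ε s ⟧              ≈⟨ ≐⇒≈ (Ring.*-identityˡ _) ⟩
    cube ⟦ ε s ⟧                  ∎

-- φ(q) Ψ(q)² = 4 ∏(1-q^(2n))³
φΨΨ : ∀ s → 0 < s → ⟦ φ s ⟧ ⊗ (⟦ Ψ s ⟧ ⊗ ⟦ Ψ s ⟧) ≐ # (+ 4) ⊗ ⟦ κ (s ℕ.+ s) ⟧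
φΨΨ s 0<s = cancel f (φ-constant s 0<s) (combine
  ((p ⊗ f ⊕ # (+ 2) ⊗ e ⊗ e₂ · Ψφ s 0<s) ∷ (⊝ (# (+ 4) ⊗ e₂ ⊗ e₂) · φε s 0<s) ∷ (⊝ (# (+ 4) ⊗ f) · jacobi (s ℕ.+ s) (0<s+s 0<s)) ∷ [])
  (solve 5 (λ f p e e₂ k₂ → f :* (f :* (p :* p)) :- f :* (con (+ 4) :* k₂)
      := (p :* f :+ con (+ 2) :* e :* e₂) :* (p :* f :- con (+ 2) :* (e :* e₂)) :+ ((:- (con (+ 4) :* e₂ :* e₂)) :* (f :* e₂ :- e :* e)
         :+ ((:- (con (+ 4) :* f)) :* (k₂ :- e₂ :* e₂ :* e₂) :+ con 0ℤ))) ≐-refl f p e e₂ k₂))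
  where
  f p e e₂ k₂ : Series
  f  = ⟦ φ s ⟧
  p  = ⟦ Ψ s ⟧
  e  = ⟦ ε s ⟧
  e₂ = ⟦ ε (s ℕ.+ s) ⟧
  k₂ = ⟦ κ (s ℕ.+ s) ⟧

σ-constant : ⟦ σ ⟧ 0 ≡ 1ℤ
σ-constant = begin
  ⟦ σ ⟧ 0                        ≡⟨ ℤ.*-identityˡ (⟦ σ ⟧ 0) ⟨
  1ℤ ℤ.* ⟦ σ ⟧ 0                 ≡⟨ cong (ℤ._* ⟦ σ ⟧ 0) (ε-constant 3 (s≤s z≤n)) ⟨
  ⟦ ε 3 ⟧ 0 ℤ.* ⟦ σ ⟧ 0          ≡⟨ ⊗-coeff₀ ⟦ ε 3 ⟧ ⟦ σ ⟧ ⟨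
  (⟦ ε 3 ⟧ ⊗ ⟦ σ ⟧) 0            ≡⟨ at εσ 0 ⟩
  (⟦ ε 6 ⟧ ⊗ ⟦ φ 9 ⟧) 0          ≡⟨ ⊗-constant _ _ (ε-constant 6 (s≤s z≤n)) (φ-constant 9 (s≤s z≤n)) ⟩
  1ℤ                             ∎
  where open ≡-Reasoning

τ : Series
τ = q^ 1 ⊗ ⟦ Ψ 9 ⟧

σ-τ-constant : (⟦ σ ⟧ ⊖ τ) 0 ≡ 1ℤ
σ-τ-constant = trans (⊕-coeff ⟦ σ ⟧ (⊝ τ) 0) (cong₂ ℤ._+_ σ-constant (trans (⊝-coeff τ 0) (cong ℤ.-_ (q^-below 1 ⟦ Ψ 9 ⟧ 0 (s≤s z≤n)))))

-- The right-hand side times σ - τ is σ³ - τ³, which the quartic relation identifies as ε(q³)⁴ / σ,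
-- because τ³ = q³ Ψ(q⁹)³. The left-hand side times σ - τ is ε(q⁶) S̃ / φ(q⁹) by the two hypotheses,
-- and `κφ`, `jacobi`, `εσ` and `φε` turn that into the same quotient.
theta-quotient : ∀ M → ⟦ σ ⟧ ⊗ (M ⊗ ⟦ φ 1 ⟧) ≐ ⟦ S̃ 3 ⟧ → ⟦ σ ⟧ ⊗ ⟦ φ 1 ⟧ ≐ (⟦ σ ⟧ ⊖ τ) ⊗ ⟦ φ 9 ⟧ →
                 M ⊗ ⟦ ε 6 ⟧ ≐ ⟦ σ ⟧ ⊗ ⟦ σ ⟧ ⊕ ⟦ σ ⟧ ⊗ τ ⊕ τ ⊗ τ
theta-quotient M h₁ h₂ = cancel s σ-constant (cancel (s ⊖ τ) σ-τ-constant (cancel e₃ (ε-constant 3 (s≤s z≤n)) (combine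
    ((⊝ (e₆ ⊗ M ⊗ (s ⊖ τ)) · ≐-sym εσ) ∷ (⊝ (e₆ ⊗ e₆ ⊗ M) · h₂) ∷ (e₆ ⊗ e₆ · h₁) ∷ (⊝ e₆ · κφ 3 (s≤s z≤n)) ∷ (e₆ ⊗ f₃ · jacobi 3 (s≤s z≤n))
      ∷ (cube e₃ · φε 3 (s≤s z≤n)) ∷ (⊝ e₃ · quartic) ∷ (e₃ ⊗ s ⊗ (y ⊗ y ⊗ y) · x³) ∷ [])
    (solve 12 (λ s y e₃ e₆ M f f₉ f₃ k S x z →
        e₃ :* ((s :- x :* y) :* (s :* (M :* e₆))) :- e₃ :* ((s :- x :* y) :* (s :* (s :* s :+ s :* (x :* y) :+ x :* y :* (x :* y))))
        := (:- (e₆ :* M :* (s :- x :* y))) :* (e₆ :* f₉ :- e₃ :* s)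
        :+ ((:- (e₆ :* e₆ :* M)) :* (s :* f :- (s :- x :* y) :* f₉)
        :+ (e₆ :* e₆ :* (s :* (M :* f) :- S)
        :+ ((:- e₆) :* (k :* f₃ :- e₆ :* S)
        :+ (e₆ :* f₃ :* (k :- e₃ :* e₃ :* e₃)
        :+ (e₃ :* e₃ :* e₃ :* (f₃ :* e₆ :- e₃ :* e₃)
        :+ ((:- e₃) :* (s :* s :* (s :* s) :- (e₃ :* e₃ :* (e₃ :* e₃) :+ z :* (y :* s :* (y :* y))))
        :+ (e₃ :* s :* (y :* y :* y) :* (x :* x :* x :- z) :+ con 0ℤ))))))))
      ≐-refl s y e₃ e₆ M f f₉ f₃ k S (q^ 1) (q^ 3)))))
  where
  s y e₃ e₆ f f₉ f₃ k S : Series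
  s  = ⟦ σ ⟧
  y  = ⟦ Ψ 9 ⟧
  e₃ = ⟦ ε 3 ⟧
  e₆ = ⟦ ε 6 ⟧
  f  = ⟦ φ 1 ⟧
  f₉ = ⟦ φ 9 ⟧
  f₃ = ⟦ φ 3 ⟧
  k  = ⟦ κ 3 ⟧
  S  = ⟦ S̃ 3 ⟧
  x³ : q^ 1 ⊗ q^ 1 ⊗ q^ 1 ≐ q^ 3
  x³ = ≐-trans (⊗-cong (≐-sym (q^-+ 1 1)) ≐-refl) (≐-sym (q^-+ 2 1))

-- Convolution with ∑ (-1)ⁱ q^(b i(i-1)/2) xⁱ, which vanishes at x = 1 and has derivative -κ there

ℤ²-shear : (ℤ × ℤ) ≅ (ℤ × ℤ)
ℤ²-shear = bij (λ (k , i) → i , k ℤ.- i) (λ (i , l) → i ℤ.+ l , i)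
  (λ (k , i) → cong (_, i) (lemma₁ k i)) (λ (i , l) → cong (i ,_) (lemma₂ i l))
  where
  lemma₁ : ∀ k i → i ℤ.+ (k ℤ.- i) ≡ k
  lemma₁ = solve-∀
  lemma₂ : ∀ i l → i ℤ.+ l ℤ.- i ≡ l
  lemma₂ = solve-∀

HasSum-⊝ : ∀ {I : Set} {f : I → Series} {s} → HasSum f s → HasSum (λ i → ⊝ f i) (⊝ s)
HasSum-⊝ h = HasSum-cong (λ _ → neg _) (neg _) (HasSum-⊗ (# (ℤ.- 1ℤ)) h)
  where
  neg : ∀ f → # (ℤ.- 1ℤ) ⊗ f ≐ ⊝ f
  neg = solve 1 (λ f → con (ℤ.- 1ℤ) :* f := :- f) ≐-refl

_⊖ᶻ_ : ∀ {f g : ℤ → Series} {s t} → HasSum f s → HasSum g t → HasSum (λ i → f i ⊖ g i) (s ⊖ t)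
h ⊖ᶻ k = HasSum-⊕ ℤ._≟_ h (HasSum-⊝ k)

HasSum-telescopeℤ : ∀ {a : ℤ → Series} {ℓ} → (∀ N k → N ≤ k → a (+ k) ≈[ N ] ℓ) → (∀ N k → N ≤ k → a -[1+ k ] ≈[ N ] 𝟘) →
                    HasSum (λ k → a k ⊖ a (k ℤ.- 1ℤ)) ℓ
HasSum-telescopeℤ {a} {ℓ} up down = HasSum-cong (λ _ → ≐-refl)
    (solve 3 (λ x y l → x :- y :+ (l :- x) :+ :- (con 0ℤ :- y) := l) ≐-refl (a (+ 0)) (a -[1+ 0 ]) ℓ)
    (HasSum-halves (HasSum-suc (HasSum-telescope {f = λ k → a (+ k)} up))
      (HasSum-cong (λ k → ≐-trans (solve 2 (λ x y → :- (y :- x) := x :- y) ≐-refl (a -[1+ k ]) (a -[1+ suc k ]))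
                        (⊕-cong ≐-refl (⊝-cong (eq λ n → cong (λ i → a i n) (cong -[1+_] (cong suc (sym (ℕ.+-identityʳ k))))))))
        ≐-refl (HasSum-⊝ (HasSum-telescope {f = λ k → a -[1+ k ]} down))))

-- Summation by parts: the derivative of (1 - x) N(x) at x = 1 is -N(1).
HasSum-weighted-difference : ∀ {N : ℤ → Series} {s t} → HasSum N s → HasSum (λ k → # k ⊗ N k) t → HasSum (λ k → # k ⊗ (N k ⊖ N (k ℤ.- 1ℤ))) (⊝ s)
HasSum-weighted-difference {N} {s} {t} h hw = HasSum-cong
    (λ k → ≐-trans (⊕-cong ≐-refl (⊝-cong (⊗-cong (≐-trans (≐-sym (#-+ (k ℤ.- 1ℤ) 1ℤ)) (eq λ n → cong (λ c → # c n) (lemma k))) ≐-refl)))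
                   (solve 3 (λ c x y → c :* x :- c :* y := c :* (x :- y)) ≐-refl (# k) (N k) (N (k ℤ.- 1ℤ))))
    (solve 2 (λ s t → t :- (t :+ s) := :- s) ≐-refl s t)
    (hw ⊖ᶻ HasSum-reindex (ℤ-shift (ℤ.- 1ℤ)) (HasSum-cong (λ k → solve 2 (λ c x → c :* x :+ x := (c :+ con 1ℤ) :* x) ≐-refl (# k) (N k)) ≐-refl (HasSum-⊕ ℤ._≟_ hw h)))
  where
  lemma : ∀ k → k ℤ.- 1ℤ ℤ.+ 1ℤ ≡ k
  lemma = solve-∀

module Convolution (b : ℕ) (0<b : 0 < b) where
  private
    O : Theta
    O = theta sgn b 0
    nz : 0 < b ℕ.+ 0
    nz = 0<s+s 0<b

  j : ℤ → Series
  j i = mono (sgn i) (expo O i)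

  HasSum-j : HasSum j 𝟘
  HasSum-j = HasSum-cong (λ _ → ≐-refl) (θ-odd b 0<b) (HasSum-θ O nz)

  HasSum-weighted-j : HasSum (λ i → # i ⊗ j i) (⊝ ⟦ κ b ⟧)
  HasSum-weighted-j = HasSum-cong (λ i → ≐-trans (mono-⊝ (κ-coef i) (expo O i)) (≐-trans (mono-coef (expo O i) (lemma i (sgn i))) (≐-trans (⊗-cong (#-* i (sgn i)) ≐-refl) (Ring.*-assoc _ _ _))))
      ≐-refl (HasSum-⊝ (HasSum-θ (κ b) nz))
    where
    lemma : ∀ i a → ℤ.- (ℤ.- i ℤ.* a) ≡ i ℤ.* a
    lemma = solve-∀

  HasSum-convolution : ∀ (f : ℤ → Series) → HasSum (λ i → j i ⊗ f i) (sumℤ (λ i → j i ⊗ f i))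
  HasSum-convolution f = HasSum-ℤ
    (λ N n N≤n → ≈-trans (⊗-cong≈ (θ-small⁺ O nz N n N≤n) ≈-refl) (≐⇒≈ (Ring.zeroˡ _)))
    (λ N n N≤n → ≈-trans (⊗-cong≈ (θ-small⁻ O nz N n N≤n) ≈-refl) (≐⇒≈ (Ring.zeroˡ _)))

  -- The product rule at x = 1 for m(x) = j(x) c(x). As j(1) = 0 and j′(1) = -κ, only -κ c(1)
  -- remains. Coefficientwise, the weight k is split as i + (k - i).
  weighted-convolution : ∀ {c m : ℤ → Series} {w w′} → HasSum c w → HasSum (λ k → # k ⊗ c k) w′ →
    (∀ k → HasSum (λ i → j i ⊗ c (k ℤ.- i)) (m k)) → HasSum (λ k → # k ⊗ m k) (⊝ (⟦ κ b ⟧ ⊗ w))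
  weighted-convolution {c} {m} {w} {w′} hc hwc conv = HasSum-cong (λ _ → ≐-refl)
    (solve 3 (λ k w w′ → (:- k) :* w :+ con 0ℤ :* w′ := :- (k :* w)) ≐-refl ⟦ κ b ⟧ w w′)
    (HasSum-Σ ℤ._≟_ (HasSum-reindex ℤ²-shear (HasSum-⊕ _≟ℤ²_ (HasSum-× HasSum-weighted-j hc) (HasSum-× HasSum-j hwc)))
      λ k → HasSum-cong (λ i → term k i) ≐-refl (HasSum-⊗ (# k) (conv k)))
    where
    lemma : ∀ k i → k ≡ i ℤ.+ (k ℤ.- i)
    lemma = solve-∀
    term : ∀ k i → # k ⊗ (j i ⊗ c (k ℤ.- i)) ≐ # i ⊗ j i ⊗ c (k ℤ.- i) ⊕ j i ⊗ (# (k ℤ.- i) ⊗ c (k ℤ.- i))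
    term k i = ≐-trans (⊗-cong (≐-trans (eq λ n → cong (λ c → # c n) (lemma k i)) (#-+ i (k ℤ.- i))) ≐-refl)
      (solve 4 (λ a b x y → (a :+ b) :* (x :* y) := a :* x :* y :+ x :* (b :* y)) ≐-refl (# i) (# (k ℤ.- i)) (j i) (c (k ℤ.- i)))

  -- The sequence a need not be summable, but its differences are, with sum ℓ. So the product rule
  -- is applied to (1 - x) a(x), and j(x)(1 - x) a(x) = (1 - x) N(x) has derivative -κℓ on the left
  -- and -N(1) on the right.
  convolution-limit : ∀ {a N : ℤ → Series} {ℓ s t} → (∀ N k → N ≤ k → a (+ k) ≈[ N ] ℓ) → (∀ N k → N ≤ k → a -[1+ k ] ≈[ N ] 𝟘) →
    (∀ k → HasSum (λ i → j i ⊗ a (k ℤ.- i)) (N k)) → HasSum N s → HasSum (λ k → # k ⊗ N k) t → ⟦ κ b ⟧ ⊗ ℓ ≐ s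
  convolution-limit {a} {N} {ℓ} {s} up down conv hN hwN = combine
    ((⊝ 𝟙 · HasSum-unique (weighted-convolution (HasSum-telescopeℤ up down) weighted conv′) (HasSum-weighted-difference hN hwN)) ∷ [])
    (solve 3 (λ k l s → k :* l :- s := (:- con 1ℤ) :* (:- (k :* l) :- (:- s)) :+ con 0ℤ) ≐-refl ⟦ κ b ⟧ ℓ s)
    where
    small : ∀ c {M f} → f ≈[ M ] 𝟘 → # c ⊗ f ≈[ M ] 𝟘
    small c z = ≈-trans (⊗-cong≈ ≈-refl z) (≐⇒≈ (Ring.zeroʳ (# c)))
    cancel-self : ∀ f → f ⊖ f ≐ 𝟘
    cancel-self = solve 1 (λ f → f :- f := con 0ℤ) ≐-refl
    weighted : HasSum (λ k → # k ⊗ (a k ⊖ a (k ℤ.- 1ℤ))) (sumℤ (λ k → # k ⊗ (a k ⊖ a (k ℤ.- 1ℤ))))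
    weighted = HasSum-ℤ
      (λ M n M≤n → small (+ (2 ℕ.+ n)) (≈-trans (⊕-cong≈ (up M _ (ℕ.m≤n⇒m≤1+n (ℕ.m≤n⇒m≤1+n M≤n))) (⊝-cong≈ (up M _ (ℕ.m≤n⇒m≤1+n M≤n)))) (≐⇒≈ (cancel-self ℓ))))
      (λ M n M≤n → small -[1+ 2 ℕ.+ n ] (≈-trans (⊕-cong≈ (down M _ (ℕ.m≤n⇒m≤1+n (ℕ.m≤n⇒m≤1+n M≤n))) (⊝-cong≈ (down M _ (ℕ.≤-trans M≤n (ℕ.≤-trans (ℕ.m≤n+m n 3) (ℕ.≤-reflexive (cong suc (sym (ℕ.+-identityʳ (2 ℕ.+ n))))))))))
                                                                  (≐⇒≈ (cancel-self 𝟘))))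
    shift-lemma : ∀ k i → k ℤ.- 1ℤ ℤ.- i ≡ k ℤ.- i ℤ.- 1ℤ
    shift-lemma = solve-∀
    conv′ : ∀ k → HasSum (λ i → j i ⊗ (a (k ℤ.- i) ⊖ a (k ℤ.- i ℤ.- 1ℤ))) (N k ⊖ N (k ℤ.- 1ℤ))
    conv′ k = HasSum-cong (λ i → ≐-trans (⊕-cong ≐-refl (⊝-cong (⊗-cong ≐-refl (eq λ n → cong (λ l → a l n) (shift-lemma k i)))))
        (solve 3 (λ j x y → j :* x :- j :* y := j :* (x :- y)) ≐-refl (j i) (a (k ℤ.- i)) (a (k ℤ.- i ℤ.- 1ℤ)))) ≐-refl
      (conv k ⊖ᶻ conv (k ℤ.- 1ℤ))

-- The sequence v(3k) = E(3k) + q^(3k+2) E₉(k), v(3k+1) = E(3k+1) - q^(6k+8) E₉(k+1), v(3k+2) = E(3k+2) - E₉(k)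

module One  = Products 1 (s≤s z≤n)
module Nine = Products 9 (s≤s z≤n)

E₁ E₉ : ℕ → Series
E₁ = One.E
E₉ = Nine.E

C₁ C₉ : Series
C₁ = One.C
C₉ = Nine.C

q^-cong : ∀ {m n} → m ≡ n → q^ m ≐ q^ n
q^-cong refl = ≐-refl

E₁-step : ∀ m → E₁ m ⊕ q^ (2 ℕ.+ m) ⊗ E₁ (2 ℕ.+ m) ≐ C₁
E₁-step m = ≐-trans (⊕-cong ≐-refl (⊗-cong (q^-cong (sym (ℕ.*-identityˡ (2 ℕ.+ m)))) ≐-refl)) (One.E+E m)

v₀ v₁ v₂ : ℕ → Series
v₀ k = E₁ (k ℕ.* 3) ⊕ q^ (2 ℕ.+ k ℕ.* 3) ⊗ E₉ k
v₁ k = E₁ (1 ℕ.+ k ℕ.* 3) ⊖ q^ (8 ℕ.+ (k ℕ.* 3 ℕ.+ k ℕ.* 3)) ⊗ E₉ (suc k)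
v₂ k = E₁ (2 ℕ.+ k ℕ.* 3) ⊖ E₉ k

-- `vℕ k m` is the term of index 3k + m. The offset k makes the residue of the index visible to
-- pattern matching without any division.
vℕ : ℕ → ℕ → Series
vℕ k 0 = v₀ k
vℕ k 1 = v₁ k
vℕ k 2 = v₂ k
vℕ k (suc (suc (suc m))) = vℕ (suc k) m

limit : ℕ → Series
limit 0 = C₁
limit 1 = C₁
limit 2 = C₁ ⊖ C₉
limit (suc (suc (suc m))) = limit m

-- In the classes 0 and 1 the multiples of E₉ cancel, the exponents 3k+2 and 6k+8 being chosen for
-- this. In class 2 they combine to E₉(k) + q^(9k+18) E₉(k+2), which is C₉ by the recurrence in base
-- q⁹.
vℕ-step : ∀ k m → vℕ k m ⊕ q^ (2 ℕ.+ (k ℕ.* 3 ℕ.+ m)) ⊗ vℕ k (2 ℕ.+ m) ≐ limit m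
vℕ-step k 0 = combine ((𝟙 · E₁-step (k ℕ.* 3)) ∷ (v₂ k · q^-cong (cong (ℕ._+_ 2) (ℕ.+-identityʳ (k ℕ.* 3)))) ∷ [])
  (solve 6 (λ e e₂ f y y₀ c → e :+ y :* f :+ y₀ :* (e₂ :- f) :- c := con 1ℤ :* (e :+ y :* e₂ :- c) :+ ((e₂ :- f) :* (y₀ :- y) :+ con 0ℤ))
    ≐-refl (E₁ (k ℕ.* 3)) (E₁ (2 ℕ.+ k ℕ.* 3)) (E₉ k) (q^ (2 ℕ.+ k ℕ.* 3)) (q^ (2 ℕ.+ (k ℕ.* 3 ℕ.+ 0))) C₁)
vℕ-step k 1 = combine ((𝟙 · E₁-step (1 ℕ.+ k ℕ.* 3)) ∷ (v₀ (suc k) · q^-cong (exponent₁ k)) ∷ (⊝ E₉ (suc k) · ≐-trans (q^-cong (exponent₂ k)) (q^-+ (3 ℕ.+ k ℕ.* 3) (2 ℕ.+ suc k ℕ.* 3))) ∷ [])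
  (solve 8 (λ e e₂ f y y₁ z w c → e :- w :* f :+ y₁ :* (e₂ :+ z :* f) :- c
      := con 1ℤ :* (e :+ y :* e₂ :- c) :+ ((e₂ :+ z :* f) :* (y₁ :- y) :+ ((:- f) :* (w :- y :* z) :+ con 0ℤ)))
    ≐-refl (E₁ (1 ℕ.+ k ℕ.* 3)) (E₁ (3 ℕ.+ k ℕ.* 3)) (E₉ (suc k)) (q^ (3 ℕ.+ k ℕ.* 3)) (q^ (2 ℕ.+ (k ℕ.* 3 ℕ.+ 1))) (q^ (2 ℕ.+ suc k ℕ.* 3)) (q^ (8 ℕ.+ (k ℕ.* 3 ℕ.+ k ℕ.* 3))) C₁)
  where
  exponent₁ : ∀ k → 2 ℕ.+ (k ℕ.* 3 ℕ.+ 1) ≡ 3 ℕ.+ k ℕ.* 3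
  exponent₁ = ℕ-Ring.solve-∀
  exponent₂ : ∀ k → 8 ℕ.+ (k ℕ.* 3 ℕ.+ k ℕ.* 3) ≡ 3 ℕ.+ k ℕ.* 3 ℕ.+ (2 ℕ.+ suc k ℕ.* 3)
  exponent₂ = ℕ-Ring.solve-∀
vℕ-step k 2 = combine ((𝟙 · E₁-step (2 ℕ.+ k ℕ.* 3)) ∷ (v₁ (suc k) · q^-cong (exponent₁ k)) ∷ (⊝ 𝟙 · Nine.E+E k)
    ∷ (E₉ (2 ℕ.+ k) · ≐-trans (q^-cong (exponent₂ k)) (q^-+ (4 ℕ.+ k ℕ.* 3) (8 ℕ.+ (suc k ℕ.* 3 ℕ.+ suc k ℕ.* 3)))) ∷ [])
  (solve 10 (λ e e₂ f f₂ y y₁ z w c c₉ → e :- f :+ y₁ :* (e₂ :- z :* f₂) :- (c :- c₉)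
      := con 1ℤ :* (e :+ y :* e₂ :- c) :+ ((e₂ :- z :* f₂) :* (y₁ :- y) :+ ((:- con 1ℤ) :* (f :+ w :* f₂ :- c₉) :+ (f₂ :* (w :- y :* z) :+ con 0ℤ))))
    ≐-refl (E₁ (2 ℕ.+ k ℕ.* 3)) (E₁ (4 ℕ.+ k ℕ.* 3)) (E₉ k) (E₉ (2 ℕ.+ k)) (q^ (4 ℕ.+ k ℕ.* 3)) (q^ (2 ℕ.+ (k ℕ.* 3 ℕ.+ 2))) (q^ (8 ℕ.+ (suc k ℕ.* 3 ℕ.+ suc k ℕ.* 3)))
      (q^ (9 ℕ.* (2 ℕ.+ k))) C₁ C₉)
  where
  exponent₁ : ∀ k → 2 ℕ.+ (k ℕ.* 3 ℕ.+ 2) ≡ 4 ℕ.+ k ℕ.* 3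
  exponent₁ = ℕ-Ring.solve-∀
  exponent₂ : ∀ k → 9 ℕ.* (2 ℕ.+ k) ≡ 4 ℕ.+ k ℕ.* 3 ℕ.+ (8 ℕ.+ (suc k ℕ.* 3 ℕ.+ suc k ℕ.* 3))
  exponent₂ = ℕ-Ring.solve-∀
vℕ-step k (suc (suc (suc m))) = ≐-trans (⊕-cong ≐-refl (⊗-cong (q^-cong (exponent k m)) ≐-refl)) (vℕ-step (suc k) m)
  where
  exponent : ∀ k m → 2 ℕ.+ (k ℕ.* 3 ℕ.+ (3 ℕ.+ m)) ≡ 2 ℕ.+ (suc k ℕ.* 3 ℕ.+ m)
  exponent = ℕ-Ring.solve-∀

vℕ-shift : ∀ j k m → vℕ j (k ℕ.* 3 ℕ.+ m) ≡ vℕ (k ℕ.+ j) m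
vℕ-shift j zero    m = refl
vℕ-shift j (suc k) m = trans (vℕ-shift (suc j) k m) (cong (λ i → vℕ i m) (ℕ.+-suc k j))

v : ℤ → Series
v (+ m)    = vℕ 0 m
v -[1+ m ] = q^ (suc m) ⊗ vℕ 0 (suc m)

v-neg : ∀ a → v (ℤ.- (+ a)) ≐ q^ a ⊗ vℕ 0 a
v-neg zero    = ≐-sym (≐-trans (⊗-cong q^0 ≐-refl) (Ring.*-identityˡ _))
v-neg (suc a) = ≐-refl

-- The 3-periodic right-hand side at every integer. Negative indices reduce by v(-m) = q^m v(m),
-- under which the recurrence at -(a+2) becomes q^a times the one at a; index -1 is its own mirror
-- image.
limitℤ : ℤ → Series
limitℤ (+ m)        = limit m
limitℤ -[1+ zero ]  = C₁ ⊖ C₉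
limitℤ -[1+ suc a ] = limit a

limitℤ-periodic : ∀ m i → limitℤ (m ℤ.- + 3 ℤ.* i) ≡ limitℤ m
limitℤ-periodic m = ℤ-induction _ (cong limitℤ (lemma₀ m)) (λ i p → trans (sym (step i)) p) (λ i p → trans (step i) p)
  where
  three : ∀ p → limitℤ (p ℤ.+ + 3) ≡ limitℤ p
  three (+ m)                              = cong limit (ℕ.+-comm m 3)
  three -[1+ 0 ]                           = refl
  three -[1+ 1 ]                           = refl
  three -[1+ 2 ]                           = refl
  three -[1+ 3 ]                           = refl
  three -[1+ suc (suc (suc (suc a))) ]     = refl
  lemma₀ : ∀ m → m ℤ.- + 3 ℤ.* 0ℤ ≡ m
  lemma₀ = solve-∀
  lemma : ∀ m i → m ℤ.- + 3 ℤ.* (1ℤ ℤ.+ i) ℤ.+ + 3 ≡ m ℤ.- + 3 ℤ.* i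
  lemma = solve-∀
  step : ∀ i → limitℤ (m ℤ.- + 3 ℤ.* i) ≡ limitℤ (m ℤ.- + 3 ℤ.* ℤ.suc i)
  step i = trans (cong limitℤ (sym (lemma m i))) (three (m ℤ.- + 3 ℤ.* ℤ.suc i))

-- The convolution of `v` in steps of 3 and its derivatives at x = 1

open Convolution 3 (s≤s z≤n)

n : ℤ → Series
n m = sumℤ (λ i → j i ⊗ v (m ℤ.- + 3 ℤ.* i))

HasSum-n : ∀ m → HasSum (λ i → j i ⊗ v (m ℤ.- + 3 ℤ.* i)) (n m)
HasSum-n m = HasSum-convolution (λ i → v (m ℤ.- + 3 ℤ.* i))

private
  exponentʲ : ℤ → ℤ
  exponentʲ i = + 3 ℤ.* tri i ℤ.+ 0ℤ ℤ.* tri (ℤ.- i)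

  exponentʲ≡ : ∀ i → exponentʲ i ≡ + 3 ℤ.* tri i
  exponentʲ≡ i = ℤ.+-identityʳ _

  0≤exponentʲ : ∀ i → 0ℤ ℤ.≤ exponentʲ i
  0≤exponentʲ = 0≤expo (theta sgn 3 0)

  -- The recurrence at the index -1. The two defects 1 in C₁ = 1 + 2q E₁(1) and C₉ = 1 + 2q⁹ E₉(1)
  -- cancel.
  2xv₁ : # (+ 2) ⊗ (q^ 1 ⊗ v₁ 0) ≐ C₁ ⊖ C₉
  2xv₁ = combine ((⊝ 𝟙 · One.C≐) ∷ (𝟙 · Nine.C≐) ∷ (# (+ 2) ⊗ E₉ 1 · q^-+ 1 8) ∷ [])
    (solve 7 (λ c c₉ x y z e e₉ → con (+ 2) :* (x :* (e :- y :* e₉)) :- (c :- c₉)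
        := (:- con 1ℤ) :* (c :- (con 1ℤ :+ con (+ 2) :* x :* e)) :+ (con 1ℤ :* (c₉ :- (con 1ℤ :+ con (+ 2) :* z :* e₉)) :+ (con (+ 2) :* e₉ :* (z :- x :* y) :+ con 0ℤ)))
      ≐-refl C₁ C₉ (q^ 1) (q^ 8) (q^ 9) (E₁ 1) (E₉ 1))

  qz-split : ∀ c a b → 0ℤ ℤ.≤ a → mono c (a ℤ.+ + b) ≐ mono c a ⊗ q^ b
  qz-split c a b 0≤a = ≐-trans (⊗-cong ≐-refl (qz-+ 0≤a 0≤+n)) (≐-sym (Ring.*-assoc _ _ _))

  -- The recurrence for v at the index p, multiplied by j i to clear negative powers.
  recurrence : ∀ i p → 0ℤ ℤ.≤ exponentʲ i ℤ.+ (p ℤ.+ + 2) →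
               j i ⊗ v p ⊕ mono (sgn i) (exponentʲ i ℤ.+ (p ℤ.+ + 2)) ⊗ v (p ℤ.+ + 2) ≐ j i ⊗ limitℤ p
  recurrence i (+ a) _ = ≐-trans
    (⊕-cong ≐-refl (≐-trans (⊗-cong (qz-split (sgn i) (exponentʲ i) (a ℕ.+ 2) (0≤exponentʲ i)) ≐-refl)
      (⊗-cong (⊗-cong ≐-refl (q^-cong (ℕ.+-comm a 2))) (eq λ k → cong (λ m → vℕ 0 m k) (ℕ.+-comm a 2)))))
    (combine ((j i · vℕ-step 0 a) ∷ []) (solve 5 (λ j x y z l → j :* x :+ j :* y :* z :- j :* l := j :* (x :+ y :* z :- l) :+ con 0ℤ) ≐-refl (j i) (vℕ 0 a) (q^ (2 ℕ.+ a)) (vℕ 0 (2 ℕ.+ a)) (limit a)))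
  recurrence i -[1+ zero ] _ = ≐-trans
    (⊕-cong ≐-refl (⊗-cong (qz-split (sgn i) (exponentʲ i) 1 (0≤exponentʲ i)) ≐-refl))
    (combine ((j i · 2xv₁) ∷ []) (solve 4 (λ j x y l → j :* (x :* y) :+ j :* x :* y :- j :* l := j :* (con (+ 2) :* (x :* y) :- l) :+ con 0ℤ) ≐-refl (j i) (q^ 1) (v₁ 0) (C₁ ⊖ C₉)))
  recurrence i -[1+ suc a ] 0≤e = ≐-trans
    (⊕-cong (⊗-cong j≐ (⊗-cong (q^-+ 2 a) ≐-refl)) (⊗-cong ≐-refl (≐-trans (eq λ k → cong (λ p → v p k) (p+2 a)) (v-neg a))))
    (≐-trans (combine ((y ⊗ q^ a · vℕ-step 0 a) ∷ (y ⊗ q^ a ⊗ vℕ 0 (2 ℕ.+ a) · ≐-sym (q^-+ 2 a)) ∷ [])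
        (solve 7 (λ y p r w w₂ l z → y :* p :* (r :* p :* w₂) :+ y :* (p :* w) :- y :* p :* l
           := y :* p :* (w :+ z :* w₂ :- l) :+ (y :* p :* w₂ :* (r :* p :- z) :+ con 0ℤ)) ≐-refl y (q^ a) (q^ 2) (vℕ 0 a) (vℕ 0 (2 ℕ.+ a)) (limit a) (q^ (2 ℕ.+ a))))
      (⊗-cong (≐-sym j≐) ≐-refl))
    where
    p+2 : ∀ a → -[1+ suc a ] ℤ.+ + 2 ≡ ℤ.- (+ a)
    p+2 zero    = refl
    p+2 (suc a) = refl
    y : Series
    y = mono (sgn i) (exponentʲ i ℤ.+ (-[1+ suc a ] ℤ.+ + 2))
    lemma : ∀ e a → e ≡ e ℤ.+ ℤ.- a ℤ.+ a
    lemma = solve-∀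
    j≐ : j i ≐ y ⊗ q^ a
    j≐ = ≐-trans (⊗-cong ≐-refl (qz-cong (trans (lemma (exponentʲ i) (+ a)) (cong (λ z → exponentʲ i ℤ.+ z ℤ.+ + a) (sym (p+2 a))))))
           (qz-split (sgn i) _ a 0≤e)

-- The recurrence at m + 1 - 3i is multiplied by the i-th coefficient of j and summed. The periodic
-- right-hand side factors out and meets j(1) = 0. In the shifted term the exponent 3i(i-1)/2 + m +
-- 3 - 3i is that of the coefficient i - 1 plus m, with opposite sign.
n-step : ∀ m → n (+ suc m) ≐ q^ m ⊗ n (+ m)
n-step m = combine ((𝟙 · HasSum-unique (HasSum-cong (λ i → ≐-trans (recurrence i (p i) (0≤e i)) (⊗-cong ≐-refl (eq λ k → cong (λ f → f k) (limitℤ-periodic (+ suc m) i)))) ≐-refl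
      (HasSum-⊕ ℤ._≟_ (HasSum-n (+ suc m)) (HasSum-cong shifted ≐-refl (HasSum-reindex (ℤ-shift (ℤ.- 1ℤ)) (HasSum-⊗ (⊝ q^ m) (HasSum-n (+ m)))))))
      (HasSum-cong (λ i → ⊗-comm (limitℤ (+ suc m)) (j i)) (Ring.zeroʳ (limitℤ (+ suc m))) (HasSum-⊗ (limitℤ (+ suc m)) HasSum-j))) ∷ [])
    (solve 3 (λ a y b → a :- y :* b := con 1ℤ :* (a :+ (:- y) :* b :- con 0ℤ) :+ con 0ℤ) ≐-refl (n (+ suc m)) (q^ m) (n (+ m)))
  where
  p : ℤ → ℤ
  p i = + suc m ℤ.- + 3 ℤ.* i
  exponent : ∀ i → exponentʲ i ℤ.+ (p i ℤ.+ + 2) ≡ exponentʲ (i ℤ.- 1ℤ) ℤ.+ + m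
  exponent i = trans (cong (λ t → t ℤ.+ (p i ℤ.+ + 2)) (exponentʲ≡ i))
    (trans (cong (λ t → + 3 ℤ.* t ℤ.+ (1ℤ ℤ.+ + m ℤ.- + 3 ℤ.* i ℤ.+ + 2)) (trans (cong tri (lemma₁ i)) (tri-suc (i ℤ.- 1ℤ))))
      (trans (lemma₂ (tri (i ℤ.- 1ℤ)) i (+ m)) (cong (ℤ._+ + m) (sym (exponentʲ≡ (i ℤ.- 1ℤ))))))
    where
    lemma₁ : ∀ i → i ≡ 1ℤ ℤ.+ (i ℤ.- 1ℤ)
    lemma₁ = solve-∀
    lemma₂ : ∀ t i m → + 3 ℤ.* (t ℤ.+ (i ℤ.- 1ℤ)) ℤ.+ (1ℤ ℤ.+ m ℤ.- + 3 ℤ.* i ℤ.+ + 2) ≡ + 3 ℤ.* t ℤ.+ m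
    lemma₂ = solve-∀
  0≤e : ∀ i → 0ℤ ℤ.≤ exponentʲ i ℤ.+ (p i ℤ.+ + 2)
  0≤e i = subst (0ℤ ℤ.≤_) (sym (exponent i)) (0≤+ (0≤exponentʲ (i ℤ.- 1ℤ)) 0≤+n)
  sgn-lemma : ∀ i → sgn i ≡ ℤ.- sgn (i ℤ.- 1ℤ)
  sgn-lemma i = trans (cong sgn (lemma i)) (sgn-suc (i ℤ.- 1ℤ))
    where
    lemma : ∀ i → i ≡ 1ℤ ℤ.+ (i ℤ.- 1ℤ)
    lemma = solve-∀
  index : ∀ i m → m ℤ.- + 3 ℤ.* (i ℤ.+ ℤ.- 1ℤ) ≡ 1ℤ ℤ.+ m ℤ.- + 3 ℤ.* i ℤ.+ + 2
  index = solve-∀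
  shifted : ∀ i → ⊝ q^ m ⊗ (j (i ℤ.+ ℤ.- 1ℤ) ⊗ v (+ m ℤ.- + 3 ℤ.* (i ℤ.+ ℤ.- 1ℤ))) ≐ mono (sgn i) (exponentʲ i ℤ.+ (p i ℤ.+ + 2)) ⊗ v (p i ℤ.+ + 2)
  shifted i = ≐-sym (≐-trans (⊗-cong (≐-trans (mono-cong (sgn-lemma i) (exponent i)) (≐-trans (qz-split _ _ m (0≤exponentʲ (i ℤ.- 1ℤ))) (⊗-cong (⊗-cong (#-neg _) ≐-refl) ≐-refl))) (eq λ k → cong (λ l → v l k) (sym (index i (+ m)))))
    (solve 4 (λ c e y w → (:- c) :* e :* y :* w := (:- y) :* (c :* e :* w)) ≐-refl (# (sgn (i ℤ.- 1ℤ))) _ (q^ m) _))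

-- The reflection of `v` carried through the sum by i ↦ -i. The cases on the sign of m - 3i only
-- keep all exponents nonnegative.
n-neg : ∀ m → n (ℤ.- (+ m)) ≐ q^ m ⊗ n (+ m)
n-neg m = HasSum-unique (HasSum-reindex ℤ-neg (HasSum-n (ℤ.- (+ m)))) (HasSum-cong term ≐-refl (HasSum-⊗ (q^ m) (HasSum-n (+ m))))
  where
  index : ∀ m i → ℤ.- m ℤ.- + 3 ℤ.* ℤ.- i ≡ ℤ.- (m ℤ.- + 3 ℤ.* i)
  index = solve-∀
  core : ∀ i p → + m ℤ.- + 3 ℤ.* i ≡ p → mono (sgn (ℤ.- i)) (exponentʲ (ℤ.- i)) ⊗ v (ℤ.- p) ≐ q^ m ⊗ (j i ⊗ v p)
  core i (+ a) e = ≐-trans (⊗-cong (mono-coef (exponentʲ (ℤ.- i)) (sgn-neg i)) (v-neg a))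
    (≐-trans (≐-sym (Ring.*-assoc _ _ _)) (≐-trans (⊗-cong (≐-sym (qz-split (sgn i) (exponentʲ (ℤ.- i)) a (0≤exponentʲ (ℤ.- i)))) ≐-refl)
      (≐-trans (⊗-cong (≐-trans (⊗-cong ≐-refl (qz-cong exponent)) (qz-split (sgn i) (exponentʲ i) m (0≤exponentʲ i))) ≐-refl)
        (solve 3 (λ j y w → j :* y :* w := y :* (j :* w)) ≐-refl (j i) (q^ m) (vℕ 0 a)))))
    where
    lemma : ∀ t i m → + 3 ℤ.* (t ℤ.+ i) ℤ.+ (m ℤ.- + 3 ℤ.* i) ≡ + 3 ℤ.* t ℤ.+ m
    lemma = solve-∀
    exponent : exponentʲ (ℤ.- i) ℤ.+ + a ≡ exponentʲ i ℤ.+ + m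
    exponent = trans (cong₂ ℤ._+_ (trans (exponentʲ≡ (ℤ.- i)) (cong (ℤ._*_ (+ 3)) (tri-neg i))) (sym e)) (trans (lemma (tri i) i (+ m)) (cong (ℤ._+ + m) (sym (exponentʲ≡ i))))
  core i -[1+ a ] e = ≐-trans (⊗-cong (≐-trans (mono-cong (sgn-neg i) exponent) (≐-trans (qz-split (sgn i) _ (suc a) (0≤+ (0≤exponentʲ i) 0≤+n)) (⊗-cong (qz-split (sgn i) (exponentʲ i) m (0≤exponentʲ i)) ≐-refl))) ≐-refl)
    (solve 4 (λ j y z w → j :* y :* z :* w := y :* (j :* (z :* w))) ≐-refl (j i) (q^ m) (q^ (suc a)) (vℕ 0 (suc a)))
    where
    lemma : ∀ t i m → + 3 ℤ.* (t ℤ.+ i) ≡ + 3 ℤ.* t ℤ.+ m ℤ.+ ℤ.- (m ℤ.- + 3 ℤ.* i)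
    lemma = solve-∀
    exponent : exponentʲ (ℤ.- i) ≡ exponentʲ i ℤ.+ + m ℤ.+ + suc a
    exponent = trans (trans (exponentʲ≡ (ℤ.- i)) (cong (ℤ._*_ (+ 3)) (tri-neg i))) (trans (lemma (tri i) i (+ m)) (cong₂ ℤ._+_ (cong (ℤ._+ + m) (sym (exponentʲ≡ i))) (cong ℤ.-_ e)))
  term : ∀ i → q^ m ⊗ (j i ⊗ v (+ m ℤ.- + 3 ℤ.* i)) ≐ j (ℤ.- i) ⊗ v (ℤ.- (+ m) ℤ.- + 3 ℤ.* ℤ.- i)
  term i = ≐-sym (≐-trans (⊗-cong ≐-refl (eq λ k → cong (λ l → v l k) (index (+ m) i))) (core i (+ m ℤ.- + 3 ℤ.* i) refl))

private
  n≐ℕ : ∀ m → n (+ m) ≐ q^ (triℕ m) ⊗ n 0ℤ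
  n≐ℕ zero    = ≐-sym (≐-trans (⊗-cong q^0 ≐-refl) (Ring.*-identityˡ _))
  n≐ℕ (suc m) = ≐-trans (n-step m) (≐-trans (⊗-cong ≐-refl (n≐ℕ m)) (≐-trans (≐-sym (Ring.*-assoc _ _ _)) (⊗-cong (≐-trans (⊗-comm _ _) (≐-sym (q^-+ (triℕ m) m))) ≐-refl)))

n≐ : ∀ m → n m ≐ qz (tri m) ⊗ n 0ℤ
n≐ (+ m)    = n≐ℕ m
n≐ -[1+ m ] = ≐-trans (n-neg (suc m)) (≐-trans (⊗-cong ≐-refl (n≐ℕ (suc m))) (≐-trans (≐-sym (Ring.*-assoc _ _ _)) (⊗-cong (≐-trans (⊗-comm _ _) (≐-sym (q^-+ (triℕ (suc m)) (suc m)))) ≐-refl)))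

vᵣ nᵣ : ℕ → ℤ → Series
vᵣ r k = v (+ 3 ℤ.* k ℤ.+ + r)
nᵣ r k = n (+ 3 ℤ.* k ℤ.+ + r)

vᵣ-convolution : ∀ r k → HasSum (λ i → j i ⊗ vᵣ r (k ℤ.- i)) (nᵣ r k)
vᵣ-convolution r k = HasSum-cong (λ i → ⊗-cong ≐-refl (eq λ m → cong (λ l → v l m) (lemma k i (+ r)))) ≐-refl (HasSum-n (+ 3 ℤ.* k ℤ.+ + r))
  where
  lemma : ∀ k i r → + 3 ℤ.* k ℤ.+ r ℤ.- + 3 ℤ.* i ≡ + 3 ℤ.* (k ℤ.- i) ℤ.+ r
  lemma = solve-∀

vᵣ-+ : ∀ r k → vᵣ r (+ k) ≐ vℕ k r
vᵣ-+ r k = eq λ m → trans (cong (λ l → v l m) (cong₂ ℤ._+_ (trans (sym (ℤ.pos-* 3 k)) (cong +_ (ℕ.*-comm 3 k))) refl))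
  (cong (λ f → f m) (trans (vℕ-shift 0 k r) (cong (λ l → vℕ l r) (ℕ.+-identityʳ k))))

vᵣ-- : ∀ r r′ k → r ℕ.+ r′ ≡ 2 → vᵣ r -[1+ k ] ≐ q^ (suc (r′ ℕ.+ k ℕ.* 3)) ⊗ vℕ k (suc r′)
vᵣ-- r r′ k e = ≐-trans (eq λ m → cong (λ l → v l m) index)
  (⊗-cong ≐-refl (eq λ m → cong (λ f → f m) (trans (cong (vℕ 0) (trans (cong suc (ℕ.+-comm r′ (k ℕ.* 3))) (sym (ℕ.+-suc (k ℕ.* 3) r′)))) (trans (vℕ-shift 0 k (suc r′)) (cong (λ l → vℕ l (suc r′)) (ℕ.+-identityʳ k))))))
  where
  lemma : ∀ r r′ k → + 3 ℤ.* ℤ.- (1ℤ ℤ.+ k) ℤ.+ r ≡ ℤ.- (1ℤ ℤ.+ (r′ ℤ.+ k ℤ.* + 3)) ℤ.+ (r ℤ.+ r′ ℤ.- + 2)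
  lemma = solve-∀
  index : + 3 ℤ.* -[1+ k ] ℤ.+ + r ≡ -[1+ (r′ ℕ.+ k ℕ.* 3) ]
  index = trans (lemma (+ r) (+ r′) (+ k)) (trans (cong₂ (λ x y → ℤ.- (1ℤ ℤ.+ (+ r′ ℤ.+ x)) ℤ.+ (y ℤ.- + 2)) (sym (ℤ.pos-* k 3)) (cong +_ e)) (ℤ.+-identityʳ _))

vℕ≈limit : ∀ k → v₀ k ≈[ k ] C₁ × v₁ k ≈[ k ] C₁ × v₂ k ≈[ k ] C₁ ⊖ C₉
vℕ≈limit k = ≈-trans (⊕-cong≈ (E≈ (k ℕ.* 3) k≤3k) (q^⊗-vanish (E₉ k) (ℕ.≤-trans k≤3k (ℕ.m≤n+m _ 2)))) (≐⇒≈ (Ring.+-identityʳ C₁))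
           , ≈-trans (⊕-cong≈ (E≈ (1 ℕ.+ k ℕ.* 3) (ℕ.m≤n⇒m≤1+n k≤3k)) (⊝-cong≈ (q^⊗-vanish (E₉ (suc k)) (ℕ.≤-trans k≤3k (ℕ.≤-trans (ℕ.m≤m+n _ _) (ℕ.m≤n+m _ 8))))))
               (≐⇒≈ (solve 1 (λ c → c :- con 0ℤ := c) ≐-refl C₁))
           , ⊕-cong≈ (E≈ (2 ℕ.+ k ℕ.* 3) (ℕ.m≤n⇒m≤1+n (ℕ.m≤n⇒m≤1+n k≤3k))) (⊝-cong≈ (Nine.E≈C k))
  where
  k≤3k : k ≤ k ℕ.* 3
  k≤3k = ℕ.m≤m*n k 3
  E≈ : ∀ m → k ≤ m → E₁ m ≈[ k ] C₁
  E≈ m k≤m = ≈-weaken k≤m (One.E≈C m)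

private
  up : ∀ r {ℓ} → (∀ k → vℕ k r ≈[ k ] ℓ) → ∀ N k → N ≤ k → vᵣ r (+ k) ≈[ N ] ℓ
  up r p N k N≤k = ≈-trans (≐⇒≈ (vᵣ-+ r k)) (≈-weaken N≤k (p k))

  down : ∀ r r′ → r ℕ.+ r′ ≡ 2 → ∀ N k → N ≤ k → vᵣ r -[1+ k ] ≈[ N ] 𝟘
  down r r′ e N k N≤k = ≈-trans (≐⇒≈ (vᵣ-- r r′ k e)) (q^⊗-vanish _ (ℕ.≤-trans N≤k (ℕ.≤-trans (ℕ.m≤m*n k 3) (ℕ.m≤n⇒m≤1+n (ℕ.m≤n+m (k ℕ.* 3) r′)))))

  tri-3k+r : ∀ k r → tri (+ 3 ℤ.* k ℤ.+ r) ≡ + 3 ℤ.* (+ 3 ℤ.* tri k ℤ.+ k) ℤ.+ tri r ℤ.+ + 3 ℤ.* k ℤ.* r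
  tri-3k+r k r = trans (tri-+ (+ 3 ℤ.* k) r) (cong (λ z → z ℤ.+ tri r ℤ.+ + 3 ℤ.* k ℤ.* r) (tri-triple k))

  expo-to-tri : ∀ A {x} k → linear A k (tri k) ≡ x → x ≡ expo A k
  expo-to-tri A k e = trans (sym e) (sym (expo≡ A k refl))

  -- Since n(m) = q^(m(m-1)/2) n(0), the exponents on residue classes decide which theta series sums
  -- n(3k + r): σ for r = 0, its reflection for r = 1 and, up to reflection, τ for r = 2.
  expo₀ : ∀ k → tri (+ 3 ℤ.* k ℤ.+ + 0) ≡ + 0 ℤ.+ expo σ k
  expo₀ k = trans (tri-3k+r k (+ 0)) (trans (expo-to-tri σ k (lemma (tri k) k)) (sym (ℤ.+-identityˡ _)))
    where
    lemma : ∀ t k → + 6 ℤ.* t ℤ.+ + 3 ℤ.* (t ℤ.+ k) ≡ + 3 ℤ.* (+ 3 ℤ.* t ℤ.+ k) ℤ.+ + 0 ℤ.+ + 3 ℤ.* k ℤ.* + 0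
    lemma = solve-∀

  expo₁ : ∀ k → tri (+ 3 ℤ.* k ℤ.+ + 1) ≡ + 0 ℤ.+ expo (theta one 3 6) k
  expo₁ k = trans (tri-3k+r k (+ 1)) (trans (expo-to-tri (theta one 3 6) k (lemma (tri k) k)) (sym (ℤ.+-identityˡ _)))
    where
    lemma : ∀ t k → + 3 ℤ.* t ℤ.+ + 6 ℤ.* (t ℤ.+ k) ≡ + 3 ℤ.* (+ 3 ℤ.* t ℤ.+ k) ℤ.+ + 0 ℤ.+ + 3 ℤ.* k ℤ.* + 1
    lemma = solve-∀

  expo₂ : ∀ k → tri (+ 3 ℤ.* k ℤ.+ + 2) ≡ + 1 ℤ.+ expo (theta one 0 9) k
  expo₂ k = trans (tri-3k+r k (+ 2)) (trans (lemma (tri k) k) (cong (ℤ._+_ (+ 1)) (sym (expo≡ (theta one 0 9) k refl))))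
    where
    lemma : ∀ t k → + 3 ℤ.* (+ 3 ℤ.* t ℤ.+ k) ℤ.+ + 1 ℤ.+ + 3 ℤ.* k ℤ.* + 2 ≡ + 1 ℤ.+ (+ 0 ℤ.* t ℤ.+ + 9 ℤ.* (t ℤ.+ k))
    lemma = solve-∀

  HasSum-n-weighted : ∀ r e a b (c : ℤ → ℤ) → 0 < a ℕ.+ b → (∀ k → tri (+ 3 ℤ.* k ℤ.+ + r) ≡ + e ℤ.+ expo (theta one a b) k) →
                      HasSum (λ k → # (c k) ⊗ nᵣ r k) (q^ e ⊗ n 0ℤ ⊗ ⟦ theta c a b ⟧)
  HasSum-n-weighted r e a b c nz p = HasSum-cong
    (λ k → ≐-sym (≐-trans (⊗-cong ≐-refl (≐-trans (n≐ (+ 3 ℤ.* k ℤ.+ + r)) (⊗-cong (≐-trans (qz-cong (p k)) (qz-+ {+ e} 0≤+n (0≤expo (theta one a b) k))) ≐-refl)))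
             (solve 4 (λ c y z w → c :* (y :* z :* w) := y :* w :* (c :* z)) ≐-refl (# (c k)) (q^ e) (qz (expo (theta one a b) k)) (n 0ℤ))))
    ≐-refl (HasSum-⊗ (q^ e ⊗ n 0ℤ) (HasSum-θ (theta c a b) nz))

  HasSum-nᵣ : ∀ r e a b → 0 < a ℕ.+ b → (∀ k → tri (+ 3 ℤ.* k ℤ.+ + r) ≡ + e ℤ.+ expo (theta one a b) k) → HasSum (nᵣ r) (q^ e ⊗ n 0ℤ ⊗ ⟦ theta one a b ⟧)
  HasSum-nᵣ r e a b nz p = HasSum-cong (λ k → Ring.*-identityˡ (nᵣ r k)) ≐-refl (HasSum-n-weighted r e a b one nz p)

κC₁ : ⟦ κ 3 ⟧ ⊗ C₁ ≐ ⟦ σ ⟧ ⊗ n 0ℤ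
κC₁ = ≐-trans (convolution-limit {a = vᵣ 0} (up 0 λ k → proj₁ (vℕ≈limit k)) (down 0 2 refl) (vᵣ-convolution 0)
    (HasSum-nᵣ 0 0 6 3 (s≤s z≤n) expo₀) (HasSum-n-weighted 0 0 6 3 id (s≤s z≤n) expo₀))
  (≐-trans (⊗-cong (⊗-cong q^0 ≐-refl) ≐-refl) (solve 2 (λ n s → con 1ℤ :* n :* s := s :* n) ≐-refl (n 0ℤ) ⟦ σ ⟧))

-- Together with `κC₁` this eliminates n(0). As C₁ and C₉ are the inverses of φ(q) and φ(q⁹), the
-- result is the relation between those two that `theta-quotient` assumes.
κ[C₁-C₉] : ⟦ κ 3 ⟧ ⊗ (C₁ ⊖ C₉) ≐ τ ⊗ n 0ℤ
κ[C₁-C₉] = ≐-trans (convolution-limit {a = vᵣ 2} (up 2 λ k → proj₂ (proj₂ (vℕ≈limit k))) (down 2 0 refl) (vᵣ-convolution 2)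
    (HasSum-nᵣ 2 1 0 9 (s≤s z≤n) expo₂) (HasSum-n-weighted 2 1 0 9 id (s≤s z≤n) expo₂))
  (≐-trans (⊗-cong ≐-refl (θ-reflect one 0 9 (s≤s z≤n))) (solve 3 (λ x n s → x :* n :* s := x :* s :* n) ≐-refl (q^ 1) (n 0ℤ) ⟦ Ψ 9 ⟧))

W B : Series
W = sumℕ (λ k → v₀ k ⊖ v₁ k)
B = ⟦ theta id 3 6 ⟧

HasSum-W : HasSum (λ k → v₀ k ⊖ v₁ k) W
HasSum-W = HasSum-ℕ λ N i N≤i → ≈-trans (⊕-cong≈ (≈-weaken (ℕ.m≤n⇒m≤1+n (ℕ.m≤n⇒m≤1+n N≤i)) (proj₁ (vℕ≈limit (2 ℕ.+ i))))
    (⊝-cong≈ (≈-weaken (ℕ.m≤n⇒m≤1+n (ℕ.m≤n⇒m≤1+n N≤i)) (proj₁ (proj₂ (vℕ≈limit (2 ℕ.+ i)))))))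
  (≐⇒≈ (solve 1 (λ c → c :- c := con 0ℤ) ≐-refl C₁))

-- The negative half repeats the positive one: by reflection its terms are q^(3k+3) v₀(k+1) -
-- q^(3k+2) v₂(k), and the recurrence in classes 0 and 1, both with limit C₁, turns this into v₀(k)
-- - v₁(k).
HasSum-2W : HasSum (λ k → vᵣ 0 k ⊖ vᵣ 1 k) (W ⊕ W)
HasSum-2W = HasSum-halves
  (HasSum-cong (λ k → ≐-sym (⊕-cong (vᵣ-+ 0 k) (⊝-cong (vᵣ-+ 1 k)))) ≐-refl HasSum-W)
  (HasSum-cong (λ k → ≐-trans (combine ((𝟙 · step₀ k) ∷ (⊝ 𝟙 · step₁ k) ∷ [])
      (solve 5 (λ a b c y z → b :- c :- (z :- y) := con 1ℤ :* (b :+ y :- a) :+ ((:- con 1ℤ) :* (c :+ z :- a) :+ con 0ℤ)) ≐-refl C₁ (v₀ k) (v₁ k) (q^ (2 ℕ.+ k ℕ.* 3) ⊗ v₂ k) (q^ (3 ℕ.+ k ℕ.* 3) ⊗ v₀ (suc k))))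
    (≐-sym (⊕-cong (vᵣ-- 0 2 k refl) (⊝-cong (vᵣ-- 1 1 k refl))))) ≐-refl HasSum-W)
  where
  step₀ : ∀ k → v₀ k ⊕ q^ (2 ℕ.+ k ℕ.* 3) ⊗ v₂ k ≐ C₁
  step₀ k = ≐-trans (⊕-cong ≐-refl (⊗-cong (q^-cong (cong (ℕ._+_ 2) (sym (ℕ.+-identityʳ (k ℕ.* 3))))) ≐-refl)) (vℕ-step k 0)
  step₁ : ∀ k → v₁ k ⊕ q^ (3 ℕ.+ k ℕ.* 3) ⊗ v₀ (suc k) ≐ C₁
  step₁ k = ≐-trans (⊕-cong ≐-refl (⊗-cong (q^-cong (cong (ℕ._+_ 2) (sym (ℕ.+-comm (k ℕ.* 3) 1)))) ≐-refl)) (vℕ-step k 1)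

-- The difference of classes 0 and 1 is summable, so the product rule applies directly. Reflection
-- makes the two weighted theta series opposite, which compensates the doubling of W.
κW : ⟦ κ 3 ⟧ ⊗ W ≐ B ⊗ n 0ℤ
κW = cancel-# (+ 2) (combine ((⊝ 𝟙 · HasSum-unique (weighted-convolution {c = λ k → vᵣ 0 k ⊖ vᵣ 1 k} HasSum-2W weighted conv) total′) ∷ (⊝ n 0ℤ · B-reflect) ∷ ((B ⊖ ⟦ theta id 6 3 ⟧) ⊗ n 0ℤ · q^0) ∷ [])
    (solve 6 (λ k w b b′ m x → con (+ 2) :* (k :* w) :- con (+ 2) :* (b :* m)
      := (:- con 1ℤ) :* (:- (k :* (w :+ w)) :- (x :* m :* b′ :- x :* m :* b)) :+ ((:- m) :* (b′ :- (:- b)) :+ ((b :- b′) :* m :* (x :- con 1ℤ) :+ con 0ℤ)))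
      ≐-refl ⟦ κ 3 ⟧ W B ⟦ theta id 6 3 ⟧ (n 0ℤ) (q^ 0)))
  where
  B-reflect : ⟦ theta id 6 3 ⟧ ≐ ⊝ B
  B-reflect = ≐-trans (θ-reflect id 6 3 (s≤s z≤n)) (θ-⊝ id 3 6 (s≤s z≤n))
  total′ : HasSum (λ k → # k ⊗ (nᵣ 0 k ⊖ nᵣ 1 k)) (q^ 0 ⊗ n 0ℤ ⊗ ⟦ theta id 6 3 ⟧ ⊖ q^ 0 ⊗ n 0ℤ ⊗ B)
  total′ = HasSum-cong (λ k → solve 3 (λ c a b → c :* a :- c :* b := c :* (a :- b)) ≐-refl (# k) (nᵣ 0 k) (nᵣ 1 k)) ≐-refl
    (HasSum-n-weighted 0 0 6 3 id (s≤s z≤n) expo₀ ⊖ᶻ HasSum-n-weighted 1 0 3 6 id (s≤s z≤n) expo₁)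
  conv : ∀ k → HasSum (λ i → j i ⊗ (vᵣ 0 (k ℤ.- i) ⊖ vᵣ 1 (k ℤ.- i))) (nᵣ 0 k ⊖ nᵣ 1 k)
  conv k = HasSum-cong (λ i → solve 3 (λ c a b → c :* a :- c :* b := c :* (a :- b)) ≐-refl (j i) (vᵣ 0 (k ℤ.- i)) (vᵣ 1 (k ℤ.- i))) ≐-refl
    (vᵣ-convolution 0 k ⊖ᶻ vᵣ-convolution 1 k)
  small : ∀ c {M f g h} → f ≈[ M ] h → g ≈[ M ] h → # c ⊗ (f ⊖ g) ≈[ M ] 𝟘
  small c {h = h} p r = ≈-trans (⊗-cong≈ ≈-refl (⊕-cong≈ p (⊝-cong≈ r))) (≐⇒≈ (solve 2 (λ c h → c :* (h :- h) := con 0ℤ) ≐-refl (# c) h))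
  weighted : HasSum (λ k → # k ⊗ (vᵣ 0 k ⊖ vᵣ 1 k)) (sumℤ (λ k → # k ⊗ (vᵣ 0 k ⊖ vᵣ 1 k)))
  weighted = HasSum-ℤ
    (λ N k N≤k → small (+ (2 ℕ.+ k)) (up 0 (λ k → proj₁ (vℕ≈limit k)) N (2 ℕ.+ k) (ℕ.m≤n⇒m≤1+n (ℕ.m≤n⇒m≤1+n N≤k))) (up 1 (λ k → proj₁ (proj₂ (vℕ≈limit k))) N (2 ℕ.+ k) (ℕ.m≤n⇒m≤1+n (ℕ.m≤n⇒m≤1+n N≤k))))
    (λ N k N≤k → small -[1+ 2 ℕ.+ k ] (down 0 2 refl N (2 ℕ.+ k) (ℕ.m≤n⇒m≤1+n (ℕ.m≤n⇒m≤1+n N≤k))) (down 1 1 refl N (2 ℕ.+ k) (ℕ.m≤n⇒m≤1+n (ℕ.m≤n⇒m≤1+n N≤k))))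

-- The difference series with `v` in place of E. The factor 6 fits: κM is n(0) times σ + 6B, and
-- this sum has the coefficients 6k + 1 of `S̃ 3`.
M : Series
M = C₁ ⊕ # (+ 6) ⊗ W

κ-constant : ∀ s → 0 < s → ⟦ κ s ⟧ 0 ≡ 1ℤ
κ-constant s 0<s = trans (at (jacobi s 0<s) 0) (cube-constant ⟦ ε s ⟧ (ε-constant s 0<s))

M≐ : M ⊗ ⟦ ε 6 ⟧ ≐ ⟦ σ ⟧ ⊗ ⟦ σ ⟧ ⊕ ⟦ σ ⟧ ⊗ τ ⊕ τ ⊗ τ
M≐ = theta-quotient M
  (cancel ⟦ κ 3 ⟧ κ₀ (combine ((s ⊗ (f ⊗ # (+ 6)) · κW) ∷ (⊝ (# (+ 6) ⊗ B ⊗ f) · κC₁) ∷ (⟦ κ 3 ⟧ ⊗ (s ⊕ # (+ 6) ⊗ B) · One.φC≐𝟙) ∷ (⟦ κ 3 ⟧ · S̃≐) ∷ [])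
    (solve 8 (λ k s c w f b m S → k :* (s :* ((c :+ con (+ 6) :* w) :* f)) :- k :* S
       := s :* (f :* con (+ 6)) :* (k :* w :- b :* m) :+ ((:- (con (+ 6) :* b :* f)) :* (k :* c :- s :* m) :+ (k :* (s :+ con (+ 6) :* b) :* (f :* c :- con 1ℤ) :+ (k :* (s :+ con (+ 6) :* b :- S) :+ con 0ℤ))))
      ≐-refl ⟦ κ 3 ⟧ s C₁ W f B (n 0ℤ) ⟦ S̃ 3 ⟧)))
  (cancel ⟦ κ 3 ⟧ κ₀ (combine ((⊝ (s ⊗ f ⊗ f₉) · κ[C₁-C₉]) ∷ (τ ⊗ f ⊗ f₉ · κC₁) ∷ (⟦ κ 3 ⟧ ⊗ f₉ ⊗ (s ⊖ τ) · One.φC≐𝟙) ∷ (⊝ (⟦ κ 3 ⟧ ⊗ s ⊗ f) · Nine.φC≐𝟙) ∷ [])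
    (solve 8 (λ k s c c₉ f f₉ t m → k :* (s :* f) :- k :* ((s :- t) :* f₉)
       := (:- (s :* f :* f₉)) :* (k :* (c :- c₉) :- t :* m) :+ (t :* f :* f₉ :* (k :* c :- s :* m) :+ (k :* f₉ :* (s :- t) :* (f :* c :- con 1ℤ) :+ ((:- (k :* s :* f)) :* (f₉ :* c₉ :- con 1ℤ) :+ con 0ℤ))))
      ≐-refl ⟦ κ 3 ⟧ s C₁ C₉ f f₉ τ (n 0ℤ))))
  where
  s f f₉ : Series
  s = ⟦ σ ⟧
  f = ⟦ φ 1 ⟧
  f₉ = ⟦ φ 9 ⟧
  κ₀ : ⟦ κ 3 ⟧ 0 ≡ 1ℤ
  κ₀ = κ-constant 3 (s≤s z≤n)
  S̃≐ : s ⊕ # (+ 6) ⊗ B ≐ ⟦ S̃ 3 ⟧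
  S̃≐ = HasSum-unique (HasSum-cong (λ k → ≐-trans (⊕-cong ≐-refl (≐-trans (≐-sym (Ring.*-assoc _ _ _)) (⊗-cong (≐-sym (#-* (+ 6) k)) ≐-refl))) (≐-trans (mono-⊕ 1ℤ (+ 6 ℤ.* k) (expo (S̃ 3) k)) (mono-coef (expo (S̃ 3) k) (ℤ.+-comm 1ℤ (+ 6 ℤ.* k))))) ≐-refl
      (HasSum-⊕ ℤ._≟_ (HasSum-cong (λ _ → ≐-refl) (≐-sym (θ-reflect one 6 3 (s≤s z≤n))) (HasSum-θ (theta one 3 6) (s≤s z≤n))) (HasSum-⊗ (# (+ 6)) (HasSum-θ (theta id 3 6) (s≤s z≤n)))))
    (HasSum-θ (S̃ 3) (s≤s z≤n))

-- The reciprocal theta function κ(q¹⁸) / j(x; q¹⁸) = φ(q⁹) ∑ E₉(2k) xᵏ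

module Reciprocal where
  module J = Convolution 18 (s≤s z≤n)

  -- For α + β = 18 these are the coefficients of the reciprocal at q^α x: at x^(-k) the factor
  -- q^(18k) becomes q^(βk), so no negative exponents occur.
  ρ : ℕ → ℕ → ℤ → Series
  ρ α β (+ k)    = q^ (α ℕ.* k) ⊗ E₉ (k ℕ.+ k)
  ρ α β -[1+ k ] = q^ (β ℕ.* suc k) ⊗ E₉ (suc k ℕ.+ suc k)

  r : ℤ → Series
  r = ρ 0 18

  c : ℤ → Series
  c m = sumℤ (λ i → J.j i ⊗ r (m ℤ.- i))

  HasSum-c : ∀ m → HasSum (λ i → J.j i ⊗ r (m ℤ.- i)) (c m)
  HasSum-c m = J.HasSum-convolution (λ i → r (m ℤ.- i))

  -- The substitution x ↦ q^α x multiplies the coefficients at i and at p = m - i by q^(αi) and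
  -- q^(αp), hence their product by q^(αm).
  term : ∀ α β → α ℕ.+ β ≡ 18 → ∀ m i p → + m ℤ.- i ≡ p →
         mono (sgn i) (expo (theta sgn β α) i) ⊗ ρ α β p ≐ q^ (α ℕ.* m) ⊗ (J.j i ⊗ r p)
  term α β e m i p p≡ = go p p≡
    where
    A : Theta
    A = theta sgn β α
    A₁₈ : ∀ i → expo A i ≡ expo (theta sgn 18 0) i ℤ.+ + α ℤ.* i
    A₁₈ i = trans (expo≡ A i refl) (trans (lemma (+ α) (+ β) (tri i) i) (trans (cong (λ z → z ℤ.* tri i ℤ.+ + α ℤ.* i) (cong +_ e)) (cong (ℤ._+ + α ℤ.* i) (sym (ℤ.+-identityʳ (+ 18 ℤ.* tri i))))))
      where
      lemma : ∀ a b t i → b ℤ.* t ℤ.+ a ℤ.* (t ℤ.+ i) ≡ (a ℤ.+ b) ℤ.* t ℤ.+ a ℤ.* i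
      lemma = solve-∀
    split : ∀ T x → mono (sgn i) (expo T i) ⊗ q^ x ≐ mono (sgn i) (expo T i ℤ.+ + x)
    split T x = ≐-trans (Ring.*-assoc _ _ _) (⊗-cong ≐-refl (≐-sym (qz-+ (0≤expo T i) 0≤+n)))
    go : ∀ p → + m ℤ.- i ≡ p → mono (sgn i) (expo A i) ⊗ ρ α β p ≐ q^ (α ℕ.* m) ⊗ (J.j i ⊗ r p)
    go (+ b) p≡ = ≐-trans (≐-sym (Ring.*-assoc _ _ _)) (≐-trans (⊗-cong (≐-trans (split A (α ℕ.* b)) (≐-trans (mono-cong refl exponent) (≐-sym (split (theta sgn 18 0) (α ℕ.* m))))) (≐-sym (≐-trans (⊗-cong q^0 ≐-refl) (Ring.*-identityˡ _))))
        (solve 3 (λ j y w → j :* y :* w := y :* (j :* w)) ≐-refl (J.j i) (q^ (α ℕ.* m)) (q^ (0 ℕ.* b) ⊗ E₉ (b ℕ.+ b))))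
      where
      lemma : ∀ x a i m → x ℤ.+ a ℤ.* i ℤ.+ a ℤ.* (m ℤ.- i) ≡ x ℤ.+ a ℤ.* m
      lemma = solve-∀
      exponent : expo A i ℤ.+ + (α ℕ.* b) ≡ expo (theta sgn 18 0) i ℤ.+ + (α ℕ.* m)
      exponent = trans (cong₂ ℤ._+_ (A₁₈ i) (trans (ℤ.pos-* α b) (cong (+ α ℤ.*_) (sym p≡)))) (trans (lemma (expo (theta sgn 18 0) i) (+ α) i (+ m)) (cong (ℤ._+_ (expo (theta sgn 18 0) i)) (sym (ℤ.pos-* α m))))
    go -[1+ b ] p≡ = ≐-trans (≐-sym (Ring.*-assoc _ _ _)) (≐-trans (⊗-cong (≐-trans (split A (β ℕ.* suc b)) (≐-trans (mono-cong refl exponent)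
            (≐-trans (≐-sym (split (theta sgn 18 0) _)) (⊗-cong ≐-refl (q^-+ (α ℕ.* m) (18 ℕ.* suc b)))))) ≐-refl)
        (solve 4 (λ j y z w → j :* (y :* z) :* w := y :* (j :* (z :* w))) ≐-refl (J.j i) (q^ (α ℕ.* m)) (q^ (18 ℕ.* suc b)) (E₉ (suc b ℕ.+ suc b))))
      where
      i≡ : i ≡ + m ℤ.+ + suc b
      i≡ = trans (lemma (+ m) i) (cong (λ z → + m ℤ.+ ℤ.- z) p≡)
        where
        lemma : ∀ m i → i ≡ m ℤ.+ ℤ.- (m ℤ.- i)
        lemma = solve-∀
      lemma : ∀ x a b m s → x ℤ.+ a ℤ.* (m ℤ.+ s) ℤ.+ b ℤ.* s ≡ x ℤ.+ (a ℤ.* m ℤ.+ (a ℤ.+ b) ℤ.* s)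
      lemma = solve-∀
      exponent : expo A i ℤ.+ + (β ℕ.* suc b) ≡ expo (theta sgn 18 0) i ℤ.+ + (α ℕ.* m ℕ.+ 18 ℕ.* suc b)
      exponent = trans (cong₂ ℤ._+_ (trans (A₁₈ i) (cong (λ z → expo (theta sgn 18 0) i ℤ.+ + α ℤ.* z) i≡)) (ℤ.pos-* β (suc b)))
        (trans (lemma (expo (theta sgn 18 0) i) (+ α) (+ β) (+ m) (+ suc b)) (cong (ℤ._+_ (expo (theta sgn 18 0) i)) (cong₂ ℤ._+_ (sym (ℤ.pos-* α m)) (trans (cong (ℤ._* + suc b) (cong +_ e)) (sym (ℤ.pos-* 18 (suc b)))))))

  ρ-neg : ∀ α β p → ρ α β (ℤ.- p) ≐ ρ β α p
  ρ-neg α β (+ zero)  = ⊗-cong (q^-cong (trans (ℕ.*-zeroʳ α) (sym (ℕ.*-zeroʳ β)))) ≐-refl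
  ρ-neg α β (+ suc k) = ≐-refl
  ρ-neg α β -[1+ k ]  = ≐-refl

  convolve⁺ : ∀ α β → α ℕ.+ β ≡ 18 → ∀ m → HasSum (λ i → mono (sgn i) (expo (theta sgn β α) i) ⊗ ρ α β (+ m ℤ.- i)) (q^ (α ℕ.* m) ⊗ c (+ m))
  convolve⁺ α β e m = HasSum-cong (λ i → ≐-sym (term α β e m i (+ m ℤ.- i) refl)) ≐-refl (HasSum-⊗ (q^ (α ℕ.* m)) (HasSum-c (+ m)))

  convolve⁻ : ∀ α β → α ℕ.+ β ≡ 18 → ∀ m → HasSum (λ i → mono (sgn i) (expo (theta sgn β α) i) ⊗ ρ α β (ℤ.- (+ m) ℤ.- i)) (q^ (β ℕ.* m) ⊗ c (+ m))
  convolve⁻ α β e m = HasSum-cong reflected ≐-refl (HasSum-reindex ℤ-neg (convolve⁺ β α (trans (ℕ.+-comm β α) e) m))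
    where
    lemma : ∀ m i → ℤ.- (m ℤ.- ℤ.- i) ≡ ℤ.- m ℤ.- i
    lemma = solve-∀
    reflected : ∀ i → mono (sgn (ℤ.- i)) (expo (theta sgn α β) (ℤ.- i)) ⊗ ρ β α (+ m ℤ.- ℤ.- i) ≐ mono (sgn i) (expo (theta sgn β α) i) ⊗ ρ α β (ℤ.- (+ m) ℤ.- i)
    reflected i = ⊗-cong (mono-cong (sgn-neg i) (trans (cong (λ z → + α ℤ.* tri (ℤ.- i) ℤ.+ + β ℤ.* tri z) (ℤ.neg-involutive i)) (ℤ.+-comm (+ α ℤ.* tri (ℤ.- i)) (+ β ℤ.* tri i))))
      (≐-trans (≐-sym (ρ-neg α β (+ m ℤ.- ℤ.- i))) (eq λ k → cong (λ l → ρ α β l k) (lemma (+ m) i)))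

  r-step : ∀ k → E₉ (k ℕ.+ k) ⊕ q^ (18 ℕ.* suc k) ⊗ E₉ (suc k ℕ.+ suc k) ≐ C₉
  r-step k = ≐-trans (⊕-cong ≐-refl (⊗-cong (q^-cong (exponent k)) (eq λ m → cong (λ l → E₉ l m) (cong suc (ℕ.+-suc k k))))) (Nine.E+E (k ℕ.+ k))
    where
    exponent : ∀ k → 18 ℕ.* suc k ≡ 9 ℕ.* (2 ℕ.+ (k ℕ.+ k))
    exponent = ℕ-Ring.solve-∀

  -- In convolution form, c(m) + (-q^(18m)) c(m) = C₉ ∑ j = 0.
  c-vanish : ∀ m → c (+ suc m) ≐ 𝟘
  c-vanish m = cancel (𝟙 ⊖ q^ (18 ℕ.* suc m) ⊗ 𝟙) (q-perturbation (18 ℕ.* suc m) 𝟙 (s≤s z≤n)) (combine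
      ((𝟙 · HasSum-unique (HasSum-cong r-recurrence ≐-refl (HasSum-⊕ ℤ._≟_ (HasSum-c (+ suc m)) (HasSum-reindex (ℤ-shift (ℤ.- 1ℤ)) (HasSum-⊗ (⊝ q^ (18 ℕ.* suc m)) (HasSum-c (+ suc m))))))
        (HasSum-cong (λ i → ⊗-comm C₉ (J.j i)) (Ring.zeroʳ C₉) (HasSum-⊗ C₉ J.HasSum-j))) ∷ [])
    (solve 2 (λ y a → (con 1ℤ :- y :* con 1ℤ) :* a :- (con 1ℤ :- y :* con 1ℤ) :* con 0ℤ := con 1ℤ :* (a :+ (:- y) :* a :- con 0ℤ) :+ con 0ℤ) ≐-refl (q^ (18 ℕ.* suc m)) (c (+ suc m))))
    where
    expoʲ : ℤ → ℤ
    expoʲ = expo (theta sgn 18 0)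
    expoʲ≡ : ∀ i → expoʲ i ≡ + 18 ℤ.* tri i
    expoʲ≡ i = ℤ.+-identityʳ _
    i≡ : ∀ i → i ≡ 1ℤ ℤ.+ (i ℤ.- 1ℤ)
    i≡ = solve-∀
    flip : ∀ i → J.j (i ℤ.- 1ℤ) ≐ ⊝ mono (sgn i) (expoʲ (i ℤ.- 1ℤ))
    flip i = ≐-trans (mono-coef (expoʲ (i ℤ.- 1ℤ)) (trans (sym (ℤ.neg-involutive _)) (cong ℤ.-_ (sym (trans (cong sgn (i≡ i)) (sgn-suc (i ℤ.- 1ℤ))))))) (≐-sym (mono-⊝ (sgn i) (expoʲ (i ℤ.- 1ℤ))))
    base : ∀ i → expoʲ i ℤ.+ + 18 ℤ.* (+ suc m ℤ.- i ℤ.+ 1ℤ) ≡ expoʲ (i ℤ.- 1ℤ) ℤ.+ + (18 ℕ.* suc m)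
    base i = trans (cong (ℤ._+ + 18 ℤ.* (+ suc m ℤ.- i ℤ.+ 1ℤ)) (trans (expoʲ≡ i) (cong (ℤ._*_ (+ 18)) (trans (cong tri (i≡ i)) (tri-suc (i ℤ.- 1ℤ))))))
      (trans (lemma (tri (i ℤ.- 1ℤ)) i (+ suc m)) (cong₂ ℤ._+_ (sym (expoʲ≡ (i ℤ.- 1ℤ))) (sym (ℤ.pos-* 18 (suc m)))))
      where
      lemma : ∀ t i m → + 18 ℤ.* (t ℤ.+ (i ℤ.- 1ℤ)) ℤ.+ + 18 ℤ.* (m ℤ.- i ℤ.+ 1ℤ) ≡ + 18 ℤ.* t ℤ.+ + 18 ℤ.* m
      lemma = solve-∀
    index : ∀ m i → m ℤ.- (i ℤ.- 1ℤ) ≡ m ℤ.- i ℤ.+ 1ℤ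
    index = solve-∀
    core : ∀ i p → + suc m ℤ.- i ≡ p → J.j i ⊗ r p ⊕ q^ (18 ℕ.* suc m) ⊗ (mono (sgn i) (expoʲ (i ℤ.- 1ℤ)) ⊗ r (p ℤ.+ 1ℤ)) ≐ J.j i ⊗ C₉
    core i p p≡ = go p (trans (cong (λ z → expoʲ i ℤ.+ + 18 ℤ.* (z ℤ.+ 1ℤ)) (sym p≡)) (base i))
      where
      x : Series
      x = q^ (18 ℕ.* suc m)
      y : Series
      y = mono (sgn i) (expoʲ (i ℤ.- 1ℤ))
      yx : y ⊗ x ≐ mono (sgn i) (expoʲ (i ℤ.- 1ℤ) ℤ.+ + (18 ℕ.* suc m))
      yx = ≐-trans (Ring.*-assoc _ _ _) (⊗-cong ≐-refl (≐-sym (qz-+ (0≤expo (theta sgn 18 0) (i ℤ.- 1ℤ)) 0≤+n)))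
      go : ∀ p → expoʲ i ℤ.+ + 18 ℤ.* (p ℤ.+ 1ℤ) ≡ expoʲ (i ℤ.- 1ℤ) ℤ.+ + (18 ℕ.* suc m) →
           J.j i ⊗ r p ⊕ x ⊗ (y ⊗ r (p ℤ.+ 1ℤ)) ≐ J.j i ⊗ C₉
      go (+ b) e = combine ((J.j i · r-step b) ∷ (E₉ (suc b ℕ.+ suc b) · shifted) ∷ (J.j i ⊗ E₉ (b ℕ.+ b) · q^0) ∷ (x ⊗ y ⊗ E₉ (suc b ℕ.+ suc b) · q^0) ∷ (x ⊗ y · r-index) ∷ [])
          (solve 9 (λ j e₀ e₁ z c₉ x y o r₁ → j :* (o :* e₀) :+ x :* (y :* r₁) :- j :* c₉
            := j :* (e₀ :+ z :* e₁ :- c₉) :+ (e₁ :* (y :* x :- j :* z) :+ (j :* e₀ :* (o :- con 1ℤ) :+ (x :* y :* e₁ :* (o :- con 1ℤ) :+ (x :* y :* (r₁ :- o :* e₁) :+ con 0ℤ)))))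
            ≐-refl (J.j i) (E₉ (b ℕ.+ b)) (E₉ (suc b ℕ.+ suc b)) (q^ (18 ℕ.* suc b)) C₉ x y (q^ 0) (r (+ b ℤ.+ 1ℤ)))
        where
        r-index : r (+ b ℤ.+ 1ℤ) ≐ q^ 0 ⊗ E₉ (suc b ℕ.+ suc b)
        r-index = eq λ k → cong (λ l → r (+ l) k) (ℕ.+-comm b 1)
        shifted : y ⊗ x ≐ J.j i ⊗ q^ (18 ℕ.* suc b)
        shifted = ≐-trans yx (≐-trans (mono-cong refl (trans (sym e) (cong (ℤ._+_ (expoʲ i)) (trans (cong (ℤ._*_ (+ 18)) (cong +_ (ℕ.+-comm b 1))) (sym (ℤ.pos-* 18 (suc b)))))))
          (≐-trans (⊗-cong ≐-refl (qz-+ (0≤expo (theta sgn 18 0) i) 0≤+n)) (≐-sym (Ring.*-assoc _ _ _))))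
      go -[1+ b ] e = combine ((y ⊗ x ⊗ z₀ · r-step b) ∷ (z ⊗ E₉ (suc b ℕ.+ suc b) ⊖ C₉ · j≐) ∷ (x ⊗ y · r-index) ∷ [])
          (solve 9 (λ j e₀ e₁ z z₀ c₉ x y r₁ → j :* (z :* e₁) :+ x :* (y :* r₁) :- j :* c₉
            := y :* x :* z₀ :* (e₀ :+ z :* e₁ :- c₉) :+ ((z :* e₁ :- c₉) :* (j :- y :* x :* z₀) :+ (x :* y :* (r₁ :- z₀ :* e₀) :+ con 0ℤ)))
            ≐-refl (J.j i) (E₉ (b ℕ.+ b)) (E₉ (suc b ℕ.+ suc b)) z z₀ C₉ x y (r (-[1+ b ] ℤ.+ 1ℤ)))
        where
        z z₀ : Series
        z  = q^ (18 ℕ.* suc b)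
        z₀ = q^ (18 ℕ.* b)
        -b : ∀ b → -[1+ b ] ℤ.+ 1ℤ ≡ ℤ.- (+ b)
        -b zero    = refl
        -b (suc b) = refl
        r-index : r (-[1+ b ] ℤ.+ 1ℤ) ≐ z₀ ⊗ E₉ (b ℕ.+ b)
        r-index = ≐-trans (eq λ k → cong (λ l → r l k) (-b b)) (ρ-neg 0 18 (+ b))
        lemma : ∀ e b → e ≡ e ℤ.+ + 18 ℤ.* ℤ.- b ℤ.+ + 18 ℤ.* b
        lemma = solve-∀
        exponent : expoʲ i ≡ expoʲ (i ℤ.- 1ℤ) ℤ.+ + (18 ℕ.* suc m) ℤ.+ + (18 ℕ.* b)
        exponent = trans (lemma (expoʲ i) (+ b)) (cong₂ ℤ._+_ (trans (cong (λ u → expoʲ i ℤ.+ + 18 ℤ.* u) (sym (-b b))) e) (sym (ℤ.pos-* 18 b)))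
        j≐ : J.j i ≐ y ⊗ x ⊗ z₀
        j≐ = ≐-trans (⊗-cong ≐-refl (≐-trans (qz-cong exponent) (qz-+ (0≤+ (0≤expo (theta sgn 18 0) (i ℤ.- 1ℤ)) 0≤+n) 0≤+n)))
               (≐-trans (≐-sym (Ring.*-assoc _ _ _)) (⊗-cong (≐-sym yx) ≐-refl))
    r-recurrence : ∀ i → J.j i ⊗ r (+ suc m ℤ.- i) ⊕ ⊝ q^ (18 ℕ.* suc m) ⊗ (J.j (i ℤ.+ ℤ.- 1ℤ) ⊗ r (+ suc m ℤ.- (i ℤ.+ ℤ.- 1ℤ))) ≐ J.j i ⊗ C₉
    r-recurrence i = ≐-trans (⊕-cong ≐-refl (≐-trans (⊗-cong ≐-refl (⊗-cong (flip i) (eq λ k → cong (λ l → r l k) (index (+ suc m) i))))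
        (solve 3 (λ x y z → (:- x) :* ((:- y) :* z) := x :* (y :* z)) ≐-refl _ _ _))) (core i (+ suc m ℤ.- i) refl)

  c-neg-vanish : ∀ m → c -[1+ m ] ≐ 𝟘
  c-neg-vanish m = ≐-trans (HasSum-unique (HasSum-c -[1+ m ]) (convolve⁻ 0 18 refl (suc m)))
    (≐-trans (⊗-cong ≐-refl (c-vanish m)) (Ring.zeroʳ _))

  concentrated : ∀ (f : ℤ → Series) → (∀ m → f (+ suc m) ≐ 𝟘) → (∀ m → f -[1+ m ] ≐ 𝟘) → HasSum f (f 0ℤ)
  concentrated f p q = HasSum-cong (λ _ → ≐-refl) (solve 1 (λ a → a :+ con 0ℤ :+ con 0ℤ := a) ≐-refl (f 0ℤ))
    (HasSum-halves (HasSum-suc (HasSum-cong (λ m → ≐-sym (p m)) ≐-refl zeros)) (HasSum-cong (λ m → ≐-sym (q m)) ≐-refl zeros))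
    where
    zeros : HasSum {ℕ} (λ _ → 𝟘) 𝟘
    zeros = HasSum-cong (λ _ → Ring.zeroˡ _) (Ring.zeroˡ _) (HasSum-⊗ 𝟘 (One.HasSum-E 0))

  k≤k+k : ∀ {N k} → N ≤ k → N ≤ k ℕ.+ k
  k≤k+k {k = k} N≤k = ℕ.≤-trans N≤k (ℕ.m≤m+n k k)

  -- The product of j with the series of r is concentrated in degree 0, and the derivative at x = 1
  -- evaluates this one coefficient.
  κC₉ : ⟦ κ 18 ⟧ ⊗ C₉ ≐ c 0ℤ
  κC₉ = J.convolution-limit {a = r}
    (λ N k N≤k → ≈-trans (≐⇒≈ (≐-trans (⊗-cong q^0 ≐-refl) (Ring.*-identityˡ _))) (≈-weaken (k≤k+k N≤k) (Nine.E≈C (k ℕ.+ k))))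
    (λ N k N≤k → q^⊗-vanish _ (ℕ.≤-trans N≤k (ℕ.≤-trans (ℕ.n≤1+n k) (ℕ.m≤n*m (suc k) 18))))
    HasSum-c
    (concentrated c c-vanish c-neg-vanish)
    (concentrated (λ k → # k ⊗ c k) (λ m → ≐-trans (⊗-cong ≐-refl (c-vanish m)) (Ring.zeroʳ _)) (λ m → ≐-trans (⊗-cong ≐-refl (c-neg-vanish m)) (Ring.zeroʳ _)))

-- The bilateral sum of `r` at x = q⁶, where j(x; q¹⁸) becomes ε(q⁶). Every term has nonnegative
-- coefficients, which the closed form Ψ²/(4 ε(q⁶)) would not show alongside `g₉`.
Θ : Series
Θ = sumℕ (λ k → q^ (6 ℕ.* k) ⊗ E₉ (k ℕ.+ k)) ⊕ sumℕ (λ k → q^ (12 ℕ.* suc k) ⊗ E₉ (suc k ℕ.+ suc k))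

HasSum-Θ₊ : HasSum (λ k → q^ (6 ℕ.* k) ⊗ E₉ (k ℕ.+ k)) (sumℕ (λ k → q^ (6 ℕ.* k) ⊗ E₉ (k ℕ.+ k)))
HasSum-Θ₊ = HasSum-ℕ λ N k N≤k → q^⊗-vanish _ (ℕ.≤-trans N≤k (ℕ.≤-trans (ℕ.m≤n+m k 2) (ℕ.m≤n*m (2 ℕ.+ k) 6)))

HasSum-Θ₋ : HasSum (λ k → q^ (12 ℕ.* suc k) ⊗ E₉ (suc k ℕ.+ suc k)) (sumℕ (λ k → q^ (12 ℕ.* suc k) ⊗ E₉ (suc k ℕ.+ suc k)))
HasSum-Θ₋ = HasSum-ℕ λ N k N≤k → q^⊗-vanish _ (ℕ.≤-trans N≤k (ℕ.≤-trans (ℕ.m≤n+m k 3) (ℕ.m≤n*m (3 ℕ.+ k) 12)))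

εΘ : ⟦ ε 6 ⟧ ⊗ Θ ≐ ⟦ κ 18 ⟧ ⊗ C₉
εΘ = ≐-trans (HasSum-unique
    (HasSum-Σ ℤ._≟_ {g = μ} (HasSum-reindex ℤ²-shear (HasSum-× (HasSum-θ (ε 6) (s≤s z≤n)) (HasSum-halves {f = ρ 6 12} HasSum-Θ₊ HasSum-Θ₋))) rows)
    (HasSum-cong (λ _ → ≐-refl) (≐-trans (⊗-cong q^0 ≐-refl) (Ring.*-identityˡ _)) (concentrated μ (λ m → ≐-trans (⊗-cong ≐-refl (c-vanish m)) (Ring.zeroʳ _)) (λ m → ≐-trans (⊗-cong ≐-refl (c-vanish m)) (Ring.zeroʳ _)))))
  (≐-sym κC₉)
  where
  open Reciprocal
  μ : ℤ → Series
  μ (+ m)    = q^ (6 ℕ.* m) ⊗ c (+ m)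
  μ -[1+ m ] = q^ (12 ℕ.* suc m) ⊗ c (+ suc m)
  rows : ∀ m → HasSum (λ i → mono (sgn i) (expo (ε 6) i) ⊗ ρ 6 12 (m ℤ.- i)) (μ m)
  rows (+ m)    = convolve⁺ 6 12 refl m
  rows -[1+ m ] = convolve⁻ 6 12 refl (suc m)

-- After multiplication by φ(q⁹), the inverse of C₉, both sides are 4κ(q¹⁸).
ΨΨ≐4Θε : ⟦ Ψ 9 ⟧ ⊗ ⟦ Ψ 9 ⟧ ≐ # (+ 4) ⊗ (Θ ⊗ ⟦ ε 6 ⟧)
ΨΨ≐4Θε = cancel ⟦ φ 9 ⟧ (φ-constant 9 (s≤s z≤n)) (combine
  ((𝟙 · φΨΨ 9 (s≤s z≤n)) ∷ (⊝ (# (+ 4) ⊗ ⟦ κ 18 ⟧) · Nine.φC≐𝟙) ∷ (⊝ (# (+ 4) ⊗ ⟦ φ 9 ⟧) · εΘ) ∷ [])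
  (solve 6 (λ f p k c t e → f :* (p :* p) :- f :* (con (+ 4) :* (t :* e))
     := con 1ℤ :* (f :* (p :* p) :- con (+ 4) :* k) :+ ((:- (con (+ 4) :* k)) :* (f :* c :- con 1ℤ) :+ ((:- (con (+ 4) :* f)) :* (e :* t :- k :* c) :+ con 0ℤ)))
    ≐-refl ⟦ φ 9 ⟧ ⟦ Ψ 9 ⟧ ⟦ κ 18 ⟧ C₉ Θ ⟦ ε 6 ⟧))

-- Positivity

Nonneg : Series → Set
Nonneg f = ∀ n → 0ℤ ℤ.≤ f n

ΣL-nonneg : ∀ {I : Set} {f : I → Series} → (∀ i → Nonneg (f i)) → ∀ L → Nonneg (ΣL f L)
ΣL-nonneg p []      n = ℤ.≤-reflexive (sym (𝟘-coeff n))
ΣL-nonneg p (i ∷ L)   = ⊕-nonneg (p i) (ΣL-nonneg p L)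

ΣL-≤ : ∀ {I : Set} {f : I → Series} {n} → (∀ i → Nonneg (f i)) → ∀ {K} M → Unique K → (∀ {x} → x ∈ K → x ∈ M ⊎ f x ≈[ suc n ] 𝟘) → ΣL f K n ℤ.≤ ΣL f M n
ΣL-≤ {f = f} {n} p {[]} M _ _ = subst (ℤ._≤ ΣL f M n) (sym (𝟘-coeff n)) (ΣL-nonneg p M n)
ΣL-≤ {f = f} {n} p {x ∷ K} M (x∉K ∷ u) K⊆M with K⊆M (here refl)
... | inj₂ z = subst (ℤ._≤ ΣL f M n) (sym (trans (⊕-coeff (f x) (ΣL f K) n) (trans (cong (ℤ._+ ΣL f K n) (trans (below z n ℕ.≤-refl) (𝟘-coeff n))) (ℤ.+-identityˡ _))))
                 (ΣL-≤ p M u (K⊆M ∘ there))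
... | inj₁ m = subst₂ ℤ._≤_ (sym (⊕-coeff (f x) (ΣL f K) n)) (sym (trans (at (ΣL-without f m) n) (⊕-coeff (f x) _ n)))
                 (ℤ.+-monoʳ-≤ (f x n) (ΣL-≤ p (without M m) u λ {y} y∈K → case K⊆M (there y∈K) of λ
                   { (inj₂ z) → inj₂ z
                   ; (inj₁ y∈M) → case without-split m y∈M of λ { (inj₁ refl) → ⊥-elim (All.lookup x∉K y∈K refl) ; (inj₂ r) → inj₁ r } }))

HasSum-coeff : ∀ {I : Set} {f : I → Series} {s} (h : HasSum f s) n → s n ≡ ΣL f (proj₁ (HasSum.support h (suc n))) n
HasSum-coeff h n = sym (below (proj₂ (proj₂ (HasSum.support h (suc n)))) n ℕ.≤-refl)

HasSum-nonneg : ∀ {I : Set} {f : I → Series} {s} → HasSum f s → (∀ i → Nonneg (f i)) → Nonneg s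
HasSum-nonneg h p n = subst (0ℤ ℤ.≤_) (sym (HasSum-coeff h n)) (ΣL-nonneg p (proj₁ (HasSum.support h (suc n))) n)

HasSum-≤ : ∀ {I J : Set} {f : J → Series} {s t} (ι : I → J) → (∀ {i k} → ι i ≡ ι k → i ≡ k) → HasSum f s → HasSum (f ∘ ι) t →
           (∀ i → Nonneg (f i)) → ∀ n → t n ℤ.≤ s n
HasSum-≤ {f = f} ι inj hs ht p n = subst₂ ℤ._≤_ (sym (trans (HasSum-coeff ht n) (sym (at (ΣL-map f ι (proj₁ (HasSum.support ht (suc n)))) n)))) (sym (HasSum-coeff hs n))
  (ΣL-≤ p _ (Unique.map⁺ inj (Covers.unique (proj₁ (proj₂ (HasSum.support ht (suc n)))))) λ {x} _ → Covers.outside (proj₁ (proj₂ (HasSum.support hs (suc n)))) x)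

HasSum-term-≤ : ∀ {I : Set} {f : I → Series} {s} → HasSum f s → (∀ i → Nonneg (f i)) → ∀ i n → f i n ℤ.≤ s n
HasSum-term-≤ {f = f} hs p i n = subst₂ ℤ._≤_ (at (Ring.+-identityʳ (f i)) n) (sym (HasSum-coeff hs n))
  (ΣL-≤ p {i ∷ []} _ ([] ∷ []) λ {x} _ → Covers.outside (proj₁ (proj₂ (HasSum.support hs (suc n)))) x)

mono-nonneg : ∀ e → Nonneg (mono 1ℤ e)
mono-nonneg (+ e)    n = subst (0ℤ ℤ.≤_) (sym (at (Ring.*-identityˡ (q^ e)) n)) (q^-nonneg e n)
mono-nonneg -[1+ e ] n = ℤ.≤-reflexive (sym (trans (at (Ring.zeroʳ (# 1ℤ)) n) (𝟘-coeff n)))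

θ-nonneg : ∀ a b → 0 < a ℕ.+ b → Nonneg ⟦ theta one a b ⟧
θ-nonneg a b nz = HasSum-nonneg (HasSum-θ (theta one a b) nz) λ i → mono-nonneg (expo (theta one a b) i)

θ-lower : ∀ a b → 0 < a ℕ.+ b → ∀ i n → expo (theta one a b) i ≡ + n → 1ℤ ℤ.≤ ⟦ theta one a b ⟧ n
θ-lower a b nz i n e = ℤ.≤-trans (ℤ.≤-reflexive (sym (trans (at (≐-trans (⊗-cong ≐-refl (qz-cong e)) (Ring.*-identityˡ (q^ n))) n) (q^-diagonal n))))
  (HasSum-term-≤ (HasSum-θ (theta one a b) nz) (λ i → mono-nonneg (expo (theta one a b) i)) i n)

-- Being a series in q³, stated through coefficients so that no root has to be extracted.
Cubic : Series → Set
Cubic f = ∀ n → ¬ 3 ∣ n → f n ≡ 0ℤ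

⊕-cubic : ∀ {f g} → Cubic f → Cubic g → Cubic (f ⊕ g)
⊕-cubic {f} {g} p r n 3∤n = trans (⊕-coeff f g n) (cong₂ ℤ._+_ (p n 3∤n) (r n 3∤n))

⊗-cubic : ∀ {f g} → Cubic f → Cubic g → Cubic (f ⊗ g)
⊗-cubic {f} {g} p r n 3∤n = ⊗-vanish-at f g n λ i j e → case 3 ℕ.∣? i of λ
  { (no  3∤i) → inj₁ (p i 3∤i)
  ; (yes 3∣i) → inj₂ (r j λ 3∣j → 3∤n (subst (3 ∣_) e (ℕ.∣m∣n⇒∣m+n 3∣i 3∣j))) }

⊝-cubic : ∀ {f} → Cubic f → Cubic (⊝ f)
⊝-cubic {f} p n 3∤n = trans (⊝-coeff f n) (cong ℤ.-_ (p n 3∤n))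

#-cubic : ∀ c → Cubic (# c)
#-cubic c zero    3∤0 = ⊥-elim (3∤0 (3 ℕ.∣0))
#-cubic c (suc n) _   = #-coeff₊ c n

q^-cubic : ∀ {m} → 3 ∣ m → Cubic (q^ m)
q^-cubic {m} 3∣m n 3∤n = q^-off-diagonal m n λ { refl → 3∤n 3∣m }

HasSum-cubic : ∀ {I : Set} {f : I → Series} {s} → HasSum f s → (∀ i → Cubic (f i)) → Cubic s
HasSum-cubic {f = f} h p n 3∤n = trans (HasSum-coeff h n) (go (proj₁ (HasSum.support h (suc n))))
  where
  go : ∀ L → ΣL f L n ≡ 0ℤ
  go []      = 𝟘-coeff n
  go (i ∷ L) = trans (⊕-coeff (f i) (ΣL f L) n) (cong₂ ℤ._+_ (p i n 3∤n) (go L))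

θ-cubic : ∀ c a b → 3 ∣ a → 3 ∣ b → 0 < a ℕ.+ b → Cubic ⟦ theta c a b ⟧
θ-cubic c a b 3∣a 3∣b nz = HasSum-cubic (HasSum-θ (theta c a b) nz) λ i → ⊗-cubic (#-cubic (c i)) (subst (Cubic ∘ qz) (sym (exponent i)) (q^-cubic (ℕ.∣m∣n⇒∣m+n (ℕ.∣m⇒∣m*n _ 3∣a) (ℕ.∣m⇒∣m*n _ 3∣b))))
  where
  exponent : ∀ i → expo (theta c a b) i ≡ + (a ℕ.* ℤ.∣ tri i ∣ ℕ.+ b ℕ.* ℤ.∣ tri (ℤ.- i) ∣)
  exponent i = trans (cong₂ (λ x y → + a ℤ.* x ℤ.+ + b ℤ.* y) (sym (ℤ.0≤i⇒+∣i∣≡i (0≤tri i))) (sym (ℤ.0≤i⇒+∣i∣≡i (0≤tri (ℤ.- i))))) (expo-ℕ a _ b _)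

module Partitions (s : ℕ) (0<s : 0 < s) where
  open Products s 0<s

  -- 1/((1-Q)...(1-Q^N))
  G : ℕ → Series
  G zero    = 𝟙
  G (suc N) = sumℕ (λ j → Q (j ℕ.* suc N) ⊗ G N)

  HasSum-G : ∀ N → HasSum (λ j → Q (j ℕ.* suc N) ⊗ G N) (G (suc N))
  HasSum-G N = HasSum-ℕ λ M j M≤j → Q-vanish (G N) 0<s (ℕ.≤-trans M≤j (ℕ.≤-trans (ℕ.m≤n+m j 2) (ℕ.m≤m*n (2 ℕ.+ j) (suc N))))

  G-suc : ∀ N → G (suc N) ≐ G N ⊕ Q (suc N) ⊗ G (suc N)
  G-suc N = ≐-trans (HasSum-unique (HasSum-G N) (HasSum-suc (HasSum-cong (λ j → ≐-trans (≐-sym (Ring.*-assoc _ _ _)) (⊗-cong (≐-sym (Q-+ (suc N) (j ℕ.* suc N))) ≐-refl)) ≐-refl (HasSum-⊗ (Q (suc N)) (HasSum-G N)))))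
    (⊕-cong (≐-trans (⊗-cong Q-0 ≐-refl) (Ring.*-identityˡ (G N))) ≐-refl)

  P⊗G : ∀ N → P N ⊗ G N ≐ 𝟙
  P⊗G zero    = Ring.*-identityˡ 𝟙
  P⊗G (suc N) = combine ((P N · G-suc N) ∷ (𝟙 · P⊗G N) ∷ [])
    (solve 4 (λ p g g₁ y → p :* (con 1ℤ :- y) :* g₁ :- con 1ℤ := p :* (g₁ :- (g :+ y :* g₁)) :+ (con 1ℤ :* (p :* g :- con 1ℤ) :+ con 0ℤ)) ≐-refl (P N) (G N) (G (suc N)) (Q (suc N)))

  G-stable : ∀ N k → G N ≈[ N ] G (k ℕ.+ N)
  G-stable N zero    = ≈-refl
  G-stable N (suc k) = ≈-trans (G-stable N k) (≈-sym (≈-trans (≐⇒≈ (G-suc (k ℕ.+ N)))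
    (≈-trans (⊕-cong≈ ≈-refl (Q-vanish (G (suc (k ℕ.+ N))) 0<s (ℕ.m≤n⇒m≤1+n (ℕ.m≤n+m N k)))) (≐⇒≈ (Ring.+-identityʳ _)))))

  U : Series
  U n = G (suc n) n

  U≈G : ∀ N → U ≈[ N ] G N
  U≈G N = eq< λ n n<N → subst (λ m → G (suc n) n ≡ G m n) (ℕ.m∸n+n≡m n<N) (below (G-stable (suc n) (N ℕ.∸ suc n)) n ℕ.≤-refl)

  εU≐𝟙 : ⟦ ε s ⟧ ⊗ U ≐ 𝟙
  εU≐𝟙 = ≈⇒≐ λ N → ≈-trans (⊗-cong≈ (ε≈P N) (U≈G N)) (≐⇒≈ (P⊗G N))

  G-nonneg : ∀ N → Nonneg (G N)
  G-nonneg zero    = 𝟙-nonneg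
  G-nonneg (suc N) = HasSum-nonneg (HasSum-G N) λ j → ⊗-nonneg (q^-nonneg (s ℕ.* (j ℕ.* suc N))) (G-nonneg N)

  G-cubic : 3 ∣ s → ∀ N → Cubic (G N)
  G-cubic 3∣s zero    = #-cubic 1ℤ
  G-cubic 3∣s (suc N) = HasSum-cubic (HasSum-G N) λ j → ⊗-cubic (q^-cubic (ℕ.∣m⇒∣m*n (j ℕ.* suc N) 3∣s)) (G-cubic 3∣s N)

  U-nonneg : Nonneg U
  U-nonneg n = G-nonneg (suc n) n

  U-cubic : 3 ∣ s → Cubic U
  U-cubic 3∣s n 3∤n = G-cubic 3∣s (suc n) n 3∤n

  -- Already the factor 1/(1 - Q) contributes Q^k, and the other factors only add.
  1≤U : ∀ k → 1ℤ ℤ.≤ U (s ℕ.* k)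
  1≤U k = 1≤G (s ℕ.* k)
    where
    1≤G : ∀ N → 1ℤ ℤ.≤ G (suc N) (s ℕ.* k)
    1≤G zero    = ℤ.≤-trans (ℤ.≤-reflexive (sym (trans (at (≐-trans (Ring.*-identityʳ _) (Q-cong (ℕ.*-identityʳ k))) (s ℕ.* k)) (q^-diagonal (s ℕ.* k)))))
      (HasSum-term-≤ (HasSum-G 0) (λ j → ⊗-nonneg (q^-nonneg (s ℕ.* (j ℕ.* 1))) 𝟙-nonneg) k (s ℕ.* k))
    1≤G (suc N) = ℤ.≤-trans (1≤G N) (subst₂ ℤ._≤_ (ℤ.+-identityʳ _) (sym (trans (at (G-suc (suc N)) (s ℕ.* k)) (⊕-coeff (G (suc N)) _ (s ℕ.* k))))
      (ℤ.+-monoʳ-≤ (G (suc N) (s ℕ.* k)) (⊗-nonneg (q^-nonneg (s ℕ.* suc (suc N))) (G-nonneg (suc (suc N))) (s ℕ.* k))))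

-- The three dissection components

-- `g₉` gathers the multiples of E₉ by which v₀(k) - v₁(k) exceeds the difference of the
-- corresponding E₁, after removal of q².
difference-series gap g₉ : Series
gap = sumℕ (λ k → E₁ (k ℕ.* 3) ⊖ E₁ (1 ℕ.+ k ℕ.* 3))
difference-series = C₁ ⊕ # (+ 6) ⊗ gap
g₉ = sumℕ (λ k → q^ (3 ℕ.* k) ⊗ E₉ k) ⊕ sumℕ (λ k → q^ (6 ℕ.* suc k) ⊗ E₉ (suc k))

HasSum-gap : HasSum (λ k → E₁ (k ℕ.* 3) ⊖ E₁ (1 ℕ.+ k ℕ.* 3)) gap
HasSum-gap = HasSum-ℕ λ N i N≤i → ≈-trans
  (⊕-cong≈ (E≈ N (2 ℕ.+ i) ((2 ℕ.+ i) ℕ.* 3) (ℕ.≤-trans N≤i (ℕ.m≤n+m i 2)) (ℕ.m≤m*n (2 ℕ.+ i) 3))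
    (⊝-cong≈ (E≈ N (2 ℕ.+ i) (1 ℕ.+ (2 ℕ.+ i) ℕ.* 3) (ℕ.≤-trans N≤i (ℕ.m≤n+m i 2)) (ℕ.m≤n⇒m≤1+n (ℕ.m≤m*n (2 ℕ.+ i) 3)))))
  (≐⇒≈ (solve 1 (λ c → c :- c := con 0ℤ) ≐-refl C₁))
  where
  E≈ : ∀ N i m → N ≤ i → i ≤ m → E₁ m ≈[ N ] C₁
  E≈ N i m N≤i i≤m = ≈-weaken (ℕ.≤-trans N≤i i≤m) (One.E≈C m)

private
  HasSum-g₊ : HasSum (λ k → q^ (3 ℕ.* k) ⊗ E₉ k) (sumℕ (λ k → q^ (3 ℕ.* k) ⊗ E₉ k))
  HasSum-g₊ = HasSum-ℕ λ N k N≤k → q^⊗-vanish _ (ℕ.≤-trans N≤k (ℕ.≤-trans (ℕ.m≤n+m k 2) (ℕ.m≤n*m (2 ℕ.+ k) 3)))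

  HasSum-g₋ : HasSum (λ k → q^ (6 ℕ.* suc k) ⊗ E₉ (suc k)) (sumℕ (λ k → q^ (6 ℕ.* suc k) ⊗ E₉ (suc k)))
  HasSum-g₋ = HasSum-ℕ λ N k N≤k → q^⊗-vanish _ (ℕ.≤-trans N≤k (ℕ.≤-trans (ℕ.m≤n+m k 3) (ℕ.m≤n*m (3 ℕ.+ k) 6)))

  E₉-nonneg : ∀ m → Nonneg (E₉ m)
  E₉-nonneg m = HasSum-nonneg (Nine.HasSum-E m) λ i → ⊗-nonneg (q^-nonneg (9 ℕ.* i)) (Nine.D-nonneg (m ℕ.+ i) i)

  D₉-cubic : ∀ i j → Cubic (Nine.D i j)
  D₉-cubic zero    j       = #-cubic 1ℤ
  D₉-cubic (suc i) zero    = #-cubic 1ℤ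
  D₉-cubic (suc i) (suc j) = ⊕-cubic (D₉-cubic i (suc j)) (⊕-cubic (⊗-cubic (q^-cubic (3∣9* (suc i))) (D₉-cubic (suc i) j)) (⊗-cubic (q^-cubic (3∣9* i)) (D₉-cubic i j)))
    where
    3∣9* : ∀ k → 3 ∣ 9 ℕ.* k
    3∣9* k = ℕ.∣m⇒∣m*n k (ℕ.divides 3 refl)

  E₉-cubic : ∀ m → Cubic (E₉ m)
  E₉-cubic m = HasSum-cubic (Nine.HasSum-E m) λ i → ⊗-cubic (q^-cubic (ℕ.∣m⇒∣m*n i (ℕ.divides 3 refl))) (D₉-cubic (m ℕ.+ i) i)

  1≤E₉ : ∀ m → 1ℤ ℤ.≤ E₉ m 0
  1≤E₉ m = ℤ.≤-trans (ℤ.≤-reflexive (sym (trans (at (Nine.first-term (m ℕ.+ 0)) 0) (#-coeff₀ 1ℤ))))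
    (HasSum-term-≤ (Nine.HasSum-E m) (λ i → ⊗-nonneg (q^-nonneg (9 ℕ.* i)) (Nine.D-nonneg (m ℕ.+ i) i)) 0 0)

W≐ : W ≐ gap ⊕ q^ 2 ⊗ g₉
W≐ = HasSum-unique HasSum-W (HasSum-cong term (≐-trans (⊕-cong ≐-refl (≐-sym (Ring.distribˡ (q^ 2) _ _))) ≐-refl)
    (HasSum-⊕ ℕ._≟_ HasSum-gap (HasSum-⊕ ℕ._≟_ (HasSum-⊗ (q^ 2) HasSum-g₊) (HasSum-⊗ (q^ 2) HasSum-g₋))))
  where
  term : ∀ k → E₁ (k ℕ.* 3) ⊖ E₁ (1 ℕ.+ k ℕ.* 3) ⊕ (q^ 2 ⊗ (q^ (3 ℕ.* k) ⊗ E₉ k) ⊕ q^ 2 ⊗ (q^ (6 ℕ.* suc k) ⊗ E₉ (suc k))) ≐ v₀ k ⊖ v₁ k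
  term k = combine ((⊝ E₉ k · ≐-trans (q^-cong (cong (ℕ._+_ 2) (ℕ.*-comm k 3))) (q^-+ 2 (3 ℕ.* k))) ∷ (⊝ E₉ (suc k) · ≐-trans (q^-cong (exponent k)) (q^-+ 2 (6 ℕ.* suc k))) ∷ [])
    (solve 9 (λ a b x y z y′ z′ e f → a :- b :+ (x :* (y :* e) :+ x :* (z :* f)) :- (a :+ y′ :* e :- (b :- z′ :* f))
      := (:- e) :* (y′ :- x :* y) :+ ((:- f) :* (z′ :- x :* z) :+ con 0ℤ))
      ≐-refl (E₁ (k ℕ.* 3)) (E₁ (1 ℕ.+ k ℕ.* 3)) (q^ 2) (q^ (3 ℕ.* k)) (q^ (6 ℕ.* suc k)) (q^ (2 ℕ.+ k ℕ.* 3)) (q^ (8 ℕ.+ (k ℕ.* 3 ℕ.+ k ℕ.* 3))) (E₉ k) (E₉ (suc k)))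
    where
    exponent : ∀ k → 8 ℕ.+ (k ℕ.* 3 ℕ.+ k ℕ.* 3) ≡ 2 ℕ.+ 6 ℕ.* suc k
    exponent = ℕ-Ring.solve-∀

module Six = Partitions 6 (s≤s z≤n)

-- The difference series is M - 6q² g₉, and M = U (σ² + στ + τ²). The last square is q² Ψ(q⁹)² = 4q²
-- Θ ε(q⁶), whose last factor cancels against U.
dissection : difference-series ≐ Six.U ⊗ (⟦ σ ⟧ ⊗ ⟦ σ ⟧) ⊕ q^ 1 ⊗ (Six.U ⊗ (⟦ σ ⟧ ⊗ ⟦ Ψ 9 ⟧)) ⊕ q^ 2 ⊗ (# (+ 4) ⊗ Θ ⊖ # (+ 6) ⊗ g₉)
dissection = combine
  ((U · M≐) ∷ (⊝ M ⊕ x ⊗ x ⊗ # (+ 4) ⊗ Θ · Six.εU≐𝟙) ∷ (⊝ # (+ 6) · W≐) ∷ (x ⊗ x ⊗ U · ΨΨ≐4Θε) ∷ (⊝ (# (+ 4) ⊗ Θ) · q^-+ 1 1) ∷ [])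
  (solve 11 (λ u e c w g g₉ s p t x y → c :+ con (+ 6) :* g :- (u :* (s :* s) :+ x :* (u :* (s :* p)) :+ y :* (con (+ 4) :* t :- con (+ 6) :* g₉))
     := u :* ((c :+ con (+ 6) :* w) :* e :- (s :* s :+ s :* (x :* p) :+ x :* p :* (x :* p)))
        :+ ((:- (c :+ con (+ 6) :* w) :+ x :* x :* con (+ 4) :* t) :* (e :* u :- con 1ℤ)
        :+ ((:- con (+ 6)) :* (w :- (g :+ y :* g₉))
        :+ (x :* x :* u :* (p :* p :- con (+ 4) :* (t :* e))
        :+ ((:- (con (+ 4) :* t)) :* (y :- x :* x) :+ con 0ℤ)))))
    ≐-refl U ⟦ ε 6 ⟧ C₁ W gap g₉ ⟦ σ ⟧ ⟦ Ψ 9 ⟧ Θ x (q^ 2))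
  where
  U x : Series
  U = Six.U
  x = q^ 1

private
  residue-unique : ∀ {r r′} a b → r < 3 → r′ < 3 → r ℕ.+ a ℕ.* 3 ≡ r′ ℕ.+ b ℕ.* 3 → r ≡ r′
  residue-unique {r} {r′} a b r<3 r′<3 e = trans (sym (mod r a r<3)) (trans (cong (ℕ._% 3) e) (mod r′ b r′<3))
    where
    mod : ∀ r a → r < 3 → (r ℕ.+ a ℕ.* 3) ℕ.% 3 ≡ r
    mod r a r<3 = trans (ℕ.[m+kn]%n≡m%n r a 3) (ℕ.m<n⇒m%n≡m r<3)

  shifted-cubic-vanish : ∀ {f m r} k → m < 3 → r < 3 → m ≢ r → Cubic f → (q^ m ⊗ f) (r ℕ.+ k ℕ.* 3) ≡ 0ℤ
  shifted-cubic-vanish {f} {m} {r} k m<3 r<3 m≢r p = ⊗-vanish-at (q^ m) f (r ℕ.+ k ℕ.* 3) λ i j e → case m ℕ.≟ i of λ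
    { (no  m≢i)  → inj₁ (q^-off-diagonal m i m≢i)
    ; (yes refl) → inj₂ (p j λ { (ℕ.divides a refl) → m≢r (residue-unique a k m<3 r<3 e) }) }

  cubic-vanish : ∀ {f r} k → r < 3 → 0 ≢ r → Cubic f → f (r ℕ.+ k ℕ.* 3) ≡ 0ℤ
  cubic-vanish {f} k r<3 0≢r p = trans (sym (at (≐-trans (⊗-cong q^0 ≐-refl) (Ring.*-identityˡ f)) _)) (shifted-cubic-vanish k (s≤s z≤n) r<3 0≢r p)

  1≤* : ∀ {a b} → 1ℤ ℤ.≤ a → 1ℤ ℤ.≤ b → 1ℤ ℤ.≤ a ℤ.* b
  1≤* {a} {b} p r = ℤ.≤-trans r (subst (ℤ._≤ a ℤ.* b) (ℤ.*-identityˡ b) (ℤ.*-monoʳ-≤-nonNeg b {{ℤ.nonNegative (ℤ.≤-trans (ℤ.+≤+ z≤n) r)}} p))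

  data Halved : ℕ → Set where
    even : ∀ l → Halved (l ℕ.+ l)
    odd  : ∀ l → Halved (suc (l ℕ.+ l))

  halve : ∀ k → Halved k
  halve zero    = even 0
  halve (suc k) with halve k
  ... | even l = odd l
  ... | odd l  = subst Halved (cong suc (ℕ.+-suc l l)) (even (suc l))

  -- U is only known to be positive at multiples of 6, so the exponent 3k is reached through the
  -- coefficient of f at 0 or at 3 according to the parity of k.
  U⊗-positive : ∀ {f} → Nonneg f → 1ℤ ℤ.≤ f 0 → 1ℤ ℤ.≤ f 3 → ∀ k → 1ℤ ℤ.≤ (Six.U ⊗ f) (k ℕ.* 3)
  U⊗-positive {f} p p₀ p₃ k with halve k
  ... | even l = ℤ.≤-trans (1≤* (Six.1≤U l) p₀) (subst (λ n → Six.U (6 ℕ.* l) ℤ.* f 0 ℤ.≤ (Six.U ⊗ f) n) (exponent l) (⊗-lower Six.U-nonneg p (6 ℕ.* l) 0))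
    where
    exponent : ∀ l → 6 ℕ.* l ℕ.+ 0 ≡ (l ℕ.+ l) ℕ.* 3
    exponent = ℕ-Ring.solve-∀
  ... | odd l  = ℤ.≤-trans (1≤* (Six.1≤U l) p₃) (subst (λ n → Six.U (6 ℕ.* l) ℤ.* f 3 ℤ.≤ (Six.U ⊗ f) n) (exponent l) (⊗-lower Six.U-nonneg p (6 ℕ.* l) 3))
    where
    exponent : ∀ l → 6 ℕ.* l ℕ.+ 3 ≡ suc (l ℕ.+ l) ℕ.* 3
    exponent = ℕ-Ring.solve-∀

  σ-nonneg : Nonneg ⟦ σ ⟧
  σ-nonneg = θ-nonneg 6 3 (s≤s z≤n)
  Ψ-nonneg : Nonneg ⟦ Ψ 9 ⟧
  Ψ-nonneg = θ-nonneg 9 0 (s≤s z≤n)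
  1≤σ₀ : 1ℤ ℤ.≤ ⟦ σ ⟧ 0
  1≤σ₀ = θ-lower 6 3 (s≤s z≤n) (+ 0) 0 refl
  1≤σ₃ : 1ℤ ℤ.≤ ⟦ σ ⟧ 3
  1≤σ₃ = θ-lower 6 3 (s≤s z≤n) (+ 1) 3 refl
  1≤Ψ₀ : 1ℤ ℤ.≤ ⟦ Ψ 9 ⟧ 0
  1≤Ψ₀ = θ-lower 9 0 (s≤s z≤n) (+ 0) 0 refl

  X Y Z : Series
  X = Six.U ⊗ (⟦ σ ⟧ ⊗ ⟦ σ ⟧)
  Y = Six.U ⊗ (⟦ σ ⟧ ⊗ ⟦ Ψ 9 ⟧)
  Z = # (+ 4) ⊗ Θ ⊖ # (+ 6) ⊗ g₉

  U-cubic : Cubic Six.U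
  U-cubic = Six.U-cubic (ℕ.divides 2 refl)
  σ-cubic : Cubic ⟦ σ ⟧
  σ-cubic = θ-cubic one 6 3 (ℕ.divides 2 refl) (ℕ.divides 1 refl) (s≤s z≤n)
  X-cubic : Cubic X
  X-cubic = ⊗-cubic U-cubic (⊗-cubic σ-cubic σ-cubic)
  Y-cubic : Cubic Y
  Y-cubic = ⊗-cubic U-cubic (⊗-cubic σ-cubic (θ-cubic one 9 0 (ℕ.divides 3 refl) (ℕ.divides 0 refl) (s≤s z≤n)))
  Z-cubic : Cubic Z
  Z-cubic = ⊕-cubic
    (⊗-cubic (#-cubic (+ 4)) (⊕-cubic (HasSum-cubic HasSum-Θ₊ λ k → ⊗-cubic (q^-cubic (ℕ.∣m⇒∣m*n k (ℕ.divides 2 refl))) (E₉-cubic (k ℕ.+ k)))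
                                      (HasSum-cubic HasSum-Θ₋ λ k → ⊗-cubic (q^-cubic (ℕ.∣m⇒∣m*n (suc k) (ℕ.divides 4 refl))) (E₉-cubic (suc k ℕ.+ suc k)))))
    (⊝-cubic (⊗-cubic (#-cubic (+ 6)) (⊕-cubic (HasSum-cubic HasSum-g₊ λ k → ⊗-cubic (q^-cubic (ℕ.∣m⇒∣m*n k (ℕ.divides 1 refl))) (E₉-cubic k))
                                      (HasSum-cubic HasSum-g₋ λ k → ⊗-cubic (q^-cubic (ℕ.∣m⇒∣m*n (suc k) (ℕ.divides 2 refl))) (E₉-cubic (suc k))))))

  double-injective : ∀ {i k} → i ℕ.+ i ≡ k ℕ.+ k → i ≡ k
  double-injective {i} {k} e = ℕ.*-cancelˡ-≡ i k 2 (trans (lemma i) (trans e (sym (lemma k))))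
    where
    lemma : ∀ i → 2 ℕ.* i ≡ i ℕ.+ i
    lemma i = cong (i ℕ.+_) (ℕ.+-identityʳ i)

  -- The terms of Θ are the terms of g₉ of even index: 6k = 3(2k) in the first sum and 12k = 6(2k)
  -- in the second.
  Θ≤g₉ : ∀ n → Θ n ℤ.≤ g₉ n
  Θ≤g₉ n = subst₂ ℤ._≤_ (sym (⊕-coeff _ _ n)) (sym (⊕-coeff _ _ n)) (ℤ.+-mono-≤
    (HasSum-≤ (λ k → k ℕ.+ k) double-injective HasSum-g₊
      (HasSum-cong (λ k → ⊗-cong (q^-cong (exponent₁ k)) ≐-refl) ≐-refl HasSum-Θ₊) (λ k → ⊗-nonneg (q^-nonneg (3 ℕ.* k)) (E₉-nonneg k)) n)
    (HasSum-≤ (λ k → k ℕ.+ suc k) (λ {i} {k} e → double-injective (ℕ.suc-injective (trans (sym (ℕ.+-suc i i)) (trans e (ℕ.+-suc k k))))) HasSum-g₋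
      (HasSum-cong (λ k → ⊗-cong (q^-cong (exponent₂ k)) ≐-refl) ≐-refl HasSum-Θ₋) (λ k → ⊗-nonneg (q^-nonneg (6 ℕ.* suc k)) (E₉-nonneg (suc k))) n))
    where
    exponent₁ : ∀ k → 6 ℕ.* k ≡ 3 ℕ.* (k ℕ.+ k)
    exponent₁ = ℕ-Ring.solve-∀
    exponent₂ : ∀ k → 12 ℕ.* suc k ≡ 6 ℕ.* suc (k ℕ.+ suc k)
    exponent₂ = ℕ-Ring.solve-∀

  1≤g₉ : ∀ k → 1ℤ ℤ.≤ g₉ (k ℕ.* 3)
  1≤g₉ k = subst (1ℤ ℤ.≤_) (sym (⊕-coeff _ _ (k ℕ.* 3))) (ℤ.+-mono-≤
    (ℤ.≤-trans (ℤ.≤-trans (1≤E₉ k) (ℤ.≤-reflexive (trans (sym (q^-shift (3 ℕ.* k) (E₉ k) 0)) (cong (q^ (3 ℕ.* k) ⊗ E₉ k) (exponent k)))))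
      (HasSum-term-≤ HasSum-g₊ (λ k → ⊗-nonneg (q^-nonneg (3 ℕ.* k)) (E₉-nonneg k)) k (k ℕ.* 3)))
    (HasSum-nonneg HasSum-g₋ (λ k → ⊗-nonneg (q^-nonneg (6 ℕ.* suc k)) (E₉-nonneg (suc k))) (k ℕ.* 3)))
    where
    exponent : ∀ k → 3 ℕ.* k ℕ.+ 0 ≡ k ℕ.* 3
    exponent = ℕ-Ring.solve-∀

  component : ∀ n → difference-series n ≡ X n ℤ.+ (q^ 1 ⊗ Y) n ℤ.+ (q^ 2 ⊗ Z) n
  component n = trans (at dissection n) (trans (⊕-coeff _ _ n) (cong (ℤ._+ (q^ 2 ⊗ Z) n) (⊕-coeff _ _ n)))

  0<3 : 0 < 3
  0<3 = s≤s z≤n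
  1<3 : 1 < 3
  1<3 = s≤s (s≤s z≤n)
  2<3 : 2 < 3
  2<3 = s≤s (s≤s (s≤s z≤n))

positive₀ : ∀ k → 0ℤ ℤ.< difference-series (k ℕ.* 3)
positive₀ k = ℤ.<-≤-trans (ℤ.+<+ (s≤s z≤n)) (subst (1ℤ ℤ.≤_)
  (sym (trans (component (k ℕ.* 3)) (trans (cong₂ (λ a b → X (k ℕ.* 3) ℤ.+ a ℤ.+ b) (shifted-cubic-vanish {r = 0} k 1<3 0<3 (λ ()) Y-cubic) (shifted-cubic-vanish {r = 0} k 2<3 0<3 (λ ()) Z-cubic))
    (trans (ℤ.+-identityʳ _) (ℤ.+-identityʳ _)))))
  (U⊗-positive (⊗-nonneg σ-nonneg σ-nonneg) (ℤ.≤-trans (1≤* 1≤σ₀ 1≤σ₀) (⊗-lower σ-nonneg σ-nonneg 0 0)) (ℤ.≤-trans (1≤* 1≤σ₀ 1≤σ₃) (⊗-lower σ-nonneg σ-nonneg 0 3)) k))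

positive₁ : ∀ k → 0ℤ ℤ.< difference-series (1 ℕ.+ k ℕ.* 3)
positive₁ k = ℤ.<-≤-trans (ℤ.+<+ (s≤s z≤n)) (subst (1ℤ ℤ.≤_)
  (sym (trans (component (1 ℕ.+ k ℕ.* 3)) (trans (cong₂ (λ a b → a ℤ.+ (q^ 1 ⊗ Y) (1 ℕ.+ k ℕ.* 3) ℤ.+ b) (cubic-vanish k 1<3 (λ ()) X-cubic) (shifted-cubic-vanish {r = 1} k 2<3 1<3 (λ ()) Z-cubic))
    (trans (ℤ.+-identityʳ _) (trans (ℤ.+-identityˡ _) (q^-shift 1 Y (k ℕ.* 3)))))))
  (U⊗-positive (⊗-nonneg σ-nonneg Ψ-nonneg) (ℤ.≤-trans (1≤* 1≤σ₀ 1≤Ψ₀) (⊗-lower σ-nonneg Ψ-nonneg 0 0)) (ℤ.≤-trans (1≤* 1≤σ₃ 1≤Ψ₀) (⊗-lower σ-nonneg Ψ-nonneg 3 0)) k))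

negative₂ : ∀ k → difference-series (2 ℕ.+ k ℕ.* 3) ℤ.< 0ℤ
negative₂ k = subst (ℤ._< 0ℤ)
  (sym (trans (component (2 ℕ.+ k ℕ.* 3)) (trans (cong₂ (λ a b → a ℤ.+ b ℤ.+ (q^ 2 ⊗ Z) (2 ℕ.+ k ℕ.* 3)) (cubic-vanish k 2<3 (λ ()) X-cubic) (shifted-cubic-vanish {r = 2} k 1<3 2<3 (λ ()) Y-cubic))
    (trans (ℤ.+-identityˡ _) (trans (q^-shift 2 Z (k ℕ.* 3)) (trans (⊕-coeff _ _ (k ℕ.* 3)) (cong₂ ℤ._+_ (#-scale (+ 4) Θ (k ℕ.* 3)) (trans (⊝-coeff _ (k ℕ.* 3)) (cong ℤ.-_ (#-scale (+ 6) g₉ (k ℕ.* 3)))))))))))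
  -- 4Θ - 6g₉ is at most -2g₉, and g₉ has positive coefficients at all multiples of 3.
  (bound (Θ≤g₉ (k ℕ.* 3)) (1≤g₉ k))
  where
  lemma : ∀ g → + 4 ℤ.* g ℤ.+ ℤ.- (+ 6 ℤ.* g) ≡ ℤ.- (+ 2 ℤ.* g)
  lemma = solve-∀
  bound : ∀ {t g} → t ℤ.≤ g → 1ℤ ℤ.≤ g → + 4 ℤ.* t ℤ.+ ℤ.- (+ 6 ℤ.* g) ℤ.< 0ℤ
  bound {t} {g} t≤g 1≤g = ℤ.≤-<-trans (ℤ.+-monoˡ-≤ (ℤ.- (+ 6 ℤ.* g)) (ℤ.*-monoˡ-≤-nonNeg (+ 4) t≤g))
    (subst (ℤ._< 0ℤ) (sym (lemma g)) (ℤ.neg-mono-< (ℤ.<-≤-trans (ℤ.+<+ (s≤s z≤n)) (1≤* {+ 2} (ℤ.+≤+ (s≤s z≤n)) 1≤g))))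

-- The rank difference as a sum over the array

indicator : ∀ {P : Set} → Dec P → ℤ
indicator (yes _) = 1ℤ
indicator (no _)  = 0ℤ

indicator-yes : ∀ {P : Set} (d : Dec P) → P → indicator d ≡ 1ℤ
indicator-yes (yes _) _ = refl
indicator-yes (no ¬p) p = ⊥-elim (¬p p)

indicator-no : ∀ {P : Set} (d : Dec P) → ¬ P → indicator d ≡ 0ℤ
indicator-no (yes p) ¬p = ⊥-elim (¬p p)
indicator-no (no _)  _  = refl

opaque
  -- The contribution of one overpartition of rank r to the difference of the two counts. It is
  -- opaque so that divisibility tests are not unfolded; only its values on residue classes enter.
  sign₃ : ℤ → ℤ
  sign₃ r = indicator (r ≡? + 0 [mod 3 ]) ℤ.- indicator (r ≡? + 1 [mod 3 ])

  sign₃≡ : ∀ r → sign₃ r ≡ indicator (r ≡? + 0 [mod 3 ]) ℤ.- indicator (r ≡? + 1 [mod 3 ])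
  sign₃≡ _ = refl

private
  congruent : ∀ x ρ j → + 3 ℤ.* x ℤ.+ + ρ ≡ + 3 ℤ.* x ℤ.+ + j → (+ 3 ℤ.* x ℤ.+ + ρ) ≡ + j [mod 3 ]
  congruent x ρ j e = subst (λ z → 3 ∣ ℤ.∣ z ∣) (sym (trans (cong (ℤ._- + j) e) (lemma x (+ j)))) (subst (3 ∣_) (sym (ℤ.abs-* (+ 3) x)) (ℕ.∣m⇒∣m*n ℤ.∣ x ∣ (ℕ.divides 1 refl)))
    where
    lemma : ∀ x j → + 3 ℤ.* x ℤ.+ j ℤ.- j ≡ + 3 ℤ.* x
    lemma = solve-∀

  incongruent : ∀ x ρ j → ρ < 3 → j < 3 → ρ ≢ j → ¬ (+ 3 ℤ.* x ℤ.+ + ρ) ≡ + j [mod 3 ]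
  incongruent x ρ j ρ<3 j<3 ρ≢j d with Signed.∣ᵤ⇒∣ {+ 3} {+ 3 ℤ.* x ℤ.+ + ρ ℤ.- + j} d
  ... | Signed.divides y e = ρ≢j (proj₂ (divmod-unique 3 x y ρ j ρ<3 j<3 (trans (lemma (+ 3 ℤ.* x ℤ.+ + ρ) (+ j)) (trans (cong (ℤ._+ + j) e) (cong (ℤ._+ + j) (ℤ.*-comm y (+ 3)))))))
    where
    lemma : ∀ a j → a ≡ a ℤ.- j ℤ.+ j
    lemma = solve-∀

  sign₃-0 : ∀ {r} x → r ≡ + 3 ℤ.* x ℤ.+ + 0 → sign₃ r ≡ 1ℤ
  sign₃-0 x refl = trans (sign₃≡ _) (cong₂ ℤ._-_ (indicator-yes ((+ 3 ℤ.* x ℤ.+ + 0) ≡? + 0 [mod 3 ]) (congruent x 0 0 refl)) (indicator-no ((+ 3 ℤ.* x ℤ.+ + 0) ≡? + 1 [mod 3 ]) (incongruent x 0 1 (s≤s z≤n) (s≤s (s≤s z≤n)) λ ())))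

  sign₃-1 : ∀ {r} x → r ≡ + 3 ℤ.* x ℤ.+ + 1 → sign₃ r ≡ ℤ.- 1ℤ
  sign₃-1 x refl = trans (sign₃≡ _) (cong₂ ℤ._-_ (indicator-no ((+ 3 ℤ.* x ℤ.+ + 1) ≡? + 0 [mod 3 ]) (incongruent x 1 0 (s≤s (s≤s z≤n)) (s≤s z≤n) λ ())) (indicator-yes ((+ 3 ℤ.* x ℤ.+ + 1) ≡? + 1 [mod 3 ]) (congruent x 1 1 refl)))

  sign₃-2 : ∀ {r} x → r ≡ + 3 ℤ.* x ℤ.+ + 2 → sign₃ r ≡ 0ℤ
  sign₃-2 x refl = trans (sign₃≡ _) (cong₂ ℤ._-_ (indicator-no ((+ 3 ℤ.* x ℤ.+ + 2) ≡? + 0 [mod 3 ]) (incongruent x 2 0 (s≤s (s≤s (s≤s z≤n))) (s≤s z≤n) λ ())) (indicator-no ((+ 3 ℤ.* x ℤ.+ + 2) ≡? + 1 [mod 3 ]) (incongruent x 2 1 (s≤s (s≤s (s≤s z≤n))) (s≤s (s≤s z≤n)) λ ())))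

open One using (D; D-sym; Ẽ; HasSum-Ẽ; HasSum-E)

Q₁≐ : ∀ k → One.Q k ≐ q^ k
Q₁≐ k = q^-cong (ℕ.*-identityˡ k)

-- Overpartitions of n with rank m ≥ 0 are counted by 2 u m.
u : ℕ → Series
u m = q^ (suc m) ⊗ Ẽ m

private
  u-small : ∀ N m → N ≤ m → u m ≈[ N ] 𝟘
  u-small N m N≤m = q^⊗-vanish (Ẽ m) (ℕ.m≤n⇒m≤1+n N≤m)

  triples : (ℕ × Fin 3) ≅ ℕ
  triples = bij (λ (k , r) → toℕ r ℕ.+ k ℕ.* 3) (λ m → m ℕ./ 3 , fromℕ< (ℕ.m%n<n m 3)) (λ (k , r) → from-to k r)
    (λ m → trans (cong (ℕ._+ m ℕ./ 3 ℕ.* 3) (toℕ-fromℕ< (ℕ.m%n<n m 3))) (sym (ℕ.m≡m%n+[m/n]*n m 3)))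
    where
    from-to : ∀ k r → let m = toℕ r ℕ.+ k ℕ.* 3 in (m ℕ./ 3 , fromℕ< (ℕ.m%n<n m 3)) ≡ (k , r)
    from-to k r = cong₂ _,_ quotient (toℕ-injective (trans (toℕ-fromℕ< (ℕ.m%n<n m 3)) remainder))
      where
      m : ℕ
      m = toℕ r ℕ.+ k ℕ.* 3
      remainder : m ℕ.% 3 ≡ toℕ r
      remainder = trans (ℕ.[m+kn]%n≡m%n (toℕ r) k 3) (ℕ.m<n⇒m%n≡m (toℕ<n r))
      quotient : m ℕ./ 3 ≡ k
      quotient = ℕ.*-cancelʳ-≡ (m ℕ./ 3) k 3 (ℕ.+-cancelˡ-≡ (toℕ r) _ _ (trans (cong (ℕ._+ m ℕ./ 3 ℕ.* 3) (sym remainder)) (sym (ℕ.m≡m%n+[m/n]*n m 3))))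

HasSum-triples : ∀ {f : ℕ → Series} {s} → HasSum f s → HasSum (λ k → f (k ℕ.* 3) ⊕ (f (1 ℕ.+ k ℕ.* 3) ⊕ f (2 ℕ.+ k ℕ.* 3))) s
HasSum-triples {f} h = HasSum-Σ ℕ._≟_ (HasSum-reindex triples h) λ k →
  HasSum-cong (λ _ → ≐-refl) (⊕-cong ≐-refl (⊕-cong ≐-refl (Ring.+-identityʳ _))) (HasSum-Fin 3 (λ r → f (toℕ r ℕ.+ k ℕ.* 3)))

-- Pairs (i , k) sorted by the rank m = i - k, with j the smaller of the two.
diagonals : (ℤ × ℕ) ≅ (ℕ × ℕ)
diagonals = bij to from from-to to-from
  where
  to : ℤ × ℕ → ℕ × ℕ
  to (+ m , j)      = m ℕ.+ j , j
  to (-[1+ m ] , j) = j , suc m ℕ.+ j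
  from : ℕ × ℕ → ℤ × ℕ
  from (i , k) with ℕ.<-cmp i k
  ... | tri< i<k _ _ = -[1+ k ℕ.∸ suc i ] , i
  ... | tri≈ _ _ _   = + (i ℕ.∸ k) , k
  ... | tri> _ _ _   = + (i ℕ.∸ k) , k
  from-to : ∀ x → from (to x) ≡ x
  from-to (+ m , j) with ℕ.<-cmp (m ℕ.+ j) j
  ... | tri< l _ _ = ⊥-elim (ℕ.<⇒≱ l (ℕ.m≤n+m j m))
  ... | tri≈ _ _ _ = cong (λ k → + k , j) (ℕ.m+n∸n≡m m j)
  ... | tri> _ _ _ = cong (λ k → + k , j) (ℕ.m+n∸n≡m m j)
  from-to (-[1+ m ] , j) with ℕ.<-cmp j (suc m ℕ.+ j)
  ... | tri< _ _ _ = cong (λ k → -[1+ k ] , j) (ℕ.m+n∸n≡m m j)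
  ... | tri≈ _ e _ = ⊥-elim (ℕ.<⇒≢ (s≤s (ℕ.m≤n+m j m)) e)
  ... | tri> _ _ l = ⊥-elim (ℕ.<⇒≱ l (ℕ.m≤n⇒m≤1+n (ℕ.m≤n+m j m)))
  to-from : ∀ x → to (from x) ≡ x
  to-from (i , k) with ℕ.<-cmp i k
  ... | tri< i<k _ _  = cong (i ,_) (trans (sym (ℕ.+-suc (k ℕ.∸ suc i) i)) (ℕ.m∸n+n≡m i<k))
  ... | tri≈ _ refl _ = cong (_, i) (ℕ.m∸n+n≡m (ℕ.≤-refl {i}))
  ... | tri> _ _ k<i  = cong (_, k) (ℕ.m∸n+n≡m (ℕ.<⇒≤ k<i))

-- Overpartitions whose parts after the largest number k and whose largest part is i + 1.
pair-term : ℕ × ℕ → Series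
pair-term (i , k) = # (sign₃ (+ i ℤ.- + k)) ⊗ (q^ (suc (i ℕ.+ k)) ⊗ D i k)

pair-sum : Series
pair-sum = sumOver (λ N → cartesianProduct (upTo N) (upTo N)) pair-term

HasSum-pair : HasSum pair-term pair-sum
HasSum-pair = HasSum-box _ λ N → covers (Unique.cartesianProduct⁺ (Unique.upTo⁺ N) (Unique.upTo⁺ N)) (out N)
  where
  small : ∀ N i k → N ≤ i ℕ.+ k → pair-term (i , k) ≈[ N ] 𝟘
  small N i k l = ≈-trans (⊗-cong≈ ≈-refl (q^⊗-vanish (D i k) (ℕ.m≤n⇒m≤1+n l))) (≐⇒≈ (Ring.zeroʳ (# (sign₃ (+ i ℤ.- + k)))))
  out : ∀ N ik → ik ∈ cartesianProduct (upTo N) (upTo N) ⊎ pair-term ik ≈[ N ] 𝟘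
  out N (i , k) with i ℕ.<? N | k ℕ.<? N
  ... | yes i<N | yes k<N = inj₁ (∈-cartesianProduct⁺ (∈-upTo⁺ i<N) (∈-upTo⁺ k<N))
  ... | no  i≮N | _       = inj₂ (small N i k (ℕ.≤-trans (ℕ.≮⇒≥ i≮N) (ℕ.m≤m+n i k)))
  ... | yes _   | no  k≮N = inj₂ (small N i k (ℕ.≤-trans (ℕ.≮⇒≥ k≮N) (ℕ.m≤n+m k i)))

rank-term : ℤ → Series
rank-term m = # (sign₃ m) ⊗ u ℤ.∣ m ∣

-- Ranks m and -m share one series because D is symmetric.
HasSum-rank : HasSum rank-term pair-sum
HasSum-rank = HasSum-Σ ℤ._≟_ (HasSum-reindex diagonals HasSum-pair) row
  where
  open ≐-Reasoning
  split : ∀ m j → One.Q (j ℕ.+ j) ⊗ D (m ℕ.+ j) j ≐ q^ (j ℕ.+ j) ⊗ D (m ℕ.+ j) j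
  split m j = ⊗-cong (Q₁≐ (j ℕ.+ j)) ≐-refl
  merge : ∀ m j e → suc (m ℕ.+ (j ℕ.+ j)) ≡ e → q^ (suc m) ⊗ (One.Q (j ℕ.+ j) ⊗ D (m ℕ.+ j) j) ≐ q^ e ⊗ D (m ℕ.+ j) j
  merge m j e p = begin
    q^ (suc m) ⊗ (One.Q (j ℕ.+ j) ⊗ D (m ℕ.+ j) j)  ≈⟨ ⊗-cong ≐-refl (split m j) ⟩
    q^ (suc m) ⊗ (q^ (j ℕ.+ j) ⊗ D (m ℕ.+ j) j)     ≈⟨ Ring.*-assoc _ _ _ ⟨
    q^ (suc m) ⊗ q^ (j ℕ.+ j) ⊗ D (m ℕ.+ j) j       ≈⟨ ⊗-cong (q^-+ (suc m) (j ℕ.+ j)) ≐-refl ⟨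
    q^ (suc m ℕ.+ (j ℕ.+ j)) ⊗ D (m ℕ.+ j) j        ≈⟨ ⊗-cong (q^-cong p) ≐-refl ⟩
    q^ e ⊗ D (m ℕ.+ j) j                            ∎
  row : ∀ m → HasSum (λ j → pair-term (_≅_.to diagonals (m , j))) (rank-term m)
  row (+ m) = HasSum-cong term ≐-refl (HasSum-⊗ (# (sign₃ (+ m))) (HasSum-⊗ (q^ (suc m)) (HasSum-Ẽ m)))
    where
    weight : ∀ j → + m ≡ + (m ℕ.+ j) ℤ.- + j
    weight j = lemma (+ m) (+ j)
      where
      lemma : ∀ m j → m ≡ m ℤ.+ j ℤ.- j
      lemma = solve-∀
    term : ∀ j → # (sign₃ (+ m)) ⊗ (q^ (suc m) ⊗ (One.Q (j ℕ.+ j) ⊗ D (m ℕ.+ j) j)) ≐ pair-term (m ℕ.+ j , j)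
    term j = ⊗-cong (eq λ n → cong (λ r → # (sign₃ r) n) (weight j)) (merge m j (suc (m ℕ.+ j ℕ.+ j)) (cong suc (sym (ℕ.+-assoc m j j))))
  row -[1+ m ] = HasSum-cong term ≐-refl (HasSum-⊗ (# (sign₃ -[1+ m ])) (HasSum-⊗ (q^ (2 ℕ.+ m)) (HasSum-Ẽ (suc m))))
    where
    weight : ∀ j → -[1+ m ] ≡ + j ℤ.- + (suc m ℕ.+ j)
    weight j = lemma (+ suc m) (+ j)
      where
      lemma : ∀ m j → ℤ.- m ≡ j ℤ.- (m ℤ.+ j)
      lemma = solve-∀
    exponent : ∀ m j → m ℕ.+ (j ℕ.+ j) ≡ j ℕ.+ (m ℕ.+ j)
    exponent = ℕ-Ring.solve-∀
    term : ∀ j → # (sign₃ -[1+ m ]) ⊗ (q^ (2 ℕ.+ m) ⊗ (One.Q (j ℕ.+ j) ⊗ D (suc m ℕ.+ j) j)) ≐ pair-term (j , suc m ℕ.+ j)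
    term j = ⊗-cong (eq λ n → cong (λ r → # (sign₃ r) n) (weight j)) (≐-trans (merge (suc m) j _ (cong suc (exponent (suc m) j))) (⊗-cong ≐-refl (D-sym (suc m ℕ.+ j) j)))

u-step : ∀ m → u (suc m) ⊕ u (2 ℕ.+ m) ≐ E₁ (suc m) ⊖ E₁ m
u-step m = combine ((⊝ 𝟙 · One.E-step m) ∷ (⊝ Ẽ (2 ℕ.+ m) · Q₁≐ (3 ℕ.+ m)) ∷ (⊝ Ẽ (suc m) · Q₁≐ (2 ℕ.+ m)) ∷ [])
  (solve 8 (λ e₀ e₁ d₁ d₂ p₂ p₃ r₂ r₃ → r₂ :* d₁ :+ r₃ :* d₂ :- (e₁ :- e₀)
     := (:- con 1ℤ) :* (e₁ :- (e₀ :+ (p₃ :* d₂ :+ p₂ :* d₁))) :+ ((:- d₂) :* (p₃ :- r₃) :+ ((:- d₁) :* (p₂ :- r₂) :+ con 0ℤ)))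
    ≐-refl (E₁ m) (E₁ (suc m)) (Ẽ (suc m)) (Ẽ (2 ℕ.+ m)) (One.Q (2 ℕ.+ m)) (One.Q (3 ℕ.+ m)) (q^ (2 ℕ.+ m)) (q^ (3 ℕ.+ m)))

-- The boundary case of `u-step`; the corner entry makes C₁ appear.
u-zero : # (+ 2) ⊗ (u 0 ⊕ u 1) ≐ # (+ 2) ⊗ E₁ 0 ⊖ 𝟙 ⊖ C₁
u-zero = combine ((⊝ # (+ 2) · One.E-zero) ∷ (𝟙 · One.C≐) ∷ (⊝ # (+ 2) ⊗ Ẽ 0 · Q₁≐ 1) ∷ (⊝ # (+ 2) ⊗ Ẽ 1 · Q₁≐ 2) ∷ (# (+ 2) ⊗ Ẽ 1 · One.Q-suc 1) ∷ [])
  (solve 9 (λ e₀ e₁ d₀ d₁ x p₂ r₁ r₂ c → con (+ 2) :* (r₁ :* d₀ :+ r₂ :* d₁) :- (con (+ 2) :* e₀ :- con 1ℤ :- c)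
     := (:- con (+ 2)) :* (e₀ :- (con 1ℤ :+ x :* e₁ :+ x :* (d₀ :+ x :* d₁))) :+ (con 1ℤ :* (c :- (con 1ℤ :+ con (+ 2) :* x :* e₁))
        :+ ((:- con (+ 2)) :* d₀ :* (x :- r₁) :+ ((:- con (+ 2)) :* d₁ :* (p₂ :- r₂) :+ (con (+ 2) :* d₁ :* (p₂ :- x :* x) :+ con 0ℤ)))))
    ≐-refl (E₁ 0) (E₁ 1) (Ẽ 0) (Ẽ 1) (One.Q 1) (One.Q 2) (q^ 1) (q^ 2) C₁)

-- The ranks m and -m together have weights -1, -1, 2 at m = 3k+1, 3k+2, 3k+3. The recurrence yields
-- only sums of neighbouring u, so the weighted sum is expressed by values of E up to a telescoping
-- remainder. The 2 stands for the free overline of the first entry, and the 1 is the constant term.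
difference-series≐ : difference-series ≐ 𝟙 ⊕ # (+ 2) ⊗ pair-sum
difference-series≐ = combine
  ((# (+ 2) · HasSum-unique (HasSum-halves (HasSum-suc sum⁺) sum⁻) HasSum-rank)
    ∷ (⊝ 𝟙 · HasSum-unique doubled total≐) ∷ (⊝ # (+ 2) ⊗ u 0 · #-cong (sign₃-0 (+ 0) refl)) ∷ (⊝ 𝟙 · u-zero) ∷ [])
  (solve 9 (λ c g p s₀ u₀ u₁ a b e → c :+ con (+ 6) :* g :- (con 1ℤ :+ con (+ 2) :* p)
     := con (+ 2) :* (s₀ :* u₀ :+ a :+ b :- p) :+ ((:- con 1ℤ) :* (con (+ 2) :* (a :+ b) :- (con (+ 6) :* g :+ (con (+ 2) :* c :- (con (+ 2) :* e :- con (+ 2) :* u₁))))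
        :+ ((:- con (+ 2)) :* u₀ :* (s₀ :- con 1ℤ) :+ ((:- con 1ℤ) :* (con (+ 2) :* (u₀ :+ u₁) :- (con (+ 2) :* e :- con 1ℤ :- c)) :+ con 0ℤ))))
    ≐-refl C₁ gap pair-sum (# (sign₃ (+ 0))) (u 0) (u 1) S⁺ S⁻ (E₁ 0))
  where
  #-cong : ∀ {a b} → a ≡ b → # a ≐ # b
  #-cong refl = ≐-refl
  S⁺ S⁻ : Series
  S⁺ = sumℕ (λ m → rank-term (+ suc m))
  S⁻ = sumℕ (λ m → rank-term -[1+ m ])
  small : ∀ N i m → N ≤ i → # (sign₃ m) ⊗ u (3 ℕ.+ i) ≈[ N ] 𝟘
  small N i m N≤i = ≈-trans (⊗-cong≈ ≈-refl (u-small N (3 ℕ.+ i) (ℕ.≤-trans N≤i (ℕ.m≤n+m i 3)))) (≐⇒≈ (Ring.zeroʳ (# (sign₃ m))))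
  sum⁺ : HasSum (λ m → rank-term (+ suc m)) S⁺
  sum⁺ = HasSum-ℕ λ N i N≤i → small N i (+ (3 ℕ.+ i)) N≤i
  sum⁻ : HasSum (λ m → rank-term -[1+ m ]) S⁻
  sum⁻ = HasSum-ℕ λ N i N≤i → small N i -[1+ 2 ℕ.+ i ] N≤i
  pair : ℕ → Series
  pair m = rank-term (+ suc m) ⊕ rank-term -[1+ m ]
  doubled : HasSum (λ k → # (+ 2) ⊗ (pair (k ℕ.* 3) ⊕ (pair (1 ℕ.+ k ℕ.* 3) ⊕ pair (2 ℕ.+ k ℕ.* 3)))) (# (+ 2) ⊗ (S⁺ ⊕ S⁻))
  doubled = HasSum-⊗ (# (+ 2)) (HasSum-triples (HasSum-⊕ ℕ._≟_ sum⁺ sum⁻))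
  h : ℕ → Series
  -- The telescoping remainder, with limit 2C₁ because u tends to 0; its value at 0 is matched by
  -- `u-zero`.
  h k = # (+ 2) ⊗ E₁ (k ℕ.* 3) ⊖ # (+ 2) ⊗ u (1 ℕ.+ k ℕ.* 3)
  h≈ : ∀ N k → N ≤ k → h k ≈[ N ] # (+ 2) ⊗ C₁
  h≈ N k N≤k = ≈-trans (⊕-cong≈ (⊗-cong≈ ≈-refl (≈-weaken (ℕ.≤-trans N≤k (ℕ.m≤m*n k 3)) (One.E≈C (k ℕ.* 3))))
      (⊝-cong≈ (⊗-cong≈ ≈-refl (u-small N (1 ℕ.+ k ℕ.* 3) (ℕ.≤-trans N≤k (ℕ.m≤n⇒m≤1+n (ℕ.m≤m*n k 3)))))))
    (≐⇒≈ (solve 1 (λ c → con (+ 2) :* c :- con (+ 2) :* con 0ℤ := con (+ 2) :* c) ≐-refl C₁))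
  pair≐ : ∀ m {a b} → sign₃ (+ suc m) ≡ a → sign₃ -[1+ m ] ≡ b → pair m ≐ # (a ℤ.+ b) ⊗ u (suc m)
  pair≐ m {a} {b} refl refl = ≐-trans (≐-sym (Ring.distribʳ (u (suc m)) _ _)) (⊗-cong (≐-sym (#-+ a b)) ≐-refl)
  triple≐ : ∀ k → pair (k ℕ.* 3) ⊕ (pair (1 ℕ.+ k ℕ.* 3) ⊕ pair (2 ℕ.+ k ℕ.* 3))
                  ≐ # (ℤ.- 1ℤ) ⊗ u (1 ℕ.+ k ℕ.* 3) ⊕ (# (ℤ.- 1ℤ) ⊗ u (2 ℕ.+ k ℕ.* 3) ⊕ # (+ 2) ⊗ u (3 ℕ.+ k ℕ.* 3))
  triple≐ k = ⊕-cong (pair≐ (k ℕ.* 3) (sign₃-1 (+ k) (residue⁺ 1)) (sign₃-2 (ℤ.- (+ 1 ℤ.+ + k)) (residue⁻ 1 2 refl)))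
    (⊕-cong (pair≐ (1 ℕ.+ k ℕ.* 3) (sign₃-2 (+ k) (residue⁺ 2)) (sign₃-1 (ℤ.- (+ 1 ℤ.+ + k)) (residue⁻ 2 1 refl)))
            (pair≐ (2 ℕ.+ k ℕ.* 3) (sign₃-0 (+ 1 ℤ.+ + k) (trans (residue⁺ 3) (lemma₀ (+ k)))) (sign₃-0 (ℤ.- (+ 1 ℤ.+ + k)) (residue⁻ 3 0 refl))))
    where
    residue⁺ : ∀ r → + (r ℕ.+ k ℕ.* 3) ≡ + 3 ℤ.* + k ℤ.+ + r
    residue⁺ r = trans (cong (λ x → + r ℤ.+ x) (ℤ.pos-* k 3)) (lemma (+ r) (+ k))
      where
      lemma : ∀ r k → r ℤ.+ k ℤ.* + 3 ≡ + 3 ℤ.* k ℤ.+ r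
      lemma = solve-∀
    lemma₀ : ∀ k → + 3 ℤ.* k ℤ.+ + 3 ≡ + 3 ℤ.* (+ 1 ℤ.+ k) ℤ.+ + 0
    lemma₀ = solve-∀
    residue⁻ : ∀ r ρ → + r ℤ.+ + ρ ≡ + 3 → ℤ.- (+ (r ℕ.+ k ℕ.* 3)) ≡ + 3 ℤ.* ℤ.- (+ 1 ℤ.+ + k) ℤ.+ + ρ
    residue⁻ r ρ e = trans (cong ℤ.-_ (residue⁺ r)) (trans (lemma₁ (+ k) (+ r) (+ ρ)) (trans (cong (λ t → + ρ ℤ.- + 3 ℤ.* + k ℤ.- t) e) (lemma₂ (+ k) (+ ρ))))
      where
      lemma₁ : ∀ k r ρ → ℤ.- (+ 3 ℤ.* k ℤ.+ r) ≡ ρ ℤ.- + 3 ℤ.* k ℤ.- (r ℤ.+ ρ)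
      lemma₁ = solve-∀
      lemma₂ : ∀ k ρ → ρ ℤ.- + 3 ℤ.* k ℤ.- + 3 ≡ + 3 ℤ.* ℤ.- (+ 1 ℤ.+ k) ℤ.+ ρ
      lemma₂ = solve-∀
  total≐ : HasSum (λ k → # (+ 2) ⊗ (pair (k ℕ.* 3) ⊕ (pair (1 ℕ.+ k ℕ.* 3) ⊕ pair (2 ℕ.+ k ℕ.* 3)))) (# (+ 6) ⊗ gap ⊕ (# (+ 2) ⊗ C₁ ⊖ h 0))
  total≐ = HasSum-cong (λ k → ≐-trans (term k) (⊗-cong ≐-refl (≐-sym (triple≐ k)))) ≐-refl (HasSum-⊕ ℕ._≟_ (HasSum-⊗ (# (+ 6)) HasSum-gap) (HasSum-telescope h≈))
    where
    term : ∀ k → # (+ 6) ⊗ (E₁ (k ℕ.* 3) ⊖ E₁ (1 ℕ.+ k ℕ.* 3)) ⊕ (h (suc k) ⊖ h k)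
                 ≐ # (+ 2) ⊗ (# (ℤ.- 1ℤ) ⊗ u (1 ℕ.+ k ℕ.* 3) ⊕ (# (ℤ.- 1ℤ) ⊗ u (2 ℕ.+ k ℕ.* 3) ⊕ # (+ 2) ⊗ u (3 ℕ.+ k ℕ.* 3)))
    term k = combine ((# (+ 4) · u-step (k ℕ.* 3)) ∷ (⊝ # (+ 2) · u-step (1 ℕ.+ k ℕ.* 3)) ∷ (⊝ # (+ 2) · u-step (2 ℕ.+ k ℕ.* 3)) ∷ [])
      (solve 8 (λ e₀ e₁ e₂ e₃ u₁ u₂ u₃ u₄ →
           con (+ 6) :* (e₀ :- e₁) :+ (con (+ 2) :* e₃ :- con (+ 2) :* u₄ :- (con (+ 2) :* e₀ :- con (+ 2) :* u₁))
             :- con (+ 2) :* (con (ℤ.- 1ℤ) :* u₁ :+ (con (ℤ.- 1ℤ) :* u₂ :+ con (+ 2) :* u₃))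
           := con (+ 4) :* (u₁ :+ u₂ :- (e₁ :- e₀)) :+ ((:- con (+ 2)) :* (u₂ :+ u₃ :- (e₂ :- e₁)) :+ ((:- con (+ 2)) :* (u₃ :+ u₄ :- (e₃ :- e₂)) :+ con 0ℤ)))
        ≐-refl (E₁ (k ℕ.* 3)) (E₁ (1 ℕ.+ k ℕ.* 3)) (E₁ (2 ℕ.+ k ℕ.* 3)) (E₁ (3 ℕ.+ k ℕ.* 3)) (u (1 ℕ.+ k ℕ.* 3)) (u (2 ℕ.+ k ℕ.* 3)) (u (3 ℕ.+ k ℕ.* 3)) (u (4 ℕ.+ k ℕ.* 3)))

-- Overpartitions by their first part

Σℤ : ∀ {I : Set} → (I → ℤ) → List I → ℤ
Σℤ w []      = 0ℤ
Σℤ w (x ∷ L) = w x ℤ.+ Σℤ w L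

sumTo : ℕ → (ℕ → ℤ) → ℤ
sumTo zero    f = 0ℤ
sumTo (suc n) f = f 0 ℤ.+ sumTo n (f ∘ suc)

Σℤ-cong : ∀ {f g : I → ℤ} L → (∀ {x} → x ∈ L → f x ≡ g x) → Σℤ f L ≡ Σℤ g L
Σℤ-cong []      p = refl
Σℤ-cong (x ∷ L) p = cong₂ ℤ._+_ (p (here refl)) (Σℤ-cong L (p ∘ there))

Σℤ-++ : ∀ (f : I → ℤ) L M → Σℤ f (L ++ M) ≡ Σℤ f L ℤ.+ Σℤ f M
Σℤ-++ f []      M = sym (ℤ.+-identityˡ _)
Σℤ-++ f (x ∷ L) M = trans (cong (ℤ._+_ (f x)) (Σℤ-++ f L M)) (sym (ℤ.+-assoc (f x) _ _))

Σℤ-map : ∀ (f : I → ℤ) (h : J → I) L → Σℤ f (map h L) ≡ Σℤ (f ∘ h) L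
Σℤ-map f h []      = refl
Σℤ-map f h (x ∷ L) = cong (ℤ._+_ (f (h x))) (Σℤ-map f h L)

Σℤ-concatMap : ∀ (f : I → ℤ) (F : J → List I) L → Σℤ f (concatMap F L) ≡ Σℤ (λ x → Σℤ f (F x)) L
Σℤ-concatMap f F []      = refl
Σℤ-concatMap f F (x ∷ L) = trans (Σℤ-++ f (F x) (concatMap F L)) (cong (ℤ._+_ (Σℤ f (F x))) (Σℤ-concatMap f F L))

Σℤ-filter : ∀ {P : I → Set} (P? : ∀ x → Dec (P x)) (f : I → ℤ) L → Σℤ f (filter P? L) ≡ Σℤ (λ x → indicator (P? x) ℤ.* f x) L
Σℤ-filter P? f []      = refl
Σℤ-filter P? f (x ∷ L) with P? x
... | yes _ = cong₂ ℤ._+_ (sym (ℤ.*-identityˡ (f x))) (Σℤ-filter P? f L)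
... | no  _ = trans (Σℤ-filter P? f L) (sym (trans (cong (ℤ._+ Σℤ (λ y → indicator (P? y) ℤ.* f y) L) (ℤ.*-zeroˡ (f x))) (ℤ.+-identityˡ _)))

length-filter : ∀ {P : I → Set} (P? : ∀ x → Dec (P x)) L → + length (filter P? L) ≡ Σℤ (indicator ∘ P?) L
length-filter P? []      = refl
length-filter P? (x ∷ L) with P? x
... | yes _ = cong (ℤ._+_ 1ℤ) (length-filter P? L)
... | no  _ = trans (length-filter P? L) (sym (ℤ.+-identityˡ _))

Σℤ-minus : ∀ (f g : I → ℤ) L → Σℤ f L ℤ.- Σℤ g L ≡ Σℤ (λ x → f x ℤ.- g x) L
Σℤ-minus f g []      = refl
Σℤ-minus f g (x ∷ L) = trans (lemma (f x) (g x) _ _) (cong (ℤ._+_ (f x ℤ.- g x)) (Σℤ-minus f g L))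
  where
  lemma : ∀ a b c d → a ℤ.+ c ℤ.- (b ℤ.+ d) ≡ a ℤ.- b ℤ.+ (c ℤ.- d)
  lemma = solve-∀

sumTo-cong : ∀ n {f g : ℕ → ℤ} → (∀ i → i < n → f i ≡ g i) → sumTo n f ≡ sumTo n g
sumTo-cong zero    p = refl
sumTo-cong (suc n) p = cong₂ ℤ._+_ (p 0 (s≤s z≤n)) (sumTo-cong n λ i i<n → p (suc i) (s≤s i<n))

sumTo-zero : ∀ n → sumTo n (λ _ → 0ℤ) ≡ 0ℤ
sumTo-zero zero    = refl
sumTo-zero (suc n) = trans (ℤ.+-identityˡ _) (sumTo-zero n)

sumTo-+ : ∀ n f g → sumTo n f ℤ.+ sumTo n g ≡ sumTo n (λ i → f i ℤ.+ g i)
sumTo-+ zero    f g = refl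
sumTo-+ (suc n) f g = trans (lemma (f 0) (g 0) _ _) (cong (ℤ._+_ (f 0 ℤ.+ g 0)) (sumTo-+ n (f ∘ suc) (g ∘ suc)))
  where
  lemma : ∀ a b c d → a ℤ.+ c ℤ.+ (b ℤ.+ d) ≡ a ℤ.+ b ℤ.+ (c ℤ.+ d)
  lemma = solve-∀

sumTo-* : ∀ n c f → c ℤ.* sumTo n f ≡ sumTo n (λ i → c ℤ.* f i)
sumTo-* zero    c f = ℤ.*-zeroʳ c
sumTo-* (suc n) c f = trans (ℤ.*-distribˡ-+ c (f 0) _) (cong (ℤ._+_ (c ℤ.* f 0)) (sumTo-* n c (f ∘ suc)))

δ : ℕ → ℕ → ℤ
δ zero    zero    = 1ℤ
δ zero    (suc i) = 0ℤ
δ (suc N) zero    = 0ℤ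
δ (suc N) (suc i) = δ N i

δ-< : ∀ {N n} (g : ℕ → ℤ) → N < n → sumTo n (λ i → δ N i ℤ.* g i) ≡ g N
δ-< {zero}  {suc n} g l = trans (cong₂ ℤ._+_ (ℤ.*-identityˡ (g 0)) (trans (sumTo-cong n λ i _ → ℤ.*-zeroˡ (g (suc i))) (sumTo-zero n))) (ℤ.+-identityʳ _)
δ-< {suc N} {suc n} g (s≤s l) = trans (cong₂ ℤ._+_ (ℤ.*-zeroˡ (g 0)) (δ-< (g ∘ suc) l)) (ℤ.+-identityˡ _)

δ-≥ : ∀ {N n} (g : ℕ → ℤ) → n ≤ N → sumTo n (λ i → δ N i ℤ.* g i) ≡ 0ℤ
δ-≥ {N} {zero} g _ = refl
δ-≥ {suc N} {suc n} g (s≤s l) = trans (cong₂ ℤ._+_ (ℤ.*-zeroˡ (g 0)) (δ-≥ (g ∘ suc) l)) refl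

q^suc-coeff : ∀ N (f : ℕ → Series) n → (q^ (suc N) ⊗ f N) n ≡ sumTo n (λ i → δ N i ℤ.* f i (n ℕ.∸ suc i))
q^suc-coeff N f n with N ℕ.<? n
... | yes N<n = trans (trans (cong (q^ (suc N) ⊗ f N) (sym (ℕ.m+[n∸m]≡n N<n))) (q^-shift (suc N) (f N) _)) (sym (δ-< (λ i → f i (n ℕ.∸ suc i)) N<n))
... | no  N≮n = trans (q^-below (suc N) (f N) n (s≤s (ℕ.≮⇒≥ N≮n))) (sym (δ-≥ (λ i → f i (n ℕ.∸ suc i)) (ℕ.≮⇒≥ N≮n)))

-- The number of entries of size i + 1 that may follow an entry of size N + 1.
successors : ℕ → ℕ → ℤ
successors zero    zero    = 1ℤ
successors zero    (suc i) = 0ℤ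
successors (suc N) zero    = + 2
successors (suc N) (suc i) = successors N i

-- The two new choices are a plain entry of the new size N + 2 and a second, overlined form of size
-- N + 1, just as in the recurrence of D.
successors-suc : ∀ N i → successors (suc N) i ≡ successors N i ℤ.+ (δ (suc N) i ℤ.+ δ N i)
successors-suc zero    zero          = refl
successors-suc zero    (suc zero)    = refl
successors-suc zero    (suc (suc i)) = refl
successors-suc (suc N) zero          = refl
successors-suc (suc N) (suc i)       = successors-suc N i

successors-< : ∀ {N i} → i < N → successors N i ≡ + 2
successors-< {suc N} {zero}  _       = refl
successors-< {suc N} {suc i} (s≤s l) = successors-< l

successors-≡ : ∀ N → successors N N ≡ 1ℤ
successors-≡ zero    = refl
successors-≡ (suc N) = successors-≡ N

successors-> : ∀ {N i} → N < i → successors N i ≡ 0ℤ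
successors-> {zero}  {suc i} _       = refl
successors-> {suc N} {suc i} (s≤s l) = successors-> l

-- The continuations after an entry of size N + 1, weighted by a function of their length; q^k
-- restores the 1 by which D lowers each entry. `tail-R` omits the empty continuation.
R tail-R : ℕ → (ℕ → ℤ) → Series
R N w      = sumℕ (λ k → # (w k) ⊗ (q^ k ⊗ D N k))
tail-R N w = sumℕ (λ k → # (w (suc k)) ⊗ (q^ (suc k) ⊗ D N (suc k)))

private
  R-small : ∀ N (w : ℕ → ℤ) k {M} → M ≤ k → # (w k) ⊗ (q^ k ⊗ D N k) ≈[ M ] 𝟘
  R-small N w k M≤k = ≈-trans (⊗-cong≈ ≈-refl (q^⊗-vanish _ M≤k)) (≐⇒≈ (Ring.zeroʳ (# (w k))))

HasSum-R : ∀ N w → HasSum (λ k → # (w k) ⊗ (q^ k ⊗ D N k)) (R N w)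
HasSum-R N w = HasSum-ℕ λ M k M≤k → R-small N w (2 ℕ.+ k) (ℕ.≤-trans M≤k (ℕ.m≤n+m k 2))

HasSum-tail-R : ∀ N w → HasSum (λ k → # (w (suc k)) ⊗ (q^ (suc k) ⊗ D N (suc k))) (tail-R N w)
HasSum-tail-R N w = HasSum-ℕ λ M k M≤k → R-small N w (3 ℕ.+ k) (ℕ.≤-trans M≤k (ℕ.m≤n+m k 3))

R≐ : ∀ N w → R N w ≐ # (w 0) ⊕ tail-R N w
R≐ N w = ≐-trans (HasSum-unique (HasSum-R N w) (HasSum-suc (HasSum-tail-R N w)))
  (⊕-cong (≐-trans (⊗-cong ≐-refl (≐-trans (⊗-cong q^0 (One.D-0 N)) (Ring.*-identityʳ 𝟙))) (Ring.*-identityʳ _)) ≐-refl)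

tail-R-zero : ∀ w → tail-R 0 w ≐ q^ 1 ⊗ R 0 (w ∘ suc)
tail-R-zero w = HasSum-unique (HasSum-tail-R 0 w) (HasSum-cong
  (λ k → ≐-trans (solve 4 (λ x c y d → x :* (c :* (y :* d)) := c :* (x :* y :* d)) ≐-refl (q^ 1) (# (w (suc k))) (q^ k) 𝟙)
    (⊗-cong ≐-refl (⊗-cong (≐-sym (q^-+ 1 k)) ≐-refl))) ≐-refl (HasSum-⊗ (q^ 1) (HasSum-R 0 (w ∘ suc))))

tail-R-suc : ∀ N w → tail-R (suc N) w ≐ tail-R N w ⊕ (q^ (2 ℕ.+ N) ⊗ R (suc N) (w ∘ suc) ⊕ q^ (suc N) ⊗ R N (w ∘ suc))
tail-R-suc N w = HasSum-unique (HasSum-tail-R (suc N) w) (HasSum-cong term ≐-refl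
  (HasSum-⊕ ℕ._≟_ (HasSum-tail-R N w) (HasSum-⊕ ℕ._≟_ (HasSum-⊗ (q^ (2 ℕ.+ N)) (HasSum-R (suc N) (w ∘ suc))) (HasSum-⊗ (q^ (suc N)) (HasSum-R N (w ∘ suc))))))
  where
  term : ∀ k → # (w (suc k)) ⊗ (q^ (suc k) ⊗ D N (suc k)) ⊕ (q^ (2 ℕ.+ N) ⊗ (# (w (suc k)) ⊗ (q^ k ⊗ D (suc N) k)) ⊕ q^ (suc N) ⊗ (# (w (suc k)) ⊗ (q^ k ⊗ D N k)))
             ≐ # (w (suc k)) ⊗ (q^ (suc k) ⊗ D (suc N) (suc k))
  term k = combine ((⊝ c ⊗ q^ (suc k) ⊗ b · Q₁≐ (suc N)) ∷ (⊝ c ⊗ q^ (suc k) ⊗ a · Q₁≐ N) ∷ (c ⊗ q^ k ⊗ b · q^-+ 1 (suc N)) ∷ (c ⊗ q^ k ⊗ a · q^-+ 1 N)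
      ∷ (⊝ c ⊗ (q^ (suc N) ⊗ b ⊕ q^ N ⊗ a) · q^-+ 1 k) ∷ [])
    (solve 12 (λ c d a b x y y₁ p₁ p₂ p₀ r₁ r₀ →
         c :* (y₁ :* d) :+ (p₂ :* (c :* (y :* b)) :+ p₁ :* (c :* (y :* a))) :- c :* (y₁ :* (d :+ (r₁ :* b :+ r₀ :* a)))
         := (:- c) :* y₁ :* b :* (r₁ :- p₁) :+ ((:- c) :* y₁ :* a :* (r₀ :- p₀) :+ (c :* y :* b :* (p₂ :- x :* p₁) :+ (c :* y :* a :* (p₁ :- x :* p₀)
            :+ ((:- c) :* (p₁ :* b :+ p₀ :* a) :* (y₁ :- x :* y) :+ con 0ℤ)))))
      ≐-refl c (D N (suc k)) a b (q^ 1) (q^ k) (q^ (suc k)) (q^ (suc N)) (q^ (2 ℕ.+ N)) (q^ N) (One.Q (suc N)) (One.Q N))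
    where
    a b c : Series
    a = D N k
    b = D (suc N) k
    c = # (w (suc k))

-- Decomposition by the next entry, whose choice shifts the length weight by one. Induction on N,
-- with the recurrence of D on one side and `successors-suc` on the other.
tail-R-coeff : ∀ N w n → tail-R N w n ≡ sumTo n (λ i → successors N i ℤ.* R i (w ∘ suc) (n ℕ.∸ suc i))
tail-R-coeff zero w n = trans (at (tail-R-zero w) n) (trans (q^suc-coeff 0 (λ i → R i (w ∘ suc)) n)
  (sumTo-cong n λ i _ → cong (ℤ._* R i (w ∘ suc) (n ℕ.∸ suc i)) (δ≡ i)))
  where
  δ≡ : ∀ i → δ 0 i ≡ successors 0 i
  δ≡ zero    = refl
  δ≡ (suc i) = refl
tail-R-coeff (suc N) w n = begin
  tail-R (suc N) w n
    ≡⟨ trans (at (tail-R-suc N w) n) (trans (⊕-coeff _ _ n) (cong (ℤ._+_ (tail-R N w n)) (⊕-coeff _ _ n))) ⟩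
  tail-R N w n ℤ.+ ((q^ (2 ℕ.+ N) ⊗ R (suc N) (w ∘ suc)) n ℤ.+ (q^ (suc N) ⊗ R N (w ∘ suc)) n)
    ≡⟨ cong₂ ℤ._+_ (tail-R-coeff N w n) (cong₂ ℤ._+_ (q^suc-coeff (suc N) (λ i → R i (w ∘ suc)) n) (q^suc-coeff N (λ i → R i (w ∘ suc)) n)) ⟩
  sumTo n (λ i → successors N i ℤ.* r i) ℤ.+ (sumTo n (λ i → δ (suc N) i ℤ.* r i) ℤ.+ sumTo n (λ i → δ N i ℤ.* r i))
    ≡⟨ trans (cong (ℤ._+_ (sumTo n (λ i → successors N i ℤ.* r i))) (sumTo-+ n _ _)) (sumTo-+ n _ _) ⟩
  sumTo n (λ i → successors N i ℤ.* r i ℤ.+ (δ (suc N) i ℤ.* r i ℤ.+ δ N i ℤ.* r i))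
    ≡⟨ sumTo-cong n (λ i _ → trans (lemma (successors N i) (δ (suc N) i) (δ N i) (r i)) (cong (ℤ._* r i) (sym (successors-suc N i)))) ⟩
  sumTo n (λ i → successors (suc N) i ℤ.* r i) ∎
  where
  open ≡-Reasoning
  r : ℕ → ℤ
  r i = R i (w ∘ suc) (n ℕ.∸ suc i)
  lemma : ∀ a b c x → a ℤ.* x ℤ.+ (b ℤ.* x ℤ.+ c ℤ.* x) ≡ (a ℤ.+ (b ℤ.+ c)) ℤ.* x
  lemma = solve-∀

private
  Σℤ-parts : ∀ (h : Part → ℤ) (e : ℕ → ℕ) n → Σℤ h (cartesianProductWith (part ∘ suc) (applyUpTo e n) (false ∷ true ∷ []))
             ≡ sumTo n (λ i → h (part (suc (e i)) false) ℤ.+ h (part (suc (e i)) true))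
  Σℤ-parts h e zero    = refl
  Σℤ-parts h e (suc n) = trans (cong (λ z → h (part (suc (e 0)) false) ℤ.+ (h (part (suc (e 0)) true) ℤ.+ z)) (Σℤ-parts h (e ∘ suc) n)) (sym (ℤ.+-assoc (h (part (suc (e 0)) false)) (h (part (suc (e 0)) true)) _))

  count-next : ∀ {N b n i} → i < n → let next = next? (part (suc N) b) n in
               indicator (next (part (suc i) false)) ℤ.+ indicator (next (part (suc i) true)) ≡ successors N i
  count-next {N} {b} {n} {i} i<n with ℕ.<-cmp i N
  ... | tri< l i≢N _ = trans (cong₂ ℤ._+_ (indicator-yes (next? (part (suc N) b) n _) ((s≤s z≤n , i<n) , ℕ.m≤n⇒m≤1+n l , λ _ → refl))
                                 (indicator-yes (next? (part (suc N) b) n _) ((s≤s z≤n , i<n) , ℕ.m≤n⇒m≤1+n l , λ e → ⊥-elim (i≢N (sym (ℕ.suc-injective e))))))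
                           (sym (successors-< l))
  ... | tri≈ _ refl _ = trans (cong₂ ℤ._+_ (indicator-yes (next? (part (suc N) b) n _) ((s≤s z≤n , i<n) , ℕ.≤-refl , λ _ → refl))
                                 (indicator-no (next? (part (suc N) b) n _) λ (_ , _ , p) → case p refl of λ ()))
                           (sym (successors-≡ N))
  ... | tri> _ _ l = trans (cong₂ ℤ._+_ (indicator-no (next? (part (suc N) b) n _) λ (_ , p , _) → ℕ.<⇒≱ l (ℕ.≤-pred p))
                                 (indicator-no (next? (part (suc N) b) n _) λ (_ , p , _) → ℕ.<⇒≱ l (ℕ.≤-pred p)))
                           (sym (successors-> l))

-- The hypothesis says that an overline on the next entry does not affect the weighted sum of what
-- follows, so its two forms merge into the multiplicity `successors N i`.
branch : ∀ {W : List Part → ℤ} {G : ℕ → ℤ} f N b n →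
         (∀ i c → i < suc n → Σℤ (λ ρ → W (part (suc i) c ∷ ρ)) (continuations f (part (suc i) c) (suc n ℕ.∸ suc i)) ≡ G i) →
         Σℤ W (continuations (suc f) (part (suc N) b) (suc n)) ≡ sumTo (suc n) (λ i → successors N i ℤ.* G i)
branch {W} {G} f N b n p = begin
  Σℤ W (concatMap (λ q → map (q ∷_) (continuations f q (suc n ℕ.∸ size q))) (filter next (parts (suc n))))
    ≡⟨ Σℤ-concatMap W (λ q → map (q ∷_) (continuations f q (suc n ℕ.∸ size q))) (filter next (parts (suc n))) ⟩
  Σℤ (λ q → Σℤ W (map (q ∷_) (continuations f q (suc n ℕ.∸ size q)))) (filter next (parts (suc n)))
    ≡⟨ Σℤ-cong (filter next (parts (suc n))) (λ {q} _ → Σℤ-map W (q ∷_) (continuations f q (suc n ℕ.∸ size q))) ⟩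
  Σℤ g (filter next (parts (suc n)))
    ≡⟨ Σℤ-filter next g (parts (suc n)) ⟩
  Σℤ (λ q → indicator (next q) ℤ.* g q) (parts (suc n))
    ≡⟨ Σℤ-parts (λ q → indicator (next q) ℤ.* g q) id (suc n) ⟩
  sumTo (suc n) (λ i → indicator (next (part (suc i) false)) ℤ.* g (part (suc i) false) ℤ.+ indicator (next (part (suc i) true)) ℤ.* g (part (suc i) true))
    ≡⟨ sumTo-cong (suc n) (λ i i<n → trans (cong₂ ℤ._+_ (cong (ℤ._*_ (indicator (next (part (suc i) false)))) (p i false i<n)) (cong (ℤ._*_ (indicator (next (part (suc i) true)))) (p i true i<n)))
         (trans (sym (ℤ.*-distribʳ-+ (G i) (indicator (next (part (suc i) false))) (indicator (next (part (suc i) true))))) (cong (ℤ._* G i) (count-next {N} {b} i<n)))) ⟩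
  sumTo (suc n) (λ i → successors N i ℤ.* G i) ∎
  where
  open ≡-Reasoning
  next : ∀ q → Dec (Next (part (suc N) b) (suc n) q)
  next = next? (part (suc N) b) (suc n)
  g : Part → ℤ
  g q = Σℤ (λ ρ → W (q ∷ ρ)) (continuations f q (suc n ℕ.∸ size q))

Σℤ-continuations : ∀ f N b n w → n ≤ f → Σℤ (w ∘ length) (continuations f (part (suc N) b) n) ≡ R N w n
Σℤ-continuations f N b zero w _ = trans (ℤ.+-identityʳ (w 0)) (sym (trans (at (R≐ N w) 0)
  (trans (⊕-coeff _ _ 0) (trans (cong₂ ℤ._+_ (#-coeff₀ (w 0)) (tail-R-coeff N w 0)) (ℤ.+-identityʳ (w 0))))))
Σℤ-continuations (suc f) N b (suc n) w (s≤s n≤f) = trans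
  (branch f N b n λ i c _ → Σℤ-continuations f i c (n ℕ.∸ i) (w ∘ suc) (ℕ.≤-trans (ℕ.m∸n≤m n i) n≤f))
  (sym (trans (at (R≐ N w) (suc n)) (trans (⊕-coeff _ _ (suc n)) (trans (cong₂ ℤ._+_ (#-coeff₊ (w 0) n) (tail-R-coeff N w (suc n))) (ℤ.+-identityˡ _)))))

-- Makes the first entry the largest, so that the rank depends only on its size and on the length of
-- the rest.
largestPart-continuations : ∀ f p n {ρ} → ρ ∈ continuations f p n → largestPart ρ ≤ size p
largestPart-continuations _ p zero (here refl) = z≤n
largestPart-continuations (suc f) p n@(suc _) ρ∈
  with q , q∈ , ρ∈q ← find (∈-concatMap⁻ (λ q → map (q ∷_) (continuations f q (n ℕ.∸ size q))) {xs = filter (next? p n) (parts n)} ρ∈)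
  with ρ′ , ρ′∈ , refl ← ∈-map⁻ (q ∷_) ρ∈q
  with _ , _ , p≥q , _ ← ∈-filter⁻ (next? p n) {xs = parts n} q∈
  = ℕ.⊔-lub p≥q (ℕ.≤-trans (largestPart-continuations f q (n ℕ.∸ size q) ρ′∈) p≥q)

rank-∷ : ∀ {i c ρ} → largestPart ρ ≤ suc i → rank (part (suc i) c ∷ ρ) ≡ + i ℤ.- + length ρ
rank-∷ {i} {c} {ρ} l = trans (cong (λ m → + m ℤ.- + suc (length ρ)) (ℕ.m≥n⇒m⊔n≡m l)) (lemma (+ i) (+ length ρ))
  where
  lemma : ∀ i k → 1ℤ ℤ.+ i ℤ.- (1ℤ ℤ.+ k) ≡ i ℤ.- k
  lemma = solve-∀

private
  ΣL-coeff : ∀ (f : ℕ → Series) (e : ℕ → ℕ) n m → ΣL f (applyUpTo e n) m ≡ sumTo n (λ i → f (e i) m)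
  ΣL-coeff f e zero    m = 𝟘-coeff m
  ΣL-coeff f e (suc n) m = trans (⊕-coeff _ _ m) (cong (ℤ._+_ (f (e 0) m)) (ΣL-coeff f (e ∘ suc) n m))

pair-sum-coeff : ∀ n → pair-sum n ≡ sumTo n (λ i → R i (λ k → sign₃ (+ i ℤ.- + k)) (n ℕ.∸ suc i))
pair-sum-coeff n = trans (HasSum-coeff HasSum-rows n) (trans
    (below (ΣL-covers row (proj₁ (proj₂ (HasSum.support HasSum-rows (suc n)))) (covers (Unique.upTo⁺ n) out)) n ℕ.≤-refl)
    (trans (ΣL-coeff row id n n) (sumTo-cong n λ i i<n →
      trans (cong (row i) (sym (ℕ.m+[n∸m]≡n i<n))) (q^-shift (suc i) _ _))))
  where
  row : ℕ → Series
  row i = q^ (suc i) ⊗ R i (λ k → sign₃ (+ i ℤ.- + k))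
  HasSum-rows : HasSum row pair-sum
  HasSum-rows = HasSum-Σ ℕ._≟_ HasSum-pair λ i → HasSum-cong (λ k → ≐-trans
      (solve 4 (λ x c y d → x :* (c :* (y :* d)) := c :* (x :* y :* d)) ≐-refl (q^ (suc i)) (# (sign₃ (+ i ℤ.- + k))) (q^ k) (D i k))
      (⊗-cong ≐-refl (⊗-cong (≐-sym (q^-+ (suc i) k)) ≐-refl)))
    ≐-refl (HasSum-⊗ (q^ (suc i)) (HasSum-R i (λ k → sign₃ (+ i ℤ.- + k))))
  out : ∀ i → i ∈ upTo n ⊎ row i ≈[ suc n ] 𝟘
  out i with i ℕ.<? n
  ... | yes i<n = inj₁ (∈-upTo⁺ i<n)
  ... | no  i≮n = inj₂ (q^⊗-vanish _ (s≤s (ℕ.≮⇒≥ i≮n)))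

rank-difference : ∀ n → + N̄ (+ 0) 3 (suc n) ℤ.- + N̄ (+ 1) 3 (suc n) ≡ difference-series (suc n)
rank-difference n = begin
  + N̄ (+ 0) 3 (suc n) ℤ.- + N̄ (+ 1) 3 (suc n)
    ≡⟨ cong₂ ℤ._-_ (length-filter (λ π → rank π ≡? + 0 [mod 3 ]) (overpartitions (suc n))) (length-filter (λ π → rank π ≡? + 1 [mod 3 ]) (overpartitions (suc n))) ⟩
  Σℤ (λ π → indicator (rank π ≡? + 0 [mod 3 ])) (overpartitions (suc n)) ℤ.- Σℤ (λ π → indicator (rank π ≡? + 1 [mod 3 ])) (overpartitions (suc n))
    ≡⟨ Σℤ-minus (λ π → indicator (rank π ≡? + 0 [mod 3 ])) (λ π → indicator (rank π ≡? + 1 [mod 3 ])) (overpartitions (suc n)) ⟩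
  Σℤ (λ π → indicator (rank π ≡? + 0 [mod 3 ]) ℤ.- indicator (rank π ≡? + 1 [mod 3 ])) (overpartitions (suc n))
    ≡⟨ Σℤ-cong (overpartitions (suc n)) (λ {π} _ → sign₃≡ (rank π)) ⟨
  Σℤ (sign₃ ∘ rank) (overpartitions (suc n))
    -- The virtual predecessor has size n + 2, so every possible first entry is smaller than it and
    -- occurs in both forms; this is the factor 2.
    ≡⟨ branch n (suc n) false n (λ i c i≤n → trans
         (Σℤ-cong (continuations n (part (suc i) c) (n ℕ.∸ i)) λ {ρ} ρ∈ → cong sign₃ (rank-∷ {i} {c} {ρ} (largestPart-continuations n (part (suc i) c) (n ℕ.∸ i) ρ∈)))
         (Σℤ-continuations n i c (n ℕ.∸ i) (λ k → sign₃ (+ i ℤ.- + k)) (ℕ.m∸n≤m n i))) ⟩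
  sumTo (suc n) (λ i → successors (suc n) i ℤ.* r i)
    ≡⟨ sumTo-cong (suc n) (λ i i<n → cong (ℤ._* r i) (successors-< i<n)) ⟩
  sumTo (suc n) (λ i → + 2 ℤ.* r i)
    ≡⟨ trans (cong (ℤ._*_ (+ 2)) (pair-sum-coeff (suc n))) (sumTo-* (suc n) (+ 2) r) ⟨
  + 2 ℤ.* pair-sum (suc n)
    ≡⟨ trans (at difference-series≐ (suc n)) (trans (⊕-coeff _ _ (suc n)) (trans (cong₂ ℤ._+_ (#-coeff₊ 1ℤ n) (#-scale (+ 2) pair-sum (suc n))) (ℤ.+-identityˡ _))) ⟨
  difference-series (suc n) ∎
  where
  open ≡-Reasoning
  r : ℕ → ℤ
  r i = R i (λ k → sign₃ (+ i ℤ.- + k)) (suc n ℕ.∸ suc i)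

theorem4 : ∀ (n : ℕ) → 1 ≤ n →
    (n % 3 ≡ 0 ⊎ n % 3 ≡ 1 → N̄ (+ 0) 3 n > N̄ (+ 1) 3 n) ×
    (n % 3 ≡ 2 → N̄ (+ 0) 3 n < N̄ (+ 1) 3 n)
theorem4 n@(suc m) _ =
  (λ { (inj₁ e) → larger (subst (λ k → 0ℤ ℤ.< difference-series k) (sym (decompose e)) (positive₀ (n ℕ./ 3)))
     ; (inj₂ e) → larger (subst (λ k → 0ℤ ℤ.< difference-series k) (sym (decompose e)) (positive₁ (n ℕ./ 3))) }) ,
  (λ e → smaller (subst (λ k → difference-series k ℤ.< 0ℤ) (sym (decompose e)) (negative₂ (n ℕ./ 3))))
  where
  decompose : ∀ {r} → n % 3 ≡ r → n ≡ r ℕ.+ n ℕ./ 3 ℕ.* 3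
  decompose e = trans (ℕ.m≡m%n+[m/n]*n n 3) (cong (ℕ._+ n ℕ./ 3 ℕ.* 3) e)
  larger : 0ℤ ℤ.< difference-series n → N̄ (+ 0) 3 n > N̄ (+ 1) 3 n
  larger p = ℤ.drop‿+<+ (ℤ.≰⇒> λ N̄₀≤N̄₁ → ℤ.<⇒≱ p (subst (ℤ._≤ 0ℤ) (rank-difference m) (ℤ.i≤j⇒i-j≤0 N̄₀≤N̄₁)))
  smaller : difference-series n ℤ.< 0ℤ → N̄ (+ 0) 3 n < N̄ (+ 1) 3 n
  smaller p = ℤ.drop‿+<+ (ℤ.≰⇒> λ N̄₁≤N̄₀ → ℤ.<⇒≱ p (subst (0ℤ ℤ.≤_) (rank-difference m) (ℤ.i≤j⇒0≤j-i N̄₁≤N̄₀)))
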